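{- Let $n\ge2$, and let $\tilde\phi:\mathbb C[\tilde Z]\to\mathbb P_e$ be the $S$-algebra isomorphism given by $\tilde\phi(z_{k,k+p})=j_{\tau^kc_p}/j_{\tau^{k-1}}$ for $1\le k\le k+p\le n$. Then for all $0\le k\le n$ and all partitions $\lambda=(\lambda_1,\dots,\lambda_k)$ (with at most $k$ parts) with $\lambda_1\le n-k$, $$\tilde\phi(z_{\lambda,k})=j_{\tau^kw_\lambda^{\mathrm{af}}}.$$ In particular $$\tilde\phi(D_i)=j_{t_{ -\omega_i^\vee}}\quad(0\le i\le n-1),\qquad \tilde\phi(D_i')=j_{s_it_{ -\omega_i^\vee}}\quad(1\le i\le n-1).$$
   Context: **Coefficients.** $S=\mathbb C[a_1,\dots,a_n]/(a_1+\dots+a_n)$, indices of $a_i$ read modulo $n$; $F=\mathrm{Frac}(S)$. **Centralizer family.** Let $\mathfrak h$ be the diagonal Cartan subalgebra of $\mathfrak{sl}_n$, $E$ the matrix with $1$'s on the superdiagonal and zeros elsewhere, $B\subset SL_n$ the upper triangular Borel subgroup, and $\tilde Z=\{(h,b)\in\mathfrak h\times B\mid b(-E+h)b^{ -1}=-E+h\}$. With $z_{ij}$ the matrix entries of $b$ ($z_{ij}=0$ for $i>j$), $\mathbb C[\tilde Z]$ is the $S$-algebra generated by $z_{ij}$ ($1\le i\le j\le n$) modulo $z_{11}\cdots z_{nn}=1$ and $z_{ij}=z_{i-1,j-1}+(a_{i-1}-a_j)z_{i-1,j}$ for $2\le i\le j\le n$. **Minors.** For a partition $\lambda=(\lambda_1\ge\dots\ge\lambda_k\ge0)$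 with $\lambda_1\le n-k$, $z_{\lambda,k}=\det(z_{p,\lambda_{k+1-q}+q})_{1\le p,q\le k}$, the minor of $(z_{ij})$ in the first $k$ rows and columns $\lambda_k+1,\lambda_{k-1}+2,\dots,\lambda_1+k$. $R_i$ is the rectangular partition with $n-i$ rows and $i$ columns, $R_i-1$ is $R_i$ with one cell removed from the last column, $D_i=z_{R_i,n-i}$ and $D_i'=z_{R_i-1,n-i}$. **Extended affine Weyl group.** $W=S_n$ with simple reflections $s_1,\dots,s_{n-1}$; $Q^\vee=\{\lambda\in\mathbb Z^n:\sum\lambda_i=0\}$; $P^\vee$ is spanned by $\omega_k^\vee=(1^k,0^{n-k})-\frac kn(1^n)$, $\omega_0^\vee=0$. $W_e=W\ltimes P^\vee$ with translations $t_\lambda$; $W_{\mathrm{af}}=W\ltimes Q^\vee$ is a Coxeter group with generators $s_0,\dots,s_{n-1}$, $s_0=t_{(1,0,\dots,0,-1)}\cdot(1\,n)$. $\tau=t_{\omega_1^\vee}s_1s_2\cdots s_{n-1}\in W_e$ satisfies $\tau^n=1$, $\tau s_i\tau^{ -1}=s_{i+1}$ (mod $n$), $W_e=\langle\tau\rangle\ltimes W_{\mathrm{af}}$; $\ell(\tau^rw):=\ell(w)$ for $w\in W_{\mathrm{af}}$. $c_p=s_{p-1}\cdots s_1s_0$, $c_0=\mathrm{id}$. For $\lambda$ with $\lambda_1<n$, $w_\lambda^{\mathrm{af}}=u_{\ell(\lambda)}\cdots u_2u_1$ with $u_i=s_{\lambda_i-i}s_{\lambda_i-i-1}\cdots s_{1-i}$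 (subscripts mod $n$), and $w_\emptyset^{\mathrm{af}}=\mathrm{id}$. (For $k=0$ the only partition is $\emptyset$, $z_{\emptyset,0}=1$; for $k=n$ the only partition is $\emptyset$.) $W_e$ acts on $F$ with $W$ permuting the $a_i$ and $t_\lambda$ acting trivially. **NilHecke and Peterson algebras.** In the twisted group algebra $\bigoplus_{w\in W_e}Fw$, $(pv)(qw)=p(v\cdot q)vw$, let $\alpha_i=a_i-a_{i+1}$ ($i\in\mathbb Z/n$), $A_i=\alpha_i^{ -1}(s_i-1)$, $A_w=A_{i_1}\cdots A_{i_\ell}$ for a reduced word $w=s_{i_1}\cdots s_{i_\ell}\in W_{\mathrm{af}}$, $A_{\tau^rw}=\tau^rA_w$. $\mathbb A_e=\bigoplus_{w\in W_e}SA_w$, and $\mathbb P_e$ is the centralizer of $S$ in $\mathbb A_e$, a commutative $S$-algebra. With $W_e^0=\{w\in W_e\mid\ell(wv)>\ell(w)\ \forall v\in W\setminus\{\mathrm{id}\}\}$, $\{j_w\mid w\in W_e^0\}$ is the unique $S$-basis of $\mathbb P_e$ with $j_w\in A_w+\sum_{x\in W_e\setminus W_e^0}SA_x$. Under the known isomorphism $H_T(\mathrm{Gr}_{PGL_n})\cong\mathbb P_e$, $j_w$ is the Schubert class of $w$. The $j_{\tau^k}$ are units in $\mathbb P_e$. -}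

module Defs where

open import Level using (Level; _⊔_) renaming (suc to lsuc)
open import Algebra.Bundles using (CommutativeRing; RawRing)
open import Algebra.Morphism.Structures using (IsRingMonomorphism)
open import Data.Bool.Base using (if_then_else_)
open import Data.Empty using (⊥-elim)
open import Data.Fin.Base as Fin using (Fin; zero; suc; toℕ; fromℕ<; punchIn; opposite)
import Data.Fin.Permutation as Perm
open import Data.Fin.Permutation using (Permutation′; _⟨$⟩ʳ_; _⟨$⟩ˡ_; _∘ₚ_)
import Data.Fin.Properties as Fin
open import Data.Integer.Base as ℤ using (ℤ; +_)
open import Data.Integer.DivMod using (_%ℕ_; _/ℕ_; n%ℕd<d; a≡a%ℕn+[a/ℕn]*n)
import Data.Integer.Divisibility.Signed as ℤ
import Data.Integer.Properties as ℤ
import Data.Integer.Solver as ℤSolver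
open import Data.List.Base as List using (List; []; _∷_; _++_; concat; concatMap; downFrom; foldr; length; map)
open import Data.List.Relation.Unary.All using (All)
open import Data.List.Relation.Unary.AllPairs using (AllPairs)
open import Data.Nat.Base as ℕ using (ℕ; zero; suc; _≤_; _<_; _∸_; s≤s; z≤n)
import Data.Nat.Divisibility as ℕ
import Data.Nat.Properties as ℕ
open import Data.Product.Base using (Σ; Σ-syntax; ∃-syntax; _×_; _,_; proj₁; proj₂)
open import Data.Sum.Base using (inj₁; inj₂)
open import Data.Vec.Functional as Vector using (Vector)
open import Function.Base using (_∘_)
open import Relation.Binary.Core using (Rel)
open import Relation.Binary.Structures using (IsDecTotalOrder)
open import Relation.Binary.PropositionalEquality as ≡ using (_≡_; _≢_)
import Relation.Binary.Reasoning.Setoid as SetoidReasoning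
open import Relation.Nullary.Decidable using (Dec; yes; no; does; _×-dec_)
open import Relation.Nullary.Negation using (¬_)
import Algebra.Definitions.RawMonoid as RawMonoidDefs
import Algebra.Definitions.RawSemiring as RawSemiringDefs
import Algebra.Properties.CommutativeMonoid.Sum as MonoidSum
import Algebra.Properties.Ring as RingProperties
import Algebra.Solver.Ring.NaturalCoefficients.Default as RingSolver

private
  variable
    c ℓ x i : Level

-- The reals are specified as a (classical) Dedekind-complete ordered
-- field, which determines them up to unique isomorphism.
record RealNumbers c ℓ : Set (lsuc (c ⊔ ℓ)) where
  field
    commutativeRing : CommutativeRing c ℓ
  open CommutativeRing commutativeRing public
  infix 4 _≤ᵣ_
  field
    _≤ᵣ_            : Rel Carrier ℓ
    isDecTotalOrder : IsDecTotalOrder _≈_ _≤ᵣ_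
    1≉0             : ¬ (1# ≈ 0#)
    inverse         : ∀ x → ¬ (x ≈ 0#) → ∃[ y ] (y * x ≈ 1#)
    +-monoˡ-≤       : ∀ z {x y} → x ≤ᵣ y → x + z ≤ᵣ y + z
    *-nonNegative   : ∀ {x y} → 0# ≤ᵣ x → 0# ≤ᵣ y → 0# ≤ᵣ x * y

  UpperBound : (Carrier → Set (c ⊔ ℓ)) → Carrier → Set (c ⊔ ℓ)
  UpperBound P b = ∀ x → P x → x ≤ᵣ b

  field
    complete : (P : Carrier → Set (c ⊔ ℓ)) → ∃[ x ] P x → ∃[ b ] UpperBound P b →
               ∃[ s ] (UpperBound P s × (∀ b → UpperBound P b → s ≤ᵣ b))

-- R[X]/(X² - e), with (a , b) standing for a + b X.
module QuadraticExtension (R : CommutativeRing c ℓ) (e : CommutativeRing.Carrier R) where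
  open CommutativeRing R
  open RingSolver commutativeSemiring using (_:=_; _:+_; _:*_) renaming (solve to solveᴿ)

  private
    C : Set _
    C = Carrier × Carrier

    _≈ₑ_ : Rel C _
    (a , b) ≈ₑ (a′ , b′) = (a ≈ a′) × (b ≈ b′)

    _+ₑ_ _*ₑ_ : C → C → C
    (a , b) +ₑ (a′ , b′) = a + a′ , b + b′
    (a , b) *ₑ (a′ , b′) = a * a′ + e * (b * b′) , a * b′ + b * a′

  extension : CommutativeRing c ℓ
  extension = record
    { Carrier = C
    ; _≈_ = _≈ₑ_
    ; _+_ = _+ₑ_
    ; _*_ = _*ₑ_
    ; -_ = λ (a , b) → - a , - b
    ; 0# = 0# , 0#
    ; 1# = 1# , 0#
    ; isCommutativeRing = record
      { isRing = record
        { +-isAbelianGroup = record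
          { isGroup = record
            { isMonoid = record
              { isSemigroup = record
                { isMagma = record
                  { isEquivalence = record
                    { refl = refl , refl
                    ; sym = λ (p , q) → sym p , sym q
                    ; trans = λ (p , q) (p′ , q′) → trans p p′ , trans q q′
                    }
                  ; ∙-cong = λ (p , q) (p′ , q′) → +-cong p p′ , +-cong q q′
                  }
                ; assoc = λ (a , b) (a′ , b′) (a″ , b″) → +-assoc a a′ a″ , +-assoc b b′ b″
                }
              ; identity = (λ (a , b) → +-identityˡ a , +-identityˡ b)
                         , (λ (a , b) → +-identityʳ a , +-identityʳ b)
              }
            ; inverse = (λ (a , b) → -‿inverseˡ a , -‿inverseˡ b)
                      , (λ (a , b) → -‿inverseʳ a , -‿inverseʳ b)
            ; ⁻¹-cong = λ (p , q) → -‿cong p , -‿cong q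
            }
          ; comm = λ (a , b) (a′ , b′) → +-comm a a′ , +-comm b b′
          }
        ; *-cong = λ (p , q) (p′ , q′) →
              +-cong (*-cong p p′) (*-congˡ (*-cong q q′))
            , +-cong (*-cong p q′) (*-cong q p′)
        ; *-assoc = λ (a , b) (a′ , b′) (a″ , b″) →
              solveᴿ 7 (λ e a b a′ b′ a″ b″ →
                ((a :* a′ :+ e :* (b :* b′)) :* a″ :+ e :* ((a :* b′ :+ b :* a′) :* b″))
                := (a :* (a′ :* a″ :+ e :* (b′ :* b″)) :+ e :* (b :* (a′ :* b″ :+ b′ :* a″))))
                refl e a b a′ b′ a″ b″
            , solveᴿ 7 (λ e a b a′ b′ a″ b″ →
                ((a :* a′ :+ e :* (b :* b′)) :* b″ :+ (a :* b′ :+ b :* a′) :* a″)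
                := (a :* (a′ :* b″ :+ b′ :* a″) :+ b :* (a′ :* a″ :+ e :* (b′ :* b″))))
                refl e a b a′ b′ a″ b″
        ; *-identity = (λ z → trans (*ₑ-comm₁ (1# , 0#) z) (idʳ₁ z)
                            , trans (*ₑ-comm₂ (1# , 0#) z) (idʳ₂ z))
                     , (λ z → idʳ₁ z , idʳ₂ z)
        ; distrib = (λ (a , b) (a′ , b′) (a″ , b″) →
              solveᴿ 7 (λ e a b a′ b′ a″ b″ →
                (a :* (a′ :+ a″) :+ e :* (b :* (b′ :+ b″)))
                := ((a :* a′ :+ e :* (b :* b′)) :+ (a :* a″ :+ e :* (b :* b″))))
                refl e a b a′ b′ a″ b″
            , solveᴿ 6 (λ a b a′ b′ a″ b″ →
                (a :* (b′ :+ b″) :+ b :* (a′ :+ a″))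
                := ((a :* b′ :+ b :* a′) :+ (a :* b″ :+ b :* a″)))
                refl a b a′ b′ a″ b″)
          , (λ (a , b) (a′ , b′) (a″ , b″) →
              solveᴿ 7 (λ e a b a′ b′ a″ b″ →
                ((a′ :+ a″) :* a :+ e :* ((b′ :+ b″) :* b))
                := ((a′ :* a :+ e :* (b′ :* b)) :+ (a″ :* a :+ e :* (b″ :* b))))
                refl e a b a′ b′ a″ b″
            , solveᴿ 6 (λ a b a′ b′ a″ b″ →
                ((a′ :+ a″) :* b :+ (b′ :+ b″) :* a)
                := ((a′ :* b :+ b′ :* a) :+ (a″ :* b :+ b″ :* a)))
                refl a b a′ b′ a″ b″)
        }
      ; *-comm = λ u v → *ₑ-comm₁ u v , *ₑ-comm₂ u v
      }
    }
    where
    *ₑ-comm₁ : ∀ u v → proj₁ (u *ₑ v) ≈ proj₁ (v *ₑ u)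
    *ₑ-comm₁ (a , b) (a′ , b′) = +-cong (*-comm a a′) (*-congˡ (*-comm b b′))

    *ₑ-comm₂ : ∀ u v → proj₂ (u *ₑ v) ≈ proj₂ (v *ₑ u)
    *ₑ-comm₂ (a , b) (a′ , b′) =
      trans (+-cong (*-comm a b′) (*-comm b a′)) (+-comm (b′ * a) (a′ * b))

    idʳ₁ : ∀ u → proj₁ (u *ₑ (1# , 0#)) ≈ proj₁ u
    idʳ₁ (a , b) = trans (+-cong (*-identityʳ a) (trans (*-congˡ (zeroʳ b)) (zeroʳ e)))
      (+-identityʳ a)

    idʳ₂ : ∀ u → proj₂ (u *ₑ (1# , 0#)) ≈ proj₂ u
    idʳ₂ (a , b) = trans (+-cong (zeroʳ a) (*-identityʳ b)) (+-identityˡ b)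

infixl 6 _⊕_
infixl 7 _⊗_
infix  8 ⊖_

data Poly {c x} (A : Set c) (X : Set x) : Set (c ⊔ x) where
  con     : A → Poly A X
  var     : X → Poly A X
  _⊕_ _⊗_ : Poly A X → Poly A X → Poly A X
  ⊖_      : Poly A X → Poly A X

-- The commutative K-algebra generated by X modulo l = r for all l ∼ r:
-- polynomial expressions modulo the least congruence containing the
-- K-algebra laws and _∼_.
module Presented (K : CommutativeRing c ℓ) {X : Set x}
  (_∼_ : Rel (Poly (CommutativeRing.Carrier K) X) i) where

  private
    module K = CommutativeRing K
    P : Set _
    P = Poly K.Carrier X

  infix 4 _≋_

  data _≋_ : Rel P (c ⊔ ℓ ⊔ x ⊔ i) where
    ≋-refl      : ∀ {p} → p ≋ p
    ≋-sym       : ∀ {p q} → p ≋ q → q ≋ p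
    ≋-trans     : ∀ {p q r} → p ≋ q → q ≋ r → p ≋ r
    ⊕-cong      : ∀ {p p′ q q′} → p ≋ p′ → q ≋ q′ → p ⊕ q ≋ p′ ⊕ q′
    ⊗-cong      : ∀ {p p′ q q′} → p ≋ p′ → q ≋ q′ → p ⊗ q ≋ p′ ⊗ q′
    ⊖-cong      : ∀ {p p′} → p ≋ p′ → ⊖ p ≋ ⊖ p′
    ⊕-assoc     : ∀ p q r → (p ⊕ q) ⊕ r ≋ p ⊕ (q ⊕ r)
    ⊕-comm      : ∀ p q → p ⊕ q ≋ q ⊕ p
    ⊕-identityˡ : ∀ p → con K.0# ⊕ p ≋ p
    ⊖-inverseˡ  : ∀ p → ⊖ p ⊕ p ≋ con K.0#
    ⊗-assoc     : ∀ p q r → (p ⊗ q) ⊗ r ≋ p ⊗ (q ⊗ r)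
    ⊗-comm      : ∀ p q → p ⊗ q ≋ q ⊗ p
    ⊗-identityˡ : ∀ p → con K.1# ⊗ p ≋ p
    ⊗-distribˡ  : ∀ p q r → p ⊗ (q ⊕ r) ≋ (p ⊗ q) ⊕ (p ⊗ r)
    con-cong    : ∀ {a b} → a K.≈ b → con a ≋ con b
    con-+       : ∀ a b → con (a K.+ b) ≋ con a ⊕ con b
    con-*       : ∀ a b → con (a K.* b) ≋ con a ⊗ con b
    rel         : ∀ {p q} → p ∼ q → p ≋ q

  algebra : CommutativeRing (c ⊔ x) (c ⊔ ℓ ⊔ x ⊔ i)
  algebra = record
    { Carrier = P
    ; _≈_ = _≋_
    ; _+_ = _⊕_
    ; _*_ = _⊗_
    ; -_ = ⊖_
    ; 0# = con K.0#
    ; 1# = con K.1#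
    ; isCommutativeRing = record
      { isRing = record
        { +-isAbelianGroup = record
          { isGroup = record
            { isMonoid = record
              { isSemigroup = record
                { isMagma = record
                  { isEquivalence = record { refl = ≋-refl ; sym = ≋-sym ; trans = ≋-trans }
                  ; ∙-cong = ⊕-cong
                  }
                ; assoc = ⊕-assoc
                }
              ; identity = ⊕-identityˡ , λ p → ≋-trans (⊕-comm p _) (⊕-identityˡ p)
              }
            ; inverse = ⊖-inverseˡ , λ p → ≋-trans (⊕-comm p _) (⊖-inverseˡ p)
            ; ⁻¹-cong = ⊖-cong
            }
          ; comm = ⊕-comm
          }
        ; *-cong = ⊗-cong
        ; *-assoc = ⊗-assoc
        ; *-identity = ⊗-identityˡ , λ p → ≋-trans (⊗-comm p _) (⊗-identityˡ p)
        ; distrib = ⊗-distribˡ , λ p q r → ≋-trans (⊗-comm (q ⊕ r) p)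
            (≋-trans (⊗-distribˡ p q r) (⊕-cong (⊗-comm p q) (⊗-comm p r)))
        }
      ; *-comm = ⊗-comm
      }
    }

  bind : (X → P) → P → P
  bind f (con a) = con a
  bind f (var v) = f v
  bind f (p ⊕ q) = bind f p ⊕ bind f q
  bind f (p ⊗ q) = bind f p ⊗ bind f q
  bind f (⊖ p)   = ⊖ bind f p

  bind-cong : ∀ f → (∀ {p q} → p ∼ q → bind f p ≋ bind f q) →
              ∀ {p q} → p ≋ q → bind f p ≋ bind f q
  bind-cong f r ≋-refl            = ≋-refl
  bind-cong f r (≋-sym e)         = ≋-sym (bind-cong f r e)
  bind-cong f r (≋-trans e e′)    = ≋-trans (bind-cong f r e) (bind-cong f r e′)
  bind-cong f r (⊕-cong e e′)     = ⊕-cong (bind-cong f r e) (bind-cong f r e′)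
  bind-cong f r (⊗-cong e e′)     = ⊗-cong (bind-cong f r e) (bind-cong f r e′)
  bind-cong f r (⊖-cong e)        = ⊖-cong (bind-cong f r e)
  bind-cong f r (⊕-assoc p q s)   = ⊕-assoc _ _ _
  bind-cong f r (⊕-comm p q)      = ⊕-comm _ _
  bind-cong f r (⊕-identityˡ p)   = ⊕-identityˡ _
  bind-cong f r (⊖-inverseˡ p)    = ⊖-inverseˡ _
  bind-cong f r (⊗-assoc p q s)   = ⊗-assoc _ _ _
  bind-cong f r (⊗-comm p q)      = ⊗-comm _ _
  bind-cong f r (⊗-identityˡ p)   = ⊗-identityˡ _
  bind-cong f r (⊗-distribˡ p q s) = ⊗-distribˡ _ _ _
  bind-cong f r (con-cong e)      = con-cong e
  bind-cong f r (con-+ a b)       = con-+ a b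
  bind-cong f r (con-* a b)       = con-* a b
  bind-cong f r (rel e)           = r e

-- For a domain the regular elements are the nonzero ones, and this is
-- the field of fractions.
module FractionField (R : CommutativeRing c ℓ) where
  open CommutativeRing R

  Regular : Carrier → Set (c ⊔ ℓ)
  Regular q = ∀ x → q * x ≈ 0# → x ≈ 0#

  regular-1 : Regular 1#
  regular-1 x e = trans (sym (*-identityˡ x)) e

  regular-* : ∀ {p q} → Regular p → Regular q → Regular (p * q)
  regular-* {p} {q} rp rq x e = rq x (rp (q * x) (trans (sym (*-assoc p q x)) e))

  record Frac : Set (c ⊔ ℓ) where
    constructor frac
    field
      num     : Carrier
      den     : Carrier
      regular : Regular den
  open Frac public

  fractionRing : RawRing (c ⊔ ℓ) ℓ
  fractionRing = record
    { Carrier = Frac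
    ; _≈_ = λ p q → num p * den q ≈ num q * den p
    ; _+_ = λ (frac a b r) (frac a′ b′ r′) → frac (a * b′ + a′ * b) (b * b′) (regular-* r r′)
    ; _*_ = λ (frac a b r) (frac a′ b′ r′) → frac (a * a′) (b * b′) (regular-* r r′)
    ; -_ = λ (frac a b r) → frac (- a) b r
    ; 0# = frac 0# 1# regular-1
    ; 1# = frac 1# 1# regular-1
    }

  fromRing : Carrier → Frac
  fromRing a = frac a 1# regular-1

-- Laplace expansion along the first row.
module Determinant (R : CommutativeRing c ℓ) where
  open CommutativeRing R hiding (zero)
  open RawMonoidDefs +-rawMonoid using (sum)
  open RawSemiringDefs (RawRing.rawSemiring rawRing) using (_^_)

  det : ∀ {k} → (Fin k → Fin k → Carrier) → Carrier
  det {zero}  M = 1#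
  det {suc k} M = sum λ q →
    ((- 1#) ^ toℕ q) * M zero q * det (λ r s → M (suc r) (punchIn q s))

private
  module Identities (R : CommutativeRing c ℓ) where
    open CommutativeRing R
    open RingSolver commutativeSemiring

    lemma₁ : ∀ s t b x y → (s + b * x) + (t + b * y) ≈ (s + t) + b * (x + y)
    lemma₁ = solve 5 (λ s t b x y → ((s :+ b :* x) :+ (t :+ b :* y)) := ((s :+ t) :+ b :* (x :+ y))) refl

    lemma₂ : ∀ s b x q → (s + b * x) * q ≈ s * q + b * (x * q)
    lemma₂ = solve 4 (λ s b x q → ((s :+ b :* x) :* q) := (s :* q :+ b :* (x :* q))) refl

    lemma₃ : ∀ s t b y e → s * (t + b * y) + b * e ≈ s * t + b * (e + s * y)
    lemma₃ = solve 5 (λ s t b y e → (s :* (t :+ b :* y) :+ b :* e) := (s :* t :+ b :* (e :+ s :* y))) refl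

    lemma₄ : ∀ x y z q r s t → (x * q + s * y) * r + (s * t) * z ≈ x * (q * r) + s * (y * r + t * z)
    lemma₄ = solve 7 (λ x y z q r s t →
      ((x :* q :+ s :* y) :* r :+ (s :* t) :* z) := (x :* (q :* r) :+ s :* (y :* r :+ t :* z))) refl

    lemma₅ : ∀ x y s t b → x * (t + b * y) + s * y ≈ y * (s + b * x) + t * x
    lemma₅ = solve 5 (λ x y s t b →
      (x :* (t :+ b :* y) :+ s :* y) := (y :* (s :+ b :* x) :+ t :* x)) refl

    lemma₆ : ∀ x y z q r s → x * (q + r) + s * (y + z) ≈ (x * q + s * y) + (x * r + s * z)
    lemma₆ = solve 6 (λ x y z q r s →
      (x :* (q :+ r) :+ s :* (y :+ z)) := ((x :* q :+ s :* y) :+ (x :* r :+ s :* z))) refl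

module Setting (ℝ : RealNumbers c ℓ) (n : ℕ) (2≤n : 2 ≤ n) where

  private
    module ℝ = RealNumbers ℝ

    instance
      n≢0 : ℕ.NonZero n
      n≢0 = ℕ.>-nonZero (ℕ.≤-trans (s≤s z≤n) 2≤n)

  ℂ : CommutativeRing c ℓ
  ℂ = QuadraticExtension.extension ℝ.commutativeRing (ℝ.- ℝ.1#)

  private
    module ℂ = CommutativeRing ℂ

  -- Positions 1, …, n and subscripts modulo n are both represented by
  -- Fin n through residues; in particular n is represented by zero.
  res : ℤ → Fin n
  res m = fromℕ< (n%ℕd<d m n)

  data SRelation : Rel (Poly ℂ.Carrier (Fin n)) c where
    sum≡0 : SRelation (Vector.foldr _⊕_ (con ℂ.0#) var) (con ℂ.0#)

  private
    module SP = Presented ℂ SRelation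

  S : CommutativeRing c (c ⊔ ℓ)
  S = SP.algebra

  private
    module S = CommutativeRing S
    module SI = Identities S
    module SR = RingProperties S.ring

  a : ℤ → S.Carrier
  a m = var (res m)

  α : ℤ → S.Carrier
  α m = a m S.- a (m ℤ.+ + 1)

  permute : Permutation′ n → S.Carrier → S.Carrier
  permute π = SP.bind (λ v → var (π ⟨$⟩ʳ v))

  private
    open FractionField S using (Regular)
    open MonoidSum S.+-commutativeMonoid using (sum; sum-permute)

    bind-sum : ∀ f {m} (g : Fin m → S.Carrier) → SP.bind f (sum g) ≡ sum (SP.bind f ∘ g)
    bind-sum f {zero}  g = ≡.refl
    bind-sum f {suc m} g = ≡.cong (SP.bind f (g zero) ⊕_) (bind-sum f (g ∘ suc))

  permute-cong : ∀ π {p q} → p S.≈ q → permute π p S.≈ permute π q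
  permute-cong π = SP.bind-cong _ λ where
    sum≡0 → S.trans (S.reflexive (bind-sum _ var))
            (S.trans (S.sym (sum-permute var π)) (SP.rel sum≡0))

  permute-inverse : ∀ (π ρ : Permutation′ n) → (∀ v → π ⟨$⟩ʳ (ρ ⟨$⟩ʳ v) ≡ v) →
                    ∀ p → permute π (permute ρ p) ≡ p
  permute-inverse π ρ e (con k) = ≡.refl
  permute-inverse π ρ e (var v) = ≡.cong var (e v)
  permute-inverse π ρ e (p ⊕ q) = ≡.cong₂ _⊕_ (permute-inverse π ρ e p) (permute-inverse π ρ e q)
  permute-inverse π ρ e (p ⊗ q) = ≡.cong₂ _⊗_ (permute-inverse π ρ e p) (permute-inverse π ρ e q)
  permute-inverse π ρ e (⊖ p)   = ≡.cong ⊖_ (permute-inverse π ρ e p)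

  permute-regular : ∀ π {q} → Regular q → Regular (permute π q)
  permute-regular π {q} r x e = S.trans
    (S.reflexive (≡.sym (permute-inverse π (Perm.flip π) (λ _ → Perm.inverseʳ π) x)))
    (permute-cong π (r _ (S.trans
      (S.*-congʳ (S.reflexive (≡.sym (permute-inverse (Perm.flip π) π (λ _ → Perm.inverseˡ π) q))))
      (permute-cong (Perm.flip π) e))))

  -- α m is regular: for suitable d with Σ d = 0, the substitution
  -- σ : a ↦ a - d α kills α, and the σ-twisted derivation ∂ with
  -- ∂ a = d satisfies p = σ p + α ∂ p, hence ∂ (α p) = p.
  private
    open S using (_-_) renaming (_≈_ to _≈ₛ_)

    ½ : Σ[ h ∈ ℂ.Carrier ] (h ℂ.+ h ℂ.≈ ℂ.1#)
    ½ = let h , e = ℝ.inverse (ℝ.1# ℝ.+ ℝ.1#) 2≉0 in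
        (h , ℝ.0#) , (ℝ.trans (ℝ.sym (ℝ.trans (ℝ.distribˡ h _ _)
          (ℝ.+-cong (ℝ.*-identityʳ h) (ℝ.*-identityʳ h)))) e) , ℝ.+-identityˡ ℝ.0#
      where
      module O = IsDecTotalOrder ℝ.isDecTotalOrder
      module RP = RingProperties ℝ.ring

      ≤-resp : ∀ {w x y z} → w ℝ.≈ x → y ℝ.≈ z → w ℝ.≤ᵣ y → x ℝ.≤ᵣ z
      ≤-resp e f p = O.trans (O.reflexive (ℝ.sym e)) (O.trans p (O.reflexive f))

      0≤1 : ℝ.0# ℝ.≤ᵣ ℝ.1#
      0≤1 with O.total ℝ.0# ℝ.1#
      ... | inj₁ p = p
      ... | inj₂ p = ≤-resp ℝ.refl
              (ℝ.trans (RP.-1*x≈-x (ℝ.- ℝ.1#)) (RP.-‿involutive ℝ.1#))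
              (ℝ.*-nonNegative 0≤-1 0≤-1)
        where
        0≤-1 : ℝ.0# ℝ.≤ᵣ ℝ.- ℝ.1#
        0≤-1 = ≤-resp (ℝ.-‿inverseʳ ℝ.1#) (ℝ.+-identityˡ _) (ℝ.+-monoˡ-≤ (ℝ.- ℝ.1#) p)

      2≉0 : ¬ (ℝ.1# ℝ.+ ℝ.1# ℝ.≈ ℝ.0#)
      2≉0 e = ℝ.1≉0 (O.antisym (≤-resp (ℝ.+-identityˡ _) e (ℝ.+-monoˡ-≤ ℝ.1# 0≤1)) 0≤1)

    δ : ∀ {m} → Fin m → ℂ.Carrier → Fin m → ℂ.Carrier
    δ zero    k zero    = k
    δ zero    k (suc v) = ℂ.0#
    δ (suc u) k zero    = ℂ.0#
    δ (suc u) k (suc v) = δ u k v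

    δ-≡ : ∀ {m} (u : Fin m) k → δ u k u ≡ k
    δ-≡ zero    k = ≡.refl
    δ-≡ (suc u) k = δ-≡ u k

    δ-≢ : ∀ {m} (u v : Fin m) k → u ≢ v → δ u k v ≡ ℂ.0#
    δ-≢ zero    zero    k ne = ⊥-elim (ne ≡.refl)
    δ-≢ zero    (suc v) k ne = ≡.refl
    δ-≢ (suc u) zero    k ne = ≡.refl
    δ-≢ (suc u) (suc v) k ne = δ-≢ u v k (ne ∘ ≡.cong suc)

    module ΣC = MonoidSum ℂ.+-commutativeMonoid

    sum-δ : ∀ {m} (u : Fin m) k → ΣC.sum (δ u k) ℂ.≈ k
    sum-δ {suc m} zero k = ℂ.trans (ℂ.+-congˡ (ΣC.sum-replicate-zero m)) (ℂ.+-identityʳ k)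
    sum-δ (suc u) k = ℂ.trans (ℂ.+-identityˡ _) (sum-δ u k)

    module _ (u v : Fin n) (u≢v : u ≢ v) where
      h = proj₁ ½
      β = var u - var v

      d : Fin n → ℂ.Carrier
      d w = δ u h w ℂ.+ δ v (ℂ.- h) w

      sum-d : ΣC.sum d ℂ.≈ ℂ.0#
      sum-d = ℂ.trans (ΣC.∑-distrib-+ (δ u h) (δ v (ℂ.- h)))
        (ℂ.trans (ℂ.+-cong (sum-δ u h) (sum-δ v (ℂ.- h))) (ℂ.-‿inverseʳ h))

      du-dv : con (d u) - con (d v) ≈ₛ S.1#
      du-dv = begin
        con (d u) - con (d v)
          ≈⟨ S.+-cong (SP.con-cong du) (S.-‿cong (SP.con-cong dv)) ⟩
        con h - con (ℂ.- h)
          ≈⟨ S.+-congˡ (RingProperties.+-inverseʳ-unique S.ring (con (ℂ.- h)) (con h)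
               (S.trans (S.sym (SP.con-+ _ _)) (SP.con-cong (ℂ.-‿inverseˡ h)))) ⟨
        con h ⊕ con h
          ≈⟨ SP.con-+ h h ⟨
        con (h ℂ.+ h)
          ≈⟨ SP.con-cong (proj₂ ½) ⟩
        S.1# ∎
        where
        open SetoidReasoning S.setoid
        du : d u ℂ.≈ h
        du = ℂ.trans (ℂ.reflexive (≡.cong₂ ℂ._+_ (δ-≡ u h) (δ-≢ v u (ℂ.- h) (u≢v ∘ ≡.sym))))
                     (ℂ.+-identityʳ h)
        dv : d v ℂ.≈ ℂ.- h
        dv = ℂ.trans (ℂ.reflexive (≡.cong₂ ℂ._+_ (δ-≢ u v h u≢v) (δ-≡ v (ℂ.- h))))
                     (ℂ.+-identityˡ (ℂ.- h))

      σ : S.Carrier → S.Carrier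
      σ = SP.bind (λ w → var w - con (d w) ⊗ β)

      ∂ : S.Carrier → S.Carrier
      ∂ (con k) = S.0#
      ∂ (var w) = con (d w)
      ∂ (p ⊕ q) = ∂ p ⊕ ∂ q
      ∂ (p ⊗ q) = ∂ p ⊗ q ⊕ σ p ⊗ ∂ q
      ∂ (⊖ p)   = ⊖ ∂ p

      taylor : ∀ p → p ≈ₛ σ p ⊕ β ⊗ ∂ p
      taylor (con k) = S.sym (S.trans (S.+-congˡ (S.zeroʳ β)) (S.+-identityʳ _))
      taylor (var w) = begin
        var w
          ≈⟨ S.+-identityʳ _ ⟨
        var w ⊕ S.0#
          ≈⟨ S.+-congˡ (S.-‿inverseˡ _) ⟨
        var w ⊕ (⊖ (con (d w) ⊗ β) ⊕ con (d w) ⊗ β)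
          ≈⟨ S.+-assoc _ _ _ ⟨
        (var w - con (d w) ⊗ β) ⊕ con (d w) ⊗ β
          ≈⟨ S.+-congˡ (S.*-comm _ _) ⟩
        (var w - con (d w) ⊗ β) ⊕ β ⊗ con (d w) ∎
        where open SetoidReasoning S.setoid
      taylor (p ⊕ q) = S.trans (S.+-cong (taylor p) (taylor q))
        (SI.lemma₁ (σ p) (σ q) β (∂ p) (∂ q))
      taylor (⊖ p) = S.trans (S.-‿cong (taylor p))
        (S.trans (S.sym (SR.-‿+-comm (σ p) (β ⊗ ∂ p))) (S.+-congˡ (SR.-‿distribʳ-* β (∂ p))))
      taylor (p ⊗ q) = begin
        p ⊗ q
          ≈⟨ S.*-congʳ (taylor p) ⟩
        (σ p ⊕ β ⊗ ∂ p) ⊗ q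
          ≈⟨ SI.lemma₂ (σ p) β (∂ p) q ⟩
        σ p ⊗ q ⊕ β ⊗ (∂ p ⊗ q)
          ≈⟨ S.+-congʳ (S.*-congˡ (taylor q)) ⟩
        σ p ⊗ (σ q ⊕ β ⊗ ∂ q) ⊕ β ⊗ (∂ p ⊗ q)
          ≈⟨ SI.lemma₃ (σ p) (σ q) β (∂ q) (∂ p ⊗ q) ⟩
        σ p ⊗ σ q ⊕ β ⊗ (∂ p ⊗ q ⊕ σ p ⊗ ∂ q) ∎
        where open SetoidReasoning S.setoid

      ∂-sum : ∀ {m} (g : Fin m → Fin n) → ∂ (sum (var ∘ g)) ≈ₛ con (ΣC.sum (d ∘ g))
      ∂-sum {zero}  g = S.refl
      ∂-sum {suc m} g = S.trans (S.+-congˡ (∂-sum (g ∘ suc))) (S.sym (SP.con-+ _ _))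

      ∂-sum≡0 : ∂ (sum var) ≈ₛ S.0#
      ∂-sum≡0 = S.trans (∂-sum (λ w → w)) (SP.con-cong sum-d)

      σ-sum≡0 : σ (sum var) ≈ₛ S.0#
      σ-sum≡0 = begin
        σ (sum var)                    ≈⟨ S.+-identityʳ _ ⟨
        σ (sum var) ⊕ S.0#             ≈⟨ S.+-congˡ (S.trans (S.*-congˡ ∂-sum≡0) (S.zeroʳ β)) ⟨
        σ (sum var) ⊕ β ⊗ ∂ (sum var)  ≈⟨ taylor (sum var) ⟨
        sum var                        ≈⟨ SP.rel sum≡0 ⟩
        S.0#                           ∎
        where open SetoidReasoning S.setoid

      σ-cong : ∀ {p q} → p ≈ₛ q → σ p ≈ₛ σ q
      σ-cong = SP.bind-cong _ λ { sum≡0 → σ-sum≡0 }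

      ∂-cong : ∀ {p q} → p ≈ₛ q → ∂ p ≈ₛ ∂ q
      ∂-cong SP.≋-refl = S.refl
      ∂-cong (SP.≋-sym e) = S.sym (∂-cong e)
      ∂-cong (SP.≋-trans e e′) = S.trans (∂-cong e) (∂-cong e′)
      ∂-cong (SP.⊕-cong e e′) = S.+-cong (∂-cong e) (∂-cong e′)
      ∂-cong (SP.⊗-cong e e′) = S.+-cong (S.*-cong (∂-cong e) e′) (S.*-cong (σ-cong e) (∂-cong e′))
      ∂-cong (SP.⊖-cong e) = S.-‿cong (∂-cong e)
      ∂-cong (SP.⊕-assoc p q r) = S.+-assoc _ _ _
      ∂-cong (SP.⊕-comm p q) = S.+-comm _ _
      ∂-cong (SP.⊕-identityˡ p) = S.+-identityˡ _
      ∂-cong (SP.⊖-inverseˡ p) = S.-‿inverseˡ _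
      ∂-cong (SP.⊗-assoc p q r) = SI.lemma₄ (∂ p) (∂ q) (∂ r) q r (σ p) (σ q)
      ∂-cong (SP.⊗-comm p q) = begin
        ∂ p ⊗ q ⊕ σ p ⊗ ∂ q
          ≈⟨ S.+-congʳ (S.*-congˡ (taylor q)) ⟩
        ∂ p ⊗ (σ q ⊕ β ⊗ ∂ q) ⊕ σ p ⊗ ∂ q
          ≈⟨ SI.lemma₅ (∂ p) (∂ q) (σ p) (σ q) β ⟩
        ∂ q ⊗ (σ p ⊕ β ⊗ ∂ p) ⊕ σ q ⊗ ∂ p
          ≈⟨ S.+-congʳ (S.*-congˡ (taylor p)) ⟨
        ∂ q ⊗ p ⊕ σ q ⊗ ∂ p ∎
        where open SetoidReasoning S.setoid
      ∂-cong (SP.⊗-identityˡ p) =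
        S.trans (S.+-cong (S.zeroˡ p) (S.*-identityˡ (∂ p))) (S.+-identityˡ (∂ p))
      ∂-cong (SP.⊗-distribˡ p q r) = SI.lemma₆ (∂ p) (∂ q) (∂ r) q r (σ p)
      ∂-cong (SP.con-cong e) = S.refl
      ∂-cong (SP.con-+ k l) = S.sym (S.+-identityˡ S.0#)
      ∂-cong (SP.con-* k l) = S.sym (S.trans (S.+-cong (S.zeroˡ _) (S.zeroʳ _)) (S.+-identityˡ S.0#))
      ∂-cong (SP.rel sum≡0) = ∂-sum≡0

      σβ : σ β ≈ₛ S.0#
      σβ = SR.+-identityˡ-unique (σ β) β (S.sym (S.trans (taylor β)
             (S.+-congˡ (S.trans (S.*-congˡ du-dv) (S.*-identityʳ β)))))

      β-regular : Regular β
      β-regular p e = begin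
        p                       ≈⟨ S.*-identityˡ p ⟨
        S.1# ⊗ p                ≈⟨ S.*-congʳ du-dv ⟨
        ∂ β ⊗ p                 ≈⟨ S.+-identityʳ _ ⟨
        ∂ β ⊗ p ⊕ S.0#          ≈⟨ S.+-congˡ (S.trans (S.*-congʳ σβ) (S.zeroˡ (∂ p))) ⟨
        ∂ (β ⊗ p)               ≈⟨ ∂-cong e ⟩
        S.0#                    ∎
        where open SetoidReasoning S.setoid

  res-≢ : ∀ m → res m ≢ res (m ℤ.+ + 1)
  res-≢ m e = ℕ.<⇒≢ 2≤n (≡.sym (ℕ.∣1⇒≡1 (ℤ.∣⇒∣ᵤ (ℤ.divides (q′ ℤ.- q) 1≡))))
    where
    open ℤSolver.+-*-Solver
    m′ = m ℤ.+ + 1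
    q = m /ℕ n
    q′ = m′ /ℕ n

    r≡ : m %ℕ n ≡ m′ %ℕ n
    r≡ = ≡.trans (≡.sym (Fin.toℕ-fromℕ< _)) (≡.trans (≡.cong toℕ e) (Fin.toℕ-fromℕ< _))

    1≡ : + 1 ≡ (q′ ℤ.- q) ℤ.* + n
    1≡ = begin
      + 1
        ≡⟨ solve 1 (λ m → con (+ 1) := (m :+ con (+ 1)) :- m) ≡.refl m ⟩
      m′ ℤ.- m
        ≡⟨ ≡.cong₂ ℤ._-_ (a≡a%ℕn+[a/ℕn]*n m′ n) (a≡a%ℕn+[a/ℕn]*n m n) ⟩
      (+ (m′ %ℕ n) ℤ.+ q′ ℤ.* + n) ℤ.- (+ (m %ℕ n) ℤ.+ q ℤ.* + n)
        ≡⟨ ≡.cong (λ r → (+ (m′ %ℕ n) ℤ.+ q′ ℤ.* + n) ℤ.- (+ r ℤ.+ q ℤ.* + n)) r≡ ⟩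
      (+ (m′ %ℕ n) ℤ.+ q′ ℤ.* + n) ℤ.- (+ (m′ %ℕ n) ℤ.+ q ℤ.* + n)
        ≡⟨ solve 4 (λ r q′ q n → (r :+ q′ :* n) :- (r :+ q :* n) := (q′ :- q) :* n) ≡.refl
             (+ (m′ %ℕ n)) q′ q (+ n) ⟩
      (q′ ℤ.- q) ℤ.* + n ∎
      where open ≡.≡-Reasoning

  abstract
    α-regular : ∀ m → Regular (α m)
    α-regular m = β-regular (res m) (res (m ℤ.+ + 1)) (res-≢ m)

  private
    module FS = FractionField S
    open FS using (Frac; frac)

  F : RawRing (c ⊔ ℓ) (c ⊔ ℓ)
  F = FS.fractionRing

  private
    module F = RawRing F

  actF : Permutation′ n → F.Carrier → F.Carrier
  actF π (frac p q r) = frac (permute π p) (permute π q) (permute-regular π r)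

  α⁻¹ : ℤ → F.Carrier
  α⁻¹ m = frac S.1# (α m) (α-regular m)

  open RawMonoidDefs ℤ.+-0-rawMonoid using () renaming (sum to sumℤ)

  -- An integer vector l stands for the coweight l - (Σ l / n) (1ⁿ); these
  -- are exactly the elements of the lattice spanned by the ω_k.
  Coweight : Set
  Coweight = Vector ℤ n

  -- n times the coordinates of the coweight represented by l.
  coordinates : Coweight → Vector ℤ n
  coordinates l v = + n ℤ.* l v ℤ.- sumℤ l

  -- t[ l ] π is the product of the translation t_l and π ∈ W.
  record Wₑ : Set where
    constructor t[_]_
    field
      translation : Coweight
      finite      : Permutation′ n
  open Wₑ

  infix 4 _≈ʷ_ _≟ʷ_

  _≈ʷ_ : Rel Wₑ _
  w ≈ʷ w′ = (∀ v → coordinates (translation w) v ≡ coordinates (translation w′) v)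
          × (finite w Perm.≈ finite w′)

  _≟ʷ_ : ∀ w w′ → Dec (w ≈ʷ w′)
  w ≟ʷ w′ = Fin.all? (λ v → coordinates (translation w) v ℤ.≟ coordinates (translation w′) v)
      ×-dec Fin.all? (λ v → (finite w ⟨$⟩ʳ v) Fin.≟ (finite w′ ⟨$⟩ʳ v))

  infixl 7 _·_

  _·_ : Wₑ → Wₑ → Wₑ
  (t[ l ] π) · (t[ m ] ρ) = t[ (λ v → l v ℤ.+ m (π ⟨$⟩ˡ v)) ] (ρ ∘ₚ π)

  fromW : Permutation′ n → Wₑ
  fromW π = t[ (λ _ → + 0) ] π

  t : Coweight → Wₑ
  t l = t[ l ] Perm.id

  idʷ : Wₑ
  idʷ = fromW Perm.id

  unit : ℤ → Coweight
  unit m v = if does (v Fin.≟ res m) then + 1 else + 0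

  -- For k < n; position n, represented by zero, has entry 0.
  ω : ℕ → Coweight
  ω k v = if does (1 ℕ.≤? toℕ v ×-dec toℕ v ℕ.≤? k) then + 1 else + 0

  s : ℤ → Wₑ
  s m = t[ l ] Perm.transpose (res m) (res (m ℤ.+ + 1))
    where
    l : Coweight
    l v = if does (res m Fin.≟ res (+ 0)) then unit (+ 1) v ℤ.- unit (+ n) v else + 0

  word : List ℤ → Wₑ
  word = foldr (λ m w → s m · w) idʷ

  τ : Wₑ
  τ = t (ω 1) · word (map (λ m → + suc m) (List.upTo (n ∸ 1)))

  τ^ : ℕ → Wₑ
  τ^ zero    = idʷ
  τ^ (suc r) = τ · τ^ r

  -- (r , m₁ ∷ m₂ ∷ …) is the expression τ^r s_{m₁} s_{m₂} ⋯
  Expression : Set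
  Expression = ℕ × List ℤ

  value : Expression → Wₑ
  value (r , ms) = τ^ r · word ms

  Reduced : Expression → Set
  Reduced e = ∀ e′ → value e′ ≈ʷ value e → length (proj₂ e) ≤ length (proj₂ e′)

  HasLength : Wₑ → ℕ → Set
  HasLength w l = ∃[ e ] (value e ≈ʷ w × Reduced e × length (proj₂ e) ≡ l)

  W⁰ : Wₑ → Set
  W⁰ w = ∀ v → ¬ (v Perm.≈ Perm.id) → ∀ {l m} → HasLength w l → HasLength (w · fromW v) m → l < m

  -- Formal sums of terms p w, compared by their coefficients.
  Twisted : Set (c ⊔ ℓ)
  Twisted = List (F.Carrier × Wₑ)

  coefficient : Twisted → Wₑ → F.Carrier
  coefficient x w = foldr (λ (p , v) r → if does (v ≟ʷ w) then p F.+ r else r) F.0# x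

  infixr 8 _•_

  _•_ : F.Carrier → Twisted → Twisted
  p • x = map (λ (q , w) → p F.* q , w) x

  [_] : Wₑ → Twisted
  [ w ] = (F.1# , w) ∷ []

  twistedRing : RawRing (c ⊔ ℓ) (c ⊔ ℓ)
  twistedRing = record
    { Carrier = Twisted
    ; _≈_ = λ x y → ∀ w → coefficient x w F.≈ coefficient y w
    ; _+_ = _++_
    ; _*_ = λ x y → concatMap (λ (p , v) → map (λ (q , w) → p F.* actF (finite v) q , v · w) y) x
    ; -_ = map (λ (p , w) → F.- p , w)
    ; 0# = []
    ; 1# = [ idʷ ]
    }

  private
    module T = RawRing twistedRing

  infix 4 _≈ᵗ_

  _≈ᵗ_ : Rel Twisted (c ⊔ ℓ)
  _≈ᵗ_ = T._≈_

  fromS : S.Carrier → Twisted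
  fromS p = FS.fromRing p • T.1#

  combination : ∀ {b} {B : Set b} → (B → Twisted) → List (S.Carrier × B) → Twisted
  combination f = foldr (λ (p , y) x → FS.fromRing p • f y T.+ x) T.0#

  Aₛ : ℤ → Twisted
  Aₛ m = α⁻¹ m • ([ s m ] T.+ T.- T.1#)

  -- A_w for w = value e, when e is reduced.
  A : Expression → Twisted
  A (r , ms) = [ τ^ r ] T.* foldr (λ m x → Aₛ m T.* x) T.1# ms

  _∈𝔸 : Twisted → Set (c ⊔ ℓ)
  x ∈𝔸 = Σ[ L ∈ List (S.Carrier × Expression) ] (All (Reduced ∘ proj₂) L × x ≈ᵗ combination A L)

  _∈ℙ : Twisted → Set (c ⊔ ℓ)
  x ∈ℙ = x ∈𝔸 × (∀ p → x T.* fromS p ≈ᵗ fromS p T.* x)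

  -- The family is indexed by W⁰; values of j outside W⁰ are unconstrained.
  record IsSchubertBasis (j : Wₑ → Twisted) : Set (c ⊔ ℓ) where
    field
      cong        : ∀ {w w′} → W⁰ w → w ≈ʷ w′ → j w ≈ᵗ j w′
      member      : ∀ {w} → W⁰ w → j w ∈ℙ
      spanning    : ∀ {x} → x ∈ℙ → Σ[ L ∈ List (S.Carrier × Wₑ) ] (All (W⁰ ∘ proj₂) L × x ≈ᵗ combination j L)
      independent : ∀ (L : List (S.Carrier × Wₑ)) → All (W⁰ ∘ proj₂) L →
                    AllPairs (λ (_ , w) (_ , w′) → ¬ (w ≈ʷ w′)) L →
                    combination j L ≈ᵗ T.0# → All (λ (p , _) → p S.≈ S.0#) L
      leading     : ∀ {e} → Reduced e → W⁰ (value e) →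
                    Σ[ L ∈ List (S.Carrier × Expression) ]
                           (All (λ (_ , e′) → Reduced e′ × ¬ W⁰ (value e′)) L
                            × j (value e) ≈ᵗ A e T.+ combination A L)

  -- x = y / u in ℙ, including that u is invertible there.
  _≈_/_ : Twisted → Twisted → Twisted → Set (c ⊔ ℓ)
  x ≈ y / u = ∃[ v ] (v ∈ℙ × v T.* u ≈ᵗ T.1# × x ≈ᵗ y T.* v)

  record Entry : Set where
    field
      row col : ℕ
      1≤row   : 1 ≤ row
      row≤col : row ≤ col
      col≤n   : col ≤ n

  z : ℕ → ℕ → Poly S.Carrier Entry
  z i j with 1 ℕ.≤? i | i ℕ.≤? j | j ℕ.≤? n
  ... | yes p | yes q | yes r = var (record { 1≤row = p ; row≤col = q ; col≤n = r })
  ... | _     | _     | _     = con S.0#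

  -- The rows and columns of (z_ij) are numbered from 1. The second
  -- relation is the one for z_{i+1,j+1}.
  data ZRelation : Rel (Poly S.Carrier Entry) c where
    det≡1      : ZRelation (Vector.foldr _⊗_ (con S.1#) (λ (v : Fin n) → z (suc (toℕ v)) (suc (toℕ v))))
                           (con S.1#)
    centrality : ∀ {i j} → 1 ≤ i → i ≤ j → suc j ≤ n →
                 ZRelation (z (suc i) (suc j)) (z i j ⊕ con (a (+ i) S.- a (+ suc j)) ⊗ z i (suc j))

  ℂ[Z̃] : CommutativeRing c (c ⊔ ℓ)
  ℂ[Z̃] = Presented.algebra S ZRelation

  private
    module Z = CommutativeRing ℂ[Z̃]

  record IsSAlgebraIsomorphism (φ : Z.Carrier → Twisted) : Set (c ⊔ ℓ) where
    field
      isRingMonomorphism : IsRingMonomorphism Z.rawRing twistedRing φ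
      coefficients       : ∀ p → φ (con p) ≈ᵗ fromS p
      image⊆ℙ            : ∀ x → φ x ∈ℙ
      ℙ⊆image            : ∀ {y} → y ∈ℙ → ∃[ x ] (φ x ≈ᵗ y)

  -- (l zero , l (suc zero) , …) = (λ₁ , λ₂ , …)
  IsPartition : ∀ {k} → Vector ℕ k → Set
  IsPartition l = ∀ {p q} → p Fin.≤ q → l q ≤ l p

  -- Columns λ_k + 1, λ_{k-1} + 2, …, λ₁ + k of the first k rows.
  minor : ∀ {k} → Vector ℕ k → Z.Carrier
  minor l = Determinant.det ℂ[Z̃] λ p q → z (suc (toℕ p)) (l (opposite q) ℕ.+ suc (toℕ q))

  cᵂ : ℕ → Wₑ
  cᵂ p = word (map +_ (downFrom p))

  -- u i l = (l - i , l - i - 1 , … , 1 - i), empty when l = 0.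
  u : ℕ → ℕ → List ℤ
  u i l = map (λ m → + suc m ℤ.- + i) (downFrom l)

  -- u_k ⋯ u₂ u₁; the factors u_i with λ_i = 0 are empty.
  wᵃᶠ : ∀ {k} → Vector ℕ k → Wₑ
  wᵃᶠ l = word (concat (List.reverse (List.tabulate (λ p → u (suc (toℕ p)) (l p)))))

  -- n - i rows and i columns; R⁻ has the last row shortened by one cell.
  R : ∀ i → Vector ℕ (n ∸ i)
  R i = λ _ → i

  R⁻ : ∀ i → Vector ℕ (n ∸ i)
  R⁻ i p = if does (suc (toℕ p) ℕ.≟ n ∸ i) then i ∸ 1 else i

  D D′ : ℕ → Z.Carrier
  D  i = minor (R i)
  D′ i = minor (R⁻ i)

  -ω : ℕ → Coweight
  -ω i v = ℤ.- ω i v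

{-# OPTIONS --safe #-}
module Submission where

-- The coefficient of A_w in an element of the Peterson algebra is detected
-- by letting the element act on δ, the indicator function of the coset W in
-- the functions on W_e / W: terms A_x with x outside W_e⁰ kill δ, by the
-- exchange property, while the A_w with w in W_e⁰ act on it by divided
-- differences.  So the function attached to j_{τ^k w} arises from the
-- indicator function of τ^k W by the divided differences of a reduced word
-- of w.  On the other side, z_{ii} goes to a translation, and the off-diagonal
-- entries are then determined by the centrality relation
-- z_{ij} = z_{i-1,j-1} + (a_{i-1} - a_j) z_{i-1,j}, which makes conjugation
-- by s_c a row and a column operation on (z_{ij}).  On the minors of the
-- first k rows, this operation adds the multiple by α_c of the minor of λ
-- with one more box of content c - k, if there is such a box, and fixes the
-- minor otherwise.  Hence the minors obey the same divided difference
-- recursion as the j_{τ^k w_λ}, and both sides agree for λ = ∅.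

open import Algebra.Bundles using (CommutativeRing; RawRing)
import Algebra.Definitions.RawMonoid as RawMonoidDefs
import Algebra.Definitions.RawSemiring as RawSemiringDefs
open import Algebra.Morphism.Structures using (IsRingMonomorphism)
import Algebra.Properties.AbelianGroup as AbelianGroupProperties
import Algebra.Properties.Ring as RingProperties
import Algebra.Properties.Semiring.Mult as Multiples
import Algebra.Properties.Semiring.Sum as SemiringSum
import Algebra.Solver.Ring
import Algebra.Solver.Ring.AlmostCommutativeRing as ACR
import Algebra.Solver.Ring.NaturalCoefficients.Default as NaturalSolver
open import Data.Bool.Base using (if_then_else_; true; false; Bool)
open import Data.Empty using (⊥)
open import Data.Fin.Base as Fin using (Fin; zero; suc; toℕ; punchIn; punchOut; inject₁; opposite)
import Data.Fin.Permutation as Perm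
open import Data.Fin.Permutation using (Permutation′; _⟨$⟩ʳ_; _⟨$⟩ˡ_; _∘ₚ_)
import Data.Fin.Permutation.Components as PC
import Data.Fin.Properties as Fin
import Data.Integer.Base as ℤᵇ
open import Data.Integer.Base as ℤ using (ℤ; +_)
open import Data.Integer.DivMod using (_%ℕ_; _/ℕ_; n%ℕd<d; a≡a%ℕn+[a/ℕn]*n)
import Data.Integer.Properties as ℤ
import Data.Integer.Solver as ℤSolver
open import Data.List.Base as List using (List; []; _∷_; foldr; length; map; applyUpTo; _++_; concatMap; concat; reverse; tabulate)
import Data.List.Properties as List
open import Data.List.Relation.Unary.All using (All; []; _∷_)
open import Data.Maybe.Base using (Maybe; just; nothing)
open import Data.Nat.Base as ℕ using (ℕ; zero; suc; z≤n; s≤s; _∸_)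
import Data.Nat.DivMod as ℕ
import Data.Nat.Properties as ℕ
open import Data.Product.Base using (_×_; _,_; proj₁; proj₂; Σ; Σ-syntax; ∃-syntax)
open import Data.Product.Properties using (≡-dec)
open import Data.Sum.Base using (_⊎_; inj₁; inj₂)
open import Data.Unit.Base using (⊤; tt)
open import Data.Vec.Functional as Vector using (Vector)
open import Defs
open import Function.Base using (_∘_; id; case_of_)
open import Function.Bundles using (_⇔_; mk⇔; Equivalence)
open import Level using (Level; _⊔_)
open import Relation.Binary.Bundles using (Setoid)
open import Relation.Binary.Definitions using (tri<; tri≈; tri>)
open import Relation.Binary.PropositionalEquality as ≡ using (_≡_; _≢_; _≗_)
import Relation.Binary.Reasoning.Setoid as SetoidReasoning
open import Relation.Nullary.Decidable using (yes; no; does; Dec; _×-dec_; dec-true; dec-false; does-⇔)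
open import Relation.Nullary.Negation using (¬_; contradiction)

-- Acting on δ loses nothing on the Peterson algebra: commuting with S forces the support of an
-- element into the translations, and each coset of W contains exactly one translation. Length and
-- W_e⁰ are defined through minimal expressions, so the word of a shape has to be proved reduced,
-- with value in W_e⁰, before its Schubert class can be addressed at all. This happens on windows: a
-- coset of W is recorded by n integers, one in each residue class, a simple reflection moves two of
-- them by one, and the words that climb at every letter are reduced words of shortest
-- representatives. The words of w_λ contain s_0, while the matrix (z_ij) is conjugated by
-- permutations only. The factor τ^k reconciles the two: it turns the letter m into m + k, and a box
-- inside the rectangle with k rows and n - k columns has content between 1 - k and n - k - 1, so m
-- + k lies between 1 and n - 1.

private
  variable
    c ℓ : Level

-- Ring identities with integer coefficients

-- The ring solver with integer coefficients; (m , n) stands for m - n.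
module IntegerSolver (R : CommutativeRing c ℓ) where
  open CommutativeRing R
  open RingProperties ring using (-‿distribˡ-*; -‿distribʳ-*; -‿involutive; -0#≈0#)
  open AbelianGroupProperties +-abelianGroup using (⁻¹-∙-comm)
  open Multiples semiring using (×-homo-+; ×1-homo-*) renaming (_×_ to infixr 8 _·_; ×-homo-1 to ×-homo-1#)
  open SetoidReasoning setoid
  private
    module N = NaturalSolver commutativeSemiring

    ⟦_⟧ : ℕ × ℕ → Carrier
    ⟦ m , n ⟧ = m · 1# - n · 1#

    -- Coefficients are kept with one component zero, because `weakDec` recognises two coefficients
    -- as equal only when their pairs coincide.
    reduce : ℕ × ℕ → ℕ × ℕ
    reduce (suc m , suc n) = reduce (m , n)
    reduce p               = p

    coefficients : RawRing _ _
    coefficients = record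
      { Carrier = ℕ × ℕ
      ; _≈_ = _≡_
      ; _+_ = λ (m , n) (m′ , n′) → reduce (m ℕ.+ m′ , n ℕ.+ n′)
      ; _*_ = λ (m , n) (m′ , n′) → reduce (m ℕ.* m′ ℕ.+ n ℕ.* n′ , m ℕ.* n′ ℕ.+ n ℕ.* m′)
      ; -_ = λ (m , n) → n , m
      ; 0# = 0 , 0
      ; 1# = 1 , 0
      }

    reduce-≡ : ∀ p → proj₁ (reduce p) ℕ.+ proj₂ p ≡ proj₁ p ℕ.+ proj₂ (reduce p)
    reduce-≡ (zero  , n)     = ≡.refl
    reduce-≡ (suc m , zero)  = ≡.refl
    reduce-≡ (suc m , suc n) = ≡.trans (ℕ.+-suc _ n) (≡.cong suc (reduce-≡ (m , n)))

    ⟦⟧-cong : ∀ p q → proj₁ p ℕ.+ proj₂ q ≡ proj₁ q ℕ.+ proj₂ p → ⟦ p ⟧ ≈ ⟦ q ⟧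
    ⟦⟧-cong (m , n) (m′ , n′) e = begin
      a - b                     ≈⟨ N.solve 2 (λ x y → x N.:+ y N.:= (x N.:+ y) N.:+ N.con 0) refl a (- b) ⟩
      (a - b) + 0#              ≈⟨ +-congˡ (-‿inverseʳ b′) ⟨
      (a - b) + (b′ - b′)       ≈⟨ N.solve 4 (λ a x b y → (a N.:+ x) N.:+ (b N.:+ y) N.:= (a N.:+ b) N.:+ (x N.:+ y)) refl a (- b) b′ (- b′) ⟩
      (a + b′) + (- b - b′)     ≈⟨ +-congʳ (trans (sym (×-homo-+ 1# m n′))
                                     (trans (reflexive (≡.cong (_· 1#) e)) (×-homo-+ 1# m′ n))) ⟩
      (a′ + b) + (- b - b′)     ≈⟨ N.solve 4 (λ a x b y → (a N.:+ b) N.:+ (x N.:+ y) N.:= (a N.:+ y) N.:+ (b N.:+ x)) refl a′ (- b) b (- b′) ⟩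
      (a′ - b′) + (b - b)       ≈⟨ +-congˡ (-‿inverseʳ b) ⟩
      (a′ - b′) + 0#            ≈⟨ +-identityʳ _ ⟩
      a′ - b′                   ∎
      where
      a = m · 1#
      b = n · 1#
      a′ = m′ · 1#
      b′ = n′ · 1#

    homo-+ : ∀ m n m′ n′ → ⟦ m ℕ.+ m′ , n ℕ.+ n′ ⟧ ≈ ⟦ m , n ⟧ + ⟦ m′ , n′ ⟧
    homo-+ m n m′ n′ = begin
      (m ℕ.+ m′) · 1# - (n ℕ.+ n′) · 1#
        ≈⟨ +-cong (×-homo-+ 1# m m′) (trans (-‿cong (×-homo-+ 1# n n′)) (sym (⁻¹-∙-comm _ _))) ⟩
      (m · 1# + m′ · 1#) + (- (n · 1#) - n′ · 1#)
        ≈⟨ N.solve 4 (λ a b x y → (a N.:+ b) N.:+ (x N.:+ y) N.:= (a N.:+ x) N.:+ (b N.:+ y)) refl _ _ _ _ ⟩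
      ⟦ m , n ⟧ + ⟦ m′ , n′ ⟧ ∎

    homo-* : ∀ m n m′ n′ →
             ⟦ m ℕ.* m′ ℕ.+ n ℕ.* n′ , m ℕ.* n′ ℕ.+ n ℕ.* m′ ⟧ ≈ ⟦ m , n ⟧ * ⟦ m′ , n′ ⟧
    homo-* m n m′ n′ = begin
      ⟦ m ℕ.* m′ ℕ.+ n ℕ.* n′ , m ℕ.* n′ ℕ.+ n ℕ.* m′ ⟧
        ≈⟨ homo-+ (m ℕ.* m′) (m ℕ.* n′) (n ℕ.* n′) (n ℕ.* m′) ⟩
      ((m ℕ.* m′) · 1# - (m ℕ.* n′) · 1#) + ((n ℕ.* n′) · 1# - (n ℕ.* m′) · 1#)
        ≈⟨ +-cong (+-cong (×1-homo-* m m′) (-‿cong (×1-homo-* m n′)))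
                  (+-cong (×1-homo-* n n′) (-‿cong (×1-homo-* n m′))) ⟩
      (a * a′ - a * b′) + (b * b′ - b * a′)
        ≈⟨ +-cong (+-congˡ (-‿distribʳ-* a b′))
             (+-cong (trans (sym (-‿involutive _))
                        (trans (-‿cong (-‿distribʳ-* b b′)) (-‿distribˡ-* b (- b′))))
                     (-‿distribˡ-* b a′)) ⟩
      (a * a′ + a * - b′) + (- b * - b′ + - b * a′)
        ≈⟨ N.solve 4 (λ a x b y → (a N.:* b N.:+ a N.:* y) N.:+ (x N.:* y N.:+ x N.:* b)
             N.:= (a N.:+ x) N.:* (b N.:+ y)) refl a (- b) a′ (- b′) ⟩
      (a - b) * (a′ - b′) ∎
      where
      a = m · 1#
      b = n · 1#
      a′ = m′ · 1#
      b′ = n′ · 1#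

    -- The literals 0 and 1 are interpreted without subtraction, so that
    -- they may occur in the goals of the solver.
    value : ℕ × ℕ → Carrier
    value (0 , 0) = 0#
    value (1 , 0) = 1#
    value p = ⟦ p ⟧

    value≈ : ∀ p → value p ≈ ⟦ p ⟧
    value≈ (0 , 0)           = sym (-‿inverseʳ _)
    value≈ (1 , 0)           = sym (trans (+-cong (×-homo-1# 1#) -0#≈0#) (+-identityʳ _))
    value≈ (0 , suc n)       = refl
    value≈ (1 , suc n)       = refl
    value≈ (suc (suc m) , n) = refl

    value-reduce : ∀ p → value (reduce p) ≈ ⟦ p ⟧
    value-reduce p = trans (value≈ (reduce p)) (⟦⟧-cong (reduce p) p (reduce-≡ p))

    homomorphism : coefficients ACR.-Raw-AlmostCommutative⟶ ACR.fromCommutativeRing R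
    homomorphism = record
      { ⟦_⟧ = value
      ; +-homo = λ p@(m , n) q@(m′ , n′) → trans (value-reduce (m ℕ.+ m′ , n ℕ.+ n′))
          (trans (homo-+ m n m′ n′) (sym (+-cong (value≈ p) (value≈ q))))
      ; *-homo = λ p@(m , n) q@(m′ , n′) → trans
          (value-reduce (m ℕ.* m′ ℕ.+ n ℕ.* n′ , m ℕ.* n′ ℕ.+ n ℕ.* m′))
          (trans (homo-* m n m′ n′) (sym (*-cong (value≈ p) (value≈ q))))
      ; -‿homo = λ p@(m , n) → trans (value≈ (n , m)) (trans (+-comm _ _)
          (trans (+-congˡ (sym (-‿involutive _))) (trans (⁻¹-∙-comm _ _) (sym (-‿cong (value≈ p))))))
      ; 0-homo = refl
      ; 1-homo = refl
      }

    weakDec : ∀ p q → Maybe (value p ≈ value q)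
    weakDec p q with ≡-dec ℕ._≟_ ℕ._≟_ p q
    ... | yes e = just (reflexive (≡.cong value e))
    ... | no _  = nothing

  open Algebra.Solver.Ring coefficients (ACR.fromCommutativeRing R) homomorphism weakDec public
    using (Polynomial; solve; _:=_; _:+_; _:*_; _:-_; :-_; con)

  :0 :1 : ∀ {m} → Polynomial m
  :0 = con (0 , 0)
  :1 = con (1 , 0)

-- Fractions with regular denominators

module Fractions (R : CommutativeRing c ℓ) where
  open CommutativeRing R
  open FractionField R
  open IntegerSolver R
  open SetoidReasoning setoid

  private
    module F = RawRing fractionRing

    cancel : ∀ {q x y} → Regular q → q * x ≈ q * y → x ≈ y
    cancel {q} {x} {y} r e = begin
      x             ≈⟨ solve 2 (λ x y → x := (x :- y) :+ y) refl x y ⟩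
      (x - y) + y   ≈⟨ +-congʳ (r (x - y) (trans
                         (solve 3 (λ q x y → q :* (x :- y) := q :* x :- q :* y) refl q x y)
                         (trans (+-congʳ e) (-‿inverseʳ _)))) ⟩
      0# + y        ≈⟨ +-identityˡ y ⟩
      y             ∎

    ≈F-trans : ∀ {p q r} → p F.≈ q → q F.≈ r → p F.≈ r
    ≈F-trans {frac a b _} {frac a′ b′ r′} {frac a″ b″ _} e e′ = cancel r′ (begin
      b′ * (a * b″)   ≈⟨ solve 3 (λ x y z → x :* (y :* z) := (y :* x) :* z) refl b′ a b″ ⟩
      (a * b′) * b″   ≈⟨ *-congʳ e ⟩
      (a′ * b) * b″   ≈⟨ solve 3 (λ x y z → (x :* y) :* z := (x :* z) :* y) refl a′ b b″ ⟩
      (a′ * b″) * b   ≈⟨ *-congʳ e′ ⟩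
      (a″ * b′) * b   ≈⟨ solve 3 (λ x y z → (x :* y) :* z := y :* (x :* z)) refl a″ b′ b ⟩
      b′ * (a″ * b)   ∎)

    +F-cong : ∀ {p p′ q q′} → p F.≈ p′ → q F.≈ q′ → p F.+ q F.≈ p′ F.+ q′
    +F-cong {frac a b _} {frac a′ b′ _} {frac c d _} {frac c′ d′ _} e e′ = begin
      (a * d + c * b) * (b′ * d′)
        ≈⟨ solve 6 (λ a b b′ c d d′ → (a :* d :+ c :* b) :* (b′ :* d′)
             := (a :* b′) :* (d :* d′) :+ (c :* d′) :* (b :* b′)) refl a b b′ c d d′ ⟩
      (a * b′) * (d * d′) + (c * d′) * (b * b′)
        ≈⟨ +-cong (*-congʳ e) (*-congʳ e′) ⟩
      (a′ * b) * (d * d′) + (c′ * d) * (b * b′)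
        ≈⟨ solve 6 (λ a′ b b′ c′ d d′ → (a′ :* b) :* (d :* d′) :+ (c′ :* d) :* (b :* b′)
             := (a′ :* d′ :+ c′ :* b′) :* (b :* d)) refl a′ b b′ c′ d d′ ⟩
      (a′ * d′ + c′ * b′) * (b * d) ∎

    *F-cong : ∀ {p p′ q q′} → p F.≈ p′ → q F.≈ q′ → p F.* q F.≈ p′ F.* q′
    *F-cong {frac a b _} {frac a′ b′ _} {frac c d _} {frac c′ d′ _} e e′ = begin
      (a * c) * (b′ * d′)  ≈⟨ solve 4 (λ a c b d → (a :* c) :* (b :* d) := (a :* b) :* (c :* d)) refl a c b′ d′ ⟩
      (a * b′) * (c * d′)  ≈⟨ *-cong e e′ ⟩
      (a′ * b) * (c′ * d)  ≈⟨ solve 4 (λ a c b d → (a :* b) :* (c :* d) := (a :* c) :* (b :* d)) refl a′ c′ b d ⟩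
      (a′ * c′) * (b * d)  ∎

  -- The wrapper lets Agda infer the fractions from a proof of equality.
  record _≈F_ (p q : F.Carrier) : Set ℓ where
    constructor wrap
    field unwrap : p F.≈ q
  open _≈F_ public

  fractions : CommutativeRing (c ⊔ ℓ) ℓ
  fractions = record
    { Carrier = F.Carrier
    ; _≈_ = _≈F_
    ; _+_ = F._+_
    ; _*_ = F._*_
    ; -_ = F.-_
    ; 0# = F.0#
    ; 1# = F.1#
    ; isCommutativeRing = record
      { isRing = record
        { +-isAbelianGroup = record
          { isGroup = record
            { isMonoid = record
              { isSemigroup = record
                { isMagma = record
                  { isEquivalence = record
                    { refl = wrap refl
                    ; sym = λ (wrap e) → wrap (sym e)
                    ; trans = λ {p} {q} {r} (wrap e) (wrap f) → wrap (≈F-trans {p} {q} {r} e f)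
                    }
                  ; ∙-cong = λ {p} {p′} {q} {q′} (wrap e) (wrap f) → wrap (+F-cong {p} {p′} {q} {q′} e f)
                  }
                ; assoc = λ (frac a b _) (frac c d _) (frac e f _) → wrap
                    (solve 6 (λ a b c d e f → ((a :* d :+ c :* b) :* f :+ e :* (b :* d)) :* (b :* (d :* f))
                      := (a :* (d :* f) :+ (c :* f :+ e :* d) :* b) :* ((b :* d) :* f)) refl a b c d e f)
                }
              ; identity = (λ (frac a b _) → wrap (solve 2 (λ a b → (:0 :* b :+ a :* :1) :* b := a :* (:1 :* b)) refl a b))
                         , (λ (frac a b _) → wrap (solve 2 (λ a b → (a :* :1 :+ :0 :* b) :* b := a :* (b :* :1)) refl a b))
              }
            ; inverse = (λ (frac a b _) → wrap (solve 2 (λ a b → (:- a :* b :+ a :* b) :* :1 := :0 :* (b :* b)) refl a b))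
                      , (λ (frac a b _) → wrap (solve 2 (λ a b → (a :* b :+ :- a :* b) :* :1 := :0 :* (b :* b)) refl a b))
            ; ⁻¹-cong = λ { {frac a b _} {frac c d _} (wrap e) → wrap (trans
                (solve 2 (λ a d → :- a :* d := :- (a :* d)) refl a d)
                (trans (-‿cong e) (solve 2 (λ c b → :- (c :* b) := :- c :* b) refl c b))) }
            }
          ; comm = λ (frac a b _) (frac c d _) → wrap
              (solve 4 (λ a b c d → (a :* d :+ c :* b) :* (d :* b) := (c :* b :+ a :* d) :* (b :* d)) refl a b c d)
          }
        ; *-cong = λ {p} {p′} {q} {q′} (wrap e) (wrap f) → wrap (*F-cong {p} {p′} {q} {q′} e f)
        ; *-assoc = λ (frac a b _) (frac c d _) (frac e f _) → wrap
            (solve 6 (λ a b c d e f → ((a :* c) :* e) :* (b :* (d :* f))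
              := (a :* (c :* e)) :* ((b :* d) :* f)) refl a b c d e f)
        ; *-identity = (λ (frac a b _) → wrap (solve 2 (λ a b → (:1 :* a) :* b := a :* (:1 :* b)) refl a b))
                     , (λ (frac a b _) → wrap (solve 2 (λ a b → (a :* :1) :* b := a :* (b :* :1)) refl a b))
        ; distrib = (λ (frac a b _) (frac c d _) (frac e f _) → wrap
              (solve 6 (λ a b c d e f → (a :* (c :* f :+ e :* d)) :* ((b :* d) :* (b :* f))
                := ((a :* c) :* (b :* f) :+ (a :* e) :* (b :* d)) :* (b :* (d :* f))) refl a b c d e f))
          , (λ (frac a b _) (frac c d _) (frac e f _) → wrap
              (solve 6 (λ a b c d e f → ((c :* f :+ e :* d) :* a) :* ((d :* b) :* (f :* b))
                := ((c :* a) :* (f :* b) :+ (e :* a) :* (d :* b)) :* ((d :* f) :* b)) refl a b c d e f))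
        }
      ; *-comm = λ (frac a b _) (frac c d _) → wrap
          (solve 4 (λ a b c d → (a :* c) :* (d :* b) := (c :* a) :* (b :* d)) refl a b c d)
      }
    }

  cancelˡ : ∀ {q} → Regular q → ∀ {x y} → (fromRing q F.* x) ≈F (fromRing q F.* y) → x ≈F y
  cancelˡ {q} r {frac a b _} {frac c d _} (wrap e) = wrap (cancel r (begin
    q * (a * d)         ≈⟨ solve 3 (λ q a d → q :* (a :* d) := (q :* a) :* (:1 :* d)) refl q a d ⟩
    (q * a) * (1# * d)  ≈⟨ e ⟩
    (q * c) * (1# * b)  ≈⟨ solve 3 (λ q c b → (q :* c) :* (:1 :* b) := q :* (c :* b)) refl q c b ⟩
    q * (c * b)         ∎))

-- Row and column operations on determinants

module DeterminantProperties (R : CommutativeRing c ℓ) where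
  open CommutativeRing R hiding (zero)
  open Determinant R
  open IntegerSolver R
  open SemiringSum semiring using (sum; sum-cong-≋; ∑-distrib-+; *-distribˡ-sum; sum-replicate-zero)
  open RawSemiringDefs (RawRing.rawSemiring rawRing) using (_^_)
  open SetoidReasoning setoid

  Matrix : ℕ → Set c
  Matrix k = Fin k → Fin k → Carrier

  sign : ∀ {k} → Fin k → Carrier
  sign q = (- 1#) ^ toℕ q

  minor₀ : ∀ {k} → Matrix (suc k) → Fin (suc k) → Matrix k
  minor₀ M q r s = M (suc r) (punchIn q s)

  sum≈0 : ∀ {k} {f : Fin k → Carrier} → (∀ q → f q ≈ 0#) → sum f ≈ 0#
  sum≈0 {k} e = trans (sum-cong-≋ e) (sum-replicate-zero k)

  det-cong : ∀ {k} {M N : Matrix k} → (∀ i j → M i j ≈ N i j) → det M ≈ det N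
  det-cong {zero}  e = refl
  det-cong {suc k} e = sum-cong-≋ λ q →
    *-cong (*-congˡ {sign q} (e zero q)) (det-cong λ r s → e (suc r) (punchIn q s))

  sum-linear : ∀ {k} b {f g h : Fin k → Carrier} → (∀ q → f q ≈ g q + b * h q) →
               sum f ≈ sum g + b * sum h
  sum-linear b {f} {g} {h} e = begin
    sum f                            ≈⟨ sum-cong-≋ e ⟩
    sum (λ q → g q + b * h q)        ≈⟨ ∑-distrib-+ g (λ q → b * h q) ⟩
    sum g + sum (λ q → b * h q)      ≈⟨ +-congˡ (*-distribˡ-sum b h) ⟨
    sum g + b * sum h                ∎

  -- In the expansion along the first row, the term of `q₀` is linear through its entry, and every
  -- other term through its minor, in which the column `q₀` survives with index `punchOut q≢`.
  det-column-linear : ∀ {k} b (q₀ : Fin k) {X Y Z : Matrix k} →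
                      (∀ i → X i q₀ ≈ Y i q₀ + b * Z i q₀) →
                      (∀ i q → q ≢ q₀ → X i q ≈ Y i q × X i q ≈ Z i q) →
                      det X ≈ det Y + b * det Z
  det-column-linear {suc k} b q₀ {X} {Y} {Z} e f = sum-linear b term
    where
    term : ∀ q → sign q * X zero q * det (minor₀ X q) ≈
                 sign q * Y zero q * det (minor₀ Y q) + b * (sign q * Z zero q * det (minor₀ Z q))
    term q with q Fin.≟ q₀
    ... | yes ≡.refl = begin
      sign q * X zero q * det (minor₀ X q)
        ≈⟨ *-congʳ (*-congˡ (e zero)) ⟩
      sign q * (Y zero q + b * Z zero q) * det (minor₀ X q)
        ≈⟨ solve 5 (λ s y b z d → s :* (y :+ b :* z) :* d := s :* y :* d :+ b :* (s :* z :* d)) refl _ _ _ _ _ ⟩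
      sign q * Y zero q * det (minor₀ X q) + b * (sign q * Z zero q * det (minor₀ X q))
        ≈⟨ +-cong (*-congˡ (det-cong λ r s → proj₁ (f (suc r) _ (Fin.punchInᵢ≢i q s))))
                  (*-congˡ (*-congˡ (det-cong λ r s → proj₂ (f (suc r) _ (Fin.punchInᵢ≢i q s))))) ⟩
      sign q * Y zero q * det (minor₀ Y q) + b * (sign q * Z zero q * det (minor₀ Z q)) ∎
    ... | no q≢ = begin
      sign q * X zero q * det (minor₀ X q)
        ≈⟨ *-congˡ (det-column-linear b (punchOut q≢)
             (λ i → ≡.subst (λ t → X (suc i) t ≈ Y (suc i) t + b * Z (suc i) t)
                      (≡.sym (Fin.punchIn-punchOut q≢)) (e (suc i)))
             (λ i s s≢ → f (suc i) _ λ t → s≢ (Fin.punchIn-injective q s _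
                            (≡.trans t (≡.sym (Fin.punchIn-punchOut q≢)))))) ⟩
      sign q * X zero q * (det (minor₀ Y q) + b * det (minor₀ Z q))
        ≈⟨ solve 5 (λ s x b d d′ → s :* x :* (d :+ b :* d′) := s :* x :* d :+ b :* (s :* x :* d′)) refl _ _ _ _ _ ⟩
      sign q * X zero q * det (minor₀ Y q) + b * (sign q * X zero q * det (minor₀ Z q))
        ≈⟨ +-cong (*-congʳ (*-congˡ (proj₁ (f zero q q≢))))
                  (*-congˡ (*-congʳ (*-congˡ (proj₂ (f zero q q≢))))) ⟩
      sign q * Y zero q * det (minor₀ Y q) + b * (sign q * Z zero q * det (minor₀ Z q)) ∎

  det-row-linear : ∀ {k} b (r₀ : Fin k) {X Y Z : Matrix k} →
                   (∀ q → X r₀ q ≈ Y r₀ q + b * Z r₀ q) →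
                   (∀ i q → i ≢ r₀ → X i q ≈ Y i q × X i q ≈ Z i q) →
                   det X ≈ det Y + b * det Z
  det-row-linear {suc k} b zero {X} {Y} {Z} e f = sum-linear b λ q → begin
      sign q * X zero q * det (minor₀ X q)
        ≈⟨ *-congʳ (*-congˡ (e q)) ⟩
      sign q * (Y zero q + b * Z zero q) * det (minor₀ X q)
        ≈⟨ solve 5 (λ s y b z d → s :* (y :+ b :* z) :* d := s :* y :* d :+ b :* (s :* z :* d)) refl _ _ _ _ _ ⟩
      sign q * Y zero q * det (minor₀ X q) + b * (sign q * Z zero q * det (minor₀ X q))
        ≈⟨ +-cong (*-congˡ (det-cong λ r s → proj₁ (f (suc r) _ λ ())))
                  (*-congˡ (*-congˡ (det-cong λ r s → proj₂ (f (suc r) _ λ ())))) ⟩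
      sign q * Y zero q * det (minor₀ Y q) + b * (sign q * Z zero q * det (minor₀ Z q)) ∎
  det-row-linear {suc k} b (suc r₀) {X} {Y} {Z} e f = sum-linear b λ q → begin
      sign q * X zero q * det (minor₀ X q)
        ≈⟨ *-congˡ (det-row-linear b r₀ (λ s → e (punchIn q s))
             (λ i s i≢ → f (suc i) _ (i≢ ∘ Fin.suc-injective))) ⟩
      sign q * X zero q * (det (minor₀ Y q) + b * det (minor₀ Z q))
        ≈⟨ solve 5 (λ s x b d d′ → s :* x :* (d :+ b :* d′) := s :* x :* d :+ b :* (s :* x :* d′)) refl _ _ _ _ _ ⟩
      sign q * X zero q * det (minor₀ Y q) + b * (sign q * X zero q * det (minor₀ Z q))
        ≈⟨ +-cong (*-congʳ (*-congˡ (proj₁ (f zero q λ ()))))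
                  (*-congˡ (*-congʳ (*-congˡ (proj₂ (f zero q λ ()))))) ⟩
      sign q * Y zero q * det (minor₀ Y q) + b * (sign q * Z zero q * det (minor₀ Z q)) ∎

  -- The terms for q, q′ and q′, q of a double sum over distinct columns
  -- have opposite signs.
  sum-antisymmetric : ∀ {k} (x : Fin (suc k) → Carrier) (h : Fin (suc k) → Fin k → Carrier) →
    (∀ q s q′ s′ → punchIn q s ≡ q′ → punchIn q′ s′ ≡ q → h q s ≈ h q′ s′) →
    sum (λ q → sign q * x q * sum (λ s → sign s * x (punchIn q s) * h q s)) ≈ 0#
  sum-antisymmetric {zero} x h _ =
    solve 2 (λ s y → s :* y :* :0 :+ :0 := :0) refl _ _
  sum-antisymmetric {suc k} x h sym-h = begin
    1# * x zero * sum f + sum (λ q → sign (suc q) * x (suc q) *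
        (1# * x zero * h (suc q) zero + sum (λ s → sign (suc s) * x (suc (punchIn q s)) * h (suc q) (suc s))))
      ≈⟨ +-cong (*-distribˡ-sum (1# * x zero) f) (sum-cong-≋ λ q → distribˡ (sign (suc q) * x (suc q)) (1# * x zero * h (suc q) zero) (inner q)) ⟩
    sum (λ q → 1# * x zero * f q) + sum (λ q → g q + g′ q)
      ≈⟨ +-congˡ (∑-distrib-+ g g′) ⟩
    sum (λ q → 1# * x zero * f q) + (sum g + sum g′)
      ≈⟨ +-assoc _ _ _ ⟨
    (sum (λ q → 1# * x zero * f q) + sum g) + sum g′
      ≈⟨ +-congʳ (∑-distrib-+ (λ q → 1# * x zero * f q) g) ⟨
    sum (λ q → 1# * x zero * f q + g q) + sum g′
      ≈⟨ +-cong (sum≈0 cancels) (sum-cong-≋ factor) ⟩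
    0# + sum (λ q → sign q * x (suc q) * sum (λ s → sign s * x (suc (punchIn q s)) * h (suc q) (suc s)))
      ≈⟨ +-identityˡ _ ⟩
    sum (λ q → sign q * x (suc q) * sum (λ s → sign s * x (suc (punchIn q s)) * h (suc q) (suc s)))
      ≈⟨ sum-antisymmetric (x ∘ suc) (λ q s → h (suc q) (suc s))
           (λ q s q′ s′ e e′ → sym-h _ _ _ _ (≡.cong suc e) (≡.cong suc e′)) ⟩
    0# ∎
    where
    f g g′ inner : Fin (suc k) → Carrier
    inner q = sum λ s → sign (suc s) * x (suc (punchIn q s)) * h (suc q) (suc s)
    f s = sign s * x (suc s) * h zero s
    g q = sign (suc q) * x (suc q) * (1# * x zero * h (suc q) zero)
    g′ q = sign (suc q) * x (suc q) * inner q

    cancels : ∀ q → 1# * x zero * f q + g q ≈ 0#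
    cancels q = trans (+-congʳ (*-congˡ (*-congˡ (sym-h zero q (suc q) zero ≡.refl ≡.refl))))
      (solve 4 (λ s y z h → :1 :* y :* (s :* z :* h) :+ (:- :1 :* s) :* z :* (:1 :* y :* h) := :0)
        refl (sign q) (x zero) (x (suc q)) (h (suc q) zero))

    factor : ∀ q → g′ q ≈ sign q * x (suc q) * sum (λ s → sign s * x (suc (punchIn q s)) * h (suc q) (suc s))
    factor q = begin
      g′ q
        ≈⟨ *-congˡ (sum-cong-≋ λ s → solve 3 (λ s x h → (:- :1 :* s) :* x :* h := :- :1 :* (s :* x :* h))
             refl (sign s) (x (suc (punchIn q s))) (h (suc q) (suc s))) ⟩
      sign (suc q) * x (suc q) * sum (λ s → - 1# * i s)
        ≈⟨ *-congˡ (*-distribˡ-sum (- 1#) i) ⟨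
      sign (suc q) * x (suc q) * (- 1# * sum i)
        ≈⟨ solve 3 (λ s x h → (:- :1 :* s) :* x :* (:- :1 :* h) := s :* x :* h)
             refl (sign q) (x (suc q)) (sum i) ⟩
      sign q * x (suc q) * sum i ∎
      where
      i : Fin k → Carrier
      i s = sign s * x (suc (punchIn q s)) * h (suc q) (suc s)

  -- Deleting two columns leaves the same columns in either order. This is the symmetry that
  -- `sum-antisymmetric` asks of the minors in a double expansion.
  punchIn-swap : ∀ {k} (q : Fin (suc (suc k))) s q′ s′ → punchIn q s ≡ q′ → punchIn q′ s′ ≡ q →
                 ∀ t → punchIn q (punchIn s t) ≡ punchIn q′ (punchIn s′ t)
  punchIn-swap zero s (suc q′) zero e e′ t with Fin.suc-injective e
  ... | ≡.refl = ≡.refl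
  punchIn-swap (suc q) zero zero s′ e e′ t with Fin.suc-injective e′
  ... | ≡.refl = ≡.refl
  punchIn-swap (suc q) (suc s) (suc q′) (suc s′) e e′ zero = ≡.refl
  punchIn-swap {suc k} (suc q) (suc s) (suc q′) (suc s′) e e′ (suc t) =
    ≡.cong suc (punchIn-swap q s q′ s′ (Fin.suc-injective e) (Fin.suc-injective e′) t)

  -- Adjacent rows suffice, since a simple reflection adds a multiple of row c to row c + 1. If they
  -- are the first two rows, a double expansion is an antisymmetric sum; otherwise they survive in
  -- every minor of the first row.
  det-equal-rows : ∀ {k} (r : Fin k) {M : Matrix (suc k)} →
                   (∀ q → M (suc r) q ≈ M (inject₁ r) q) → det M ≈ 0#
  det-equal-rows {suc k} zero {M} e = begin
    det M
      ≈⟨ sum-cong-≋ (λ q → *-congˡ {sign q * M zero q} (sum-cong-≋ λ s →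
           *-congʳ {det (λ r t → M (suc (suc r)) (punchIn q (punchIn s t)))} (*-congˡ {sign s} (e (punchIn q s))))) ⟩
    sum (λ q → sign q * M zero q * sum (λ s → sign s * M zero (punchIn q s) *
      det (λ r t → M (suc (suc r)) (punchIn q (punchIn s t)))))
      ≈⟨ sum-antisymmetric (M zero) (λ q s → det (λ r t → M (suc (suc r)) (punchIn q (punchIn s t))))
           (λ q s q′ s′ e e′ → det-cong λ r t → reflexive (≡.cong (M (suc (suc r))) (punchIn-swap q s q′ s′ e e′ t))) ⟩
    0# ∎
  det-equal-rows {suc k} (suc r) {M} e = sum≈0 λ q →
    trans (*-congˡ {sign q * M zero q} (det-equal-rows r {minor₀ M q} λ s → e (punchIn q s))) (zeroʳ _)

  det-row-operation : ∀ {k} b (r : Fin k) {X Y : Matrix (suc k)} →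
                      (∀ q → X (suc r) q ≈ Y (suc r) q + b * Y (inject₁ r) q) →
                      (∀ i q → i ≢ suc r → X i q ≈ Y i q) → det X ≈ det Y
  det-row-operation b r {X} {Y} e f = begin
    det X               ≈⟨ det-row-linear b (suc r) (λ q → trans (e q) (+-congˡ (*-congˡ (Z-suc q)))) (λ i q i≢ → f i q i≢ , trans (f i q i≢) (Z-≢ i q i≢)) ⟩
    det Y + b * det Z   ≈⟨ +-congˡ (trans (*-congˡ (det-equal-rows r {Z} Z-equal)) (zeroʳ b)) ⟩
    det Y + 0#          ≈⟨ +-identityʳ _ ⟩
    det Y               ∎
    where
    -- `Z` repeats row `inject₁ r` in row `suc r`: it carries the multiple of b in row-linearity,
    -- and its determinant vanishes.
    Z : Matrix (suc _)
    Z i q with i Fin.≟ suc r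
    ... | yes _ = Y (inject₁ r) q
    ... | no  _ = Y i q

    Z-suc : ∀ q → Y (inject₁ r) q ≈ Z (suc r) q
    Z-suc q with suc r Fin.≟ suc r
    ... | yes _ = refl
    ... | no ne = contradiction ≡.refl ne

    Z-≢ : ∀ i q → i ≢ suc r → Y i q ≈ Z i q
    Z-≢ i q i≢ with i Fin.≟ suc r
    ... | yes p = contradiction p i≢
    ... | no  _ = refl

    inject₁≢suc : ∀ {k} (r : Fin k) → inject₁ r ≢ suc r
    inject₁≢suc (suc r) p = inject₁≢suc r (Fin.suc-injective p)

    Z-equal : ∀ q → Z (suc r) q ≈ Z (inject₁ r) q
    Z-equal q = trans (sym (Z-suc q)) (Z-≢ (inject₁ r) q (inject₁≢suc r))

  -- For a zero column, linearity with b = 1 reads det M = det M + det M.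
  det-zero-column : ∀ {k} (q₀ : Fin k) {M : Matrix k} → (∀ i → M i q₀ ≈ 0#) → det M ≈ 0#
  det-zero-column q₀ {M} e = begin
    det M                       ≈⟨ solve 1 (λ d → d := (d :+ :1 :* d) :- d) refl (det M) ⟩
    (det M + 1# * det M) - det M ≈⟨ +-congʳ (det-column-linear 1# q₀ (λ i → trans (e i)
                                     (sym (trans (+-cong (e i) (trans (*-identityˡ _) (e i))) (+-identityˡ 0#))))
                                     (λ i q _ → refl , refl)) ⟨
    det M - det M               ≈⟨ -‿inverseʳ _ ⟩
    0#                          ∎

  det-first-column : ∀ {k} {M : Matrix (suc k)} → (∀ i → M (suc i) zero ≈ 0#) →
                     det M ≈ M zero zero * det (λ r s → M (suc r) (suc s))
  det-first-column {k} {M} e = begin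
    1# * M zero zero * det (λ r s → M (suc r) (suc s)) + sum (λ q → term (suc q))
      ≈⟨ +-cong (*-congʳ (*-identityˡ _)) (sum≈0 (vanishes {M = M} e)) ⟩
    M zero zero * det (λ r s → M (suc r) (suc s)) + 0#
      ≈⟨ +-identityʳ _ ⟩
    M zero zero * det (λ r s → M (suc r) (suc s)) ∎
    where
    term : Fin (suc k) → Carrier
    term q = sign q * M zero q * det (minor₀ M q)

    vanishes : ∀ {k} {M : Matrix (suc k)} → (∀ i → M (suc i) zero ≈ 0#) →
               ∀ q → sign (suc q) * M zero (suc q) * det (minor₀ M (suc q)) ≈ 0#
    vanishes {suc k} {M} e q = trans (*-congˡ (det-zero-column zero {minor₀ M (suc q)} e)) (zeroʳ _)

-- Words of simple reflections acting on windows

module IntegerOrder where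
  open ℤSolver.+-*-Solver public using (solve; _:=_; _:+_; _:*_; _:-_; :-_; con)
  open ℤᵇ using (_<_; _+_; _-_)

  <⇒0< : ∀ {a b} → a < b → + 0 < b - a
  <⇒0< {a} {b} p = ≡.subst (_< b - a) (ℤ.+-inverseʳ a) (ℤ.+-monoˡ-< (ℤ.- a) p)

  0<⇒< : ∀ {a b} → + 0 < b - a → a < b
  0<⇒< {a} {b} p = ≡.subst₂ _<_ (ℤ.+-identityˡ a)
    (solve 2 (λ a b → (b :- a) :+ a := b) ≡.refl a b) (ℤ.+-monoˡ-< a p)

  -- The equations between differences are left to the ring solver.
  from₁ : ∀ {a b a′ b′} → a < b → b′ - a′ ≡ b - a → a′ < b′
  from₁ p e = 0<⇒< (≡.subst (+ 0 <_) (≡.sym e) (<⇒0< p))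

  from₂ : ∀ {a b c d a′ b′} → a < b → c < d → b′ - a′ ≡ (b - a) + (d - c) → a′ < b′
  from₂ p q e = 0<⇒< (≡.subst (+ 0 <_) (≡.sym e) (ℤ.+-mono-< (<⇒0< p) (<⇒0< q)))

  -- The constant is -2, the value that the differences take in the contradictions below, which all
  -- come from n = 2.
  absurd₁ : ∀ {a b} → a < b → b - a ≡ ℤ.-[1+ 1 ] → ⊥
  absurd₁ p e = case ≡.subst (+ 0 <_) e (<⇒0< p) of λ ()

  absurd₂ : ∀ {a b c d} → a < b → c < d → (b - a) + (d - c) ≡ ℤ.-[1+ 1 ] → ⊥
  absurd₂ p q e = case ≡.subst (+ 0 <_) e (ℤ.+-mono-< (<⇒0< p) (<⇒0< q)) of λ ()

-- A coset w W is recorded by the function P sending a residue modulo n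
-- to the element of the affine window of w in that residue class, and
-- op u describes left multiplication by a simple reflection.
module Reflection {n} (nxt : Fin n → Fin n) (nxt-≢ : ∀ u → nxt u ≢ u)
  (nxt-injective : ∀ {u v} → nxt u ≡ nxt v → u ≡ v) where
  open IntegerOrder
  open ℤᵇ using (_<_; _+_; _-_)

  State : Set
  State = Fin n → ℤ

  -- The reflection s_u sends the window element of class u to its successor, in class `nxt u`.
  -- Comparing `P u + 1` with the old element of that class tells whether the coset becomes longer,
  -- stays the same or becomes shorter.
  Ascent Fixed Descent : Fin n → State → Set
  Ascent  u P = P (nxt u) < P u + + 1
  Fixed   u P = P u + + 1 ≡ P (nxt u)
  Descent u P = P u + + 1 < P (nxt u)

  abstract
    op : Fin n → State → State
    op u P v with v Fin.≟ u
    ... | yes _ = P (nxt u) - + 1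
    ... | no  _ with v Fin.≟ nxt u
    ...   | yes _ = P u + + 1
    ...   | no  _ = P v

    op-here : ∀ u {P} → op u P u ≡ P (nxt u) - + 1
    op-here u with u Fin.≟ u
    ... | yes _ = ≡.refl
    ... | no ne = contradiction ≡.refl ne

    op-next : ∀ u {P} → op u P (nxt u) ≡ P u + + 1
    op-next u with nxt u Fin.≟ u
    ... | yes e = contradiction e (nxt-≢ u)
    ... | no  _ with nxt u Fin.≟ nxt u
    ...   | yes _ = ≡.refl
    ...   | no ne = contradiction ≡.refl ne

    op-other : ∀ u {P v} → v ≢ u → v ≢ nxt u → op u P v ≡ P v
    op-other u {P} {v} p q with v Fin.≟ u
    ... | yes e = contradiction e p
    ... | no  _ with v Fin.≟ nxt u
    ...   | yes e = contradiction e q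
    ...   | no  _ = ≡.refl

  data Position (u v : Fin n) : Set where
    here  : v ≡ u → Position u v
    next  : v ≡ nxt u → Position u v
    other : v ≢ u → v ≢ nxt u → Position u v

  position : ∀ u v → Position u v
  position u v with v Fin.≟ u
  ... | yes e = here e
  ... | no p with v Fin.≟ nxt u
  ...   | yes e = next e
  ...   | no q = other p q

  op-cong : ∀ u {P Q} → P ≗ Q → op u P ≗ op u Q
  op-cong u e v with position u v
  ... | here ≡.refl = ≡.trans (op-here u) (≡.trans (≡.cong (_- + 1) (e (nxt u))) (≡.sym (op-here u)))
  ... | next ≡.refl = ≡.trans (op-next u) (≡.trans (≡.cong (_+ + 1) (e u)) (≡.sym (op-next u)))
  ... | other p q   = ≡.trans (op-other u p q) (≡.trans (e v) (≡.sym (op-other u p q)))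

  private
    +1-1 : ∀ x → x + + 1 - + 1 ≡ x
    +1-1 = solve 1 (λ x → x :+ con (+ 1) :- con (+ 1) := x) ≡.refl

    -1+1 : ∀ x → x - + 1 + + 1 ≡ x
    -1+1 = solve 1 (λ x → x :- con (+ 1) :+ con (+ 1) := x) ≡.refl

    -1+1-comm : ∀ x → x - + 1 + + 1 ≡ x + + 1 - + 1
    -1+1-comm x = ≡.trans (-1+1 x) (≡.sym (+1-1 x))

  op-involutive : ∀ u P → op u (op u P) ≗ P
  op-involutive u P v with position u v
  ... | here ≡.refl = ≡.trans (op-here u) (≡.trans (≡.cong (_- + 1) (op-next u {P})) (+1-1 _))
  ... | next ≡.refl = ≡.trans (op-next u) (≡.trans (≡.cong (_+ + 1) (op-here u {P})) (-1+1 _))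
  ... | other p q   = ≡.trans (op-other u p q) (op-other u p q)

  op-fixed : ∀ u {P} → Fixed u P → op u P ≗ P
  op-fixed u {P} f v with position u v
  ... | here ≡.refl = ≡.trans (op-here u) (≡.trans (≡.cong (_- + 1) (≡.sym f)) (+1-1 _))
  ... | next ≡.refl = ≡.trans (op-next u) f
  ... | other p q   = op-other u p q

  op-comm : ∀ {u v} → u ≢ v → nxt u ≢ v → nxt v ≢ u → ∀ P → op u (op v P) ≗ op v (op u P)
  op-comm {u} {v} u≢v u⁺≢v v⁺≢u P w with position u w | position v w
  ... | here ≡.refl | here ≡.refl = contradiction ≡.refl u≢v
  ... | here ≡.refl | next ≡.refl = contradiction ≡.refl v⁺≢u
  ... | here ≡.refl | other p q = ≡.trans (op-here u)
        (≡.trans (≡.cong (_- + 1) (op-other v u⁺≢v (u≢v ∘ nxt-injective)))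
        (≡.sym (≡.trans (op-other v p q) (op-here u))))
  ... | next ≡.refl | here ≡.refl = contradiction ≡.refl u⁺≢v
  ... | next ≡.refl | next e = contradiction (nxt-injective e) u≢v
  ... | next ≡.refl | other p q = ≡.trans (op-next u)
        (≡.trans (≡.cong (_+ + 1) (op-other v u≢v (v⁺≢u ∘ ≡.sym)))
        (≡.sym (≡.trans (op-other v p q) (op-next u))))
  ... | other p q | here ≡.refl = ≡.trans (op-other u p q) (≡.trans (op-here v)
        (≡.sym (≡.trans (op-here v) (≡.cong (_- + 1) (op-other u v⁺≢u (u≢v ∘ ≡.sym ∘ nxt-injective))))))
  ... | other p q | next ≡.refl = ≡.trans (op-other u p q) (≡.trans (op-next v)
        (≡.sym (≡.trans (op-next v) (≡.cong (_+ + 1) (op-other u (u≢v ∘ ≡.sym) (u⁺≢v ∘ ≡.sym))))))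
  ... | other p q | other p′ q′ = ≡.trans (op-other u p q) (≡.trans (op-other v p′ q′)
        (≡.sym (≡.trans (op-other v p′ q′) (op-other u p q))))

  -- The hypothesis excludes n = 2, where the two simple reflections satisfy no braid relation.
  op-braid : ∀ u → nxt (nxt u) ≢ u → ∀ P →
             op u (op (nxt u) (op u P)) ≗ op (nxt u) (op u (op (nxt u) P))
  op-braid u₁ u₃≢u₁ P v with position u₁ v | position (nxt u₁) v
  ... | here ≡.refl | _ = begin
          op u₁ (op u₂ (op u₁ P)) u₁   ≡⟨ op-here u₁ ⟩
          op u₂ (op u₁ P) u₂ - + 1     ≡⟨ ≡.cong (_- + 1) (op-here u₂) ⟩
          op u₁ P u₃ - + 1 - + 1       ≡⟨ ≡.cong (λ x → x - + 1 - + 1) (op-other u₁ u₃≢u₁ (nxt-≢ u₂)) ⟩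
          P u₃ - + 1 - + 1             ≡⟨ ≡.cong (_- + 1) (op-here u₂) ⟨
          op u₂ P u₂ - + 1             ≡⟨ op-here u₁ ⟨
          op u₁ (op u₂ P) u₁           ≡⟨ op-other u₂ (nxt-≢ u₁ ∘ ≡.sym) (u₃≢u₁ ∘ ≡.sym) ⟨
          op u₂ (op u₁ (op u₂ P)) u₁   ∎
    where
    open ≡.≡-Reasoning
    u₂ = nxt u₁
    u₃ = nxt u₂
  ... | next ≡.refl | _ = begin
          op u₁ (op u₂ (op u₁ P)) u₂   ≡⟨ op-next u₁ ⟩
          op u₂ (op u₁ P) u₁ + + 1     ≡⟨ ≡.cong (_+ + 1) (op-other u₂ (nxt-≢ u₁ ∘ ≡.sym) (u₃≢u₁ ∘ ≡.sym)) ⟩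
          op u₁ P u₁ + + 1             ≡⟨ ≡.cong (_+ + 1) (op-here u₁) ⟩
          P u₂ - + 1 + + 1             ≡⟨ -1+1-comm (P u₂) ⟩
          P u₂ + + 1 - + 1             ≡⟨ ≡.cong (_- + 1) (op-next u₂) ⟨
          op u₂ P u₃ - + 1             ≡⟨ ≡.cong (_- + 1) (op-other u₁ u₃≢u₁ (nxt-≢ u₂)) ⟨
          op u₁ (op u₂ P) u₃ - + 1     ≡⟨ op-here u₂ ⟨
          op u₂ (op u₁ (op u₂ P)) u₂   ∎
    where
    open ≡.≡-Reasoning
    u₂ = nxt u₁
    u₃ = nxt u₂
  ... | other p q | here e = contradiction e q
  ... | other p q | next ≡.refl = begin
          op u₁ (op u₂ (op u₁ P)) u₃   ≡⟨ op-other u₁ p q ⟩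
          op u₂ (op u₁ P) u₃           ≡⟨ op-next u₂ ⟩
          op u₁ P u₂ + + 1             ≡⟨ ≡.cong (_+ + 1) (op-next u₁) ⟩
          P u₁ + + 1 + + 1             ≡⟨ ≡.cong (λ x → x + + 1 + + 1) (op-other u₂ (nxt-≢ u₁ ∘ ≡.sym) (u₃≢u₁ ∘ ≡.sym)) ⟨
          op u₂ P u₁ + + 1 + + 1       ≡⟨ ≡.cong (_+ + 1) (op-next u₁) ⟨
          op u₁ (op u₂ P) u₂ + + 1     ≡⟨ op-next u₂ ⟨
          op u₂ (op u₁ (op u₂ P)) u₃   ∎
    where
    open ≡.≡-Reasoning
    u₂ = nxt u₁
    u₃ = nxt u₂
  ... | other p q | other p′ q′ =
          ≡.trans (op-other u₁ p q) (≡.trans (op-other u₂ p′ q′) (≡.trans (op-other u₁ p q)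
          (≡.sym (≡.trans (op-other u₂ p′ q′) (≡.trans (op-other u₁ p q) (op-other u₂ p′ q′))))))
    where
    u₂ = nxt u₁

  -- A power of τ rotates the residues and shifts the window by a constant, so this is the relation
  -- τ s_u τ⁻¹ = s_{u+1} on windows.
  op-equivariant : ∀ (ρ : Fin n → Fin n) d → (∀ {u v} → ρ u ≡ ρ v → u ≡ v) → (∀ u → ρ (nxt u) ≡ nxt (ρ u)) →
                   ∀ u {P Q} → (∀ v → P v ≡ Q (ρ v) + d) → ∀ v → op u P v ≡ op (ρ u) Q (ρ v) + d
  op-equivariant ρ d ρ-injective ρ-nxt u {P} {Q} e v with position u v
  ... | here ≡.refl = begin
          op u P u                       ≡⟨ op-here u ⟩
          P (nxt u) - + 1                ≡⟨ ≡.cong (_- + 1) (e (nxt u)) ⟩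
          Q (ρ (nxt u)) + d - + 1        ≡⟨ ≡.cong (λ w → Q w + d - + 1) (ρ-nxt u) ⟩
          Q (nxt (ρ u)) + d - + 1        ≡⟨ solve 2 (λ q d → q :+ d :- con (+ 1) := q :- con (+ 1) :+ d) ≡.refl (Q (nxt (ρ u))) d ⟩
          Q (nxt (ρ u)) - + 1 + d        ≡⟨ ≡.cong (_+ d) (op-here (ρ u)) ⟨
          op (ρ u) Q (ρ u) + d           ∎
    where open ≡.≡-Reasoning
  ... | next ≡.refl = begin
          op u P (nxt u)                 ≡⟨ op-next u ⟩
          P u + + 1                      ≡⟨ ≡.cong (_+ + 1) (e u) ⟩
          Q (ρ u) + d + + 1              ≡⟨ solve 2 (λ q d → q :+ d :+ con (+ 1) := q :+ con (+ 1) :+ d) ≡.refl (Q (ρ u)) d ⟩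
          Q (ρ u) + + 1 + d              ≡⟨ ≡.cong (_+ d) (op-next (ρ u)) ⟨
          op (ρ u) Q (nxt (ρ u)) + d     ≡⟨ ≡.cong (λ w → op (ρ u) Q w + d) (ρ-nxt u) ⟨
          op (ρ u) Q (ρ (nxt u)) + d     ∎
    where open ≡.≡-Reasoning
  ... | other p q = ≡.trans (op-other u p q) (≡.trans (e v) (≡.cong (_+ d)
          (≡.sym (op-other (ρ u) (p ∘ ρ-injective) (q ∘ ρ-injective ∘ λ t → ≡.trans t (≡.sym (ρ-nxt u)))))))

  data Step (u : Fin n) (P : State) : Set where
    ascent  : Ascent u P → Step u P
    fixed   : Fixed u P → Step u P
    descent : Descent u P → Step u P

  step : ∀ u P → Step u P
  step u P with ℤ.<-cmp (P u + + 1) (P (nxt u))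
  ... | tri< p _ _ = descent p
  ... | tri≈ _ p _ = fixed p
  ... | tri> _ _ p = ascent p

  data Relative (u v : Fin n) : Set where
    same   : u ≡ v → Relative u v
    after  : u ≡ nxt v → Relative u v
    before : nxt u ≡ v → Relative u v
    apart  : u ≢ v → nxt u ≢ v → nxt v ≢ u → Relative u v

  relative : ∀ u v → Relative u v
  relative u v with u Fin.≟ v | u Fin.≟ nxt v | nxt u Fin.≟ v
  ... | yes e | _ | _ = same e
  ... | no _ | yes e | _ = after e
  ... | no _ | no _ | yes e = before e
  ... | no p | no q | no r = apart p r (q ∘ ≡.sym)

  module Chains (base : State) (base-sorted : ∀ u → ¬ Descent u base) where

    end : List (Fin n) → State
    end []       = base
    end (u ∷ us) = op u (end us)

    -- Words that climb from the coset W at every letter, read from right to left. By `up⇒reduced`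
    -- and `up⇒W⁰` they are reduced words of elements of W_e⁰, also behind a power of τ.
    data Up : List (Fin n) → Set where
      []  : Up []
      _∷_ : ∀ {u us} → Ascent u (end us) → Up us → Up (u ∷ us)

    up? : ∀ us → Dec (Up us)
    up? [] = yes []
    up? (u ∷ us) with up? us | end us (nxt u) ℤ.<? end us u + + 1
    ... | yes p | yes q = yes (q ∷ p)
    ... | no ¬p | _     = no λ { (_ ∷ p) → ¬p p }
    ... | _     | no ¬q = no λ { (q ∷ _) → ¬q q }

    -- The exchange argument is carried out for any action of the nilCoxeter relations and serves
    -- twice: for the divided differences, and with a one-element carrier for lengths. `A-base` says
    -- that the simple reflections of W annihilate `x₀`.
    record NilCoxeterAction (X : Setoid c ℓ) : Set (c ⊔ ℓ) where
      open Setoid X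
      field
        A        : Fin n → Carrier → Carrier
        x₀ 0ₓ    : Carrier
        A-cong   : ∀ u {x y} → x ≈ y → A u x ≈ A u y
        A-comm   : ∀ {u v} → u ≢ v → nxt u ≢ v → nxt v ≢ u → ∀ x → A u (A v x) ≈ A v (A u x)
        A-braid  : ∀ u → nxt (nxt u) ≢ u → ∀ x → A u (A (nxt u) (A u x)) ≈ A (nxt u) (A u (A (nxt u) x))
        A-square : ∀ u x → A u (A u x) ≈ 0ₓ
        A-0      : ∀ u → A u 0ₓ ≈ 0ₓ
        A-base   : ∀ u → Fixed u base → A u x₀ ≈ 0ₓ

    module Operators (X : Setoid c ℓ) (action : NilCoxeterAction X) where
      open Setoid X
      open NilCoxeterAction action

      A* : List (Fin n) → Carrier
      A* = foldr A x₀

      -- The word `u ∷ word` is obtained from `us` by braid moves. The moves themselves are not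
      -- recorded, only their effect `A*≈` on the operators.
      record Exchange (u : Fin n) (us : List (Fin n)) : Set ℓ where
        field
          word    : List (Fin n)
          up      : Up word
          end≗    : end word ≗ op u (end us)
          length≡ : suc (length word) ≡ length us
          A*≈     : A* us ≈ A u (A* word)

      apart-exchange : ∀ {u v us} → u ≢ v → nxt u ≢ v → nxt v ≢ u → Ascent v (end us) →
                       Exchange u us → Exchange u (v ∷ us)
      apart-exchange {u} {v} {us} u≢v u⁺≢v v⁺≢u a E = record
        { word = v ∷ E.word
        ; up = ≡.subst₂ (λ x y → x < y + + 1)
            (≡.sym (≡.trans (E.end≗ (nxt v)) (op-other u v⁺≢u (u≢v ∘ ≡.sym ∘ nxt-injective))))
            (≡.sym (≡.trans (E.end≗ v) (op-other u (u≢v ∘ ≡.sym) (u⁺≢v ∘ ≡.sym))))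
            a ∷ E.up
        ; end≗ = λ w → ≡.trans (op-cong v E.end≗ w) (op-comm (u≢v ∘ ≡.sym) v⁺≢u u⁺≢v (end us) w)
        ; length≡ = ≡.cong suc E.length≡
        ; A*≈ = trans (A-cong v E.A*≈) (A-comm (u≢v ∘ ≡.sym) v⁺≢u u⁺≢v _)
        }
        where module E = Exchange E

      -- The two orders of neighbouring reflections, with x, y and z the window elements in the
      -- classes of u₁, u₂ and u₃. Two exchanges below the first letter expose three letters to
      -- which the braid relation applies.
      module Consecutive (u₁ : Fin n) (us : List (Fin n)) where
        u₂ = nxt u₁
        u₃ = nxt u₂
        x = end us u₁
        y = end us u₂
        z = end us u₃

        u₁≢u₂ : u₁ ≢ u₂
        u₁≢u₂ = nxt-≢ u₁ ∘ ≡.sym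

        -- For n = 2 the classes u₁ and u₃ coincide, and adding the two inequalities gives a
        -- contradiction. So the braid relation is available whenever it is called for.
        after-≢ : Ascent u₁ (end us) → Descent u₂ (op u₁ (end us)) → u₃ ≢ u₁
        after-≢ a d e = absurd₂ a
          (≡.subst₂ (λ x y → x + + 1 < y) (op-next u₁) (≡.trans (≡.cong (op u₁ (end us)) e) (op-here u₁)) d)
          (solve 2 (λ x y → ((x :+ con (+ 1)) :- y) :+ ((y :- con (+ 1)) :- (x :+ con (+ 1) :+ con (+ 1)))
            := con ℤ.-[1+ 1 ]) ≡.refl x y)

        before-≢ : Ascent u₂ (end us) → Descent u₁ (op u₂ (end us)) → u₃ ≢ u₁
        before-≢ a d e = absurd₂ a
          (≡.subst₂ (λ x y → x + + 1 < y) (≡.trans (≡.cong (op u₂ (end us)) (≡.sym e)) (op-next u₂)) (op-here u₂) d)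
          (solve 2 (λ z y → ((y :+ con (+ 1)) :- z) :+ ((z :- con (+ 1)) :- (y :+ con (+ 1) :+ con (+ 1)))
            := con ℤ.-[1+ 1 ]) ≡.refl z y)

        module _ (u₃≢u₁ : u₃ ≢ u₁) where
          private
            u₁≢u₃ : u₁ ≢ u₃
            u₁≢u₃ = u₃≢u₁ ∘ ≡.sym

          module After (a : Ascent u₁ (end us)) (d : Descent u₂ (op u₁ (end us))) where
            d′ : x + + 1 + + 1 < z
            d′ = ≡.subst₂ (λ x y → x + + 1 < y) (op-next u₁) (op-other u₁ u₃≢u₁ (nxt-≢ u₂)) d

            descent₁ : Descent u₂ (end us)
            descent₁ = from₂ a d′ (solve 3 (λ x y z → z :- (y :+ con (+ 1))
              := ((x :+ con (+ 1)) :- y) :+ (z :- (x :+ con (+ 1) :+ con (+ 1)))) ≡.refl x y z)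

            module _ (E₁ : Exchange u₂ us) where
              private
                module E₁ = Exchange E₁
                at₁′ : end E₁.word u₁ ≡ x
                at₁′ = ≡.trans (E₁.end≗ u₁) (op-other u₂ u₁≢u₂ u₁≢u₃)
                at₂′ : end E₁.word u₂ ≡ z - + 1
                at₂′ = ≡.trans (E₁.end≗ u₂) (op-here u₂)
                at₃′ : end E₁.word u₃ ≡ y + + 1
                at₃′ = ≡.trans (E₁.end≗ u₃) (op-next u₂)

              descent₂ : Descent u₁ (end E₁.word)
              descent₂ = ≡.subst₂ (λ x y → x + + 1 < y) (≡.sym at₁′) (≡.sym at₂′)
                (from₁ d′ (solve 2 (λ x z → (z :- con (+ 1)) :- (x :+ con (+ 1)) := z :- (x :+ con (+ 1) :+ con (+ 1))) ≡.refl x z))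

              -- By the first exchange `us` can start with u₂, and by the second the rest can start
              -- with u₁. So `u₁ ∷ us` becomes u₁ u₂ u₁ v with v = `E₂.word`, and the braid relation
              -- turns this into u₂ u₁ u₂ v.
              exchange-after : Exchange u₁ E₁.word → Exchange u₂ (u₁ ∷ us)
              exchange-after E₂ = record
                { word = u₁ ∷ u₂ ∷ E₂.word
                ; up = ≡.subst₂ (λ x y → x < y + + 1)
                         (≡.sym (≡.trans (op-here u₂) (≡.cong (_- + 1) at₃)))
                         (≡.sym (≡.trans (op-other u₂ u₁≢u₂ u₁≢u₃) at₁))
                         (from₂ a d′ (solve 3 (λ x y z → (z :- con (+ 1) :- con (+ 1) :+ con (+ 1)) :- (y :+ con (+ 1) :- con (+ 1))
                           := ((x :+ con (+ 1)) :- y) :+ (z :- (x :+ con (+ 1) :+ con (+ 1)))) ≡.refl x y z))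
                     ∷ ≡.subst₂ (λ x y → x < y + + 1) (≡.sym at₃) (≡.sym at₂) (ℤ.+-monoˡ-< (+ 1) a)
                     ∷ E₂.up
                ; end≗ = λ w → ≡.trans (op-cong u₁ (op-cong u₂ (λ w → ≡.trans (E₂.end≗ w) (op-cong u₁ E₁.end≗ w))) w)
                         (≡.trans (op-braid u₁ u₃≢u₁ (op u₂ (end us)) w)
                         (op-cong u₂ (op-cong u₁ (op-involutive u₂ (end us))) w))
                ; length≡ = ≡.cong suc (≡.trans (≡.cong suc E₂.length≡) E₁.length≡)
                ; A*≈ = trans (A-cong u₁ (trans E₁.A*≈ (A-cong u₂ E₂.A*≈))) (A-braid u₁ u₃≢u₁ _)
                }
                where
                module E₂ = Exchange E₂
                at₁ : end E₂.word u₁ ≡ z - + 1 - + 1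
                at₁ = ≡.trans (E₂.end≗ u₁) (≡.trans (op-here u₁) (≡.cong (_- + 1) at₂′))
                at₂ : end E₂.word u₂ ≡ x + + 1
                at₂ = ≡.trans (E₂.end≗ u₂) (≡.trans (op-next u₁) (≡.cong (_+ + 1) at₁′))
                at₃ : end E₂.word u₃ ≡ y + + 1
                at₃ = ≡.trans (E₂.end≗ u₃) (≡.trans (op-other u₁ u₃≢u₁ (nxt-≢ u₂)) at₃′)

          module Before (a : Ascent u₂ (end us)) (d : Descent u₁ (op u₂ (end us))) where
            d′ : x + + 1 < z - + 1
            d′ = ≡.subst₂ (λ x y → x + + 1 < y) (op-other u₂ u₁≢u₂ u₁≢u₃) (op-here u₂) d

            descent₁ : Descent u₁ (end us)
            descent₁ = from₂ a d′ (solve 3 (λ x y z → y :- (x :+ con (+ 1))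
              := ((y :+ con (+ 1)) :- z) :+ ((z :- con (+ 1)) :- (x :+ con (+ 1)))) ≡.refl x y z)

            module _ (E₁ : Exchange u₁ us) where
              private
                module E₁ = Exchange E₁
                at₁′ : end E₁.word u₁ ≡ y - + 1
                at₁′ = ≡.trans (E₁.end≗ u₁) (op-here u₁)
                at₂′ : end E₁.word u₂ ≡ x + + 1
                at₂′ = ≡.trans (E₁.end≗ u₂) (op-next u₁)
                at₃′ : end E₁.word u₃ ≡ z
                at₃′ = ≡.trans (E₁.end≗ u₃) (op-other u₁ u₃≢u₁ (nxt-≢ u₂))

              descent₂ : Descent u₂ (end E₁.word)
              descent₂ = ≡.subst₂ (λ x y → x + + 1 < y) (≡.sym at₂′) (≡.sym at₃′)
                (from₁ d′ (solve 2 (λ x z → z :- (x :+ con (+ 1) :+ con (+ 1)) := (z :- con (+ 1)) :- (x :+ con (+ 1))) ≡.refl x z))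

              exchange-before : Exchange u₂ E₁.word → Exchange u₁ (u₂ ∷ us)
              exchange-before E₂ = record
                { word = u₂ ∷ u₁ ∷ E₂.word
                ; up = ≡.subst₂ (λ x y → x < y + + 1)
                         (≡.sym (≡.trans (op-other u₁ u₃≢u₁ (nxt-≢ u₂)) at₃))
                         (≡.sym (≡.trans (op-next u₁) (≡.cong (_+ + 1) at₁)))
                         (from₂ a d′ (solve 3 (λ x y z → (y :- con (+ 1) :+ con (+ 1) :+ con (+ 1)) :- (x :+ con (+ 1) :+ con (+ 1))
                           := ((y :+ con (+ 1)) :- z) :+ ((z :- con (+ 1)) :- (x :+ con (+ 1)))) ≡.refl x y z))
                     ∷ ≡.subst₂ (λ x y → x < y + + 1) (≡.sym at₂) (≡.sym at₁)
                         (from₁ a (solve 2 (λ y z → (y :- con (+ 1) :+ con (+ 1)) :- (z :- con (+ 1)) := y :+ con (+ 1) :- z) ≡.refl y z))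
                     ∷ E₂.up
                ; end≗ = λ w → ≡.trans (op-cong u₂ (op-cong u₁ (λ w → ≡.trans (E₂.end≗ w) (op-cong u₂ E₁.end≗ w))) w)
                         (≡.trans (≡.sym (op-braid u₁ u₃≢u₁ (op u₁ (end us)) w))
                         (op-cong u₁ (op-cong u₂ (op-involutive u₁ (end us))) w))
                ; length≡ = ≡.cong suc (≡.trans (≡.cong suc E₂.length≡) E₁.length≡)
                ; A*≈ = trans (A-cong u₂ (trans E₁.A*≈ (A-cong u₁ E₂.A*≈))) (sym (A-braid u₁ u₃≢u₁ _))
                }
                where
                module E₂ = Exchange E₂
                at₁ : end E₂.word u₁ ≡ y - + 1
                at₁ = ≡.trans (E₂.end≗ u₁) (≡.trans (op-other u₂ u₁≢u₂ u₁≢u₃) at₁′)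
                at₂ : end E₂.word u₂ ≡ z - + 1
                at₂ = ≡.trans (E₂.end≗ u₂) (≡.trans (op-here u₂) (≡.cong (_- + 1) at₃′))
                at₃ : end E₂.word u₃ ≡ x + + 1 + + 1
                at₃ = ≡.trans (E₂.end≗ u₃) (≡.trans (op-next u₂) (≡.cong (_+ + 1) at₂′))

      private
        shorter : ∀ {u us} (E : Exchange u us) {k} → length us ℕ.≤ k → length (Exchange.word E) ℕ.≤ k
        shorter E l = ℕ.≤-trans (ℕ.n≤1+n _) (ℕ.≤-trans (ℕ.≤-reflexive (Exchange.length≡ E)) l)

      -- The recursion is on a bound for the length, because in the braid cases the second call
      -- concerns `E₁.word`, which is not a part of `us`.
      exchange′ : ∀ k {u us} → length us ℕ.≤ k → Up us → Descent u (end us) → Exchange u us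
      exchange′ k {u} {[]} _ _ d = contradiction d (base-sorted u)
      exchange′ (suc k) {u} {v ∷ us} (s≤s len) (a ∷ up) d with relative u v
      ... | same ≡.refl = record
        { word = us
        ; up = up
        ; end≗ = λ w → ≡.sym (op-involutive u (end us) w)
        ; length≡ = ≡.refl
        ; A*≈ = refl
        }
      ... | apart u≢v u⁺≢v v⁺≢u = apart-exchange u≢v u⁺≢v v⁺≢u a (exchange′ k {u} {us} len up
          (≡.subst₂ (λ x y → x + + 1 < y) (op-other v u≢v (v⁺≢u ∘ ≡.sym))
            (op-other v u⁺≢v (u≢v ∘ nxt-injective)) d))
      ... | after ≡.refl = exchange-after E₁ (exchange′ k (shorter E₁ len) (Exchange.up E₁) (descent₂ E₁))
        where
        open Consecutive v us
        open After (after-≢ a d) a d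
        E₁ = exchange′ k {u₂} {us} len up descent₁
      ... | before ≡.refl = exchange-before E₁ (exchange′ k (shorter E₁ len) (Exchange.up E₁) (descent₂ E₁))
        where
        open Consecutive u us
        open Before (before-≢ a d) a d
        E₁ = exchange′ k {u} {us} len up descent₁

      exchange : ∀ {u us} → Up us → Descent u (end us) → Exchange u us
      exchange {u} {us} = exchange′ (length us) ℕ.≤-refl

      module ConsecutiveFixed (u₁ : Fin n) (us : List (Fin n)) where
        open Consecutive u₁ us

        module AfterFixed (a : Ascent u₁ (end us)) (f : Fixed u₂ (op u₁ (end us))) where
          u₃≢u₁ : u₃ ≢ u₁
          u₃≢u₁ e = absurd₁ a (≡.trans (≡.cong ((x + + 1) -_) (≡.sym
            (≡.trans (≡.cong (_+ + 1) (≡.trans (≡.cong (_+ + 1) (≡.sym (op-next u₁)))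
              (≡.trans f (≡.trans (≡.cong (op u₁ (end us)) e) (op-here u₁))))) (-1+1 y))))
            (solve 1 (λ x → (x :+ con (+ 1)) :- (x :+ con (+ 1) :+ con (+ 1) :+ con (+ 1)) := con ℤ.-[1+ 1 ]) ≡.refl x))

          f′ : x + + 1 + + 1 ≡ z
          f′ = ≡.subst₂ (λ x y → x + + 1 ≡ y) (op-next u₁) (op-other u₁ u₃≢u₁ (nxt-≢ u₂)) f

          descent₁ : Descent u₂ (end us)
          descent₁ = ≡.subst (y + + 1 <_) f′ (ℤ.+-monoˡ-< (+ 1) a)

          module _ (E : Exchange u₂ us) where
            private module E = Exchange E

            fixed₂ : Fixed u₁ (end E.word)
            fixed₂ = ≡.trans (≡.cong (_+ + 1) (≡.trans (E.end≗ u₁) (op-other u₂ u₁≢u₂ (u₃≢u₁ ∘ ≡.sym))))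
              (≡.trans (≡.sym (+1-1 _)) (≡.trans (≡.cong (_- + 1) f′) (≡.sym (≡.trans (E.end≗ u₂) (op-here u₂)))))

            after-vanishes : A u₁ (A* E.word) ≈ 0ₓ → A u₂ (A* (u₁ ∷ us)) ≈ 0ₓ
            after-vanishes e = trans (A-cong u₂ (A-cong u₁ E.A*≈)) (trans (sym (A-braid u₁ u₃≢u₁ _))
              (trans (A-cong u₁ (trans (A-cong u₂ e) (A-0 u₂))) (A-0 u₁)))

        module BeforeFixed (a : Ascent u₂ (end us)) (f : Fixed u₁ (op u₂ (end us))) where
          u₃≢u₁ : u₃ ≢ u₁
          u₃≢u₁ e = absurd₁ a (≡.trans (≡.cong ((y + + 1) -_) (≡.sym
            (≡.trans (≡.cong (_+ + 1) (≡.trans (≡.cong (_+ + 1) (≡.sym (≡.trans (≡.cong (op u₂ (end us)) (≡.sym e)) (op-next u₂))))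
              (≡.trans f (op-here u₂)))) (-1+1 z))))
            (solve 1 (λ x → (x :+ con (+ 1)) :- (x :+ con (+ 1) :+ con (+ 1) :+ con (+ 1)) := con ℤ.-[1+ 1 ]) ≡.refl y))

          f′ : x + + 1 ≡ z - + 1
          f′ = ≡.subst₂ (λ x y → x + + 1 ≡ y) (op-other u₂ u₁≢u₂ (u₃≢u₁ ∘ ≡.sym)) (op-here u₂) f

          descent₁ : Descent u₁ (end us)
          descent₁ = ≡.subst (_< y) (≡.sym f′)
            (from₁ a (solve 2 (λ y z → y :- (z :- con (+ 1)) := (y :+ con (+ 1)) :- z) ≡.refl y z))

          module _ (E : Exchange u₁ us) where
            private module E = Exchange E

            fixed₂ : Fixed u₂ (end E.word)
            fixed₂ = ≡.trans (≡.cong (_+ + 1) (≡.trans (E.end≗ u₂) (op-next u₁)))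
              (≡.trans (≡.cong (_+ + 1) f′) (≡.trans (-1+1 _)
              (≡.sym (≡.trans (E.end≗ u₃) (op-other u₁ u₃≢u₁ (nxt-≢ u₂))))))

            before-vanishes : A u₂ (A* E.word) ≈ 0ₓ → A u₁ (A* (u₂ ∷ us)) ≈ 0ₓ
            before-vanishes e = trans (A-cong u₁ (A-cong u₂ E.A*≈)) (trans (A-braid u₁ u₃≢u₁ _)
              (trans (A-cong u₂ (trans (A-cong u₁ e) (A-0 u₁))) (A-0 u₂)))

      -- If s_u fixes the coset of w, then s_u w = w s for some reflection s in W. The letter is
      -- moved to the right, by commutation or by a braid relation after an exchange, until it meets
      -- `x₀`, where `A-base` applies.
      fixed-vanishes : ∀ k {u us} → length us ℕ.≤ k → Up us → Fixed u (end us) → A u (A* us) ≈ 0ₓ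
      fixed-vanishes k {u} {[]} _ _ f = A-base u f
      fixed-vanishes (suc k) {u} {v ∷ us} (s≤s len) (a ∷ up) f with relative u v
      -- Just after an ascent at `u`, the coset has a descent at `u`, so it is not fixed.
      ... | same ≡.refl = contradiction
        (≡.subst (_< end us u + + 1) (≡.trans (≡.sym (-1+1 _)) (≡.trans (≡.cong (_+ + 1) (≡.sym (op-here u)))
          (≡.trans f (op-next u)))) a)
        (ℤ.<-irrefl ≡.refl)
      ... | apart u≢v u⁺≢v v⁺≢u = trans (A-comm u≢v u⁺≢v v⁺≢u _) (trans (A-cong v
        (fixed-vanishes k len up (≡.subst₂ (λ x y → x + + 1 ≡ y) (op-other v u≢v (v⁺≢u ∘ ≡.sym))
          (op-other v u⁺≢v (u≢v ∘ nxt-injective)) f))) (A-0 v))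
      ... | after ≡.refl = after-vanishes E (fixed-vanishes k (shorter E len) (Exchange.up E) (fixed₂ E))
        where
        open ConsecutiveFixed v us
        open AfterFixed a f
        E = exchange up descent₁
      ... | before ≡.refl = before-vanishes E (fixed-vanishes k (shorter E len) (Exchange.up E) (fixed₂ E))
        where
        open ConsecutiveFixed u us
        open BeforeFixed a f
        E = exchange up descent₁

      non-ascent-vanishes : ∀ {u us} → Up us → ¬ Ascent u (end us) → A u (A* us) ≈ 0ₓ
      non-ascent-vanishes {u} {us} up ¬a with step u (end us)
      ... | ascent a  = contradiction a ¬a
      ... | fixed f   = fixed-vanishes (length us) ℕ.≤-refl up f
      ... | descent d = trans (A-cong u (Exchange.A*≈ (exchange up d))) (A-square u _)

      -- At the first letter from the right that does not climb, the operator meets a coset that it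
      -- fixes or, after an exchange, a second copy of itself.
      vanishes : ∀ us → ¬ Up us → A* us ≈ 0ₓ
      vanishes [] ¬up = contradiction [] ¬up
      vanishes (u ∷ us) ¬up with up? us
      ... | no ¬p = trans (A-cong u (vanishes us ¬p)) (A-0 u)
      ... | yes p = non-ascent-vanishes p λ a → ¬up (a ∷ p)

      -- The deletion property for cosets: a letter that fixes the coset is dropped, and a letter
      -- that descends cancels against an earlier one.
      up-or-shorter : ∀ us → Up us ⊎ Σ[ vs ∈ List (Fin n) ] (Up vs × end vs ≗ end us × length vs ℕ.< length us)
      up-or-shorter [] = inj₁ []
      up-or-shorter (u ∷ us) with up-or-shorter us
      ... | inj₁ up with step u (end us)
      ...   | ascent a  = inj₁ (a ∷ up)
      ...   | fixed f   = inj₂ (us , up , (λ w → ≡.sym (op-fixed u f w)) , ℕ.≤-refl)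
      ...   | descent d = inj₂ (E.word , E.up , E.end≗ , ℕ.≤-trans (ℕ.≤-reflexive E.length≡) (ℕ.n≤1+n _))
        where module E = Exchange (exchange up d)
      up-or-shorter (u ∷ us) | inj₂ (vs , up , e , l) with step u (end vs)
      ...   | ascent a  = inj₂ (u ∷ vs , a ∷ up , op-cong u e , s≤s l)
      ...   | fixed f   = inj₂ (vs , up , (λ w → ≡.trans (≡.sym (op-fixed u f w)) (op-cong u e w)) , ℕ.≤-trans l (ℕ.n≤1+n _))
      ...   | descent d = inj₂ (E.word , E.up , (λ w → ≡.trans (E.end≗ w) (op-cong u e w)) ,
                            ℕ.≤-trans (ℕ.≤-reflexive E.length≡) (ℕ.≤-trans (ℕ.<⇒≤ l) (ℕ.n≤1+n _)))
        where module E = Exchange (exchange up d)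

      -- The rotation `ρ` and the shift `d` allow the two words to stand behind different powers of
      -- τ. The first letter of `us` is a descent of its end; carried over to `vs`, it is removed
      -- there by the exchange property.
      length-unique : ∀ (ρ ρ⁻¹ : Fin n → Fin n) d → (∀ v → ρ (ρ⁻¹ v) ≡ v) → (∀ {u v} → ρ u ≡ ρ v → u ≡ v) →
                      (∀ u → ρ (nxt u) ≡ nxt (ρ u)) → ∀ us vs → Up us → Up vs →
                      (∀ v → end us v ≡ end vs (ρ v) + d) → length us ≡ length vs
      length-unique ρ ρ⁻¹ d inverse injective commutes = go
        where
        shift : ∀ {u us vs} → (∀ v → end us v ≡ end vs (ρ v) + d) → Descent u (end us) → Descent (ρ u) (end vs)
        shift {u} {us} {vs} e p = from₁ p (≡.trans
          (solve 3 (λ x y d → y :- (x :+ con (+ 1)) := (y :+ d) :- (x :+ d :+ con (+ 1))) ≡.refl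
            (end vs (ρ u)) (end vs (nxt (ρ u))) d)
          (≡.sym (≡.cong₂ (λ x y → y - (x + + 1)) (e u) (≡.trans (e (nxt u)) (≡.cong (λ w → end vs w + d) (commutes u))))))

        unshift : ∀ {u us vs} → (∀ v → end us v ≡ end vs (ρ v) + d) → Descent (ρ u) (end vs) → Descent u (end us)
        unshift {u} {us} {vs} e p = from₁ p (≡.trans
          (≡.cong₂ (λ x y → y - (x + + 1)) (e u) (≡.trans (e (nxt u)) (≡.cong (λ w → end vs w + d) (commutes u))))
          (≡.sym (solve 3 (λ x y d → y :- (x :+ con (+ 1)) := (y :+ d) :- (x :+ d :+ con (+ 1))) ≡.refl
            (end vs (ρ u)) (end vs (nxt (ρ u))) d)))

        ascent⇒descent : ∀ {u P} → Ascent u P → Descent u (op u P)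
        ascent⇒descent {u} {P} a = ≡.subst₂ (λ x y → x + + 1 < y) (≡.sym (op-here u)) (≡.sym (op-next u))
          (≡.subst (_< P u + + 1) (≡.sym (-1+1 _)) a)

        go : ∀ us vs → Up us → Up vs → (∀ v → end us v ≡ end vs (ρ v) + d) → length us ≡ length vs
        go [] [] _ _ _ = ≡.refl
        go [] (v ∷ vs) _ (a ∷ up) e = contradiction
          (unshift {ρ⁻¹ v} {[]} {v ∷ vs} e (≡.subst (λ w → Descent w (end (v ∷ vs))) (≡.sym (inverse v)) (ascent⇒descent a)))
          (base-sorted (ρ⁻¹ v))
        go (u ∷ us) vs (a ∷ up) up′ e = ≡.trans (≡.cong suc (go us E.word up E.up λ w → begin
            end us w                             ≡⟨ op-involutive u (end us) w ⟨
            op u (op u (end us)) w               ≡⟨ op-equivariant ρ d injective commutes u e w ⟩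
            op (ρ u) (end vs) (ρ w) + d          ≡⟨ ≡.cong (_+ d) (E.end≗ (ρ w)) ⟨
            end E.word (ρ w) + d                 ∎)) E.length≡
          where
          open ≡.≡-Reasoning
          module E = Exchange (exchange up′ (shift {u} {u ∷ us} {vs} e (ascent⇒descent a)))

-- Transpositions, formal sums and twisted products

transpose-left : ∀ {n} (i j : Fin n) → PC.transpose i j i ≡ j
transpose-left i j rewrite dec-true (i Fin.≟ i) ≡.refl = ≡.refl

transpose-right : ∀ {n} (i j : Fin n) → PC.transpose i j j ≡ i
transpose-right i j with j Fin.≟ i
... | yes e = e
... | no  _ rewrite dec-true (j Fin.≟ j) ≡.refl = ≡.refl

transpose-other : ∀ {n} (i j : Fin n) {k} → k ≢ i → k ≢ j → PC.transpose i j k ≡ k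
transpose-other i j {k} p q rewrite dec-false (k Fin.≟ i) p | dec-false (k Fin.≟ j) q = ≡.refl

module FormalSums (K : CommutativeRing c ℓ) (W : Set) where
  open CommutativeRing K
  open IntegerSolver K
  open SetoidReasoning setoid

  Sum : Set c
  Sum = List (Carrier × W)

  total : Sum → (W → Carrier) → Carrier
  total x g = foldr (λ (p , v) r → p * g v + r) 0# x

  total-cong : ∀ x {g h} → (∀ v → g v ≈ h v) → total x g ≈ total x h
  total-cong [] e = refl
  total-cong ((p , v) ∷ x) e = +-cong (*-congˡ (e v)) (total-cong x e)

  total-* : ∀ x a g → total x (λ v → a * g v) ≈ a * total x g
  total-* [] a g = sym (zeroʳ a)
  total-* ((p , v) ∷ x) a g = trans (+-congˡ (total-* x a g))
    (solve 4 (λ p a g r → p :* (a :* g) :+ a :* r := a :* (p :* g :+ r)) refl p a (g v) (total x g))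

  total-- : ∀ x g h → total x (λ v → g v - h v) ≈ total x g - total x h
  total-- [] g h = sym (-‿inverseʳ 0#)
  total-- ((p , v) ∷ x) g h = trans (+-congˡ (total-- x g h))
    (solve 5 (λ p g h r t → p :* (g :- h) :+ (r :- t) := (p :* g :+ r) :- (p :* h :+ t)) refl
      p (g v) (h v) (total x g) (total x h))

  total-++ : ∀ x y g → total (x ++ y) g ≈ total x g + total y g
  total-++ [] y g = sym (+-identityˡ _)
  total-++ ((p , v) ∷ x) y g = trans (+-congˡ (total-++ x y g)) (sym (+-assoc _ _ _))

  negate : Sum → Sum
  negate = map (λ (p , w) → - p , w)

  total-negate : ∀ x g → total (negate x) g ≈ - total x g
  total-negate [] g = solve 0 (:0 := :- :0) refl
  total-negate ((p , v) ∷ x) g = trans (+-congˡ (total-negate x g))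
    (solve 3 (λ p g r → :- p :* g :+ :- r := :- (p :* g :+ r)) refl p (g v) (total x g))

  indicator : Bool → Carrier
  indicator b = if b then 1# else 0#

  module Coefficients {r} {_~_ : W → W → Set r} (_~?_ : ∀ v w → Dec (v ~ w)) where

    coeff : Sum → W → Carrier
    coeff x w = foldr (λ (p , v) r → if does (v ~? w) then p + r else r) 0# x

    coeff-total : ∀ x w → coeff x w ≈ total x (λ v → indicator (does (v ~? w)))
    coeff-total [] w = refl
    coeff-total ((p , v) ∷ x) w with does (v ~? w)
    ... | true  = +-cong (sym (*-identityʳ p)) (coeff-total x w)
    ... | false = trans (coeff-total x w) (solve 2 (λ p r → r := p :* :0 :+ r) refl p _)

    coeff-++ : ∀ x y w → coeff (x ++ y) w ≈ coeff x w + coeff y w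
    coeff-++ x y w = trans (coeff-total (x ++ y) w) (trans (total-++ x y _)
      (sym (+-cong (coeff-total x w) (coeff-total y w))))

    coeff-negate : ∀ x w → coeff (negate x) w ≈ - coeff x w
    coeff-negate x w = trans (coeff-total (negate x) w) (trans (total-negate x _) (-‿cong (sym (coeff-total x w))))

  module Extensionality {r} {_~_ : W → W → Set r} (_~?_ : ∀ v w → Dec (v ~ w))
    (~-refl : ∀ {v} → v ~ v) (~-sym : ∀ {v w} → v ~ w → w ~ v) (~-trans : ∀ {u v w} → u ~ v → v ~ w → u ~ w) where
    open Coefficients _~?_

    private
      remove : W → Sum → Sum
      remove v [] = []
      remove v ((p , u) ∷ x) = if does (u ~? v) then remove v x else (p , u) ∷ remove v x

      length-remove : ∀ v x → length (remove v x) ℕ.≤ length x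
      length-remove v [] = z≤n
      length-remove v ((p , u) ∷ x) with does (u ~? v)
      ... | true  = ℕ.≤-trans (length-remove v x) (ℕ.n≤1+n _)
      ... | false = s≤s (length-remove v x)

      total-remove : ∀ v x g → (∀ {u w} → u ~ w → g u ≈ g w) → total x g ≈ coeff x v * g v + total (remove v x) g
      total-remove v [] g _ = solve 1 (λ y → :0 := :0 :* y :+ :0) refl (g v)
      total-remove v ((p , u) ∷ x) g g-cong with u ~? v
      ... | yes e = trans (+-cong (*-congˡ (g-cong e)) (total-remove v x g g-cong))
        (solve 4 (λ p g c r → p :* g :+ (c :* g :+ r) := (p :+ c) :* g :+ r) refl p (g v) (coeff x v) (total (remove v x) g))
      ... | no _ = trans (+-congˡ (total-remove v x g g-cong))
        (solve 5 (λ p h g c r → p :* h :+ (c :* g :+ r) := c :* g :+ (p :* h :+ r)) refl p (g u) (g v) (coeff x v) (total (remove v x) g))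

      coeff-remove : ∀ v x w → ¬ (v ~ w) → coeff (remove v x) w ≈ coeff x w
      coeff-remove v [] w _ = refl
      coeff-remove v ((p , u) ∷ x) w ne with u ~? v
      coeff-remove v ((p , u) ∷ x) w ne | yes e with u ~? w
      ... | yes e′ = contradiction (~-trans (~-sym e) e′) ne
      ... | no _ = coeff-remove v x w ne
      coeff-remove v ((p , u) ∷ x) w ne | no _ with u ~? w
      ... | yes _ = +-congˡ (coeff-remove v x w ne)
      ... | no _  = coeff-remove v x w ne

      coeff-remove-same : ∀ v x w → v ~ w → coeff (remove v x) w ≈ 0#
      coeff-remove-same v [] w _ = refl
      coeff-remove-same v ((p , u) ∷ x) w e with u ~? v
      ... | yes _ = coeff-remove-same v x w e
      ... | no ne with u ~? w
      ...   | yes e′ = contradiction (~-trans e′ (~-sym e)) ne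
      ...   | no _   = coeff-remove-same v x w e

    -- All terms equivalent to the first one are collected and removed at once: the list becomes
    -- shorter, and the coefficients at the other classes stay the same.
    total-vanishes′ : ∀ k x → length x ℕ.≤ k → ∀ g → (∀ {u w} → u ~ w → g u ≈ g w) →
                      (∀ w → coeff x w * g w ≈ 0#) → total x g ≈ 0#
    total-vanishes′ k [] _ g _ _ = refl
    total-vanishes′ (suc k) x@((p , v) ∷ x′) (s≤s l) g g-cong e = begin
      total x g                                   ≈⟨ total-remove v x g g-cong ⟩
      coeff x v * g v + total (remove v x) g      ≈⟨ +-cong (e v) (total-vanishes′ k (remove v x) shorter g g-cong removed) ⟩
      0# + 0#                                     ≈⟨ +-identityˡ 0# ⟩
      0#                                          ∎
      where
      shorter : length (remove v x) ℕ.≤ k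
      shorter with v ~? v
      ... | yes _ = ℕ.≤-trans (length-remove v x′) l
      ... | no ne = contradiction ~-refl ne
      removed : ∀ w → coeff (remove v x) w * g w ≈ 0#
      removed w with v ~? w
      ... | yes e′ = trans (*-congʳ (coeff-remove-same v x w e′)) (zeroˡ _)
      ... | no ne  = trans (*-congʳ (coeff-remove v x w ne)) (e w)

    total-vanishes : ∀ x g → (∀ {u w} → u ~ w → g u ≈ g w) → (∀ w → coeff x w * g w ≈ 0#) → total x g ≈ 0#
    total-vanishes x = total-vanishes′ (length x) x ℕ.≤-refl

    total-ext : ∀ x y g → (∀ {u w} → u ~ w → g u ≈ g w) → (∀ w → coeff x w ≈ coeff y w) → total x g ≈ total y g
    total-ext x y g g-cong e = begin
      total x g                        ≈⟨ solve 2 (λ a b → a := (a :+ :- b) :+ b) refl (total x g) (total y g) ⟩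
      (total x g - total y g) + total y g
        ≈⟨ +-congʳ (trans (+-congˡ (sym (total-negate y g))) (trans (sym (total-++ x (negate y) g))
             (total-vanishes (x ++ negate y) g g-cong λ w → trans (*-congʳ (trans (coeff-++ x (negate y) w)
               (trans (+-cong (e w) (coeff-negate y w)) (-‿inverseʳ _)))) (zeroˡ _)))) ⟩
      0# + total y g                   ≈⟨ +-identityˡ _ ⟩
      total y g                        ∎

    coeff-cong : ∀ x {v w} → v ~ w → coeff x v ≈ coeff x w
    coeff-cong x {v} {w} e = trans (coeff-total x v) (trans (total-cong x λ u → reflexive (≡.cong indicator
      (does-⇔ (mk⇔ (λ f → ~-trans f e) (λ f → ~-trans f (~-sym e))) (u ~? v) (u ~? w)))) (sym (coeff-total x w)))

  module Product (_·_ : W → W → W) (inv : W → W) (act : W → Carrier → Carrier)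
    (act-cong : ∀ v {p q} → p ≈ q → act v p ≈ act v q)
    (act-+ : ∀ v p q → act v (p + q) ≈ act v p + act v q)
    (act-0 : ∀ v → act v 0# ≈ 0#) where

    multiply : Sum → Sum → Sum
    multiply x y = concatMap (λ (p , v) → map (λ (q , w) → p * act v q , v · w) y) x

    -- The left action of the group on functions, (v κ)(w) = v (κ (v⁻¹ w)). Extended linearly as
    -- `_▷_`, it expresses the coefficients of a product through those of its right factor.
    apply : W → (W → Carrier) → W → Carrier
    apply v κ w = act v (κ (inv v · w))

    infixr 5 _▷_

    _▷_ : Sum → (W → Carrier) → W → Carrier
    (x ▷ κ) w = total x (λ v → apply v κ w)

    ▷-congʳ : ∀ x {κ κ′} → (∀ w → κ w ≈ κ′ w) → ∀ w → (x ▷ κ) w ≈ (x ▷ κ′) w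
    ▷-congʳ x e w = total-cong x λ v → act-cong v (e (inv v · w))

    module CoefficientsOfProduct {r} {_~_ : W → W → Set r} (_~?_ : ∀ v w → Dec (v ~ w))
      (shift : ∀ v u w → (v · u) ~ w ⇔ u ~ (inv v · w)) where
      open Coefficients _~?_

      -- The equivalence enters through `shift`, so one proof covers equality in W_e and equality of
      -- cosets of W.
      coeff-multiply : ∀ x y w → coeff (multiply x y) w ≈ (x ▷ coeff y) w
      coeff-multiply [] y w = refl
      coeff-multiply ((p , v) ∷ x) y w = trans (coeff-++ (map _ y) (multiply x y) w)
        (+-cong (term y) (coeff-multiply x y w))
        where
        term : ∀ y → coeff (map (λ (q , u) → p * act v q , v · u) y) w ≈ p * act v (coeff y (inv v · w))
        term [] = sym (trans (*-congˡ (act-0 v)) (zeroʳ p))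
        term ((q , u) ∷ y) rewrite does-⇔ (shift v u w) ((v · u) ~? w) (u ~? (inv v · w)) with does (u ~? (inv v · w))
        ... | true  = trans (+-congˡ (term y)) (trans (sym (distribˡ p _ _)) (*-congˡ (sym (act-+ v q _))))
        ... | false = term y

-- Divided differences and their nilCoxeter relations

module TransparentDifferences (K : CommutativeRing c ℓ) (W : Set) where
  open CommutativeRing K
  open IntegerSolver K
  open SetoidReasoning setoid

  record Endomorphism : Set (c ⊔ ℓ) where
    field
      fun    : Carrier → Carrier
      cong   : ∀ {p q} → p ≈ q → fun p ≈ fun q
      homo-* : ∀ p q → fun (p * q) ≈ fun p * fun q
      homo-- : ∀ p q → fun (p - q) ≈ fun p - fun q

  module _ (i : Carrier) (f : Carrier → Carrier) (S : W → W) where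
    difference : (W → Carrier) → W → Carrier
    difference κ w = i * (f (κ (S w)) - κ w)

    difference-cong : (∀ {p q} → p ≈ q → f p ≈ f q) → ∀ {κ κ′ w w′} →
                      κ (S w) ≈ κ′ (S w′) → κ w ≈ κ′ w′ → difference κ w ≈ difference κ′ w′
    difference-cong f-cong e e′ = *-congˡ (+-cong (f-cong e) (-‿cong e′))

    difference-fixed : ∀ {κ w} → f (κ (S w)) ≈ κ w → difference κ w ≈ 0#
    difference-fixed e = trans (*-congˡ (trans (+-congʳ e) (-‿inverseʳ _))) (zeroʳ i)

  module _ {i j k : Carrier} (f g : Endomorphism) (S S′ : W → W) where
    private
      module f = Endomorphism f
      module g = Endomorphism g
      A A′ : (W → Carrier) → W → Carrier
      A = difference i f.fun S
      A′ = difference j g.fun S′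

    module _ (κ : W → Carrier) (w : W) where

      difference-square : f.fun i ≈ - i → f.fun (f.fun (κ (S (S w)))) ≈ κ w → A (A κ) w ≈ 0#
      difference-square fi ff = begin
        i * (f.fun (i * (f.fun (κ (S (S w))) - κ (S w))) - i * (f.fun (κ (S w)) - κ w))
          ≈⟨ *-congˡ (+-congʳ (trans (f.homo-* _ _) (*-cong fi (trans (f.homo-- _ _) (+-congʳ ff))))) ⟩
        i * (- i * (κ w - f.fun (κ (S w))) - i * (f.fun (κ (S w)) - κ w))
          ≈⟨ solve 3 (λ i a b → i :* (:- i :* (a :- b) :- i :* (b :- a)) := :0) refl i (κ w) (f.fun (κ (S w))) ⟩
        0# ∎

      difference-difference : f.fun j ≈ j →
        A (A′ κ) w ≈ i * j * (f.fun (g.fun (κ (S′ (S w)))) - f.fun (κ (S w)) - g.fun (κ (S′ w)) + κ w)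
      difference-difference fj = begin
        i * (f.fun (j * (g.fun (κ (S′ (S w))) - κ (S w))) - j * (g.fun (κ (S′ w)) - κ w))
          ≈⟨ *-congˡ (+-congʳ (trans (f.homo-* _ _) (*-cong fj (f.homo-- _ _)))) ⟩
        i * (j * (f.fun (g.fun (κ (S′ (S w)))) - f.fun (κ (S w))) - j * (g.fun (κ (S′ w)) - κ w))
          ≈⟨ solve 6 (λ i j a b c d → i :* (j :* (a :- b) :- j :* (c :- d)) := i :* j :* (a :- b :- c :+ d)) refl
               i j (f.fun (g.fun (κ (S′ (S w))))) (f.fun (κ (S w))) (g.fun (κ (S′ w))) (κ w) ⟩
        i * j * (f.fun (g.fun (κ (S′ (S w)))) - f.fun (κ (S w)) - g.fun (κ (S′ w)) + κ w) ∎

      difference-braid : f.fun i ≈ - i → f.fun j ≈ k → f.fun k ≈ j → g.fun i ≈ k → i * j ≈ k * (i + j) →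
        f.fun (f.fun (κ (S (S w)))) ≈ κ w →
        A (A′ (A κ)) w ≈ i * j * k * (f.fun (g.fun (f.fun (κ (S (S′ (S w)))))) - f.fun (g.fun (κ (S′ (S w))))
                           - g.fun (f.fun (κ (S (S′ w)))) + g.fun (κ (S′ w)) + f.fun (κ (S w)) - κ w)
      difference-braid fi fj fk gi ij ff = begin
        i * (f.fun (j * (g.fun (i * (f.fun (κ (S (S′ (S w)))) - κ (S′ (S w)))) - i * (f.fun (κ (S (S w))) - κ (S w))))
          - j * (g.fun (i * (f.fun (κ (S (S′ w))) - κ (S′ w))) - i * (b - d)))
          ≈⟨ *-congˡ (+-cong
               (trans (f.homo-* _ _) (*-cong fj (trans (f.homo-- _ _) (+-cong
                 (trans (f.cong (trans (g.homo-* _ _) (*-cong gi (g.homo-- _ _)))) (trans (f.homo-* _ _) (*-cong fk (f.homo-- _ _))))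
                 (-‿cong (trans (f.homo-* _ _) (*-cong fi (trans (f.homo-- _ _) (+-congʳ ff)))))))))
               (-‿cong (*-congˡ (+-congʳ (trans (g.homo-* _ _) (*-cong gi (g.homo-- _ _))))))) ⟩
        i * (k * (j * (x - y) - - i * (d - b)) - j * (k * (z - a) - i * (b - d)))
          ≈⟨ solve 9 (λ i j k x y z a b d →
               i :* (k :* (j :* (x :- y) :- :- i :* (d :- b)) :- j :* (k :* (z :- a) :- i :* (b :- d)))
               := i :* j :* k :* (x :- y :- z :+ a) :+ i :* (i :* j :- k :* i) :* (b :- d)) refl i j k x y z a b d ⟩
        i * j * k * (x - y - z + a) + i * (i * j - k * i) * (b - d)
          ≈⟨ +-congˡ (*-congʳ (*-congˡ (+-congʳ ij))) ⟩
        i * j * k * (x - y - z + a) + i * (k * (i + j) - k * i) * (b - d)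
          ≈⟨ solve 9 (λ i j k x y z a b d →
               i :* j :* k :* (x :- y :- z :+ a) :+ i :* (k :* (i :+ j) :- k :* i) :* (b :- d)
               := i :* j :* k :* (x :- y :- z :+ a :+ b :- d)) refl i j k x y z a b d ⟩
        i * j * k * (x - y - z + a + b - d) ∎
        where
        x = f.fun (g.fun (f.fun (κ (S (S′ (S w))))))
        y = f.fun (g.fun (κ (S′ (S w))))
        z = g.fun (f.fun (κ (S (S′ w))))
        a = g.fun (κ (S′ w))
        b = f.fun (κ (S w))
        d = κ w

  module _ {i j k : Carrier} (f g : Endomorphism) (S S′ : W → W) (κ : W → Carrier) (w : W) where
    private
      module f = Endomorphism f
      module g = Endomorphism g
      A A′ : (W → Carrier) → W → Carrier
      A = difference i f.fun S
      A′ = difference j g.fun S′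

    differences-commute : f.fun j ≈ j → g.fun i ≈ i →
      f.fun (g.fun (κ (S′ (S w)))) ≈ g.fun (f.fun (κ (S (S′ w)))) → A (A′ κ) w ≈ A′ (A κ) w
    differences-commute fj gi e = begin
      A (A′ κ) w
        ≈⟨ difference-difference {i} {j} {k} f g S S′ κ w fj ⟩
      i * j * (f.fun (g.fun (κ (S′ (S w)))) - f.fun (κ (S w)) - g.fun (κ (S′ w)) + κ w)
        ≈⟨ *-congˡ (+-congʳ (+-congʳ (+-congʳ e))) ⟩
      i * j * (g.fun (f.fun (κ (S (S′ w)))) - f.fun (κ (S w)) - g.fun (κ (S′ w)) + κ w)
        ≈⟨ solve 6 (λ i j x b d k → i :* j :* (x :- b :- d :+ k) := j :* i :* (x :- d :- b :+ k)) refl i j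
             (g.fun (f.fun (κ (S (S′ w))))) (f.fun (κ (S w))) (g.fun (κ (S′ w))) (κ w) ⟩
      j * i * (g.fun (f.fun (κ (S (S′ w)))) - g.fun (κ (S′ w)) - f.fun (κ (S w)) + κ w)
        ≈⟨ difference-difference {j} {i} {k} g f S′ S κ w gi ⟨
      A′ (A κ) w ∎

    differences-braid : f.fun i ≈ - i → g.fun j ≈ - j → f.fun j ≈ k → g.fun i ≈ k → f.fun k ≈ j → g.fun k ≈ i →
      i * j ≈ k * (i + j) → f.fun (f.fun (κ (S (S w)))) ≈ κ w → g.fun (g.fun (κ (S′ (S′ w)))) ≈ κ w →
      f.fun (g.fun (f.fun (κ (S (S′ (S w)))))) ≈ g.fun (f.fun (g.fun (κ (S′ (S (S′ w)))))) →
      A (A′ (A κ)) w ≈ A′ (A (A′ κ)) w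
    differences-braid fi gj fj gi fk gk ij ff gg e = begin
      A (A′ (A κ)) w
        ≈⟨ difference-braid {i} {j} {k} f g S S′ κ w fi fj fk gi ij ff ⟩
      i * j * k * (f.fun (g.fun (f.fun (κ (S (S′ (S w)))))) - y - z + a + b - κ w)
        ≈⟨ *-congˡ (+-congʳ (+-congʳ (+-congʳ (+-congʳ (+-congʳ e))))) ⟩
      i * j * k * (x - y - z + a + b - κ w)
        ≈⟨ solve 9 (λ i j k x y z a b d → i :* j :* k :* (x :- y :- z :+ a :+ b :- d)
             := j :* i :* k :* (x :- z :- y :+ b :+ a :- d)) refl i j k x y z a b (κ w) ⟩
      j * i * k * (x - z - y + b + a - κ w)
        ≈⟨ difference-braid {j} {i} {k} g f S′ S κ w gj gi gk fj
             (trans (*-comm j i) (trans ij (*-congˡ (+-comm i j)))) gg ⟨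
      A′ (A (A′ κ)) w ∎
      where
      x = g.fun (f.fun (g.fun (κ (S′ (S (S′ w))))))
      y = f.fun (g.fun (κ (S′ (S w))))
      z = g.fun (f.fun (κ (S (S′ w))))
      a = g.fun (κ (S′ w))
      b = f.fun (κ (S w))

-- Unfolding iterated differences is expensive when K is a ring of
-- fractions, hence the abstract copy.
module DividedDifferences (K : CommutativeRing c ℓ) (W : Set) where
  open CommutativeRing K
  private module Δ = TransparentDifferences K W
  open Δ public using (Endomorphism; module Endomorphism)

  abstract
    difference : Carrier → (Carrier → Carrier) → (W → W) → (W → Carrier) → W → Carrier
    difference = Δ.difference

    difference-def : ∀ i f S κ w → difference i f S κ w ≡ i * (f (κ (S w)) - κ w)
    difference-def i f S κ w = ≡.refl

    difference-cong : ∀ i f S → (∀ {p q} → p ≈ q → f p ≈ f q) → ∀ {κ κ′ w w′} →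
                      κ (S w) ≈ κ′ (S w′) → κ w ≈ κ′ w′ → difference i f S κ w ≈ difference i f S κ′ w′
    difference-cong i f S f-cong {κ} {κ′} {w} {w′} = Δ.difference-cong i f S f-cong {κ} {κ′} {w} {w′}

    difference-fixed : ∀ i f S {κ w} → f (κ (S w)) ≈ κ w → difference i f S κ w ≈ 0#
    difference-fixed i f S {κ} {w} = Δ.difference-fixed i f S {κ} {w}

  module _ (i j k : Carrier) (f g : Endomorphism) (S S′ : W → W) (κ : W → Carrier) (w : W) where
    private
      module f = Endomorphism f
      module g = Endomorphism g
      A A′ : (W → Carrier) → W → Carrier
      A = difference i f.fun S
      A′ = difference j g.fun S′

    abstract
      difference-square : f.fun i ≈ - i → f.fun (f.fun (κ (S (S w)))) ≈ κ w → A (A κ) w ≈ 0#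
      difference-square = Δ.difference-square {i} {j} {k} f g S S′ κ w

      differences-commute : f.fun j ≈ j → g.fun i ≈ i →
        f.fun (g.fun (κ (S′ (S w)))) ≈ g.fun (f.fun (κ (S (S′ w)))) → A (A′ κ) w ≈ A′ (A κ) w
      differences-commute = Δ.differences-commute {i} {j} {k} f g S S′ κ w

      differences-braid : f.fun i ≈ - i → g.fun j ≈ - j → f.fun j ≈ k → g.fun i ≈ k → f.fun k ≈ j → g.fun k ≈ i →
        i * j ≈ k * (i + j) → f.fun (f.fun (κ (S (S w)))) ≈ κ w → g.fun (g.fun (κ (S′ (S′ w)))) ≈ κ w →
        f.fun (g.fun (f.fun (κ (S (S′ (S w)))))) ≈ g.fun (f.fun (g.fun (κ (S′ (S (S′ w)))))) →
        A (A′ (A κ)) w ≈ A′ (A (A′ κ)) w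
      differences-braid = Δ.differences-braid {i} {j} {k} f g S S′ κ w

transpose-braid : ∀ {n} {a b c : Fin n} → a ≢ b → b ≢ c → a ≢ c → ∀ v →
  PC.transpose a b (PC.transpose b c (PC.transpose a b v)) ≡ PC.transpose b c (PC.transpose a b (PC.transpose b c v))
transpose-braid {a = a} {b} {c} a≢b b≢c a≢c v = by (v Fin.≟ a) (v Fin.≟ b) (v Fin.≟ c)
  where
  open ≡.≡-Reasoning
  ab = PC.transpose a b
  bc = PC.transpose b c
  by : Dec (v ≡ a) → Dec (v ≡ b) → Dec (v ≡ c) → ab (bc (ab v)) ≡ bc (ab (bc v))
  by (yes ≡.refl) _ _ = begin
    ab (bc (ab a))   ≡⟨ ≡.cong (ab ∘ bc) (transpose-left a b) ⟩
    ab (bc b)        ≡⟨ ≡.cong ab (transpose-left b c) ⟩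
    ab c             ≡⟨ transpose-other a b (a≢c ∘ ≡.sym) (b≢c ∘ ≡.sym) ⟩
    c                ≡⟨ transpose-left b c ⟨
    bc b             ≡⟨ ≡.cong bc (transpose-left a b) ⟨
    bc (ab a)        ≡⟨ ≡.cong (bc ∘ ab) (transpose-other b c a≢b a≢c) ⟨
    bc (ab (bc a))   ∎
  by (no _) (yes ≡.refl) _ = begin
    ab (bc (ab b))   ≡⟨ ≡.cong (ab ∘ bc) (transpose-right a b) ⟩
    ab (bc a)        ≡⟨ ≡.cong ab (transpose-other b c a≢b a≢c) ⟩
    ab a             ≡⟨ transpose-left a b ⟩
    b                ≡⟨ transpose-right b c ⟨
    bc c             ≡⟨ ≡.cong bc (transpose-other a b (a≢c ∘ ≡.sym) (b≢c ∘ ≡.sym)) ⟨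
    bc (ab c)        ≡⟨ ≡.cong (bc ∘ ab) (transpose-left b c) ⟨
    bc (ab (bc b))   ∎
  by (no _) (no _) (yes ≡.refl) = begin
    ab (bc (ab c))   ≡⟨ ≡.cong (ab ∘ bc) (transpose-other a b (a≢c ∘ ≡.sym) (b≢c ∘ ≡.sym)) ⟩
    ab (bc c)        ≡⟨ ≡.cong ab (transpose-right b c) ⟩
    ab b             ≡⟨ transpose-right a b ⟩
    a                ≡⟨ transpose-other b c a≢b a≢c ⟨
    bc a             ≡⟨ ≡.cong bc (transpose-right a b) ⟨
    bc (ab b)        ≡⟨ ≡.cong (bc ∘ ab) (transpose-right b c) ⟨
    bc (ab (bc c))   ∎
  by (no p) (no q) (no r) = begin
    ab (bc (ab v))   ≡⟨ ≡.cong (ab ∘ bc) (transpose-other a b p q) ⟩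
    ab (bc v)        ≡⟨ ≡.cong ab (transpose-other b c q r) ⟩
    ab v             ≡⟨ transpose-other a b p q ⟩
    v                ≡⟨ transpose-other b c q r ⟨
    bc v             ≡⟨ ≡.cong bc (transpose-other a b p q) ⟨
    bc (ab v)        ≡⟨ ≡.cong (bc ∘ ab) (transpose-other b c q r) ⟨
    bc (ab (bc v))   ∎

transpose-comm : ∀ {n} {a b c d : Fin n} → a ≢ c → a ≢ d → b ≢ c → b ≢ d → ∀ v →
  PC.transpose a b (PC.transpose c d v) ≡ PC.transpose c d (PC.transpose a b v)
transpose-comm {a = a} {b} {c} {d} a≢c a≢d b≢c b≢d v = outer (v Fin.≟ a) (v Fin.≟ b)
  where
  by : v ≢ a → v ≢ b → Dec (v ≡ c) → Dec (v ≡ d) → PC.transpose a b (PC.transpose c d v) ≡ PC.transpose c d v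
  by p q (yes ≡.refl) _ = ≡.trans (≡.cong (PC.transpose a b) (transpose-left c d))
    (≡.trans (transpose-other a b (a≢d ∘ ≡.sym) (b≢d ∘ ≡.sym)) (≡.sym (transpose-left c d)))
  by p q (no _) (yes ≡.refl) = ≡.trans (≡.cong (PC.transpose a b) (transpose-right c d))
    (≡.trans (transpose-other a b (a≢c ∘ ≡.sym) (b≢c ∘ ≡.sym)) (≡.sym (transpose-right c d)))
  by p q (no r) (no t) = ≡.trans (≡.cong (PC.transpose a b) (transpose-other c d r t))
    (≡.trans (transpose-other a b p q) (≡.sym (transpose-other c d r t)))
  outer : Dec (v ≡ a) → Dec (v ≡ b) → PC.transpose a b (PC.transpose c d v) ≡ PC.transpose c d (PC.transpose a b v)
  outer (yes ≡.refl) _ = ≡.trans (≡.cong (PC.transpose a b) (transpose-other c d a≢c a≢d))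
    (≡.trans (transpose-left a b) (≡.sym (≡.trans (≡.cong (PC.transpose c d) (transpose-left a b)) (transpose-other c d b≢c b≢d))))
  outer (no _) (yes ≡.refl) = ≡.trans (≡.cong (PC.transpose a b) (transpose-other c d b≢c b≢d))
    (≡.trans (transpose-right a b) (≡.sym (≡.trans (≡.cong (PC.transpose c d) (transpose-right a b)) (transpose-other c d a≢c a≢d))))
  outer (no p) (no q) = ≡.trans (by p q (v Fin.≟ c) (v Fin.≟ d)) (≡.cong (PC.transpose c d) (≡.sym (transpose-other a b p q)))

transpose-involutive : ∀ {n} (a b : Fin n) v → PC.transpose a b (PC.transpose a b v) ≡ v
transpose-involutive a b v = by (v Fin.≟ a) (v Fin.≟ b)
  where
  by : Dec (v ≡ a) → Dec (v ≡ b) → PC.transpose a b (PC.transpose a b v) ≡ v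
  by (yes ≡.refl) _ = ≡.trans (≡.cong (PC.transpose a b) (transpose-left a b)) (transpose-right a b)
  by (no _) (yes ≡.refl) = ≡.trans (≡.cong (PC.transpose a b) (transpose-right a b)) (transpose-left a b)
  by (no p) (no q) = ≡.trans (≡.cong (PC.transpose a b) (transpose-other a b p q)) (transpose-other a b p q)

-- Identities for inverse roots and for the centrality relation

module InverseDifferences (R : CommutativeRing c ℓ) where
  open CommutativeRing R
  open FractionField R
  open Fractions R using (_≈F_; wrap; fractions)
  open IntegerSolver R
  private module F = CommutativeRing fractions

  inverse-swap : ∀ a b (r : Regular (a - b)) (r′ : Regular (b - a)) →
                 frac 1# (b - a) r′ ≈F (F.- frac 1# (a - b) r)
  inverse-swap a b r r′ = wrap (solve 2 (λ a b → :1 :* (a :- b) := (:- :1) :* (b :- a)) refl a b)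

  inverse-sum : ∀ a b c (r : Regular (a - b)) (r′ : Regular (b - c)) (r″ : Regular (a - c)) →
    (frac 1# (a - b) r F.* frac 1# (b - c) r′) ≈F
    (frac 1# (a - c) r″ F.* (frac 1# (a - b) r F.+ frac 1# (b - c) r′))
  inverse-sum a b c r r′ r″ = wrap (solve 3 (λ a b c →
    (:1 :* :1) :* ((a :- c) :* ((a :- b) :* (b :- c))) :=
    (:1 :* (:1 :* (b :- c) :+ :1 :* (a :- b))) :* ((a :- b) :* (b :- c))) refl a b c)

-- The cases of the centrality relation after the row and column
-- operations of a simple reflection exchanging the parameters c and c′.
module CentralityIdentities (R : CommutativeRing c ℓ) where
  open CommutativeRing R
  open IntegerSolver R
  open SetoidReasoning setoid

  plain : ∀ u v p d x → u ≈ v + (p - d) * x → u - v ≈ (p - d) * x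
  plain u v p d x e = trans (+-congʳ e) (solve 4 (λ v p d x → v :+ (p :- d) :* x :- v := (p :- d) :* x) refl v p d x)

  into-column : ∀ u u′ v p c c′ x x′ → u ≈ v + (p - c) * x → u′ ≈ x + (p - c′) * x′ →
                (u + (c - c′) * u′) - v ≈ (p - c′) * (x + (c - c′) * x′)
  into-column u u′ v p c c′ x x′ e e′ = trans (+-congʳ (+-cong e (*-congˡ e′)))
    (solve 6 (λ v p c c′ x x′ → (v :+ (p :- c) :* x :+ (c :- c′) :* (x :+ (p :- c′) :* x′)) :- v
      := (p :- c′) :* (x :+ (c :- c′) :* x′)) refl v p c c′ x x′)

  out-of-column : ∀ u v p c c′ x → u ≈ v + (p - c′) * x → u - (v + (c - c′) * x) ≈ (p - c) * x
  out-of-column u v p c c′ x e = trans (+-congʳ e)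
    (solve 5 (λ v p c c′ x → v :+ (p :- c′) :* x :- (v :+ (c :- c′) :* x) := (p :- c) :* x) refl v p c c′ x)

  corner : ∀ u v c c′ x → u ≈ v + (c - c′) * x → (u - (c - c′) * x) - (v + (c - c′) * x) ≈ (c′ - c) * x
  corner u v c c′ x e = trans (+-congʳ (+-congʳ e))
    (solve 4 (λ v c c′ x → (v :+ (c :- c′) :* x :- (c :- c′) :* x) :- (v :+ (c :- c′) :* x) := (c′ :- c) :* x) refl v c c′ x)

  out-of-row : ∀ u v c c′ d x → u ≈ v + (c - d) * x → (u - (c - c′) * x) - v ≈ (c′ - d) * x
  out-of-row u v c c′ d x e = trans (+-congʳ (+-congʳ e))
    (solve 5 (λ v c c′ d x → (v :+ (c :- d) :* x :- (c :- c′) :* x) :- v := (c′ :- d) :* x) refl v c c′ d x)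

  into-row : ∀ u v c c′ d x y x₀ → u ≈ v + (c′ - d) * x → x ≈ y + (c - d) * x₀ →
             u - (v - (c - c′) * y) ≈ (c - d) * (x - (c - c′) * x₀)
  into-row u v c c′ d x y x₀ e e′ = begin
    u - (v - (c - c′) * y)
      ≈⟨ +-congʳ e ⟩
    v + (c′ - d) * x - (v - (c - c′) * y)
      ≈⟨ solve 7 (λ v c c′ d x y x₀ → v :+ (c′ :- d) :* x :- (v :- (c :- c′) :* y)
           := (c′ :- d) :* x :+ (c :- c′) :* (y :+ (c :- d) :* x₀) :- (c :- c′) :* ((c :- d) :* x₀)) refl v c c′ d x y x₀ ⟩
    (c′ - d) * x + (c - c′) * (y + (c - d) * x₀) - (c - c′) * ((c - d) * x₀)
      ≈⟨ +-congʳ (+-congˡ (*-congˡ e′)) ⟨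
    (c′ - d) * x + (c - c′) * x - (c - c′) * ((c - d) * x₀)
      ≈⟨ solve 5 (λ c c′ d x x₀ → (c′ :- d) :* x :+ (c :- c′) :* x :- (c :- c′) :* ((c :- d) :* x₀)
           := (c :- d) :* (x :- (c :- c′) :* x₀)) refl c c′ d x x₀ ⟩
    (c - d) * (x - (c - c′) * x₀) ∎

  below-diagonal : ∀ u v c c′ x → u ≈ v + (c - c′) * x →
                   (0# + (c - c′) * u) - (c - c′) * (v + (c - c′) * x) ≈ 0#
  below-diagonal u v c c′ x e = trans (+-congʳ (+-congˡ (*-congˡ e)))
    (solve 4 (λ v c c′ x → (:0 :+ (c :- c′) :* (v :+ (c :- c′) :* x)) :- (c :- c′) :* (v :+ (c :- c′) :* x) := :0)
      refl v c c′ x)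

  diagonal-down : ∀ u v c c′ x → u ≈ v + (c - c′) * x → u - (c - c′) * x ≈ v
  diagonal-down u v c c′ x e = trans (+-congʳ e) (solve 4 (λ v c c′ x → v :+ (c :- c′) :* x :- (c :- c′) :* x := v) refl v c c′ x)

module _ {c ℓ} (ℝ : RealNumbers c ℓ) (n : ℕ) (2≤n : 2 ℕ.≤ n) where

  -- Residues modulo n and the window of the identity

  module Residues where
    open Setting ℝ n 2≤n
    open IntegerOrder
    open ℤᵇ using (_<_; _+_; _-_; _*_)

    instance
      n≢0 : ℕ.NonZero n
      n≢0 = ℕ.>-nonZero (ℕ.≤-trans (s≤s z≤n) 2≤n)

    private
      toℕ-res : ∀ m → toℕ (res m) ≡ m %ℕ n
      toℕ-res m = Fin.toℕ-fromℕ< _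

      unique-remainder : ∀ {r r′} q → r ℕ.< n → + r ≡ + r′ + q * + n → r ≡ r′ ⊎ n ℕ.≤ r′
      unique-remainder {r} {r′} (+ zero) _ e = inj₁ (ℤ.+-injective (≡.trans e (ℤ.+-identityʳ _)))
      unique-remainder {r} {r′} (+ suc q) r<n e = contradiction
        (ℕ.≤-trans (ℕ.m≤m+n n _) (ℕ.≤-trans (ℕ.m≤n+m _ r′)
          (ℕ.≤-reflexive (≡.sym (ℤ.+-injective (≡.trans e (≡.cong (λ x → + r′ + x) (≡.sym (ℤ.pos-* (suc q) n)))))))))
        (ℕ.<⇒≱ r<n)
      unique-remainder {r} {r′} ℤ.-[1+ q ] r<n e = inj₂ (ℕ.≤-trans (ℕ.m≤m+n n _) (ℕ.≤-trans (ℕ.m≤n+m _ r)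
        (ℕ.≤-reflexive (≡.sym (ℤ.+-injective (begin
          + r′                                         ≡⟨ solve 3 (λ r q n → r := (r :+ (:- q) :* n) :+ q :* n) ≡.refl (+ r′) (+ suc q) (+ n) ⟩
          (+ r′ + ℤ.-[1+ q ] * + n) + + suc q * + n    ≡⟨ ≡.cong₂ _+_ e (ℤ.pos-* (suc q) n) ⟨
          + (r ℕ.+ suc q ℕ.* n) ∎))))))
        where open ≡.≡-Reasoning

    res-≡ : ∀ m m′ q → m ≡ m′ + q * + n → res m ≡ res m′
    res-≡ m m′ q e = Fin.toℕ-injective (≡.trans (toℕ-res m) (≡.trans r≡r′ (≡.sym (toℕ-res m′))))
      where
      r = m %ℕ n
      r′ = m′ %ℕ n
      k = m /ℕ n
      k′ = m′ /ℕ n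
      p : + r ≡ + r′ + (k′ + q - k) * + n
      p = begin
        + r                                   ≡⟨ solve 2 (λ r x → r := (r :+ x) :- x) ≡.refl (+ r) (k * + n) ⟩
        + r + k * + n - k * + n               ≡⟨ ≡.cong (_- k * + n) (a≡a%ℕn+[a/ℕn]*n m n) ⟨
        m - k * + n                           ≡⟨ ≡.cong (_- k * + n) e ⟩
        m′ + q * + n - k * + n                ≡⟨ ≡.cong (λ x → x + q * + n - k * + n) (a≡a%ℕn+[a/ℕn]*n m′ n) ⟩
        + r′ + k′ * + n + q * + n - k * + n   ≡⟨ solve 5 (λ r k′ q k n → r :+ k′ :* n :+ q :* n :- k :* n := r :+ (k′ :+ q :- k) :* n) ≡.refl (+ r′) k′ q k (+ n) ⟩
        + r′ + (k′ + q - k) * + n             ∎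
        where open ≡.≡-Reasoning
      r≡r′ : r ≡ r′
      r≡r′ = case unique-remainder (k′ + q - k) (n%ℕd<d m n) p of λ
        { (inj₁ x) → x
        ; (inj₂ x) → contradiction x (ℕ.<⇒≱ (n%ℕd<d m′ n))
        }

    res-≡⁻¹ : ∀ m m′ → res m ≡ res m′ → ∃[ q ] m ≡ m′ + q * + n
    res-≡⁻¹ m m′ e = m /ℕ n - m′ /ℕ n , (begin
      m                                                       ≡⟨ a≡a%ℕn+[a/ℕn]*n m n ⟩
      + (m %ℕ n) + m /ℕ n * + n                               ≡⟨ ≡.cong (λ r → + r + m /ℕ n * + n) r≡ ⟩
      + (m′ %ℕ n) + m /ℕ n * + n                              ≡⟨ solve 4 (λ r k k′ n → r :+ k :* n := r :+ k′ :* n :+ (k :- k′) :* n) ≡.refl (+ (m′ %ℕ n)) (m /ℕ n) (m′ /ℕ n) (+ n) ⟩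
      + (m′ %ℕ n) + m′ /ℕ n * + n + (m /ℕ n - m′ /ℕ n) * + n  ≡⟨ ≡.cong (_+ (m /ℕ n - m′ /ℕ n) * + n) (a≡a%ℕn+[a/ℕn]*n m′ n) ⟨
      m′ + (m /ℕ n - m′ /ℕ n) * + n                           ∎)
      where
      open ≡.≡-Reasoning
      r≡ : m %ℕ n ≡ m′ %ℕ n
      r≡ = ≡.trans (≡.sym (toℕ-res m)) (≡.trans (≡.cong toℕ e) (toℕ-res m′))

    res-+ : ∀ k m m′ → res m ≡ res m′ → res (m + k) ≡ res (m′ + k)
    res-+ k m m′ e = let q , p = res-≡⁻¹ m m′ e in res-≡ (m + k) (m′ + k) q (≡.trans (≡.cong (_+ k) p)
      (solve 4 (λ m q n k → m :+ q :* n :+ k := m :+ k :+ q :* n) ≡.refl m′ q (+ n) k))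

    toℕ-res-< : ∀ {i} → i ℕ.< n → toℕ (res (+ i)) ≡ i
    toℕ-res-< {i} i<n = ≡.trans (toℕ-res (+ i)) (ℕ.m<n⇒m%n≡m i<n)

    res-toℕ : ∀ v → res (+ toℕ v) ≡ v
    res-toℕ v = Fin.toℕ-injective (toℕ-res-< (Fin.toℕ<n v))

    rotate : ℤ → Fin n → Fin n
    rotate k v = res (+ toℕ v + k)

    rotate-res : ∀ k m → rotate k (res m) ≡ res (m + k)
    rotate-res k m = res-+ k (+ toℕ (res m)) m (res-toℕ (res m))

    rotate-rotate : ∀ k k′ v → rotate k (rotate k′ v) ≡ rotate (k′ + k) v
    rotate-rotate k k′ v = ≡.trans (rotate-res k (+ toℕ v + k′)) (≡.cong res (ℤ.+-assoc (+ toℕ v) k′ k))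

    rotate-0 : ∀ v → rotate (+ 0) v ≡ v
    rotate-0 v = ≡.trans (≡.cong res (ℤ.+-identityʳ (+ toℕ v))) (res-toℕ v)

    rotate-inverse : ∀ k v → rotate (ℤ.- k) (rotate k v) ≡ v
    rotate-inverse k v = ≡.trans (rotate-rotate (ℤ.- k) k v)
      (≡.trans (≡.cong (λ k → rotate k v) (ℤ.+-inverseʳ k)) (rotate-0 v))

    rotate-inverse′ : ∀ k v → rotate k (rotate (ℤ.- k) v) ≡ v
    rotate-inverse′ k v = ≡.trans (rotate-rotate k (ℤ.- k) v)
      (≡.trans (≡.cong (λ k → rotate k v) (ℤ.+-inverseˡ k)) (rotate-0 v))

    rotate-injective : ∀ k {u v} → rotate k u ≡ rotate k v → u ≡ v
    rotate-injective k {u} {v} e = ≡.trans (≡.sym (rotate-inverse k u))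
      (≡.trans (≡.cong (rotate (ℤ.- k)) e) (rotate-inverse k v))

    nxt : Fin n → Fin n
    nxt = rotate (+ 1)

    nxt-res : ∀ m → nxt (res m) ≡ res (m + + 1)
    nxt-res = rotate-res (+ 1)

    nxt-≢ : ∀ u → nxt u ≢ u
    nxt-≢ u e = res-≢ (+ toℕ u) (≡.trans (res-toℕ u) (≡.sym e))

    nxt-injective : ∀ {u v} → nxt u ≡ nxt v → u ≡ v
    nxt-injective = rotate-injective (+ 1)

    rotate-nxt : ∀ k u → rotate k (nxt u) ≡ nxt (rotate k u)
    rotate-nxt k u = ≡.trans (rotate-rotate k (+ 1) u)
      (≡.trans (≡.cong (λ j → rotate j u) (ℤ.+-comm (+ 1) k)) (≡.sym (rotate-rotate (+ 1) k u)))

    -- The affine window of the identity.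
    base : Fin n → ℤ
    base v with toℕ v
    ... | zero  = + n
    ... | suc k = + suc k

    base-zero : ∀ v → toℕ v ≡ 0 → base v ≡ + n
    base-zero v e with toℕ v
    base-zero v ≡.refl | zero = ≡.refl

    base-suc : ∀ v {k} → toℕ v ≡ suc k → base v ≡ + suc k
    base-suc v e with toℕ v
    base-suc v ≡.refl | suc k = ≡.refl

    res-n : res (+ n) ≡ res (+ 0)
    res-n = res-≡ (+ n) (+ 0) (+ 1) (solve 1 (λ n → n := con (+ 0) :+ con (+ 1) :* n) ≡.refl (+ n))

    toℕ-res-n : toℕ (res (+ n)) ≡ 0
    toℕ-res-n = ≡.trans (≡.cong toℕ res-n) (toℕ-res-< (ℕ.≤-trans (s≤s z≤n) 2≤n))

    base-res : ∀ {i} → 1 ℕ.≤ i → i ℕ.≤ n → base (res (+ i)) ≡ + i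
    base-res {suc k} _ i≤n with suc k ℕ.≟ n
    ... | yes ≡.refl = base-zero _ toℕ-res-n
    ... | no  i≢n = base-suc _ (toℕ-res-< (ℕ.≤∧≢⇒< i≤n i≢n))

    res-base : ∀ v → res (base v) ≡ v
    res-base v with toℕ v in e
    ... | zero  = ≡.trans res-n (≡.trans (≡.cong (λ x → res (+ x)) (≡.sym e)) (res-toℕ v))
    ... | suc k = ≡.trans (≡.cong (λ x → res (+ x)) (≡.sym e)) (res-toℕ v)

    base-∈ : ∀ v → ∃[ i ] (1 ℕ.≤ i × i ℕ.≤ n × base v ≡ + i × v ≡ res (+ i))
    base-∈ v with toℕ v in e
    ... | zero  = n , ℕ.≤-trans (s≤s z≤n) 2≤n , ℕ.≤-refl , ≡.refl , ≡.sym
          (≡.trans res-n (≡.trans (≡.cong (λ x → res (+ x)) (≡.sym e)) (res-toℕ v)))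
    ... | suc k = suc k , s≤s z≤n , ℕ.<⇒≤ (≡.subst (ℕ._< n) e (Fin.toℕ<n v)) , ≡.refl , ≡.sym
          (≡.trans (≡.cong (λ x → res (+ x)) (≡.sym e)) (res-toℕ v))

    nxt-res-+ : ∀ i → nxt (res (+ i)) ≡ res (+ suc i)
    nxt-res-+ i = ≡.trans (nxt-res (+ i)) (≡.cong (λ x → res (+ x)) (ℕ.+-comm i 1))

    base-nxt : ∀ u → u ≢ res (+ 0) → base (nxt u) ≡ base u + + 1
    base-nxt u u≢0 with base-∈ u
    ... | i , 1≤i , i≤n , e , ≡.refl with i ℕ.≟ n
    ...   | yes ≡.refl = contradiction res-n u≢0
    ...   | no  i≢n = ≡.trans (≡.cong base (nxt-res-+ i)) (≡.trans (base-res (s≤s z≤n) (ℕ.≤∧≢⇒< i≤n i≢n))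
            (≡.trans (≡.cong (λ x → + x) (ℕ.+-comm 1 i)) (≡.cong (_+ + 1) (≡.sym e))))

    base-res-0 : base (res (+ 0)) ≡ + n
    base-res-0 = ≡.trans (≡.cong base (≡.sym res-n)) (base-res (ℕ.≤-trans (s≤s z≤n) 2≤n) ℕ.≤-refl)

    base-res-1 : base (nxt (res (+ 0))) ≡ + 1
    base-res-1 = ≡.trans (≡.cong base (nxt-res-+ 0)) (base-res (s≤s z≤n) (ℕ.≤-trans (s≤s z≤n) 2≤n))

    open Reflection nxt nxt-≢ nxt-injective public

    base-sorted : ∀ u → ¬ Descent u base
    base-sorted u d with u Fin.≟ res (+ 0)
    ... | no u≢0 = ℤ.<-irrefl (≡.sym (base-nxt u u≢0)) d
    ... | yes ≡.refl = ℤ.<-asym (≡.subst₂ (λ x y → x + + 1 < y) base-res-0 base-res-1 d)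
            (ℤ.+<+ (ℕ.≤-trans 2≤n (ℕ.m≤m+n n 1)))

    open Chains base base-sorted public

  -- Windows of elements of the extended affine Weyl group

  module WeylGroup where
    open Setting ℝ n 2≤n
    open Wₑ public
    open Residues
    open IntegerOrder
    open ℤᵇ using (_+_; _-_; _*_)

    -- The coset of w contains the translation of w, and t_l sends the integer `base v` to
    -- `base v + n l_v`. Hence the window of a coset depends on the translation part only.
    window : Coweight → State
    window l v = base v + + n * l v

    windowʷ : Wₑ → State
    windowʷ w = window (translation w)

    shift-s : ℤ → Coweight
    shift-s m = translation (s m)

    s-shift-0 : ∀ m → res m ≢ res (+ 0) → ∀ v → shift-s m v ≡ + 0
    s-shift-0 m ne v rewrite dec-false (res m Fin.≟ res (+ 0)) ne = ≡.refl

    s-shift : ∀ m → res m ≡ res (+ 0) → ∀ v → shift-s m v ≡ unit (+ 1) v - unit (+ n) v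
    s-shift m e v rewrite dec-true (res m Fin.≟ res (+ 0)) e = ≡.refl

    unit-≡ : ∀ m v → v ≡ res m → unit m v ≡ + 1
    unit-≡ m v e rewrite dec-true (v Fin.≟ res m) e = ≡.refl

    unit-≢ : ∀ m v → v ≢ res m → unit m v ≡ + 0
    unit-≢ m v e rewrite dec-false (v Fin.≟ res m) e = ≡.refl

    private
      res-1 : nxt (res (+ 0)) ≡ res (+ 1)
      res-1 = nxt-res-+ 0

      base-s-next : ∀ m → base (nxt (res m)) + + n * shift-s m (nxt (res m)) ≡ base (res m) + + 1
      base-s-next m = by (res m Fin.≟ res (+ 0))
        where
        by : Dec (res m ≡ res (+ 0)) → base (nxt (res m)) + + n * shift-s m (nxt (res m)) ≡ base (res m) + + 1
        by (no ne) = ≡.trans (≡.cong₂ (λ x y → x + + n * y) (base-nxt (res m) ne) (s-shift-0 m ne (nxt (res m))))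
            (solve 2 (λ b n → b :+ con (+ 1) :+ n :* con (+ 0) := b :+ con (+ 1)) ≡.refl (base (res m)) (+ n))
        by (yes e) = begin
          base (nxt (res m)) + + n * shift-s m (nxt (res m))
            ≡⟨ ≡.cong₂ (λ x y → x + + n * y) (≡.trans (≡.cong (base ∘ nxt) e) base-res-1) (s-shift m e (nxt (res m))) ⟩
          + 1 + + n * (unit (+ 1) (nxt (res m)) - unit (+ n) (nxt (res m)))
            ≡⟨ ≡.cong₂ (λ x y → + 1 + + n * (x - y)) (unit-≡ (+ 1) (nxt (res m)) (≡.trans (≡.cong nxt e) res-1))
                 (unit-≢ (+ n) (nxt (res m)) λ p → nxt-≢ (res m) (≡.trans p (≡.trans res-n (≡.sym e)))) ⟩
          + 1 + + n * (+ 1 - + 0)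
            ≡⟨ solve 1 (λ n → con (+ 1) :+ n :* (con (+ 1) :- con (+ 0)) := n :+ con (+ 1)) ≡.refl (+ n) ⟩
          + n + + 1
            ≡⟨ ≡.cong (_+ + 1) (≡.trans (≡.cong base e) base-res-0) ⟨
          base (res m) + + 1 ∎
            where open ≡.≡-Reasoning

      base-s-here : ∀ m → base (res m) + + n * shift-s m (res m) ≡ base (nxt (res m)) - + 1
      base-s-here m = by (res m Fin.≟ res (+ 0))
        where
        by : Dec (res m ≡ res (+ 0)) → base (res m) + + n * shift-s m (res m) ≡ base (nxt (res m)) - + 1
        by (no ne) = ≡.trans (≡.cong (λ y → base (res m) + + n * y) (s-shift-0 m ne (res m)))
            (≡.trans (solve 2 (λ b n → b :+ n :* con (+ 0) := b :+ con (+ 1) :- con (+ 1)) ≡.refl (base (res m)) (+ n))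
            (≡.cong (_- + 1) (≡.sym (base-nxt (res m) ne))))
        by (yes e) = begin
          base (res m) + + n * shift-s m (res m)
            ≡⟨ ≡.cong₂ (λ x y → x + + n * y) (≡.trans (≡.cong base e) base-res-0) (s-shift m e (res m)) ⟩
          + n + + n * (unit (+ 1) (res m) - unit (+ n) (res m))
            ≡⟨ ≡.cong₂ (λ x y → + n + + n * (x - y))
                 (unit-≢ (+ 1) (res m) λ p → nxt-≢ (res m) (≡.trans (≡.trans (≡.cong nxt e) res-1) (≡.sym p)))
                 (unit-≡ (+ n) (res m) (≡.trans e (≡.sym res-n))) ⟩
          + n + + n * (+ 0 - + 1)
            ≡⟨ solve 1 (λ n → n :+ n :* (con (+ 0) :- con (+ 1)) := con (+ 1) :- con (+ 1)) ≡.refl (+ n) ⟩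
          + 1 - + 1
            ≡⟨ ≡.cong (_- + 1) (≡.trans (≡.cong (base ∘ nxt) e) base-res-1) ⟨
          base (nxt (res m)) - + 1 ∎
            where open ≡.≡-Reasoning

      base-s-other : ∀ m v → v ≢ res m → v ≢ nxt (res m) → shift-s m v ≡ + 0
      base-s-other m v p q = by (res m Fin.≟ res (+ 0))
        where
        by : Dec (res m ≡ res (+ 0)) → shift-s m v ≡ + 0
        by (no ne) = s-shift-0 m ne v
        by (yes e) = ≡.trans (s-shift m e v) (≡.cong₂ _-_
            (unit-≢ (+ 1) v λ r → q (≡.trans r (≡.sym (≡.trans (≡.cong nxt e) res-1))))
            (unit-≢ (+ n) v λ r → p (≡.trans r (≡.trans res-n (≡.sym e)))))

      distribute : ∀ b n x y → b + n * (x + y) ≡ b + n * x + n * y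
      distribute = solve 4 (λ b n x y → b :+ n :* (x :+ y) := b :+ n :* x :+ n :* y) ≡.refl

    private
      window-reflection : ∀ u (sh : Coweight) (σ : Fin n → Fin n) → σ u ≡ nxt u → σ (nxt u) ≡ u →
        (∀ v → v ≢ u → v ≢ nxt u → σ v ≡ v) →
        base u + + n * sh u ≡ base (nxt u) - + 1 → base (nxt u) + + n * sh (nxt u) ≡ base u + + 1 →
        (∀ v → v ≢ u → v ≢ nxt u → sh v ≡ + 0) →
        ∀ l v → base v + + n * (sh v + l (σ v)) ≡ op u (window l) v
      window-reflection u sh σ σu σu⁺ σv su su⁺ sv l v = by (position u v)
        where
        open ≡.≡-Reasoning
        by : Position u v → base v + + n * (sh v + l (σ v)) ≡ op u (window l) v
        by (here ≡.refl) = begin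
          base u + + n * (sh u + l (σ u))
            ≡⟨ distribute (base u) (+ n) (sh u) (l (σ u)) ⟩
          base u + + n * sh u + + n * l (σ u)
            ≡⟨ ≡.cong₂ (λ x y → x + + n * l y) su σu ⟩
          base (nxt u) - + 1 + + n * l (nxt u)
            ≡⟨ solve 2 (λ b x → b :- con (+ 1) :+ x := b :+ x :- con (+ 1)) ≡.refl (base (nxt u)) (+ n * l (nxt u)) ⟩
          window l (nxt u) - + 1
            ≡⟨ op-here u ⟨
          op u (window l) u ∎
        by (next ≡.refl) = begin
          base (nxt u) + + n * (sh (nxt u) + l (σ (nxt u)))
            ≡⟨ distribute (base (nxt u)) (+ n) (sh (nxt u)) (l (σ (nxt u))) ⟩
          base (nxt u) + + n * sh (nxt u) + + n * l (σ (nxt u))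
            ≡⟨ ≡.cong₂ (λ x y → x + + n * l y) su⁺ σu⁺ ⟩
          base u + + 1 + + n * l u
            ≡⟨ solve 2 (λ b x → b :+ con (+ 1) :+ x := b :+ x :+ con (+ 1)) ≡.refl (base u) (+ n * l u) ⟩
          window l u + + 1
            ≡⟨ op-next u ⟨
          op u (window l) (nxt u) ∎
        by (other p q) = begin
          base v + + n * (sh v + l (σ v))
            ≡⟨ ≡.cong₂ (λ x y → base v + + n * (x + l y)) (sv v p q) (σv v p q) ⟩
          base v + + n * (+ 0 + l v)
            ≡⟨ ≡.cong (λ x → base v + + n * x) (ℤ.+-identityˡ (l v)) ⟩
          window l v
            ≡⟨ op-other u p q ⟨
          op u (window l) v ∎

    -- This identifies `op` with left multiplication. The translation part of s_0 makes up for the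
    -- jump of `base` from n to 1, so that all residues follow the same rule.
    window-s : ∀ m w → windowʷ (s m · w) ≗ op (res m) (windowʷ w)
    window-s m w = window-reflection (res m) (shift-s m) (PC.transpose (res (m + + 1)) (res m))
      (≡.trans (transpose-right (res (m + + 1)) (res m)) (≡.sym (nxt-res m)))
      (≡.trans (≡.cong (PC.transpose (res (m + + 1)) (res m)) (nxt-res m)) (transpose-left (res (m + + 1)) (res m)))
      (λ v p q → transpose-other (res (m + + 1)) (res m) (λ e → q (≡.trans e (≡.sym (nxt-res m)))) p)
      (base-s-here m) (base-s-next m) (base-s-other m) (translation w)

    window-word : ∀ ms → windowʷ (word ms) ≗ end (map res ms)
    window-word [] v = ≡.trans (≡.cong (λ x → base v + x) (ℤ.*-zeroʳ (+ n))) (ℤ.+-identityʳ _)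
    window-word (m ∷ ms) v = ≡.trans (window-s m (word ms) v) (op-cong (res m) (window-word ms) v)

    translation-word-0 : ∀ f j → (∀ i → i ℕ.< j → res (f i) ≢ res (+ 0)) →
                         ∀ v → translation (word (applyUpTo f j)) v ≡ + 0
    translation-word-0 f zero    ne v = ≡.refl
    translation-word-0 f (suc j) ne v = ≡.cong₂ _+_ (s-shift-0 (f 0) (ne 0 (s≤s z≤n)) v)
      (translation-word-0 (f ∘ suc) j (λ i i<j → ne (suc i) (s≤s i<j)) _)

    res-+-≢ : ∀ {i j} → 1 ℕ.≤ i → i ℕ.≤ n → 1 ℕ.≤ j → j ℕ.≤ n → i ≢ j → res (+ i) ≢ res (+ j)
    res-+-≢ 1≤i i≤n 1≤j j≤n i≢j e = i≢j (ℤ.+-injective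
      (≡.trans (≡.sym (base-res 1≤i i≤n)) (≡.trans (≡.cong base e) (base-res 1≤j j≤n))))

    private
      2+a≤n : ∀ {a j} → a ℕ.+ suc j ≡ n ∸ 1 → suc (suc a) ℕ.≤ n
      2+a≤n {a} {j} e = ℕ.≤-trans (s≤s (ℕ.≤-trans (ℕ.≤-trans (s≤s (ℕ.m≤m+n a j)) (ℕ.≤-reflexive (≡.sym (ℕ.+-suc a j))))
        (ℕ.≤-reflexive e))) (ℕ.≤-reflexive (ℕ.m+[n∸m]≡n {1} {n} (ℕ.≤-trans (s≤s z≤n) 2≤n)))

      swap : ℕ → Fin n → Fin n
      swap a = PC.transpose (res (+ suc a)) (res (+ suc a + + 1))

      suc-+1 : ∀ a → res (+ suc (suc a)) ≡ res (+ suc a + + 1)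
      suc-+1 a = ≡.cong (λ x → res (+ x)) (≡.sym (ℕ.+-comm (suc a) 1))

      swap-suc : ∀ a → swap a (res (+ suc (suc a))) ≡ res (+ suc a)
      swap-suc a = ≡.trans (≡.cong (swap a) (suc-+1 a)) (transpose-right (res (+ suc a)) (res (+ suc a + + 1)))

      swap-other : ∀ a i → suc (suc a) ℕ.≤ n → 1 ℕ.≤ i → i ℕ.≤ n → i ≢ suc a → i ≢ suc (suc a) →
                   swap a (res (+ i)) ≡ res (+ i)
      swap-other a i a≤n 1≤i i≤n p q = transpose-other _ _ (res-+-≢ 1≤i i≤n (s≤s z≤n) (ℕ.<⇒≤ a≤n) p)
        (res-+-≢ 1≤i i≤n (s≤s z≤n) a≤n q ∘ λ e → ≡.trans e (≡.sym (suc-+1 a)))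

    -- The product of the simple reflections a + 1, …, n - 1.
    finite-word : ∀ a j f → (∀ i → f i ≡ + suc (a ℕ.+ i)) → a ℕ.+ j ≡ n ∸ 1 →
      let π = finite (word (applyUpTo f j)) in
      (π ⟨$⟩ʳ res (+ n) ≡ res (+ suc a)) ×
      (∀ i → 1 ℕ.≤ i → i ℕ.≤ a → π ⟨$⟩ʳ res (+ i) ≡ res (+ i)) ×
      (∀ i → a ℕ.< i → i ℕ.< n → π ⟨$⟩ʳ res (+ i) ≡ res (+ suc i))
    finite-word a zero f fi e = ≡.cong (λ x → res (+ x)) n≡1+a , (λ _ _ _ → ≡.refl) ,
      λ i a<i i<n → contradiction (ℕ.≤-trans i<n (ℕ.≤-reflexive n≡1+a)) (ℕ.<⇒≱ (s≤s a<i))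
      where
      n≡1+a : n ≡ suc a
      n≡1+a = ≡.trans (≡.sym (ℕ.m+[n∸m]≡n {1} {n} (ℕ.≤-trans (s≤s z≤n) 2≤n))) (≡.cong suc (≡.trans (≡.sym e) (ℕ.+-identityʳ a)))
    finite-word a (suc j) f fi e with finite-word (suc a) j (f ∘ suc)
      (λ i → ≡.trans (fi (suc i)) (≡.cong (λ x → + suc x) (ℕ.+-suc a i))) (≡.trans (≡.sym (ℕ.+-suc a j)) e)
    ... | p , q , r = ≡.trans (to (res (+ n))) (≡.trans (≡.cong (swap a) p) (swap-suc a)) ,
      (λ i 1≤i i≤a → ≡.trans (to (res (+ i))) (≡.trans (≡.cong (swap a) (q i 1≤i (ℕ.≤-trans i≤a (ℕ.n≤1+n a))))
        (swap-other a i (2+a≤n e) 1≤i (ℕ.≤-trans i≤a (ℕ.≤-trans (ℕ.n≤1+n a) (ℕ.<⇒≤ (2+a≤n e))))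
          (ℕ.<⇒≢ (s≤s i≤a)) (ℕ.<⇒≢ (s≤s (ℕ.≤-trans i≤a (ℕ.n≤1+n a))))))) ,
      λ i a<i i<n → ≡.trans (to (res (+ i))) (case i ℕ.≟ suc a of λ
        { (yes ≡.refl) → ≡.trans (≡.cong (swap a) (q i (s≤s z≤n) ℕ.≤-refl))
            (≡.trans (transpose-left (res (+ suc a)) (res (+ suc a + + 1))) (≡.sym (suc-+1 a)))
        ; (no ne) → ≡.trans (≡.cong (swap a) (r i (ℕ.≤∧≢⇒< a<i (ne ∘ ≡.sym)) i<n))
            (swap-other a (suc i) (2+a≤n e) (s≤s z≤n) i<n (λ x → ℕ.<⇒≢ a<i (≡.sym (ℕ.suc-injective x))) (ne ∘ ℕ.suc-injective))
        })
      where
      to : ∀ v → finite (word (applyUpTo f (suc j))) ⟨$⟩ʳ v ≡ swap a (finite (word (applyUpTo (f ∘ suc) j)) ⟨$⟩ʳ v)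
      to v = ≡.cong (λ m → PC.transpose (res m) (res (m + + 1)) (finite (word (applyUpTo (f ∘ suc) j)) ⟨$⟩ʳ v))
        (≡.trans (fi 0) (≡.cong (λ x → + suc x) (ℕ.+-identityʳ a)))

    private
      τ-letters : map (λ m → + suc m) (List.upTo (n ∸ 1)) ≡ applyUpTo (λ m → + suc m) (n ∸ 1)
      τ-letters = List.map-applyUpTo id (λ m → + suc m) (n ∸ 1)

    finite-τ : ∀ v → finite τ ⟨$⟩ʳ v ≡ nxt v
    finite-τ v with base-∈ v | finite-word 0 (n ∸ 1) (λ m → + suc m) (λ _ → ≡.refl) ≡.refl
    ... | i , 1≤i , i≤n , _ , ≡.refl | p , q , r = ≡.trans
          (≡.cong (λ ms → finite (word ms) ⟨$⟩ʳ res (+ i)) τ-letters)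
          (≡.trans rotated (≡.sym (nxt-res-+ i)))
      where
      rotated : finite (word (applyUpTo (λ m → + suc m) (n ∸ 1))) ⟨$⟩ʳ res (+ i) ≡ res (+ suc i)
      rotated with i ℕ.≟ n
      ... | yes ≡.refl = ≡.trans p (≡.trans (≡.sym (nxt-res-+ 0)) (≡.trans (≡.cong nxt (≡.sym res-n)) (nxt-res-+ n)))
      ... | no i≢n = r i 1≤i (ℕ.≤∧≢⇒< i≤n i≢n)

    private
      res-suc-≢ : ∀ i → i ℕ.< n ∸ 1 → res (+ suc i) ≢ res (+ 0)
      res-suc-≢ i i<n∸1 e = res-+-≢ (s≤s z≤n) (ℕ.<⇒≤ i<n) (ℕ.≤-trans (s≤s z≤n) 2≤n) ℕ.≤-refl (ℕ.<⇒≢ i<n)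
        (≡.trans e (≡.sym res-n))
        where
        i<n : suc i ℕ.< n
        i<n = ℕ.≤-trans (s≤s i<n∸1) (ℕ.≤-reflexive (ℕ.m+[n∸m]≡n {1} {n} (ℕ.≤-trans (s≤s z≤n) 2≤n)))

      translation-τ : ∀ v → translation τ v ≡ ω 1 v
      translation-τ v = ≡.trans (≡.cong (λ x → ω 1 v + x)
        (≡.trans (≡.cong (λ ms → translation (word ms) v) τ-letters)
          (translation-word-0 (λ m → + suc m) (n ∸ 1) res-suc-≢ v)))
        (ℤ.+-identityʳ _)

      ω-one : ∀ v → toℕ v ≡ 1 → ω 1 v ≡ + 1
      ω-one v e with toℕ v
      ω-one v ≡.refl | suc zero = ≡.refl

      ω-other : ∀ v → toℕ v ≢ 1 → ω 1 v ≡ + 0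
      ω-other v ne with toℕ v
      ... | zero        = ≡.refl
      ... | suc zero    = contradiction ≡.refl ne
      ... | suc (suc _) = ≡.refl

      base-τ : ∀ u → base (nxt u) + + n * ω 1 (nxt u) ≡ base u + + 1
      base-τ u with u Fin.≟ res (+ 0)
      ... | yes ≡.refl = begin
          base (nxt u) + + n * ω 1 (nxt u)   ≡⟨ ≡.cong₂ (λ x y → x + + n * y) base-res-1 (ω-one (nxt u) toℕ≡1) ⟩
          + 1 + + n * + 1                    ≡⟨ solve 1 (λ n → con (+ 1) :+ n :* con (+ 1) := n :+ con (+ 1)) ≡.refl (+ n) ⟩
          + n + + 1                          ≡⟨ ≡.cong (_+ + 1) base-res-0 ⟨
          base u + + 1                       ∎
        where
        open ≡.≡-Reasoning
        toℕ≡1 : toℕ (nxt u) ≡ 1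
        toℕ≡1 = ≡.trans (≡.cong toℕ (nxt-res-+ 0)) (toℕ-res-< 2≤n)
      ... | no ne = ≡.trans (≡.cong₂ (λ x y → x + + n * y) (base-nxt u ne)
          (ω-other (nxt u) λ e → ne (nxt-injective (≡.trans (Fin.toℕ-injective (≡.trans e (≡.sym (toℕ-res-< 2≤n)))) (≡.sym (nxt-res-+ 0))))))
          (solve 2 (λ b n → b :+ con (+ 1) :+ n :* con (+ 0) := b :+ con (+ 1)) ≡.refl (base u) (+ n))

    -- τ is the map i ↦ i + 1 of the integers: its translation part compensates for the wrap of
    -- positions from n to 1.
    window-τ : ∀ w v → windowʷ (τ · w) (nxt v) ≡ windowʷ w v + + 1
    window-τ w v = begin
      base (nxt v) + + n * (translation τ (nxt v) + l (finite τ ⟨$⟩ˡ nxt v))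
        ≡⟨ ≡.cong₂ (λ x y → base (nxt v) + + n * (x + l y)) (translation-τ (nxt v))
             (≡.trans (≡.cong (finite τ ⟨$⟩ˡ_) (≡.sym (finite-τ v))) (Perm.inverseˡ (finite τ))) ⟩
      base (nxt v) + + n * (ω 1 (nxt v) + l v)
        ≡⟨ distribute (base (nxt v)) (+ n) (ω 1 (nxt v)) (l v) ⟩
      base (nxt v) + + n * ω 1 (nxt v) + + n * l v
        ≡⟨ ≡.cong (_+ + n * l v) (base-τ v) ⟩
      base v + + 1 + + n * l v
        ≡⟨ solve 2 (λ b x → b :+ con (+ 1) :+ x := b :+ x :+ con (+ 1)) ≡.refl (base v) (+ n * l v) ⟩
      window l v + + 1 ∎
      where
      open ≡.≡-Reasoning
      l = translation w

    finite-τ^ : ∀ r v → finite (τ^ r) ⟨$⟩ʳ v ≡ rotate (+ r) v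
    finite-τ^ zero v = ≡.sym (rotate-0 v)
    finite-τ^ (suc r) v = ≡.trans (finite-τ _) (≡.trans (≡.cong nxt (finite-τ^ r v))
      (≡.trans (rotate-rotate (+ 1) (+ r) v) (≡.cong (λ x → rotate (+ x) v) (ℕ.+-comm r 1))))

    window-assoc : ∀ x y w → windowʷ ((x · y) · w) ≗ windowʷ (x · (y · w))
    window-assoc x y w v = ≡.cong (λ z → base v + + n * z) (ℤ.+-assoc (translation x v) _ _)

    window-τ^ : ∀ r w v → windowʷ (τ^ r · w) (rotate (+ r) v) ≡ windowʷ w v + + r
    window-τ^ zero w v = ≡.trans (≡.cong (windowʷ (idʷ · w)) (rotate-0 v))
      (≡.trans (≡.cong (λ x → base v + + n * x) (ℤ.+-identityˡ _)) (≡.sym (ℤ.+-identityʳ _)))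
    window-τ^ (suc r) w v = begin
      windowʷ ((τ · τ^ r) · w) (rotate (+ suc r) v)      ≡⟨ window-assoc τ (τ^ r) w (rotate (+ suc r) v) ⟩
      windowʷ (τ · (τ^ r · w)) (rotate (+ suc r) v)      ≡⟨ ≡.cong (windowʷ (τ · (τ^ r · w)))
                                                              (≡.sym (≡.trans (rotate-rotate (+ 1) (+ r) v) (≡.cong (λ x → rotate (+ x) v) (ℕ.+-comm r 1)))) ⟩
      windowʷ (τ · (τ^ r · w)) (nxt (rotate (+ r) v))    ≡⟨ window-τ (τ^ r · w) _ ⟩
      windowʷ (τ^ r · w) (rotate (+ r) v) + + 1          ≡⟨ ≡.cong (_+ + 1) (window-τ^ r w v) ⟩
      windowʷ w v + + r + + 1                            ≡⟨ solve 2 (λ x r → x :+ r :+ con (+ 1) := x :+ (con (+ 1) :+ r)) ≡.refl (windowʷ w v) (+ r) ⟩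
      windowʷ w v + + suc r                              ∎
      where open ≡.≡-Reasoning

  -- Lengths and shortest coset representatives

  module Lengths where
    open Setting ℝ n 2≤n hiding (F; u; z; a; t; D; R)
    open Residues
    open WeylGroup
    open IntegerOrder
    open ℤᵇ using (_<_; _≤_; _+_; _-_; _*_)
    open RawMonoidDefs ℤ.+-0-rawMonoid using (sum)

    infix 4 _≈ᶜ_

    -- Equality of the cosets w W and w′ W: the finite parts are ignored.
    _≈ᶜ_ : Wₑ → Wₑ → Set
    w ≈ᶜ w′ = ∀ v → coordinates (translation w) v ≡ coordinates (translation w′) v

    private
      sum-shift : ∀ k d {m} (f g : Fin m → ℤ) → (∀ v → k * f v ≡ k * g v + d) →
                  k * sum f ≡ k * sum g + + m * d
      sum-shift k d {zero} f g e = ≡.sym (ℤ.+-identityʳ _)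
      sum-shift k d {suc m} f g e = begin
        k * (f zero + Σf)                          ≡⟨ ℤ.*-distribˡ-+ k (f zero) Σf ⟩
        k * f zero + k * Σf                        ≡⟨ ≡.cong₂ _+_ (e zero) (sum-shift k d (f ∘ suc) (g ∘ suc) (e ∘ suc)) ⟩
        k * g zero + d + (k * Σg + + m * d)        ≡⟨ solve 5 (λ k x d y m → k :* x :+ d :+ (k :* y :+ m :* d) := k :* (x :+ y) :+ (con (+ 1) :+ m) :* d) ≡.refl k (g zero) d Σg (+ m) ⟩
        k * (g zero + Σg) + + suc m * d            ∎
        where
        open ≡.≡-Reasoning
        Σf = sum (f ∘ suc)
        Σg = sum (g ∘ suc)

    -- Two integer vectors give the same coweight when they differ by a multiple of (1, ..., 1). So
    -- the window of a coset is defined up to a constant, here the difference of the two coordinate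
    -- sums.
    ≈ᶜ⇒window : ∀ {w w′} → w ≈ᶜ w′ → ∃[ d ] (∀ v → windowʷ w v ≡ windowʷ w′ v + d)
    ≈ᶜ⇒window {w} {w′} e = sum l - sum l′ , λ v → begin
      base v + + n * l v                                   ≡⟨ solve 3 (λ b x y → b :+ x := b :+ (x :- y) :+ y) ≡.refl (base v) (+ n * l v) (sum l) ⟩
      base v + (+ n * l v - sum l) + sum l                 ≡⟨ ≡.cong (λ x → base v + x + sum l) (e v) ⟩
      base v + (+ n * l′ v - sum l′) + sum l               ≡⟨ solve 4 (λ b x y z → b :+ (x :- y) :+ z := b :+ x :+ (z :- y)) ≡.refl (base v) (+ n * l′ v) (sum l′) (sum l) ⟩
      base v + + n * l′ v + (sum l - sum l′)               ∎
      where
      open ≡.≡-Reasoning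
      l = translation w
      l′ = translation w′

    window⇒≈ᶜ : ∀ {w w′} d → (∀ v → windowʷ w v ≡ windowʷ w′ v + d) → w ≈ᶜ w′
    window⇒≈ᶜ {w} {w′} d e v = begin
      + n * l v - sum l                  ≡⟨ ≡.cong₂ _-_ (difference v) sums ⟩
      + n * l′ v + d - (sum l′ + d)      ≡⟨ solve 3 (λ x d y → x :+ d :- (y :+ d) := x :- y) ≡.refl (+ n * l′ v) d (sum l′) ⟩
      + n * l′ v - sum l′                ∎
      where
      open ≡.≡-Reasoning
      l = translation w
      l′ = translation w′
      difference : ∀ v → + n * l v ≡ + n * l′ v + d
      difference v = ≡.trans (solve 2 (λ b x → x := b :+ x :- b) ≡.refl (base v) (+ n * l v))
        (≡.trans (≡.cong (_- base v) (e v))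
          (solve 3 (λ b y d → b :+ y :+ d :- b := y :+ d) ≡.refl (base v) (+ n * l′ v) d))
      sums : sum l ≡ sum l′ + d
      sums = ℤ.*-cancelˡ-≡ (+ n) (sum l) (sum l′ + d)
        (≡.trans (sum-shift (+ n) d l l′ difference) (≡.sym (ℤ.*-distribˡ-+ (+ n) (sum l′) d)))

    res-window : ∀ l v → res (window l v) ≡ v
    res-window l v = ≡.trans (res-≡ (window l v) (base v) (l v)
      (≡.cong (λ x → base v + x) (ℤ.*-comm (+ n) (l v)))) (res-base v)

    base-injective : ∀ {u v} → base u ≡ base v → u ≡ v
    base-injective {u} {v} e = ≡.trans (≡.sym (res-base u)) (≡.trans (≡.cong res e) (res-base v))

    -- w is the shortest element of its coset w W.
    Sorted : Wₑ → Set
    Sorted w = ∀ p q → base p < base q → windowʷ w (finite w ⟨$⟩ʳ p) < windowʷ w (finite w ⟨$⟩ʳ q)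

    private
      <⇒+1≤ : ∀ {x y} → x < y → x + + 1 ≤ y
      <⇒+1≤ {x} {y} p = ≡.subst (_≤ y) (ℤ.+-comm (+ 1) x) (ℤ.i<j⇒suc[i]≤j p)

      <⇒+1< : ∀ {x y} → x < y → x + + 1 ≢ y → x + + 1 < y
      <⇒+1< p ne = ℤ.≤∧≢⇒< (<⇒+1≤ p) ne

      <+1 : ∀ x → x < x + + 1
      <+1 x = ≡.subst (_< x + + 1) (ℤ.+-identityʳ x) (ℤ.+-monoʳ-< x (ℤ.+<+ (s≤s z≤n)))

      -1< : ∀ x → x - + 1 < x
      -1< x = from₁ (<+1 x) (solve 1 (λ x → x :- (x :- con (+ 1)) := x :+ con (+ 1) :- x) ≡.refl x)

    -- Only the elements in the classes u and u + 1 move, each by one. An inequality could break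
    -- only between consecutive integers, which `gap` excludes, or between the two moving elements,
    -- where the ascent fixes their order.
    sorted-s : ∀ m w → Ascent (res m) (windowʷ w) → Sorted w → Sorted (s m · w)
    sorted-s m w a sorted p q p<q = by (position u x) (position u y)
      where
      u = res m
      P = windowʷ w
      x = finite w ⟨$⟩ʳ p
      y = finite w ⟨$⟩ʳ q
      σ = PC.transpose u (res (m + + 1))
      at : Fin n → ℤ
      at z = windowʷ (s m · w) (σ z)
      x<y : P x < P y
      x<y = sorted p q p<q

      at-here : ∀ {z} → z ≡ u → at z ≡ P u + + 1
      at-here ≡.refl = ≡.trans (≡.cong (windowʷ (s m · w)) (≡.trans (transpose-left u (res (m + + 1))) (≡.sym (nxt-res m))))
        (≡.trans (window-s m w (nxt u)) (op-next u))
      at-next : ∀ {z} → z ≡ nxt u → at z ≡ P (nxt u) - + 1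
      at-next ≡.refl = ≡.trans (≡.cong (windowʷ (s m · w)) (≡.trans (≡.cong σ (nxt-res m)) (transpose-right u (res (m + + 1)))))
        (≡.trans (window-s m w u) (op-here u))
      at-other : ∀ {z} → z ≢ u → z ≢ nxt u → at z ≡ P z
      at-other {z} r t = ≡.trans (≡.cong (windowʷ (s m · w)) (transpose-other u (res (m + + 1)) r (λ e → t (≡.trans e (≡.sym (nxt-res m))))))
        (≡.trans (window-s m w z) (op-other u r t))

      gap : ∀ {z z′} → z′ ≢ nxt z → P z + + 1 ≢ P z′
      gap {z} {z′} ne e = ne (≡.trans (≡.sym (res-window (translation w) z′)) (≡.trans (≡.cong res (≡.sym e))
        (≡.trans (≡.sym (nxt-res (P z))) (≡.cong nxt (res-window (translation w) z)))))

      by : Position u x → Position u y → at x < at y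
      by (here e) (here e′) = contradiction (≡.subst₂ (λ x y → P x < P y) e e′ x<y) (ℤ.<-irrefl ≡.refl)
      by (next e) (next e′) = contradiction (≡.subst₂ (λ x y → P x < P y) e e′ x<y) (ℤ.<-irrefl ≡.refl)
      by (here e) (next e′) = contradiction (ℤ.<-≤-trans a (<⇒+1≤ (≡.subst₂ (λ x y → P x < P y) e e′ x<y))) (ℤ.<-irrefl ≡.refl)
      by (here e) (other r t) = ≡.subst₂ _<_ (≡.sym (at-here e)) (≡.sym (at-other r t))
        (<⇒+1< (≡.subst (λ x → P x < P y) e x<y) (gap t))
      by (next e) (here e′) = ≡.subst₂ _<_ (≡.sym (at-next e)) (≡.sym (at-here e′))
        (ℤ.<-trans (-1< _) (ℤ.<-trans (≡.subst₂ (λ x y → P x < P y) e e′ x<y) (<+1 _)))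
      by (next e) (other r t) = ≡.subst₂ _<_ (≡.sym (at-next e)) (≡.sym (at-other r t))
        (ℤ.<-trans (-1< _) (≡.subst (λ x → P x < P y) e x<y))
      by (other r t) (here e′) = ≡.subst₂ _<_ (≡.sym (at-other r t)) (≡.sym (at-here e′))
        (ℤ.<-trans (≡.subst (λ y → P x < P y) e′ x<y) (<+1 _))
      by (other r t) (next e′) = ≡.subst₂ _<_ (≡.sym (at-other r t)) (≡.sym (at-next e′))
        (from₁ (<⇒+1< (≡.subst (λ y → P x < P y) e′ x<y) (gap λ e → r (nxt-injective (≡.sym e))))
          (solve 2 (λ x y → y :- con (+ 1) :- x := y :- (x :+ con (+ 1))) ≡.refl (P x) (P (nxt u))))
      by (other r t) (other r′ t′) = ≡.subst₂ _<_ (≡.sym (at-other r t)) (≡.sym (at-other r′ t′)) x<y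

    sorted-word : ∀ ms → Up (map res ms) → Sorted (word ms)
    sorted-word [] [] p q p<q = ≡.subst₂ _<_ (≡.sym (window-word [] p)) (≡.sym (window-word [] q)) p<q
    sorted-word (m ∷ ms) (a ∷ up) = sorted-s m (word ms)
      (≡.subst₂ (λ x y → x < y + + 1) (≡.sym (window-word ms _)) (≡.sym (window-word ms _)) a)
      (sorted-word ms up)

    sorted-value : ∀ r ms → Up (map res ms) → Sorted (value (r , ms))
    sorted-value r ms up p q p<q = ≡.subst₂ _<_ (≡.sym (at p)) (≡.sym (at q))
      (ℤ.+-monoˡ-< (+ r) (sorted-word ms up p q p<q))
      where
      at : ∀ p → windowʷ (value (r , ms)) (finite (value (r , ms)) ⟨$⟩ʳ p) ≡ windowʷ (word ms) (finite (word ms) ⟨$⟩ʳ p) + + r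
      at p = ≡.trans (≡.cong (windowʷ (value (r , ms))) (finite-τ^ r (finite (word ms) ⟨$⟩ʳ p)))
        (window-τ^ r (word ms) (finite (word ms) ⟨$⟩ʳ p))

    private
      Increasing : (Fin n → Fin n) → Set
      Increasing ρ = ∀ p q → base p < base q → base (ρ p) < base (ρ q)

      base≥1 : ∀ v → + 1 ≤ base v
      base≥1 v with base-∈ v
      ... | i , 1≤i , _ , e , _ = ≡.subst (+ 1 ≤_) (≡.sym e) (ℤ.+≤+ 1≤i)

      increasing-≥ : ∀ ρ → Increasing ρ → ∀ i → 1 ℕ.≤ i → i ℕ.≤ n → + i ≤ base (ρ (res (+ i)))
      increasing-≥ ρ inc (suc zero) _ _ = base≥1 _
      increasing-≥ ρ inc (suc (suc i)) _ i≤n = ≡.subst (_≤ base (ρ (res (+ suc (suc i))))) (ℤ.+-comm (+ suc i) (+ 1))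
        (ℤ.≤-trans (ℤ.+-monoˡ-≤ (+ 1) (increasing-≥ ρ inc (suc i) (s≤s z≤n) (ℕ.<⇒≤ i≤n)))
          (<⇒+1≤ (inc _ _ (≡.subst₂ _<_ (≡.sym (base-res (s≤s z≤n) (ℕ.<⇒≤ i≤n))) (≡.sym (base-res (s≤s z≤n) i≤n))
            (ℤ.+<+ ℕ.≤-refl)))))

      increasing-≥′ : ∀ ρ → Increasing ρ → ∀ v → base v ≤ base (ρ v)
      increasing-≥′ ρ inc v with base-∈ v
      ... | i , 1≤i , i≤n , e , p = ≡.subst₂ _≤_ (≡.sym e) (≡.cong (base ∘ ρ) (≡.sym p)) (increasing-≥ ρ inc i 1≤i i≤n)

      relative-increasing : ∀ {w w′} d → Sorted w → Sorted w′ → (∀ v → windowʷ w v ≡ windowʷ w′ v + d) →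
                            Increasing (λ p → finite w′ ⟨$⟩ˡ (finite w ⟨$⟩ʳ p))
      relative-increasing {w} {w′} d sw sw′ e p q p<q = by (ℤ.<-cmp (base p′) (base q′))
        where
        x = finite w ⟨$⟩ʳ p
        y = finite w ⟨$⟩ʳ q
        p′ = finite w′ ⟨$⟩ˡ x
        q′ = finite w′ ⟨$⟩ˡ y
        x<y : windowʷ w′ x < windowʷ w′ y
        x<y = from₁ (≡.subst₂ _<_ (e x) (e y) (sw p q p<q))
          (solve 3 (λ x y d → y :- x := y :+ d :- (x :+ d)) ≡.refl (windowʷ w′ x) (windowʷ w′ y) d)
        by : _ → base p′ < base q′
        by (tri< p _ _) = p
        by (tri≈ _ p _) = contradiction (≡.subst (λ z → windowʷ w′ z < windowʷ w′ y)
          (≡.trans (≡.sym (Perm.inverseʳ (finite w′))) (≡.trans (≡.cong (finite w′ ⟨$⟩ʳ_) (base-injective p)) (Perm.inverseʳ (finite w′)))) x<y)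
          (ℤ.<-irrefl ≡.refl)
        by (tri> _ _ p) = contradiction x<y (ℤ.<-asym (≡.subst₂ (λ a b → windowʷ w′ a < windowʷ w′ b)
          (Perm.inverseʳ (finite w′)) (Perm.inverseʳ (finite w′)) (sw′ q′ p′ p)))

    -- The finite parts differ by a permutation of {1, ..., n} that is increasing, and so is its
    -- inverse. An increasing map of {1, ..., n} to itself is nowhere below the identity; applied to
    -- both, this leaves only the identity.
    sorted-unique : ∀ {w w′} → Sorted w → Sorted w′ → w ≈ᶜ w′ → finite w Perm.≈ finite w′
    sorted-unique {w} {w′} sw sw′ e p = ≡.trans (≡.sym (Perm.inverseʳ (finite w′)))
      (≡.cong (finite w′ ⟨$⟩ʳ_) (base-injective (ℤ.≤-antisym
        (≡.subst (base (ρ p) ≤_) (≡.cong base back) (increasing-≥′ ρ⁻¹ (relative-increasing {w′} {w} _ sw′ sw (proj₂ (≈ᶜ⇒window {w′} {w} (≡.sym ∘ e)))) (ρ p)))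
        (increasing-≥′ ρ (relative-increasing {w} {w′} _ sw sw′ (proj₂ (≈ᶜ⇒window {w} {w′} e))) p))))
      where
      ρ ρ⁻¹ : Fin n → Fin n
      ρ p = finite w′ ⟨$⟩ˡ (finite w ⟨$⟩ʳ p)
      ρ⁻¹ p = finite w ⟨$⟩ˡ (finite w′ ⟨$⟩ʳ p)
      back : ρ⁻¹ (ρ p) ≡ p
      back = ≡.trans (≡.cong (finite w ⟨$⟩ˡ_) (Perm.inverseʳ (finite w′))) (Perm.inverseˡ (finite w))

    private
      trivialAction : NilCoxeterAction (≡.setoid ⊤)
      trivialAction = record
        { A = λ _ _ → tt ; x₀ = tt ; 0ₓ = tt
        ; A-cong = λ _ _ → ≡.refl ; A-comm = λ _ _ _ _ → ≡.refl ; A-braid = λ _ _ _ → ≡.refl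
        ; A-square = λ _ _ → ≡.refl ; A-0 = λ _ → ≡.refl ; A-base = λ _ _ → ≡.refl }

      module L = Operators (≡.setoid ⊤) trivialAction

      ends : ∀ r ms r′ ms′ → value (r , ms) ≈ᶜ value (r′ , ms′) →
             ∃[ d ] (∀ v → end (map res ms) v ≡ end (map res ms′) (rotate (+ r - + r′) v) + d)
      ends r ms r′ ms′ e = + r′ + d - + r , λ v → begin
        E v                                                 ≡⟨ solve 2 (λ x r → x := x :+ r :- r) ≡.refl (E v) (+ r) ⟩
        E v + + r - + r                                     ≡⟨ ≡.cong (_- + r) (at r ms v) ⟨
        windowʷ (value (r , ms)) (rotate (+ r) v) - + r     ≡⟨ ≡.cong (_- + r) (p (rotate (+ r) v)) ⟩
        windowʷ (value (r′ , ms′)) (rotate (+ r) v) + d - + r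
          ≡⟨ ≡.cong (λ u → windowʷ (value (r′ , ms′)) u + d - + r) (≡.sym (≡.trans (rotate-rotate (+ r′) (+ r - + r′) v)
               (≡.cong (λ k → rotate k v) (solve 2 (λ r r′ → r :- r′ :+ r′ := r) ≡.refl (+ r) (+ r′))))) ⟩
        windowʷ (value (r′ , ms′)) (rotate (+ r′) (rotate (+ r - + r′) v)) + d - + r
          ≡⟨ ≡.cong (λ x → x + d - + r) (at r′ ms′ (rotate (+ r - + r′) v)) ⟩
        E′ (rotate (+ r - + r′) v) + + r′ + d - + r
          ≡⟨ solve 4 (λ x r′ d r → x :+ r′ :+ d :- r := x :+ (r′ :+ d :- r)) ≡.refl (E′ (rotate (+ r - + r′) v)) (+ r′) d (+ r) ⟩
        E′ (rotate (+ r - + r′) v) + (+ r′ + d - + r)       ∎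
        where
        open ≡.≡-Reasoning
        E = end (map res ms)
        E′ = end (map res ms′)
        d = proj₁ (≈ᶜ⇒window {value (r , ms)} {value (r′ , ms′)} e)
        p : ∀ v → windowʷ (value (r , ms)) v ≡ windowʷ (value (r′ , ms′)) v + d
        p = proj₂ (≈ᶜ⇒window {value (r , ms)} {value (r′ , ms′)} e)
        at : ∀ r ms v → windowʷ (value (r , ms)) (rotate (+ r) v) ≡ end (map res ms) v + + r
        at r ms v = ≡.trans (window-τ^ r (word ms) v) (≡.cong (_+ + r) (window-word ms v))

    -- Membership in W_e⁰ asks for a strict inequality of lengths. Therefore the second component
    -- treats the case of equality: an expression that is not strictly longer must climb as well.
    same-coset-lengths : ∀ r ms r′ ms′ → Up (map res ms) → value (r , ms) ≈ᶜ value (r′ , ms′) →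
      length ms ℕ.≤ length ms′ × (Up (map res ms′) ⊎ length ms ℕ.< length ms′)
    same-coset-lengths r ms r′ ms′ up e = by (L.up-or-shorter (map res ms′))
      where
      k = + r - + r′
      d = proj₁ (ends r ms r′ ms′ e)
      p : ∀ v → end (map res ms) v ≡ end (map res ms′) (rotate k v) + d
      p = proj₂ (ends r ms r′ ms′ e)

      unique : ∀ us → Up us → (∀ v → end (map res ms) v ≡ end us (rotate k v) + d) → length ms ≡ length us
      unique us up′ q = ≡.trans (≡.sym (List.length-map res ms))
        (L.length-unique (rotate k) (rotate (ℤ.- k)) d (rotate-inverse′ k) (rotate-injective k) (rotate-nxt k)
          (map res ms) us up up′ q)

      by : _ → length ms ℕ.≤ length ms′ × (Up (map res ms′) ⊎ length ms ℕ.< length ms′)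
      by (inj₁ up′) = ℕ.≤-reflexive (≡.trans (unique (map res ms′) up′ p) (List.length-map res ms′)) , inj₁ up′
      by (inj₂ (us , up′ , e′ , l)) = ℕ.<⇒≤ shorter , inj₂ shorter
        where
        shorter : length ms ℕ.< length ms′
        shorter = ≡.subst₂ ℕ._<_ (≡.sym (unique us up′ λ v → ≡.trans (p v) (≡.cong (_+ d) (≡.sym (e′ (rotate k v))))))
          (List.length-map res ms′) l

    up⇒reduced : ∀ r ms → Up (map res ms) → Reduced (r , ms)
    up⇒reduced r ms up (r′ , ms′) (e , _) = proj₁ (same-coset-lengths r ms r′ ms′ up (≡.sym ∘ e))

    ·fromW-≈ᶜ : ∀ w v → w · fromW v ≈ᶜ w
    ·fromW-≈ᶜ w v = window⇒≈ᶜ {w · fromW v} {w} (+ 0) λ x →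
      ≡.trans (≡.cong (λ y → base x + + n * y) (ℤ.+-identityʳ (translation w x))) (≡.sym (ℤ.+-identityʳ _))

    -- As `w · fromW v` lies in the coset of w, an expression of it is longer than `ms` unless it
    -- climbs too. In that case both elements are sorted, `sorted-unique` gives them the same finite
    -- part, and v is the identity.
    up⇒W⁰ : ∀ r ms → Up (map res ms) → W⁰ (value (r , ms))
    up⇒W⁰ r ms up v v≉id {l} {m} ((r₁ , ms₁) , (e₁ , f₁) , red₁ , len₁) ((r₂ , ms₂) , (e₂ , f₂) , red₂ , len₂) =
      by (same-coset-lengths r ms r₂ ms₂ up same-coset)
      where
      w = value (r , ms)
      w₂ = value (r₂ , ms₂)

      same-coset : w ≈ᶜ w₂
      same-coset x = ≡.sym (≡.trans (e₂ x) (·fromW-≈ᶜ w v x))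

      l≤ : l ℕ.≤ length ms
      l≤ = ≡.subst (ℕ._≤ length ms) len₁ (red₁ (r , ms) ((λ x → ≡.sym (e₁ x)) , λ x → ≡.sym (f₁ x)))

      by : length ms ℕ.≤ length ms₂ × (Up (map res ms₂) ⊎ length ms ℕ.< length ms₂) → l ℕ.< m
      by (_ , inj₂ lt) = ℕ.≤-trans (s≤s l≤) (≡.subst (length ms ℕ.<_) len₂ lt)
      by (_ , inj₁ up₂) = contradiction acts-trivially v≉id
        where
        fixed-by : ∀ x → finite w ⟨$⟩ʳ (v ⟨$⟩ʳ x) ≡ finite w ⟨$⟩ʳ x
        fixed-by x = ≡.trans (≡.sym (f₂ x))
          (≡.sym (sorted-unique {w} {w₂} (sorted-value r ms up) (sorted-value r₂ ms₂ up₂) same-coset x))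
        acts-trivially : ∀ x → v ⟨$⟩ʳ x ≡ x
        acts-trivially x = ≡.trans (≡.sym (Perm.inverseˡ (finite w)))
          (≡.trans (≡.cong (finite w ⟨$⟩ˡ_) (fixed-by x)) (Perm.inverseˡ (finite w)))

  -- The twisted group algebra acting on functions on cosets

  module TwistedAlgebra where
    open Setting ℝ n 2≤n hiding (u; z)
    open Residues
    open WeylGroup
    open Lengths

    module S = CommutativeRing S
    module T = RawRing twistedRing

    𝔽 : CommutativeRing _ _
    𝔽 = Fractions.fractions S

    module 𝔽 = CommutativeRing 𝔽
    open Fractions S using (wrap; unwrap)

    infix 4 _≋ᵗ_

    _≋ᵗ_ : Twisted → Twisted → Set _
    x ≋ᵗ y = ∀ w → coefficient x w 𝔽.≈ coefficient y w

    ≋ᵗ⇒≈ᵗ : ∀ {x y} → x ≋ᵗ y → x ≈ᵗ y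
    ≋ᵗ⇒≈ᵗ e w = unwrap (e w)

    ≈ᵗ⇒≋ᵗ : ∀ {x y} → x ≈ᵗ y → x ≋ᵗ y
    ≈ᵗ⇒≋ᵗ e w = wrap (e w)

    open FormalSums 𝔽 Wₑ public

    act : Wₑ → 𝔽.Carrier → 𝔽.Carrier
    act v = actF (finite v)

    permute-≗ : ∀ (π ρ : Permutation′ n) → π Perm.≈ ρ → ∀ p → permute π p ≡ permute ρ p
    permute-≗ π ρ e (con k) = ≡.refl
    permute-≗ π ρ e (var v) = ≡.cong var (e v)
    permute-≗ π ρ e (p ⊕ q) = ≡.cong₂ _⊕_ (permute-≗ π ρ e p) (permute-≗ π ρ e q)
    permute-≗ π ρ e (p ⊗ q) = ≡.cong₂ _⊗_ (permute-≗ π ρ e p) (permute-≗ π ρ e q)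
    permute-≗ π ρ e (⊖ p)   = ≡.cong ⊖_ (permute-≗ π ρ e p)

    permute-id : ∀ p → permute Perm.id p ≡ p
    permute-id (con k) = ≡.refl
    permute-id (var v) = ≡.refl
    permute-id (p ⊕ q) = ≡.cong₂ _⊕_ (permute-id p) (permute-id q)
    permute-id (p ⊗ q) = ≡.cong₂ _⊗_ (permute-id p) (permute-id q)
    permute-id (⊖ p)   = ≡.cong ⊖_ (permute-id p)

    permute-∘ : ∀ π ρ p → permute (ρ ∘ₚ π) p ≡ permute π (permute ρ p)
    permute-∘ π ρ (con k) = ≡.refl
    permute-∘ π ρ (var v) = ≡.refl
    permute-∘ π ρ (p ⊕ q) = ≡.cong₂ _⊕_ (permute-∘ π ρ p) (permute-∘ π ρ q)
    permute-∘ π ρ (p ⊗ q) = ≡.cong₂ _⊗_ (permute-∘ π ρ p) (permute-∘ π ρ q)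
    permute-∘ π ρ (⊖ p)   = ≡.cong ⊖_ (permute-∘ π ρ p)

    open FractionField S using (num; den)

    frac-≡ : ∀ {p q : 𝔽.Carrier} → num p ≡ num q → den p ≡ den q → p 𝔽.≈ q
    frac-≡ e f = wrap (S.*-cong (S.reflexive e) (S.reflexive (≡.sym f)))

    actF-cong : ∀ π {p q} → p 𝔽.≈ q → actF π p 𝔽.≈ actF π q
    actF-cong π (wrap e) = wrap (permute-cong π e)

    actF-≗ : ∀ (π ρ : Permutation′ n) → π Perm.≈ ρ → ∀ p → actF π p 𝔽.≈ actF ρ p
    actF-≗ π ρ e p = frac-≡ {actF π p} {actF ρ p} (permute-≗ π ρ e (num p)) (permute-≗ π ρ e (den p))

    actF-id : ∀ p → actF Perm.id p 𝔽.≈ p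
    actF-id p = frac-≡ {actF Perm.id p} {p} (permute-id (num p)) (permute-id (den p))

    actF-∘ : ∀ π ρ p → actF (ρ ∘ₚ π) p 𝔽.≈ actF π (actF ρ p)
    actF-∘ π ρ p = frac-≡ {actF (ρ ∘ₚ π) p} {actF π (actF ρ p)} (permute-∘ π ρ (num p)) (permute-∘ π ρ (den p))

    actF-+ : ∀ π p q → actF π (p 𝔽.+ q) 𝔽.≈ actF π p 𝔽.+ actF π q
    actF-+ π p q = frac-≡ {actF π (p 𝔽.+ q)} {actF π p 𝔽.+ actF π q} ≡.refl ≡.refl

    actF-* : ∀ π p q → actF π (p 𝔽.* q) 𝔽.≈ actF π p 𝔽.* actF π q
    actF-* π p q = frac-≡ {actF π (p 𝔽.* q)} {actF π p 𝔽.* actF π q} ≡.refl ≡.refl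

    actF-- : ∀ π p q → actF π (p 𝔽.- q) 𝔽.≈ actF π p 𝔽.- actF π q
    actF-- π p q = frac-≡ {actF π (p 𝔽.- q)} {actF π p 𝔽.- actF π q} ≡.refl ≡.refl

    actF-0 : ∀ π → actF π 𝔽.0# 𝔽.≈ 𝔽.0#
    actF-0 π = frac-≡ {actF π 𝔽.0#} {𝔽.0#} ≡.refl ≡.refl

    actF-1 : ∀ π → actF π 𝔽.1# 𝔽.≈ 𝔽.1#
    actF-1 π = frac-≡ {actF π 𝔽.1#} {𝔽.1#} ≡.refl ≡.refl

    -- The formula is (t_l π)⁻¹ = t_{l′} π⁻¹ with l′ = -π⁻¹ l.
    inv : Wₑ → Wₑ
    inv (t[ l ] π) = t[ (λ v → ℤ.- l (π ⟨$⟩ʳ v)) ] Perm.flip π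

    _≟ᶜ_ : ∀ w w′ → Dec (w ≈ᶜ w′)
    w ≟ᶜ w′ = Fin.all? (λ v → coordinates (translation w) v ℤ.≟ coordinates (translation w′) v)

    ≈ᶜ-refl : ∀ {w} → w ≈ᶜ w
    ≈ᶜ-refl v = ≡.refl

    ≈ᶜ-sym : ∀ {w w′} → w ≈ᶜ w′ → w′ ≈ᶜ w
    ≈ᶜ-sym e v = ≡.sym (e v)

    ≈ᶜ-trans : ∀ {w w′ w″} → w ≈ᶜ w′ → w′ ≈ᶜ w″ → w ≈ᶜ w″
    ≈ᶜ-trans e f v = ≡.trans (e v) (f v)

    ≈ʷ-refl : ∀ {w} → w ≈ʷ w
    ≈ʷ-refl = (λ _ → ≡.refl) , λ _ → ≡.refl

    ≈ʷ-sym : ∀ {w w′} → w ≈ʷ w′ → w′ ≈ʷ w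
    ≈ʷ-sym (e , f) = (λ v → ≡.sym (e v)) , λ v → ≡.sym (f v)

    ≈ʷ-trans : ∀ {w w′ w″} → w ≈ʷ w′ → w′ ≈ʷ w″ → w ≈ʷ w″
    ≈ʷ-trans (e , f) (e′ , f′) = (λ v → ≡.trans (e v) (e′ v)) , λ v → ≡.trans (f v) (f′ v)

    open IntegerOrder

    private
      ≈ᶜ⇒scaled : ∀ {w w′} → w ≈ᶜ w′ →
                  ∃[ d ] (∀ v → + n ℤ.* translation w v ≡ + n ℤ.* translation w′ v ℤ.+ d)
      ≈ᶜ⇒scaled {w} {w′} e = proj₁ f , λ v → ≡.trans
        (solve 2 (λ b x → x := b :+ x :- b) ≡.refl (base v) (+ n ℤ.* translation w v))
        (≡.trans (≡.cong (ℤ._- base v) (proj₂ f v))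
        (solve 3 (λ b x d → b :+ x :+ d :- b := x :+ d) ≡.refl (base v) (+ n ℤ.* translation w′ v) (proj₁ f)))
        where f = ≈ᶜ⇒window {w} {w′} e

      scaled⇒≈ᶜ : ∀ {w w′} d → (∀ v → + n ℤ.* translation w v ≡ + n ℤ.* translation w′ v ℤ.+ d) → w ≈ᶜ w′
      scaled⇒≈ᶜ {w} {w′} d e = window⇒≈ᶜ {w} {w′} d λ v →
        ≡.trans (≡.cong (λ x → base v ℤ.+ x) (e v)) (≡.sym (ℤ.+-assoc (base v) _ d))

    infix 4 _~_

    _~_ : Coweight → Coweight → Set
    l ~ l′ = ∀ v → coordinates l v ≡ coordinates l′ v

    -- Equality of coweights is equality modulo (1, ..., 1), which is stable under adding a vector
    -- and, by `~-relabel`, under relabelling coordinates. These two rules reduce later comparisons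
    -- of cosets to pointwise identities.
    ~-shift : ∀ (m : Coweight) {l l′ k k′ : Coweight} → l ~ l′ → (∀ v → k v ≡ l v ℤ.+ m v) → (∀ v → k′ v ≡ l′ v ℤ.+ m v) → k ~ k′
    ~-shift m {l} {l′} {k} {k′} e p q = scaled⇒≈ᶜ {t k} {t k′} (proj₁ f) λ v → begin
      + n ℤ.* k v                                 ≡⟨ ≡.cong (λ x → + n ℤ.* x) (p v) ⟩
      + n ℤ.* (l v ℤ.+ m v)                       ≡⟨ ℤ.*-distribˡ-+ (+ n) (l v) (m v) ⟩
      + n ℤ.* l v ℤ.+ + n ℤ.* m v                 ≡⟨ ≡.cong (λ x → x ℤ.+ + n ℤ.* m v) (proj₂ f v) ⟩
      + n ℤ.* l′ v ℤ.+ proj₁ f ℤ.+ + n ℤ.* m v    ≡⟨ solve 4 (λ n x d y → n :* x :+ d :+ n :* y := n :* (x :+ y) :+ d) ≡.refl (+ n) (l′ v) (proj₁ f) (m v) ⟩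
      + n ℤ.* (l′ v ℤ.+ m v) ℤ.+ proj₁ f          ≡⟨ ≡.cong (λ x → + n ℤ.* x ℤ.+ proj₁ f) (q v) ⟨
      + n ℤ.* k′ v ℤ.+ proj₁ f                    ∎
      where
      open ≡.≡-Reasoning
      f = ≈ᶜ⇒scaled {t l} {t l′} e

    ~-relabel : ∀ (f : Fin n → Fin n) {l l′ k k′ : Coweight} → l ~ l′ →
                (∀ v → k v ≡ l (f v)) → (∀ v → k′ v ≡ l′ (f v)) → k ~ k′
    ~-relabel f {l} {l′} {k} {k′} e p q = scaled⇒≈ᶜ {t k} {t k′} (proj₁ d) λ v →
      ≡.trans (≡.cong (λ x → + n ℤ.* x) (p v)) (≡.trans (proj₂ d (f v)) (≡.cong (λ x → + n ℤ.* x ℤ.+ proj₁ d) (≡.sym (q v))))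
      where d = ≈ᶜ⇒scaled {t l} {t l′} e

    ≗⇒~ : ∀ {l l′ : Coweight} → l ≗ l′ → l ~ l′
    ≗⇒~ {l} {l′} e = window⇒≈ᶜ {t l} {t l′} (+ 0) λ v →
      ≡.trans (≡.cong (λ x → base v ℤ.+ + n ℤ.* x) (e v)) (≡.sym (ℤ.+-identityʳ _))

    ≗⇒≈ʷ : ∀ {w w′} → translation w ≗ translation w′ → finite w Perm.≈ finite w′ → w ≈ʷ w′
    ≗⇒≈ʷ {w} {w′} e f = ≗⇒~ e , f

    shiftᶜ : ∀ v u w → (v · u) ≈ᶜ w ⇔ u ≈ᶜ (inv v · w)
    shiftᶜ v u w = mk⇔
      (λ e → let d , f = ≈ᶜ⇒scaled {v · u} {w} e in scaled⇒≈ᶜ {u} {inv v · w} d λ x → begin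
        N ℤ.* m x
          ≡⟨ solve 3 (λ n a b → n :* a := n :* (b :+ a) :+ n :* :- b) ≡.refl N (m x) (l (π x)) ⟩
        N ℤ.* (l (π x) ℤ.+ m x) ℤ.+ N ℤ.* (ℤ.- l (π x))
          ≡⟨ ≡.cong (λ y → N ℤ.* (l (π x) ℤ.+ m y) ℤ.+ N ℤ.* (ℤ.- l (π x))) (Perm.inverseˡ (finite v)) ⟨
        N ℤ.* (l (π x) ℤ.+ m (finite v ⟨$⟩ˡ π x)) ℤ.+ N ℤ.* (ℤ.- l (π x))
          ≡⟨ ≡.cong (ℤ._+ N ℤ.* (ℤ.- l (π x))) (f (π x)) ⟩
        N ℤ.* k (π x) ℤ.+ d ℤ.+ N ℤ.* (ℤ.- l (π x))
          ≡⟨ solve 4 (λ n a d b → n :* a :+ d :+ n :* :- b := n :* (:- b :+ a) :+ d) ≡.refl N (k (π x)) d (l (π x)) ⟩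
        N ℤ.* (ℤ.- l (π x) ℤ.+ k (π x)) ℤ.+ d ∎)
      (λ e → let d , f = ≈ᶜ⇒scaled {u} {inv v · w} e in scaled⇒≈ᶜ {v · u} {w} d λ y → begin
        N ℤ.* (l y ℤ.+ m (π⁻¹ y))
          ≡⟨ solve 3 (λ n a b → n :* (a :+ b) := n :* a :+ n :* b) ≡.refl N (l y) (m (π⁻¹ y)) ⟩
        N ℤ.* l y ℤ.+ N ℤ.* m (π⁻¹ y)
          ≡⟨ ≡.cong (λ z → N ℤ.* l y ℤ.+ z) (f (π⁻¹ y)) ⟩
        N ℤ.* l y ℤ.+ (N ℤ.* (ℤ.- l (π (π⁻¹ y)) ℤ.+ k (π (π⁻¹ y))) ℤ.+ d)
          ≡⟨ ≡.cong (λ z → N ℤ.* l y ℤ.+ (N ℤ.* (ℤ.- l z ℤ.+ k z) ℤ.+ d)) (Perm.inverseʳ (finite v)) ⟩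
        N ℤ.* l y ℤ.+ (N ℤ.* (ℤ.- l y ℤ.+ k y) ℤ.+ d)
          ≡⟨ solve 4 (λ n a b d → n :* a :+ (n :* (:- a :+ b) :+ d) := n :* b :+ d) ≡.refl N (l y) (k y) d ⟩
        N ℤ.* k y ℤ.+ d ∎)
      where
      open ≡.≡-Reasoning
      N = + n
      l = translation v
      m = translation u
      k = translation w
      π = finite v ⟨$⟩ʳ_
      π⁻¹ = finite v ⟨$⟩ˡ_

    shiftʷ : ∀ v u w → (v · u) ≈ʷ w ⇔ u ≈ʷ (inv v · w)
    shiftʷ v u w = mk⇔
      (λ (e , f) → Equivalence.to (shiftᶜ v u w) e , λ x →
        ≡.trans (≡.sym (Perm.inverseˡ (finite v))) (≡.cong (finite v ⟨$⟩ˡ_) (f x)))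
      (λ (e , f) → Equivalence.from (shiftᶜ v u w) e , λ x →
        ≡.trans (≡.cong (finite v ⟨$⟩ʳ_) (f x)) (Perm.inverseʳ (finite v)))

    ·-congˡᶜ : ∀ v {u w} → u ≈ᶜ w → v · u ≈ᶜ v · w
    ·-congˡᶜ v {u} {w} e = let d , f = ≈ᶜ⇒scaled {u} {w} e in scaled⇒≈ᶜ {v · u} {v · w} d λ x → ≡.trans
      (ℤ.*-distribˡ-+ (+ n) (translation v x) _) (≡.trans (≡.cong (λ y → + n ℤ.* translation v x ℤ.+ y) (f _))
      (solve 4 (λ n a b d → n :* a :+ (n :* b :+ d) := n :* (a :+ b) :+ d) ≡.refl (+ n) (translation v x) (translation w (finite v ⟨$⟩ˡ x)) d))

    inv-congʷ : ∀ {v v′} w → v ≈ʷ v′ → inv v · w ≈ʷ inv v′ · w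
    inv-congʷ {v} {v′} w (e , f) =
      (let d , g = ≈ᶜ⇒scaled {v} {v′} e in scaled⇒≈ᶜ {inv v · w} {inv v′ · w} (ℤ.- d) λ x → begin
        N ℤ.* (ℤ.- l (π x) ℤ.+ k (π x))
          ≡⟨ solve 3 (λ n a b → n :* (:- a :+ b) := :- (n :* a) :+ n :* b) ≡.refl N (l (π x)) (k (π x)) ⟩
        ℤ.- (N ℤ.* l (π x)) ℤ.+ N ℤ.* k (π x)
          ≡⟨ ≡.cong (λ y → ℤ.- y ℤ.+ N ℤ.* k (π x)) (g (π x)) ⟩
        ℤ.- (N ℤ.* l′ (π x) ℤ.+ d) ℤ.+ N ℤ.* k (π x)
          ≡⟨ ≡.cong (λ y → ℤ.- (N ℤ.* l′ y ℤ.+ d) ℤ.+ N ℤ.* k y) (f x) ⟩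
        ℤ.- (N ℤ.* l′ (π′ x) ℤ.+ d) ℤ.+ N ℤ.* k (π′ x)
          ≡⟨ solve 4 (λ n a b d → :- (n :* a :+ d) :+ n :* b := n :* (:- a :+ b) :+ :- d) ≡.refl N (l′ (π′ x)) (k (π′ x)) d ⟩
        N ℤ.* (ℤ.- l′ (π′ x) ℤ.+ k (π′ x)) ℤ.+ ℤ.- d ∎) ,
      λ x → ≡.trans (≡.cong (finite v ⟨$⟩ˡ_) (≡.trans (≡.sym (Perm.inverseʳ (finite v′))) (≡.sym (f _))))
        (Perm.inverseˡ (finite v))
      where
      open ≡.≡-Reasoning
      N = + n
      l = translation v
      l′ = translation v′
      k = translation w
      π = finite v ⟨$⟩ʳ_
      π′ = finite v′ ⟨$⟩ʳ_

    open Product _·_ inv act (λ v → actF-cong (finite v)) (λ v → actF-+ (finite v)) (λ v → actF-0 (finite v)) public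

    -- `ε x w` is the sum of the coefficients of x over the coset w W. As a function of w it is the
    -- result of x acting on δ.
    open Coefficients _≟ᶜ_ public using () renaming (coeff to ε; coeff-++ to ε-++; coeff-total to ε-total; coeff-negate to ε-negate)
    open Extensionality _≟ʷ_ (λ {w} → ≈ʷ-refl {w}) (λ {v} {w} → ≈ʷ-sym {v} {w}) (λ {u} {v} {w} → ≈ʷ-trans {u} {v} {w}) public
      using (total-ext; total-vanishes) renaming (coeff-cong to coefficient-cong)
    open Extensionality _≟ᶜ_ (λ {w} → ≈ᶜ-refl {w}) (λ {v} {w} → ≈ᶜ-sym {v} {w}) (λ {u} {v} {w} → ≈ᶜ-trans {u} {v} {w}) public
      using () renaming (coeff-cong to ε-cong)

    Invariantʷ Invariantᶜ : (Wₑ → 𝔽.Carrier) → Set _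
    Invariantʷ κ = ∀ w w′ → w ≈ʷ w′ → κ w 𝔽.≈ κ w′
    Invariantᶜ κ = ∀ w w′ → w ≈ᶜ w′ → κ w 𝔽.≈ κ w′

    coefficient-* : ∀ x y w → coefficient (x T.* y) w 𝔽.≈ (x ▷ coefficient y) w
    coefficient-* = CoefficientsOfProduct.coeff-multiply _≟ʷ_ shiftʷ

    ε-* : ∀ x y w → ε (x T.* y) w 𝔽.≈ (x ▷ ε y) w
    ε-* = CoefficientsOfProduct.coeff-multiply _≟ᶜ_ shiftᶜ

    apply-cong : ∀ {κ} → Invariantʷ κ → ∀ w {v v′} → v ≈ʷ v′ → apply v κ w 𝔽.≈ apply v′ κ w
    apply-cong {κ} κ-inv w {v} {v′} e = 𝔽.trans (actF-cong (finite v) (κ-inv (inv v · w) (inv v′ · w) (inv-congʷ {v} {v′} w e)))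
      (actF-≗ (finite v) (finite v′) (proj₂ e) (κ (inv v′ · w)))

    ▷-congˡ : ∀ {x y κ} → Invariantʷ κ → x ≋ᵗ y → ∀ w → (x ▷ κ) w 𝔽.≈ (y ▷ κ) w
    ▷-congˡ {x} {y} {κ} κ-inv e w = total-ext x y (λ v → apply v κ w) (λ {v} {v′} → apply-cong {κ} κ-inv w {v} {v′}) e

    coefficient-invariant : ∀ x → Invariantʷ (coefficient x)
    coefficient-invariant x w w′ = coefficient-cong x {w} {w′}

    ε-invariant : ∀ x → Invariantᶜ (ε x)
    ε-invariant x w w′ = ε-cong x {w} {w′}

    *-congᵗ : ∀ {x x′ y y′} → x ≋ᵗ x′ → y ≋ᵗ y′ → x T.* y ≋ᵗ x′ T.* y′
    *-congᵗ {x} {x′} {y} {y′} e f w = 𝔽.trans (coefficient-* x y w)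
      (𝔽.trans (▷-congˡ {x} {x′} {coefficient y} (coefficient-invariant y) e w)
      (𝔽.trans (▷-congʳ x′ f w) (𝔽.sym (coefficient-* x′ y′ w))))

    ε-≋ᵗ : ∀ {x y} → x ≋ᵗ y → ∀ w → ε x w 𝔽.≈ ε y w
    ε-≋ᵗ {x} {y} e w = 𝔽.trans (ε-total x w) (𝔽.trans
      (total-ext x y _ (λ {v} {v′} f → indicator-cong {v} {v′} (proj₁ f)) e) (𝔽.sym (ε-total y w)))
      where
      indicator-cong : ∀ {v v′} → v ≈ᶜ v′ → indicator (does (v ≟ᶜ w)) 𝔽.≈ indicator (does (v′ ≟ᶜ w))
      indicator-cong {v} {v′} f = 𝔽.reflexive (≡.cong indicator (does-⇔
        (mk⇔ (λ p x → ≡.trans (≡.sym (f x)) (p x)) (λ p x → ≡.trans (f x) (p x))) (v ≟ᶜ w) (v′ ≟ᶜ w)))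

  -- Divided difference operators on functions on cosets

  module PetersonOperators where
    open Setting ℝ n 2≤n hiding (u; z; A; a)
    open Setting ℝ n 2≤n using () renaming (A to Aᵉ)
    open Residues
    open WeylGroup
    open Lengths
    open TwistedAlgebra
    open FractionField S using (frac; den; Regular; Frac)
    open InverseDifferences S
    open DividedDifferences 𝔽 Wₑ
    open SetoidReasoning 𝔽.setoid

    cancel-window : ∀ v w → windowʷ (v · (inv v · w)) ≗ windowʷ w
    cancel-window v w x = ≡.cong (λ y → base x ℤ.+ + n ℤ.* y) (≡.trans
      (≡.cong (λ y → translation v x ℤ.+ (ℤ.- translation v y ℤ.+ translation w y)) (Perm.inverseʳ (finite v)))
      (solve 2 (λ a b → a :+ (:- a :+ b) := b) ≡.refl (translation v x) (translation w x)))
      where open IntegerOrder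

    window-inv-s : ∀ m w → windowʷ (inv (s m) · w) ≗ op (res m) (windowʷ w)
    window-inv-s m w v = ≡.trans (≡.sym (op-involutive (res m) (windowʷ (inv (s m) · w)) v))
      (op-cong (res m) (λ x → ≡.trans (≡.sym (window-s m (inv (s m) · w) x)) (cancel-window (s m) w x)) v)

    invariant-window : ∀ {κ : Wₑ → 𝔽.Carrier} → Invariantᶜ κ → ∀ w w′ → windowʷ w ≗ windowʷ w′ → κ w 𝔽.≈ κ w′
    invariant-window {κ} inv w w′ e = inv w w′ (window⇒≈ᶜ {w} {w′} (+ 0) λ v → ≡.trans (e v) (≡.sym (ℤ.+-identityʳ _)))

    α-regularᵤ : ∀ u → Regular (var u S.- var (nxt u))
    α-regularᵤ u = ≡.subst (λ v → Regular (var v S.- var (nxt u))) (res-toℕ u) (α-regular (+ toℕ u))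

    1/α : Fin n → 𝔽.Carrier
    1/α u = frac S.1# (var u S.- var (nxt u)) (α-regularᵤ u)

    swap : Fin n → Permutation′ n
    swap u = Perm.transpose u (nxt u)

    -- The action on functions calls for the inverse of s_u. Its effect on windows is again `op u`,
    -- because `op u` is an involution.
    reflect : Fin n → Wₑ → Wₑ
    reflect u w = inv (s (+ toℕ u)) · w

    window-reflect : ∀ u w → windowʷ (reflect u w) ≗ op u (windowʷ w)
    window-reflect u w v = ≡.trans (window-inv-s (+ toℕ u) w v) (≡.cong (λ u → op u (windowʷ w) v) (res-toℕ u))

    endomorphism : Permutation′ n → Endomorphism
    endomorphism π = record
      { fun = actF π
      ; cong = actF-cong π
      ; homo-* = actF-* π
      ; homo-- = actF-- π
      }

    -- The operator κ ↦ α_u⁻¹ (s_u κ - κ), by which A_u acts on functions on W_e / W.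
    A : Fin n → (Wₑ → 𝔽.Carrier) → Wₑ → 𝔽.Carrier
    A u = difference (1/α u) (actF (swap u)) (reflect u)

    A-congF : ∀ u {κ κ′ : Wₑ → 𝔽.Carrier} → (∀ w → κ w 𝔽.≈ κ′ w) → ∀ w → A u κ w 𝔽.≈ A u κ′ w
    A-congF u {κ} {κ′} e w = difference-cong (1/α u) (actF (swap u)) (reflect u) (actF-cong (swap u)) {κ} {κ′} {w} {w} (e (reflect u w)) (e w)

    A-invariant : ∀ u {κ} → Invariantᶜ κ → Invariantᶜ (A u κ)
    A-invariant u {κ} inv-κ w w′ e = difference-cong (1/α u) (actF (swap u)) (reflect u) (actF-cong (swap u)) {κ} {κ} {w} {w′}
      (inv-κ (reflect u w) (reflect u w′) (·-congˡᶜ (inv (s (+ toℕ u))) {w} {w′} e)) (inv-κ w w′ e)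

    act₂-cong : ∀ π ρ π′ ρ′ → (ρ ∘ₚ π) Perm.≈ (ρ′ ∘ₚ π′) → ∀ p q → p 𝔽.≈ q →
                actF π (actF ρ p) 𝔽.≈ actF π′ (actF ρ′ q)
    act₂-cong π ρ π′ ρ′ e p q p≈q = begin
      actF π (actF ρ p)     ≈⟨ actF-∘ π ρ p ⟨
      actF (ρ ∘ₚ π) p       ≈⟨ actF-≗ (ρ ∘ₚ π) (ρ′ ∘ₚ π′) e p ⟩
      actF (ρ′ ∘ₚ π′) p     ≈⟨ actF-∘ π′ ρ′ p ⟩
      actF π′ (actF ρ′ p)   ≈⟨ actF-cong π′ {actF ρ′ p} {actF ρ′ q} (actF-cong ρ′ {p} {q} p≈q) ⟩
      actF π′ (actF ρ′ q)   ∎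

    private
      swap-≡ : ∀ (π : Permutation′ n) u {v v′} → π ⟨$⟩ʳ u ≡ v → π ⟨$⟩ʳ nxt u ≡ v′ →
               den (actF π (1/α u)) ≡ var v S.- var v′
      swap-≡ π u e e′ = ≡.cong₂ (λ x y → var x S.- var y) e e′

      act-1/α-swap : ∀ u → actF (swap u) (1/α u) 𝔽.≈ 𝔽.- 1/α u
      act-1/α-swap u = 𝔽.trans (frac-≡ {actF (swap u) (1/α u)} {frac S.1# (var (nxt u) S.- var u) regular} ≡.refl d≡)
        (inverse-swap (var u) (var (nxt u)) (α-regularᵤ u) regular)
        where
        d≡ : den (actF (swap u) (1/α u)) ≡ var (nxt u) S.- var u
        d≡ = swap-≡ (swap u) u (transpose-left u (nxt u)) (transpose-right u (nxt u))
        regular : Regular (var (nxt u) S.- var u)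
        regular = ≡.subst Regular d≡ (Frac.regular (actF (swap u) (1/α u)))

      act-swap² : ∀ u p → actF (swap u) (actF (swap u) p) 𝔽.≈ p
      act-swap² u p = 𝔽.trans (𝔽.sym (actF-∘ (swap u) (swap u) p))
        (𝔽.trans (actF-≗ (swap u ∘ₚ swap u) Perm.id (transpose-involutive u (nxt u)) p) (actF-id p))

      act₃-cong : ∀ π ρ σ π′ ρ′ σ′ → (σ ∘ₚ (ρ ∘ₚ π)) Perm.≈ (σ′ ∘ₚ (ρ′ ∘ₚ π′)) → ∀ p q → p 𝔽.≈ q →
                  actF π (actF ρ (actF σ p)) 𝔽.≈ actF π′ (actF ρ′ (actF σ′ q))
      act₃-cong π ρ σ π′ ρ′ σ′ e p q p≈q = begin
        actF π (actF ρ (actF σ p))       ≈⟨ actF-∘ π ρ (actF σ p) ⟨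
        actF (ρ ∘ₚ π) (actF σ p)         ≈⟨ act₂-cong (ρ ∘ₚ π) σ (ρ′ ∘ₚ π′) σ′ e p q p≈q ⟩
        actF (ρ′ ∘ₚ π′) (actF σ′ q)      ≈⟨ actF-∘ π′ ρ′ (actF σ′ q) ⟩
        actF π′ (actF ρ′ (actF σ′ q))    ∎

      reflect² : ∀ u {κ} → Invariantᶜ κ → ∀ w → actF (swap u) (actF (swap u) (κ (reflect u (reflect u w)))) 𝔽.≈ κ w
      reflect² u {κ} inv-κ w = 𝔽.trans (act-swap² u (κ (reflect u (reflect u w)))) (invariant-window {κ} inv-κ (reflect u (reflect u w)) w λ v →
        ≡.trans (window-reflect u (reflect u w) v) (≡.trans (op-cong u (window-reflect u w) v) (op-involutive u (windowʷ w) v)))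

    A-square : ∀ u {κ} → Invariantᶜ κ → ∀ w → A u (A u κ) w 𝔽.≈ 𝔽.0#
    A-square u {κ} inv-κ w = difference-square (1/α u) (1/α u) (1/α u) (endomorphism (swap u)) (endomorphism (swap u))
      (reflect u) (reflect u) κ w (act-1/α-swap u) (reflect² u inv-κ w)

    A-comm : ∀ {u v} → u ≢ v → nxt u ≢ v → nxt v ≢ u → ∀ {κ} → Invariantᶜ κ → ∀ w → A u (A v κ) w 𝔽.≈ A v (A u κ) w
    A-comm {u} {v} u≢v u⁺≢v v⁺≢u {κ} inv-κ w = differences-commute i j i (endomorphism (swap u)) (endomorphism (swap v))
      (reflect u) (reflect v) κ w
      (frac-≡ {actF (swap u) j} {j} ≡.refl
        (swap-≡ (swap u) v (transpose-other u (nxt u) (u≢v ∘ ≡.sym) (u⁺≢v ∘ ≡.sym)) (transpose-other u (nxt u) v⁺≢u (u≢v ∘ ≡.sym ∘ nxt-injective))))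
      (frac-≡ {actF (swap v) i} {i} ≡.refl
        (swap-≡ (swap v) u (transpose-other v (nxt v) u≢v (v⁺≢u ∘ ≡.sym)) (transpose-other v (nxt v) u⁺≢v (u≢v ∘ nxt-injective))))
      commuted
      where
      i = 1/α u
      j = 1/α v
      commuted : actF (swap u) (actF (swap v) (κ (reflect v (reflect u w)))) 𝔽.≈
                 actF (swap v) (actF (swap u) (κ (reflect u (reflect v w))))
      commuted = act₂-cong (swap u) (swap v) (swap v) (swap u)
        (transpose-comm u≢v (v⁺≢u ∘ ≡.sym) u⁺≢v (u≢v ∘ nxt-injective))
        (κ (reflect v (reflect u w))) (κ (reflect u (reflect v w)))
        (invariant-window {κ} inv-κ (reflect v (reflect u w)) (reflect u (reflect v w)) λ x →
          ≡.trans (window-reflect v (reflect u w) x)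
            (≡.trans (op-cong v (window-reflect u w) x) (≡.trans (op-comm (u≢v ∘ ≡.sym) v⁺≢u u⁺≢v (windowʷ w) x)
            (≡.sym (≡.trans (window-reflect u (reflect v w) x) (op-cong u (window-reflect v w) x))))))

    A-braid : ∀ u → nxt (nxt u) ≢ u → ∀ {κ} → Invariantᶜ κ → ∀ w →
              A u (A (nxt u) (A u κ)) w 𝔽.≈ A (nxt u) (A u (A (nxt u) κ)) w
    A-braid u u₃≢u {κ} inv-κ w = differences-braid i j k (endomorphism (swap u)) (endomorphism (swap v))
      (reflect u) (reflect v) κ w (act-1/α-swap u) (act-1/α-swap v) fj gi (act-swap² u j) gk ij
      (reflect² u {κ} inv-κ w) (reflect² v {κ} inv-κ w) braided
      where
      v = nxt u
      u₃ = nxt v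
      i = 1/α u
      j = 1/α v
      -- This is 1/(α_u + α_v). Taking it as the image of 1/α_v under s_u also provides the
      -- regularity of its denominator.
      k = actF (swap u) j
      u≢v : u ≢ v
      u≢v = nxt-≢ u ∘ ≡.sym
      v≢u₃ : v ≢ u₃
      v≢u₃ = nxt-≢ v ∘ ≡.sym
      u≢u₃ : u ≢ u₃
      u≢u₃ = u₃≢u ∘ ≡.sym
      x = actF (swap u) (actF (swap v) (actF (swap u) (κ (reflect u (reflect v (reflect u w))))))
      x′ = actF (swap v) (actF (swap u) (actF (swap v) (κ (reflect v (reflect u (reflect v w))))))

      k-den : den k ≡ var u S.- var u₃
      k-den = swap-≡ (swap u) v (transpose-right u v) (transpose-other u v u₃≢u (nxt-≢ v))

      gi : actF (swap v) i 𝔽.≈ k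
      gi = frac-≡ {actF (swap v) i} {k} ≡.refl
        (≡.trans (swap-≡ (swap v) u (transpose-other v u₃ u≢v u≢u₃) (transpose-left v u₃)) (≡.sym k-den))

      fj : actF (swap u) j 𝔽.≈ k
      fj = 𝔽.refl {k}

      gk : actF (swap v) k 𝔽.≈ i
      gk = 𝔽.trans {actF (swap v) k} {actF (swap v) (actF (swap v) i)} {i}
        (actF-cong (swap v) {k} {actF (swap v) i} (𝔽.sym {actF (swap v) i} {k} gi)) (act-swap² v i)

      u-u₃-regular : Regular (var u S.- var u₃)
      u-u₃-regular = ≡.subst Regular k-den (Frac.regular k)

      ij : i 𝔽.* j 𝔽.≈ k 𝔽.* (i 𝔽.+ j)
      ij = 𝔽.trans (inverse-sum (var u) (var v) (var u₃) (α-regularᵤ u) (α-regularᵤ v) u-u₃-regular)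
        (𝔽.*-congʳ {i 𝔽.+ j} {frac S.1# (var u S.- var u₃) u-u₃-regular} {k}
          (frac-≡ {frac S.1# (var u S.- var u₃) u-u₃-regular} {k} ≡.refl (≡.sym k-den)))

      braided : x 𝔽.≈ x′
      braided = act₃-cong (swap u) (swap v) (swap u) (swap v) (swap u) (swap v) (transpose-braid u≢v v≢u₃ u≢u₃)
        (κ (reflect u (reflect v (reflect u w)))) (κ (reflect v (reflect u (reflect v w))))
        (invariant-window {κ} inv-κ (reflect u (reflect v (reflect u w))) (reflect v (reflect u (reflect v w))) λ t →
          ≡.trans (windows u v u t) (≡.trans (op-braid u u₃≢u (windowʷ w) t) (≡.sym (windows v u v t))))
        where
        windows : ∀ p q r → windowʷ (reflect p (reflect q (reflect r w))) ≗ op p (op q (op r (windowʷ w)))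
        windows p q r t = ≡.trans (window-reflect p (reflect q (reflect r w)) t)
          (op-cong p (λ t → ≡.trans (window-reflect q (reflect r w) t) (op-cong q (window-reflect r w) t)) t)

    A-0F : ∀ u w → A u (λ _ → 𝔽.0#) w 𝔽.≈ 𝔽.0#
    A-0F u w = difference-fixed (1/α u) (actF (swap u)) (reflect u) {λ _ → 𝔽.0#} {w} (actF-0 (swap u))

  -- Coset functions of the Schubert basis

  module SchubertBasis where
    open Setting ℝ n 2≤n hiding (u; z; A; a)
    open Setting ℝ n 2≤n using () renaming (A to Aᵉ)
    open Residues
    open WeylGroup
    open Lengths
    open TwistedAlgebra
    open PetersonOperators
    open FractionField S using (fromRing)
    open DividedDifferences 𝔽 Wₑ
    open SetoidReasoning 𝔽.setoid

    Functions : Setoid _ _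
    Functions = record
      { Carrier = Σ (Wₑ → 𝔽.Carrier) Invariantᶜ
      ; _≈_ = λ (κ , _) (κ′ , _) → ∀ w → κ w 𝔽.≈ κ′ w
      ; isEquivalence = record
        { refl = λ w → 𝔽.refl
        ; sym = λ e w → 𝔽.sym (e w)
        ; trans = λ e f w → 𝔽.trans (e w) (f w)
        }
      }

    δ₀ : Wₑ → 𝔽.Carrier
    δ₀ = ε T.1#

    δ₀-indicator : ∀ w → δ₀ w 𝔽.≈ indicator (does (idʷ ≟ᶜ w))
    δ₀-indicator w = 𝔽.trans (ε-total T.1# w) (𝔽.trans (𝔽.+-identityʳ _) (𝔽.*-identityˡ _))

    act-indicator : ∀ π b → actF π (indicator b) 𝔽.≈ indicator b
    act-indicator π true  = actF-1 π
    act-indicator π false = actF-0 π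

    -- For such u the reflection s_u fixes the coset W, so δ is unchanged by moving its argument;
    -- its values 0 and 1 are fixed by the action on F.
    A-δ₀ : ∀ u → Fixed u base → ∀ w → A u δ₀ w 𝔽.≈ 𝔽.0#
    A-δ₀ u f w = difference-fixed (1/α u) (actF (swap u)) (reflect u) {δ₀} {w} (begin
      actF (swap u) (δ₀ (reflect u w))
        ≈⟨ actF-cong (swap u) (δ₀-indicator (reflect u w)) ⟩
      actF (swap u) (indicator (does (idʷ ≟ᶜ reflect u w)))
        ≈⟨ act-indicator (swap u) (does (idʷ ≟ᶜ reflect u w)) ⟩
      indicator (does (idʷ ≟ᶜ reflect u w))
        ≡⟨ ≡.cong indicator (does-⇔ (mk⇔ (λ e → ≈ᶜ-trans {idʷ} {s (+ toℕ u) · idʷ} {w} (≈ᶜ-sym {s (+ toℕ u) · idʷ} {idʷ} fixes)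
               (Equivalence.from (shiftᶜ (s (+ toℕ u)) idʷ w) e))
             (λ e → Equivalence.to (shiftᶜ (s (+ toℕ u)) idʷ w) (≈ᶜ-trans {s (+ toℕ u) · idʷ} {idʷ} {w} fixes e)))
             (idʷ ≟ᶜ reflect u w) (idʷ ≟ᶜ w)) ⟩
      indicator (does (idʷ ≟ᶜ w))
        ≈⟨ δ₀-indicator w ⟨
      δ₀ w ∎)
      where
      fixes : s (+ toℕ u) · idʷ ≈ᶜ idʷ
      fixes = window⇒≈ᶜ {s (+ toℕ u) · idʷ} {idʷ} (+ 0) λ v → ≡.trans (window-s (+ toℕ u) idʷ v)
        (≡.trans (≡.cong (λ u → op u (windowʷ idʷ) v) (res-toℕ u))
        (≡.trans (op-cong u (window-word []) v) (≡.trans (op-fixed u f v)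
        (≡.trans (≡.sym (window-word [] v)) (≡.sym (ℤ.+-identityʳ _))))))

    differences : NilCoxeterAction Functions
    differences = record
      { A        = λ u (κ , κ-inv) → A u κ , A-invariant u {κ} κ-inv
      ; x₀       = δ₀ , ε-invariant T.1#
      ; 0ₓ       = (λ _ → 𝔽.0#) , λ _ _ _ → 𝔽.refl
      ; A-cong   = λ u {x} {y} e → A-congF u {proj₁ x} {proj₁ y} e
      ; A-comm   = λ p q r x → A-comm p q r {proj₁ x} (proj₂ x)
      ; A-braid  = λ u p x → A-braid u p {proj₁ x} (proj₂ x)
      ; A-square = λ u x → A-square u {proj₁ x} (proj₂ x)
      ; A-0      = A-0F
      ; A-base   = A-δ₀
      }

    module O = Operators Functions differences

    ξ : List ℤ → Wₑ → 𝔽.Carrier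
    ξ ms = proj₁ (O.A* (map res ms))

    ξ-invariant : ∀ ms → Invariantᶜ (ξ ms)
    ξ-invariant ms = proj₂ (O.A* (map res ms))

    private
      apply-id : ∀ {κ} → Invariantᶜ κ → ∀ w → apply idʷ κ w 𝔽.≈ κ w
      apply-id {κ} κ-inv w = 𝔽.trans (actF-id (κ (inv idʷ · w)))
        (invariant-window {κ} κ-inv (inv idʷ · w) w λ v → ≡.cong (λ x → base v ℤ.+ + n ℤ.* x) (ℤ.+-identityˡ _))

      apply-s : ∀ m {κ} → Invariantᶜ κ → ∀ w → apply (s m) κ w 𝔽.≈ actF (swap (res m)) (κ (reflect (res m) w))
      apply-s m {κ} κ-inv w = 𝔽.trans
        (actF-cong (finite (s m)) {κ (inv (s m) · w)} {κ (reflect (res m) w)} (invariant-window {κ} κ-inv (inv (s m) · w) (reflect (res m) w) λ v →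
          ≡.trans (window-inv-s m w v) (≡.sym (window-reflect (res m) w v))))
        (actF-≗ (finite (s m)) (swap (res m)) (λ v → ≡.cong (λ x → PC.transpose (res m) x v) (≡.sym (nxt-res m))) (κ (reflect (res m) w)))

      α⁻¹-1/α : ∀ m → α⁻¹ m 𝔽.≈ 1/α (res m)
      α⁻¹-1/α m = frac-≡ {α⁻¹ m} {1/α (res m)} ≡.refl (≡.cong (λ v → var (res m) S.- var v) (≡.sym (nxt-res m)))

      module _ where
        open CommutativeRing 𝔽
        open IntegerSolver 𝔽

        collect : ∀ i x y → (i * 1#) * x + ((i * - 1#) * y + 0#) ≈ i * (x - y)
        collect i x y = solve 3 (λ i x y → (i :* :1) :* x :+ ((i :* :- :1) :* y :+ :0) := i :* (x :- y)) refl i x y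

    Aₛ-▷ : ∀ m {κ} → Invariantᶜ κ → ∀ w → (Aₛ m ▷ κ) w 𝔽.≈ A (res m) κ w
    Aₛ-▷ m {κ} κ-inv w = begin
      (Aₛ m ▷ κ) w
        ≈⟨ collect (α⁻¹ m) (apply (s m) κ w) (apply idʷ κ w) ⟩
      α⁻¹ m 𝔽.* (apply (s m) κ w 𝔽.- apply idʷ κ w)
        ≈⟨ 𝔽.*-cong {α⁻¹ m} {1/α (res m)} (α⁻¹-1/α m) (𝔽.+-cong (apply-s m {κ} κ-inv w) (𝔽.-‿cong (apply-id {κ} κ-inv w))) ⟩
      1/α (res m) 𝔽.* (actF (swap (res m)) (κ (reflect (res m) w)) 𝔽.- κ w)
        ≡⟨ difference-def (1/α (res m)) (actF (swap (res m))) (reflect (res m)) κ w ⟨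
      A (res m) κ w ∎

    ε-A-word : ∀ ms w → ε (foldr (λ m x → Aₛ m T.* x) T.1# ms) w 𝔽.≈ ξ ms w
    ε-A-word [] w = 𝔽.refl
    ε-A-word (m ∷ ms) w = 𝔽.trans (ε-* (Aₛ m) x w) (𝔽.trans (Aₛ-▷ m {ε x} (ε-invariant x) w)
      (A-congF (res m) {ε x} {ξ ms} (ε-A-word ms) w))
      where x = foldr (λ m x → Aₛ m T.* x) T.1# ms

    singleton-▷ : ∀ v κ w → ([ v ] ▷ κ) w 𝔽.≈ apply v κ w
    singleton-▷ v κ w = 𝔽.trans (𝔽.+-identityʳ _) (𝔽.*-identityˡ _)

    ε-A : ∀ r ms w → ε (Aᵉ (r , ms)) w 𝔽.≈ apply (τ^ r) (ξ ms) w
    ε-A r ms w = 𝔽.trans (ε-* [ τ^ r ] x w) (𝔽.trans (singleton-▷ (τ^ r) (ε x) w)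
      (actF-cong (finite (τ^ r)) {ε x (inv (τ^ r) · w)} {ξ ms (inv (τ^ r) · w)} (ε-A-word ms (inv (τ^ r) · w))))
      where x = foldr (λ m x → Aₛ m T.* x) T.1# ms

    -- By the contrapositive of `up⇒W⁰`, a word whose value is outside W_e⁰ fails to climb
    -- somewhere, and then `vanishes` applies.
    ε-A-vanishes : ∀ e → ¬ W⁰ (value e) → ∀ w → ε (Aᵉ e) w 𝔽.≈ 𝔽.0#
    ε-A-vanishes (r , ms) ¬W⁰ w = 𝔽.trans (ε-A r ms w)
      (𝔽.trans (actF-cong (finite (τ^ r)) {ξ ms (inv (τ^ r) · w)} {𝔽.0#}
        (O.vanishes (map res ms) (λ up → ¬W⁰ (up⇒W⁰ r ms up)) (inv (τ^ r) · w))) (actF-0 (finite (τ^ r))))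

    ε-• : ∀ p x w → ε (p • x) w 𝔽.≈ p 𝔽.* ε x w
    ε-• p x w = 𝔽.trans (ε-total (p • x) w) (𝔽.trans (scale x) (𝔽.*-congˡ {p} (𝔽.sym (ε-total x w))))
      where
      g : Wₑ → 𝔽.Carrier
      g v = indicator (does (v ≟ᶜ w))
      scale : ∀ x → total (p • x) g 𝔽.≈ p 𝔽.* total x g
      scale [] = 𝔽.sym (𝔽.zeroʳ p)
      scale ((q , v) ∷ x) = 𝔽.trans (𝔽.+-cong (𝔽.*-assoc p q (g v)) (scale x)) (𝔽.sym (𝔽.distribˡ p (q 𝔽.* g v) (total x g)))

    ε-combination : ∀ L → All (λ (_ , e) → Reduced e × ¬ W⁰ (value e)) L → ∀ w → ε (combination Aᵉ L) w 𝔽.≈ 𝔽.0#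
    ε-combination [] [] w = 𝔽.refl
    ε-combination ((p , e) ∷ L) ((_ , ¬W⁰) ∷ all) w = begin
      ε (fromRing p • Aᵉ e T.+ combination Aᵉ L) w
        ≈⟨ ε-++ (fromRing p • Aᵉ e) (combination Aᵉ L) w ⟩
      ε (fromRing p • Aᵉ e) w 𝔽.+ ε (combination Aᵉ L) w
        ≈⟨ 𝔽.+-cong (𝔽.trans (ε-• (fromRing p) (Aᵉ e) w) (𝔽.*-congˡ {fromRing p} (ε-A-vanishes e ¬W⁰ w))) (ε-combination L all w) ⟩
      fromRing p 𝔽.* 𝔽.0# 𝔽.+ 𝔽.0#
        ≈⟨ 𝔽.trans (𝔽.+-identityʳ _) (𝔽.zeroʳ (fromRing p)) ⟩
      𝔽.0# ∎

    module _ (j : Wₑ → Twisted) (isSchubertBasis : IsSchubertBasis j) where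
      open IsSchubertBasis isSchubertBasis

      -- The leading term is all that the coset function sees, since the other terms of j_w lie
      -- outside W_e⁰. So the function of j_w is computed from any climbing word of w.
      ε-j : ∀ r ms → Up (map res ms) → ∀ w → ε (j (value (r , ms))) w 𝔽.≈ apply (τ^ r) (ξ ms) w
      ε-j r ms up w =
        let L , all , e = leading {r , ms} (up⇒reduced r ms up) (up⇒W⁰ r ms up) in begin
        ε (j (value (r , ms))) w
          ≈⟨ ε-≋ᵗ {j (value (r , ms))} {Aᵉ (r , ms) T.+ combination Aᵉ L} (≈ᵗ⇒≋ᵗ {j (value (r , ms))} {Aᵉ (r , ms) T.+ combination Aᵉ L} e) w ⟩
        ε (Aᵉ (r , ms) T.+ combination Aᵉ L) w
          ≈⟨ ε-++ (Aᵉ (r , ms)) (combination Aᵉ L) w ⟩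
        ε (Aᵉ (r , ms)) w 𝔽.+ ε (combination Aᵉ L) w
          ≈⟨ 𝔽.+-cong (ε-A r ms w) (ε-combination L all w) ⟩
        apply (τ^ r) (ξ ms) w 𝔽.+ 𝔽.0#
          ≈⟨ 𝔽.+-identityʳ _ ⟩
        apply (τ^ r) (ξ ms) w ∎

  -- The centralizer of S consists of combinations of translations

  module Centralizer where
    open Setting ℝ n 2≤n hiding (u; z; A; a)
    open Residues
    open WeylGroup
    open TwistedAlgebra
    open PetersonOperators
    open SchubertBasis
    open Fractions S using (wrap; cancelˡ)
    open FractionField S using (Regular; fromRing)
    open SetoidReasoning 𝔽.setoid

    private
      module FC = FormalSums.Coefficients 𝔽 Wₑ _≟ʷ_

    fromRing-- : ∀ p q → fromRing (p S.- q) 𝔽.≈ fromRing p 𝔽.- fromRing q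
    fromRing-- p q = wrap (S.*-cong (S.+-cong (S.sym (S.*-identityʳ p)) (S.sym (S.*-identityʳ (S.- q)))) (S.*-identityʳ S.1#))

    -- Two transpositions carry the variables of the simple root α_0 to those of u and v, and
    -- permutations preserve regularity.
    regular-difference : ∀ {u v} → u ≢ v → Regular (var u S.- var v)
    regular-difference {u} {v} u≢v = ≡.subst Regular (≡.cong₂ (λ x y → var x S.- var y) at-u₀ at-u₁)
      (permute-regular (π₁ ∘ₚ π₂) {var u₀ S.- var u₁} (α-regularᵤ u₀))
      where
      u₀ = res (+ 0)
      u₁ = nxt u₀
      π₁ = Perm.transpose u₀ u
      x = π₁ ⟨$⟩ʳ u₁
      π₂ = Perm.transpose x v
      u≢x : u ≢ x
      u≢x e = nxt-≢ u₀ (≡.trans (≡.sym (Perm.inverseˡ π₁)) (≡.trans (≡.cong (π₁ ⟨$⟩ˡ_)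
        (≡.trans (≡.sym e) (≡.sym (transpose-left u₀ u)))) (Perm.inverseˡ π₁)))
      at-u₀ : (π₁ ∘ₚ π₂) ⟨$⟩ʳ u₀ ≡ u
      at-u₀ = ≡.trans (≡.cong (π₂ ⟨$⟩ʳ_) (transpose-left u₀ u)) (transpose-other x v u≢x u≢v)
      at-u₁ : (π₁ ∘ₚ π₂) ⟨$⟩ʳ u₁ ≡ v
      at-u₁ = transpose-left x v

    coefficient-fromS-* : ∀ p x w → coefficient (fromS p T.* x) w 𝔽.≈ fromRing p 𝔽.* coefficient x w
    coefficient-fromS-* p x w = 𝔽.trans (coefficient-* (fromS p) x w) (𝔽.trans (𝔽.+-identityʳ _)
      (𝔽.*-cong {fromRing p 𝔽.* 𝔽.1#} {fromRing p} (𝔽.*-identityʳ (fromRing p))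
        (𝔽.trans (actF-id (coefficient x (inv idʷ · w)))
          (coefficient-invariant x (inv idʷ · w) w (≗⇒≈ʷ {inv idʷ · w} {w} (λ v → ℤ.+-identityˡ _) (λ v → ≡.refl))))))

    ε-fromS-* : ∀ p x w → ε (fromS p T.* x) w 𝔽.≈ fromRing p 𝔽.* ε x w
    ε-fromS-* p x w = 𝔽.trans (ε-* (fromS p) x w) (𝔽.trans (𝔽.+-identityʳ _)
      (𝔽.*-cong {fromRing p 𝔽.* 𝔽.1#} {fromRing p} (𝔽.*-identityʳ (fromRing p))
        (𝔽.trans (actF-id (ε x (inv idʷ · w)))
          (ε-invariant x (inv idʷ · w) w (≗⇒~ {translation (inv idʷ · w)} {translation w} (λ v → ℤ.+-identityˡ _))))))

    coefficient-fromS : ∀ p w → coefficient (fromS p) w 𝔽.≈ fromRing p 𝔽.* indicator (does (idʷ ≟ʷ w))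
    coefficient-fromS p w = 𝔽.trans (FC.coeff-total (fromS p) w) (𝔽.trans (𝔽.+-identityʳ _)
      (𝔽.*-congʳ {indicator (does (idʷ ≟ʷ w))} {fromRing p 𝔽.* 𝔽.1#} {fromRing p} (𝔽.*-identityʳ (fromRing p))))

    private
      ·-identityʳ : ∀ v → v · idʷ ≈ʷ v
      ·-identityʳ v = ≗⇒≈ʷ {v · idʷ} {v} (λ x → ℤ.+-identityʳ _) (λ x → ≡.refl)

    coefficient-*-fromS : ∀ x p w → coefficient (x T.* fromS p) w 𝔽.≈ actF (finite w) (fromRing p) 𝔽.* coefficient x w
    coefficient-*-fromS x p w = begin
      coefficient (x T.* fromS p) w
        ≈⟨ coefficient-* x (fromS p) w ⟩
      total x (λ v → apply v (coefficient (fromS p)) w)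
        ≈⟨ total-cong x term ⟩
      total x (λ v → actF (finite w) (fromRing p) 𝔽.* indicator (does (v ≟ʷ w)))
        ≈⟨ total-* x (actF (finite w) (fromRing p)) (λ v → indicator (does (v ≟ʷ w))) ⟩
      actF (finite w) (fromRing p) 𝔽.* total x (λ v → indicator (does (v ≟ʷ w)))
        ≈⟨ 𝔽.*-congˡ {actF (finite w) (fromRing p)} (FC.coeff-total x w) ⟨
      actF (finite w) (fromRing p) 𝔽.* coefficient x w ∎
      where
      agree : ∀ v → does (idʷ ≟ʷ (inv v · w)) ≡ does (v ≟ʷ w)
      agree v = does-⇔ (mk⇔
        (λ e → ≈ʷ-trans {v} {v · idʷ} {w} (≈ʷ-sym {v · idʷ} {v} (·-identityʳ v)) (Equivalence.from (shiftʷ v idʷ w) e))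
        (λ e → Equivalence.to (shiftʷ v idʷ w) (≈ʷ-trans {v · idʷ} {v} {w} (·-identityʳ v) e)))
        (idʷ ≟ʷ (inv v · w)) (v ≟ʷ w)

      choose : ∀ v → Dec (v ≈ʷ w) → (d : Bool) → d ≡ does (v ≟ʷ w) →
               actF (finite v) (fromRing p) 𝔽.* indicator d 𝔽.≈ actF (finite w) (fromRing p) 𝔽.* indicator d
      choose v (yes (_ , f)) d _ = 𝔽.*-congʳ {indicator d} {actF (finite v) (fromRing p)} {actF (finite w) (fromRing p)}
        (actF-≗ (finite v) (finite w) f (fromRing p))
      choose v (no ne) false _ = 𝔽.trans (𝔽.zeroʳ (actF (finite v) (fromRing p))) (𝔽.sym (𝔽.zeroʳ (actF (finite w) (fromRing p))))
      choose v (no ne) true e = contradiction (true⇒ (v ≟ʷ w) e) ne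
        where
        true⇒ : (d : Dec (v ≈ʷ w)) → true ≡ does d → v ≈ʷ w
        true⇒ (yes p) _ = p

      term : ∀ v → apply v (coefficient (fromS p)) w 𝔽.≈ actF (finite w) (fromRing p) 𝔽.* indicator (does (v ≟ʷ w))
      term v = begin
        actF (finite v) (coefficient (fromS p) (inv v · w))
          ≈⟨ actF-cong (finite v) {coefficient (fromS p) (inv v · w)} (coefficient-fromS p (inv v · w)) ⟩
        actF (finite v) (fromRing p 𝔽.* indicator (does (idʷ ≟ʷ (inv v · w))))
          ≈⟨ actF-* (finite v) (fromRing p) (indicator (does (idʷ ≟ʷ (inv v · w)))) ⟩
        actF (finite v) (fromRing p) 𝔽.* actF (finite v) (indicator (does (idʷ ≟ʷ (inv v · w))))
          ≈⟨ 𝔽.*-congˡ {actF (finite v) (fromRing p)} (𝔽.trans (act-indicator (finite v) (does (idʷ ≟ʷ (inv v · w)))) (𝔽.reflexive (≡.cong indicator (agree v)))) ⟩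
        actF (finite v) (fromRing p) 𝔽.* indicator (does (v ≟ʷ w))
          ≈⟨ choose v (v ≟ʷ w) (does (v ≟ʷ w)) ≡.refl ⟩
        actF (finite w) (fromRing p) 𝔽.* indicator (does (v ≟ʷ w)) ∎

    TranslationsOnly : Twisted → Set _
    TranslationsOnly x = ∀ w → ¬ (finite w Perm.≈ Perm.id) → coefficient x w 𝔽.≈ 𝔽.0#

    -- Comparing the coefficients b of w in x a_v = a_v x gives (a_{πv} - a_v) b = 0, where π is the
    -- finite part of w. If π moves v, the first factor is regular.
    ∈ℙ⇒translationsOnly : ∀ {x} → x ∈ℙ → TranslationsOnly x
    ∈ℙ⇒translationsOnly {x} (_ , commutes) w π≉id = cancelˡ (regular-difference moved) (begin
      fromRing (var (π ⟨$⟩ʳ v) S.- var v) 𝔽.* b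
        ≈⟨ 𝔽.*-congʳ {b} {fromRing (var (π ⟨$⟩ʳ v) S.- var v)} (fromRing-- (var (π ⟨$⟩ʳ v)) (var v)) ⟩
      (fromRing (var (π ⟨$⟩ʳ v)) 𝔽.- fromRing (var v)) 𝔽.* b
        ≈⟨ distribute (fromRing (var (π ⟨$⟩ʳ v))) (fromRing (var v)) b ⟩
      fromRing (var (π ⟨$⟩ʳ v)) 𝔽.* b 𝔽.- fromRing (var v) 𝔽.* b
        ≈⟨ 𝔽.+-congʳ {𝔽.- (fromRing (var v) 𝔽.* b)} {fromRing (var (π ⟨$⟩ʳ v)) 𝔽.* b} {fromRing (var v) 𝔽.* b} (𝔽.trans (𝔽.*-congʳ {b} {fromRing (var (π ⟨$⟩ʳ v))} {actF π (fromRing (var v))}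
             (frac-≡ {fromRing (var (π ⟨$⟩ʳ v))} {actF π (fromRing (var v))} ≡.refl ≡.refl)) (𝔽.trans (𝔽.sym (coefficient-*-fromS x (var v) w)) (𝔽.trans (≈ᵗ⇒≋ᵗ {x T.* fromS (var v)} {fromS (var v) T.* x} (commutes (var v)) w) (coefficient-fromS-* (var v) x w)))) ⟩
      fromRing (var v) 𝔽.* b 𝔽.- fromRing (var v) 𝔽.* b
        ≈⟨ 𝔽.-‿inverseʳ (fromRing (var v) 𝔽.* b) ⟩
      𝔽.0#
        ≈⟨ 𝔽.zeroʳ (fromRing (var (π ⟨$⟩ʳ v) S.- var v)) ⟨
      fromRing (var (π ⟨$⟩ʳ v) S.- var v) 𝔽.* 𝔽.0# ∎)
      where
      π = finite w
      b = coefficient x w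
      not-fixed : ∃[ v ] (π ⟨$⟩ʳ v ≢ v)
      not-fixed = Fin.¬∀⟶∃¬ n (λ v → π ⟨$⟩ʳ v ≡ v) (λ v → (π ⟨$⟩ʳ v) Fin.≟ v) π≉id
      v = proj₁ not-fixed
      moved = proj₂ not-fixed
      distribute : ∀ x y b → (x 𝔽.- y) 𝔽.* b 𝔽.≈ x 𝔽.* b 𝔽.- y 𝔽.* b
      distribute = solve 3 (λ x y b → (x :- y) :* b := x :* b :- y :* b) 𝔽.refl
        where open IntegerSolver 𝔽

    -- The list x may still contain terms with nontrivial finite part whose coefficients cancel. So
    -- the two sums are compared through the coefficients of x and not term by term.
    translationsOnly-ext : ∀ {x} → TranslationsOnly x → ∀ {g g′ : Wₑ → 𝔽.Carrier} → Invariantʷ g → Invariantʷ g′ →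
                           (∀ w → finite w Perm.≈ Perm.id → g w 𝔽.≈ g′ w) → total x g 𝔽.≈ total x g′
    translationsOnly-ext {x} only {g} {g′} g-inv g′-inv e = begin
      total x g
        ≈⟨ rearrange (total x g) (total x g′) ⟩
      (total x g 𝔽.- total x g′) 𝔽.+ total x g′
        ≈⟨ 𝔽.+-congʳ {total x g′} {total x g 𝔽.- total x g′} {𝔽.0#} (𝔽.trans (𝔽.sym (total-- x g g′)) (total-vanishes x (λ v → g v 𝔽.- g′ v)
             (λ {u} {w} f → 𝔽.+-cong (g-inv u w f) (𝔽.-‿cong (g′-inv u w f))) vanish)) ⟩
      𝔽.0# 𝔽.+ total x g′
        ≈⟨ 𝔽.+-identityˡ _ ⟩
      total x g′ ∎
      where
      rearrange : ∀ a b → a 𝔽.≈ (a 𝔽.- b) 𝔽.+ b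
      rearrange = solve 2 (λ a b → a := (a :- b) :+ b) 𝔽.refl
        where open IntegerSolver 𝔽
      vanish : ∀ w → coefficient x w 𝔽.* (g w 𝔽.- g′ w) 𝔽.≈ 𝔽.0#
      vanish w = by (Fin.all? (λ v → (finite w ⟨$⟩ʳ v) Fin.≟ v))
        where
        by : Dec (finite w Perm.≈ Perm.id) → coefficient x w 𝔽.* (g w 𝔽.- g′ w) 𝔽.≈ 𝔽.0#
        by (yes p) = 𝔽.trans (𝔽.*-congˡ {coefficient x w} {g w 𝔽.- g′ w} {𝔽.0#} (𝔽.trans {g w 𝔽.- g′ w} {g′ w 𝔽.- g′ w} {𝔽.0#} (𝔽.+-congʳ {𝔽.- g′ w} {g w} {g′ w} (e w p)) (𝔽.-‿inverseʳ (g′ w)))) (𝔽.zeroʳ (coefficient x w))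
        by (no ne) = 𝔽.trans (𝔽.*-congʳ {g w 𝔽.- g′ w} {coefficient x w} {𝔽.0#} (only w ne)) (𝔽.zeroˡ (g w 𝔽.- g′ w))

    private
      does-≟ʷ-invariant : ∀ w → Invariantʷ (λ v → indicator (does (v ≟ʷ w)))
      does-≟ʷ-invariant w u v e = 𝔽.reflexive (≡.cong indicator (does-⇔
        (mk⇔ (λ p → ≈ʷ-trans {v} {u} {w} (≈ʷ-sym {u} {v} e) p) (λ p → ≈ʷ-trans {u} {v} {w} e p)) (u ≟ʷ w) (v ≟ʷ w)))

    does-≟ᶜ-invariant : ∀ w → Invariantʷ (λ v → indicator (does (v ≟ᶜ w)))
    does-≟ᶜ-invariant w u v (e , _) = 𝔽.reflexive (≡.cong indicator (does-⇔
      (mk⇔ (λ p → ≈ᶜ-trans {v} {u} {w} (≈ᶜ-sym {u} {v} e) p) (λ p → ≈ᶜ-trans {u} {v} {w} e p)) (u ≟ᶜ w) (v ≟ᶜ w)))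

    -- Each coset contains exactly one translation, so for these elements the sum `ε` over a coset
    -- has a single contribution, the coefficient of that translation.
    translationsOnly-detect : ∀ {x y} → TranslationsOnly x → TranslationsOnly y → (∀ w → ε x w 𝔽.≈ ε y w) → x ≋ᵗ y
    translationsOnly-detect {x} {y} only-x only-y e w = by (Fin.all? (λ v → (finite w ⟨$⟩ʳ v) Fin.≟ v))
      where
      coefficient-ε : finite w Perm.≈ Perm.id → ∀ {x} → TranslationsOnly x → coefficient x w 𝔽.≈ ε x w
      coefficient-ε f {x} only = 𝔽.trans (FC.coeff-total x w) (𝔽.trans
        (translationsOnly-ext {x} only {λ v → indicator (does (v ≟ʷ w))} {λ v → indicator (does (v ≟ᶜ w))}
          (does-≟ʷ-invariant w) (does-≟ᶜ-invariant w) λ v g → 𝔽.reflexive (≡.cong indicator (does-⇔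
            (mk⇔ proj₁ (λ p → p , λ x → ≡.trans (g x) (≡.sym (f x)))) (v ≟ʷ w) (v ≟ᶜ w)))) (𝔽.sym (ε-total x w)))
      by : Dec (finite w Perm.≈ Perm.id) → coefficient x w 𝔽.≈ coefficient y w
      by (yes f) = 𝔽.trans (coefficient-ε f {x} only-x) (𝔽.trans (e w) (𝔽.sym (coefficient-ε f {y} only-y)))
      by (no ne) = 𝔽.trans (only-x w ne) (𝔽.sym (only-y w ne))

  -- Conjugation by permutations in the twisted algebra

  module Conjugation where
    open Setting ℝ n 2≤n hiding (u; z; A; a)
    open Residues
    open WeylGroup
    open Lengths
    open TwistedAlgebra
    open PetersonOperators
    open SchubertBasis using (act-indicator)
    open SetoidReasoning 𝔽.setoid

    private
      module FC = FormalSums.Coefficients 𝔽 Wₑ _≟ʷ_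

    conjugateʷ : Permutation′ n → Wₑ → Wₑ
    conjugateʷ π v = fromW π · v · fromW (Perm.flip π)

    conjugate : Permutation′ n → Twisted → Twisted
    conjugate π = map (λ (p , v) → actF π p , conjugateʷ π v)

    conjugate-total : ∀ π x {g h : Wₑ → 𝔽.Carrier} → (∀ v → g (conjugateʷ π v) 𝔽.≈ actF π (h v)) →
                      total (conjugate π x) g 𝔽.≈ actF π (total x h)
    conjugate-total π [] e = 𝔽.sym (actF-0 π)
    conjugate-total π ((p , v) ∷ x) {g} {h} e = begin
      actF π p 𝔽.* g (conjugateʷ π v) 𝔽.+ total (conjugate π x) g
        ≈⟨ 𝔽.+-cong (𝔽.*-congˡ {actF π p} (e v)) (conjugate-total π x {g} {h} e) ⟩
      actF π p 𝔽.* actF π (h v) 𝔽.+ actF π (total x h)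
        ≈⟨ 𝔽.+-congʳ {actF π (total x h)} {actF π (p 𝔽.* h v)} {actF π p 𝔽.* actF π (h v)} (actF-* π p (h v)) ⟨
      actF π (p 𝔽.* h v) 𝔽.+ actF π (total x h)
        ≈⟨ actF-+ π (p 𝔽.* h v) (total x h) ⟨
      actF π (p 𝔽.* h v 𝔽.+ total x h) ∎

    conjugateʷ-⇔ : ∀ π v w → conjugateʷ π v ≈ʷ w ⇔ v ≈ʷ conjugateʷ (Perm.flip π) w
    conjugateʷ-⇔ π v w = mk⇔
      (λ (e , f) → ~-relabel (π ⟨$⟩ʳ_) {translation (conjugateʷ π v)} {translation w} e
          (λ x → ≡.sym (≡.trans (zeros (translation v _)) (≡.cong (translation v) (Perm.inverseˡ π)))) (λ x → zeros _) ,
        λ x → ≡.trans (≡.sym (Perm.inverseˡ π)) (≡.cong (π ⟨$⟩ˡ_)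
          (≡.trans (≡.cong (λ y → π ⟨$⟩ʳ (finite v ⟨$⟩ʳ y)) (≡.sym (Perm.inverseˡ π))) (f (π ⟨$⟩ʳ x)))))
      (λ (e , f) → ~-relabel (π ⟨$⟩ˡ_) {translation v} {translation (conjugateʷ (Perm.flip π) w)} e
          (λ x → zeros _) (λ x → ≡.sym (≡.trans (zeros _) (≡.cong (translation w) (Perm.inverseʳ π)))) ,
        λ x → ≡.trans (≡.cong (π ⟨$⟩ʳ_) (f (π ⟨$⟩ˡ x)))
          (≡.trans (Perm.inverseʳ π) (≡.cong (finite w ⟨$⟩ʳ_) (Perm.inverseʳ π))))
      where
      zeros : ∀ x → + 0 ℤ.+ x ℤ.+ + 0 ≡ x
      zeros x = ≡.trans (ℤ.+-identityʳ _) (ℤ.+-identityˡ x)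

    private
      conjugateᶜ-⇔ : ∀ π v w → conjugateʷ π v ≈ᶜ w ⇔ v ≈ᶜ fromW (Perm.flip π) · w
      conjugateᶜ-⇔ π v w = mk⇔
        (λ e → ~-relabel (π ⟨$⟩ʳ_) {translation (conjugateʷ π v)} {translation w} e
          (λ x → ≡.sym (≡.trans (zeros (translation v _)) (≡.cong (translation v) (Perm.inverseˡ π)))) (λ x → ℤ.+-identityˡ _))
        (λ e → ~-relabel (π ⟨$⟩ˡ_) {translation v} {translation (fromW (Perm.flip π) · w)} e
          (λ x → zeros _) (λ x → ≡.sym (≡.trans (ℤ.+-identityˡ _) (≡.cong (translation w) (Perm.inverseʳ π)))))
        where
        zeros : ∀ x → + 0 ℤ.+ x ℤ.+ + 0 ≡ x
        zeros x = ≡.trans (ℤ.+-identityʳ _) (ℤ.+-identityˡ x)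

    coefficient-conjugate : ∀ π x w → coefficient (conjugate π x) w 𝔽.≈ actF π (coefficient x (conjugateʷ (Perm.flip π) w))
    coefficient-conjugate π x w = 𝔽.trans (FC.coeff-total (conjugate π x) w) (𝔽.trans
      (conjugate-total π x {λ v → indicator (does (v ≟ʷ w))} {λ v → indicator (does (v ≟ʷ conjugateʷ (Perm.flip π) w))}
        λ v → 𝔽.trans (𝔽.reflexive (≡.cong indicator (does-⇔ (conjugateʷ-⇔ π v w) (conjugateʷ π v ≟ʷ w) (v ≟ʷ conjugateʷ (Perm.flip π) w))))
          (𝔽.sym (act-indicator π _)))
      (actF-cong π (𝔽.sym (FC.coeff-total x (conjugateʷ (Perm.flip π) w)))))

    -- In π x π⁻¹ the right factor is absorbed by the coset, so on coset functions conjugation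
    -- becomes the left action of π alone.
    ε-conjugate : ∀ π x w → ε (conjugate π x) w 𝔽.≈ actF π (ε x (fromW (Perm.flip π) · w))
    ε-conjugate π x w = 𝔽.trans (ε-total (conjugate π x) w) (𝔽.trans
      (conjugate-total π x {λ v → indicator (does (v ≟ᶜ w))} {λ v → indicator (does (v ≟ᶜ (fromW (Perm.flip π) · w)))}
        λ v → 𝔽.trans (𝔽.reflexive (≡.cong indicator (does-⇔ (conjugateᶜ-⇔ π v w) (conjugateʷ π v ≟ᶜ w) (v ≟ᶜ (fromW (Perm.flip π) · w)))))
          (𝔽.sym (act-indicator π _)))
      (actF-cong π (𝔽.sym (ε-total x (fromW (Perm.flip π) · w)))))

    conjugate-cong : ∀ π {x y} → x ≋ᵗ y → conjugate π x ≋ᵗ conjugate π y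
    conjugate-cong π {x} {y} e w = 𝔽.trans (coefficient-conjugate π x w)
      (𝔽.trans (actF-cong π (e (conjugateʷ (Perm.flip π) w))) (𝔽.sym (coefficient-conjugate π y w)))

    conjugate-* : ∀ π x y → conjugate π (x T.* y) ≋ᵗ conjugate π x T.* conjugate π y
    conjugate-* π x y w = begin
      coefficient (conjugate π (x T.* y)) w
        ≈⟨ coefficient-conjugate π (x T.* y) w ⟩
      actF π (coefficient (x T.* y) ŵ)
        ≈⟨ actF-cong π (coefficient-* x y ŵ) ⟩
      actF π (total x (λ v → apply v (coefficient y) ŵ))
        ≈⟨ conjugate-total π x {λ v → apply v (coefficient (conjugate π y)) w} {λ v → apply v (coefficient y) ŵ} term ⟨
      total (conjugate π x) (λ v → apply v (coefficient (conjugate π y)) w)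
        ≈⟨ coefficient-* (conjugate π x) (conjugate π y) w ⟨
      coefficient (conjugate π x T.* conjugate π y) w ∎
      where
      ŵ = conjugateʷ (Perm.flip π) w
      term : ∀ v → apply (conjugateʷ π v) (coefficient (conjugate π y)) w 𝔽.≈ actF π (apply v (coefficient y) ŵ)
      term v = 𝔽.trans (actF-cong (finite (conjugateʷ π v)) (coefficient-conjugate π y (inv (conjugateʷ π v) · w)))
        (act₂-cong (finite (conjugateʷ π v)) π π (finite v) (λ x → ≡.cong (λ y → π ⟨$⟩ʳ (finite v ⟨$⟩ʳ y)) (Perm.inverseˡ π))
          (coefficient y v′) (coefficient y (inv v · ŵ))
          (coefficient-invariant y v′ (inv v · ŵ) (≗⇒≈ʷ {v′} {inv v · ŵ} translations λ x → Perm.inverseˡ π)))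
        where
        v′ = conjugateʷ (Perm.flip π) (inv (conjugateʷ π v) · w)
        l = translation v
        k = translation w
        translations : translation v′ ≗ translation (inv v · ŵ)
        translations x = ≡.trans
          (≡.cong₂ (λ y y′ → + 0 ℤ.+ (ℤ.- (+ 0 ℤ.+ l y ℤ.+ + 0) ℤ.+ k (π ⟨$⟩ʳ (finite v ⟨$⟩ʳ y′))) ℤ.+ + 0)
            (≡.trans (Perm.inverseˡ π) (≡.cong (finite v ⟨$⟩ʳ_) (Perm.inverseˡ π))) (Perm.inverseˡ π))
          (solve 2 (λ l k → con (+ 0) :+ (:- (con (+ 0) :+ l :+ con (+ 0)) :+ k) :+ con (+ 0)
            := :- l :+ (con (+ 0) :+ k :+ con (+ 0))) ≡.refl (l (finite v ⟨$⟩ʳ x)) (k (π ⟨$⟩ʳ (finite v ⟨$⟩ʳ x))))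
          where open IntegerOrder using (solve; _:=_; _:+_; :-_; con)

  record PetersonIsomorphism : Set (c ⊔ ℓ) where
    open Setting ℝ n 2≤n
    field
      j               : Wₑ → Twisted
      isSchubertBasis : IsSchubertBasis j
      φ               : CommutativeRing.Carrier ℂ[Z̃] → Twisted
      isIsomorphism   : IsSAlgebraIsomorphism φ
      φ-z             : ∀ k p → 1 ℕ.≤ k → k ℕ.+ p ℕ.≤ n → φ (z k (k ℕ.+ p)) ≈ j (τ^ k · cᵂ p) / j (τ^ (k ∸ 1))

  -- Partitions built box by box along their words

  module Shapes where
    open Setting ℝ n 2≤n using (IsPartition; u)

    -- Reading ms from right to left adds the boxes of l one by one, the
    -- letter of a box being its content.
    data Built {k} : List ℤ → Vector ℕ k → Set where
      empty : ∀ {l} → (∀ p → l p ≡ 0) → Built [] l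
      box   : ∀ {ms l l′ m} p → Built ms l → IsPartition l → IsPartition l′ → (∀ q → l′ q ℕ.≤ n ∸ k) →
              m ≡ + suc (l p) ℤ.- + suc (toℕ p) → l′ p ≡ suc (l p) → (∀ q → q ≢ p → l′ q ≡ l q) → Built (m ∷ ms) l′

    built-resp : ∀ {k ms} {l l′ : Vector ℕ k} → l ≗ l′ → Built ms l → Built ms l′
    built-resp e (empty f) = empty λ p → ≡.trans (≡.sym (e p)) (f p)
    built-resp e (box p b pl pl′ bounded m≡ at-p elsewhere) = box p b pl
      (λ {x} {y} x≤y → ≡.subst₂ ℕ._≤_ (e y) (e x) (pl′ x≤y)) (λ q → ≡.subst (ℕ._≤ _) (e q) (bounded q))
      m≡ (≡.trans (≡.sym (e p)) at-p) (λ q q≢ → ≡.trans (≡.sym (e q)) (elsewhere q q≢))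

    module _ {k} (l : Vector ℕ k) where
      -- The intermediate shapes, with rows counted from 0: the rows of `l` before row i, then x
      -- boxes in row i, then empty rows.
      fill : ℕ → ℕ → Vector ℕ k
      fill i x q with ℕ.<-cmp (toℕ q) i
      ... | tri< _ _ _ = l q
      ... | tri≈ _ _ _ = x
      ... | tri> _ _ _ = 0

      fill-< : ∀ {i x} q → toℕ q ℕ.< i → fill i x q ≡ l q
      fill-< {i} q q<i with ℕ.<-cmp (toℕ q) i
      ... | tri< _ _ _    = ≡.refl
      ... | tri≈ q≮i _ _  = contradiction q<i q≮i
      ... | tri> q≮i _ _  = contradiction q<i q≮i

      fill-≡ : ∀ {i x} q → toℕ q ≡ i → fill i x q ≡ x
      fill-≡ {i} q q≡i with ℕ.<-cmp (toℕ q) i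
      ... | tri< _ q≢i _ = contradiction q≡i q≢i
      ... | tri≈ _ _ _   = ≡.refl
      ... | tri> _ q≢i _ = contradiction q≡i q≢i

      fill-> : ∀ {i x} q → i ℕ.< toℕ q → fill i x q ≡ 0
      fill-> {i} q i<q with ℕ.<-cmp (toℕ q) i
      ... | tri< _ _ i≮q = contradiction i<q i≮q
      ... | tri≈ _ _ i≮q = contradiction i<q i≮q
      ... | tri> _ _ _   = ≡.refl

      module _ (l-partition : IsPartition l) (l-bounded : ∀ q → l q ℕ.≤ n ∸ k) where

        fill-partition : ∀ i x p → toℕ p ≡ i → x ℕ.≤ l p → IsPartition (fill i x)
        fill-partition i x p₀ p₀≡i x≤ {p} {q} p≤q = by (ℕ.<-cmp (toℕ p) i) (ℕ.<-cmp (toℕ q) i)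
          where
          by : _ → _ → fill i x q ℕ.≤ fill i x p
          by _ (tri> _ _ i<q) = ≡.subst (ℕ._≤ fill i x p) (≡.sym (fill-> q i<q)) z≤n
          by (tri< p<i _ _) (tri< q<i _ _) = ≡.subst₂ ℕ._≤_ (≡.sym (fill-< q q<i)) (≡.sym (fill-< p p<i)) (l-partition p≤q)
          by (tri< p<i _ _) (tri≈ _ q≡i _) = ≡.subst₂ ℕ._≤_ (≡.sym (fill-≡ q q≡i)) (≡.sym (fill-< p p<i))
            (ℕ.≤-trans x≤ (l-partition (ℕ.≤-trans p≤q (ℕ.≤-reflexive (≡.trans q≡i (≡.sym p₀≡i))))))
          by (tri≈ _ p≡i _) (tri≈ _ q≡i _) = ℕ.≤-reflexive (≡.trans (fill-≡ q q≡i) (≡.sym (fill-≡ p p≡i)))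
          by (tri≈ _ p≡i _) (tri< q<i _ _) = contradiction q<i (ℕ.≤⇒≯ (ℕ.≤-trans (ℕ.≤-reflexive (≡.sym p≡i)) p≤q))
          by (tri> _ _ i<p) (tri< q<i _ _) = contradiction q<i (ℕ.≤⇒≯ (ℕ.≤-trans (ℕ.<⇒≤ i<p) p≤q))
          by (tri> _ _ i<p) (tri≈ _ q≡i _) = contradiction (ℕ.<-≤-trans i<p p≤q) (ℕ.≤⇒≯ (ℕ.≤-reflexive q≡i))

        fill-bounded : ∀ i x p → toℕ p ≡ i → x ℕ.≤ l p → ∀ q → fill i x q ℕ.≤ n ∸ k
        fill-bounded i x p₀ p₀≡i x≤ q = by (ℕ.<-cmp (toℕ q) i)
          where
          by : _ → fill i x q ℕ.≤ n ∸ k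
          by (tri< q<i _ _) = ≡.subst (ℕ._≤ n ∸ k) (≡.sym (fill-< q q<i)) (l-bounded q)
          by (tri≈ _ q≡i _) = ≡.subst (ℕ._≤ n ∸ k) (≡.sym (fill-≡ q q≡i)) (ℕ.≤-trans x≤ (l-bounded p₀))
          by (tri> _ _ i<q) = ≡.subst (ℕ._≤ n ∸ k) (≡.sym (fill-> q i<q)) z≤n

        built-row : ∀ i x p {ms} → toℕ p ≡ i → x ℕ.≤ l p → Built ms (fill i 0) → Built (u (suc i) x ++ ms) (fill i x)
        built-row i zero    p p≡i x≤ b = b
        built-row i (suc x) p p≡i x≤ b = box p (built-row i x p p≡i (ℕ.<⇒≤ x≤) b)
          (fill-partition i x p p≡i (ℕ.<⇒≤ x≤)) (fill-partition i (suc x) p p≡i x≤) (fill-bounded i (suc x) p p≡i x≤)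
          (≡.sym (≡.cong₂ (λ y i → + suc y ℤ.- + suc i) (fill-≡ p p≡i) p≡i))
          (≡.trans (fill-≡ p p≡i) (≡.cong suc (≡.sym (fill-≡ p p≡i))))
          (λ q q≢p → by q (ℕ.<-cmp (toℕ q) i) q≢p)
          where
          by : ∀ q → _ → q ≢ p → fill i (suc x) q ≡ fill i x q
          by q (tri< q<i _ _) _ = ≡.trans (fill-< q q<i) (≡.sym (fill-< q q<i))
          by q (tri≈ _ q≡i _) q≢p = contradiction (Fin.toℕ-injective (≡.trans q≡i (≡.sym p≡i))) q≢p
          by q (tri> _ _ i<q) _ = ≡.trans (fill-> q i<q) (≡.sym (fill-> q i<q))

        rows : ∀ {j} → (Fin j → Fin k) → List ℤ
        rows f = concat (reverse (tabulate λ p → u (suc (toℕ (f p))) (l (f p))))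

        -- The map `f` lists the rows from i on. Starting from the identity, it is composed with
        -- `suc` at each step, in accordance with the tail of `tabulate`.
        built-rows : ∀ j i (f : Fin j → Fin k) {ms} → (∀ p → toℕ (f p) ≡ i ℕ.+ toℕ p) → i ℕ.+ j ≡ k →
                     Built ms (fill i 0) → Built (rows f ++ ms) l
        built-rows zero i f _ e b = built-resp (λ q → fill-< q (ℕ.≤-trans (Fin.toℕ<n q)
          (ℕ.≤-reflexive (≡.trans (≡.sym e) (ℕ.+-identityʳ i))))) b
        built-rows (suc j) i f {ms} f≡ e b = ≡.subst (λ ms → Built ms l) split
          (built-rows j (suc i) (f ∘ suc) (λ p → ≡.trans (f≡ (suc p)) (ℕ.+-suc i (toℕ p))) (≡.trans (≡.sym (ℕ.+-suc i j)) e)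
            (built-resp (λ q → by q (ℕ.<-cmp (toℕ q) i)) (built-row i (l (f zero)) (f zero) at-zero ℕ.≤-refl b)))
          where
          at-zero : toℕ (f zero) ≡ i
          at-zero = ≡.trans (f≡ zero) (ℕ.+-identityʳ i)
          row = u (suc i) (l (f zero))
          split : rows (f ∘ suc) ++ row ++ ms ≡ rows f ++ ms
          split = begin
            rows (f ∘ suc) ++ row ++ ms
              ≡⟨ List.++-assoc (rows (f ∘ suc)) row ms ⟨
            (rows (f ∘ suc) ++ row) ++ ms
              ≡⟨ ≡.cong (λ r → (rows (f ∘ suc) ++ r) ++ ms) (List.++-identityʳ row) ⟨
            (rows (f ∘ suc) ++ concat (row ∷ [])) ++ ms
              ≡⟨ ≡.cong (_++ ms) (List.concat-++ (reverse later) (row ∷ [])) ⟩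
            concat (reverse later ++ row ∷ []) ++ ms
              ≡⟨ ≡.cong (λ r → concat r ++ ms) (List.unfold-reverse row later) ⟨
            concat (reverse (row ∷ later)) ++ ms
              ≡⟨ ≡.cong (λ i → concat (reverse (u (suc i) (l (f zero)) ∷ later)) ++ ms) at-zero ⟨
            rows f ++ ms ∎
            where
            open ≡.≡-Reasoning
            later = tabulate λ p → u (suc (toℕ (f (suc p)))) (l (f (suc p)))
          by : ∀ q → _ → fill i (l (f zero)) q ≡ fill (suc i) 0 q
          by q (tri< q<i _ _) = ≡.trans (fill-< q q<i) (≡.sym (fill-< q (ℕ.<-trans q<i ℕ.≤-refl)))
          by q (tri≈ _ q≡i _) = ≡.trans (fill-≡ q q≡i) (≡.trans (≡.cong l (Fin.toℕ-injective (≡.trans at-zero (≡.sym q≡i))))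
            (≡.sym (fill-< q (ℕ.≤-reflexive (≡.cong suc q≡i)))))
          by q (tri> _ _ i<q) = ≡.trans (fill-> q i<q) (≡.sym (after (ℕ.<-cmp (toℕ q) (suc i))))
            where
            after : _ → fill (suc i) 0 q ≡ 0
            after (tri< q<1+i _ _) = contradiction q<1+i (ℕ.≤⇒≯ i<q)
            after (tri≈ _ q≡ _)    = fill-≡ q q≡
            after (tri> _ _ 1+i<q) = fill-> q 1+i<q

        built : Built (rows id) l
        built = ≡.subst (λ ms → Built ms l) (List.++-identityʳ (rows id))
          (built-rows k 0 id (λ p → ≡.refl) ≡.refl (empty λ p → by p (ℕ.<-cmp (toℕ p) 0)))
          where
          by : ∀ q → _ → fill 0 0 q ≡ 0
          by q (tri≈ _ q≡0 _) = fill-≡ q q≡0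
          by q (tri> _ _ 0<q) = fill-> q 0<q

  module _ (isomorphism : PetersonIsomorphism) where
    open PetersonIsomorphism isomorphism

    -- Images of the diagonal entries

    module Isomorphism where
      open Setting ℝ n 2≤n
      open Residues
      open WeylGroup
      open Lengths
      open TwistedAlgebra
      open SchubertBasis
      open Centralizer
      open SetoidReasoning 𝔽.setoid
      open IsSAlgebraIsomorphism isIsomorphism

      module Z = CommutativeRing ℂ[Z̃]

      φ-translationsOnly : ∀ x → TranslationsOnly (φ x)
      φ-translationsOnly x = ∈ℙ⇒translationsOnly {φ x} (image⊆ℙ x)

      Ω : ℕ → Coweight
      Ω r = translation (τ^ r)

      private
        scaled-Ω : ∀ r x → base x ℤ.+ + n ℤ.* Ω r x ≡ base (rotate (ℤ.- (+ r)) x) ℤ.+ + r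
        scaled-Ω r x = ≡.trans (≡.cong (λ y → base x ℤ.+ + n ℤ.* y) (≡.sym (ℤ.+-identityʳ (Ω r x))))
          (≡.trans (≡.cong (windowʷ (τ^ r · idʷ)) (≡.sym (rotate-inverse′ (+ r) x)))
          (≡.trans (window-τ^ r idʷ (rotate (ℤ.- (+ r)) x))
          (≡.cong (ℤ._+ + r) (window-word [] (rotate (ℤ.- (+ r)) x)))))

        rotate-suc : ∀ r x → nxt (rotate (ℤ.- (+ suc r)) x) ≡ rotate (ℤ.- (+ r)) x
        rotate-suc r x = ≡.trans (rotate-rotate (+ 1) (ℤ.- (+ suc r)) x) (≡.cong (λ k → rotate k x)
          (solve 1 (λ r → :- (con (+ 1) :+ r) :+ con (+ 1) := :- r) ≡.refl (+ r)))
          where open IntegerOrder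

      -- Since τ is i ↦ i + 1, the window of τ^r at x is `base (x - r) + r`. From r to r + 1 it
      -- jumps by n exactly when x - r - 1 is the class of 0, that is at x = r + 1, and stays the
      -- same elsewhere.
      Ω-suc : ∀ r x → Ω (suc r) x ≡ Ω r x ℤ.+ unit (+ suc r) x
      Ω-suc r x = ℤ.*-cancelˡ-≡ (+ n) (Ω (suc r) x) (Ω r x ℤ.+ unit (+ suc r) x) (by (y Fin.≟ res (+ 0)))
        where
        open IntegerOrder
        y = rotate (ℤ.- (+ suc r)) x
        Ω-difference : + n ℤ.* Ω (suc r) x ≡ + n ℤ.* Ω r x ℤ.+ (base y ℤ.- base (nxt y) ℤ.+ + 1)
        Ω-difference = ≡.trans (solve 2 (λ b o → o := b :+ o :- b) ≡.refl (base x) (+ n ℤ.* Ω (suc r) x))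
          (≡.trans (≡.cong (ℤ._- base x) (scaled-Ω (suc r) x))
          (≡.trans (solve 4 (λ b b′ r x → b :+ (con (+ 1) :+ r) :- x := b′ :+ r :- x :+ (b :- b′ :+ con (+ 1))) ≡.refl (base y) (base (nxt y)) (+ r) (base x))
          (≡.cong (ℤ._+ (base y ℤ.- base (nxt y) ℤ.+ + 1)) (≡.trans
            (≡.cong (λ z → z ℤ.+ + r ℤ.- base x) (≡.cong base (rotate-suc r x)))
            (≡.trans (≡.cong (ℤ._- base x) (≡.sym (scaled-Ω r x)))
              (solve 2 (λ b o → b :+ o :- b := o) ≡.refl (base x) (+ n ℤ.* Ω r x)))))))
        by : Dec (y ≡ res (+ 0)) → + n ℤ.* Ω (suc r) x ≡ + n ℤ.* (Ω r x ℤ.+ unit (+ suc r) x)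
        by (yes e) = ≡.trans Ω-difference (≡.trans (≡.cong (λ d → + n ℤ.* Ω r x ℤ.+ (d ℤ.+ + 1))
            (≡.cong₂ ℤ._-_ (≡.trans (≡.cong base e) base-res-0) (≡.trans (≡.cong (base ∘ nxt) e) base-res-1)))
          (≡.trans (solve 2 (λ n o → n :* o :+ (n :- con (+ 1) :+ con (+ 1)) := n :* (o :+ con (+ 1))) ≡.refl (+ n) (Ω r x))
          (≡.cong (λ u → + n ℤ.* (Ω r x ℤ.+ u)) (≡.sym (unit-≡ (+ suc r) x
            (≡.trans (≡.sym (rotate-inverse′ (+ suc r) x)) (≡.trans (≡.cong (rotate (+ suc r)) e)
              (≡.trans (rotate-res (+ suc r) (+ 0)) (≡.cong res (ℤ.+-identityˡ (+ suc r)))))))))))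
        by (no ne) = ≡.trans Ω-difference (≡.trans (≡.cong (λ b → + n ℤ.* Ω r x ℤ.+ (base y ℤ.- b ℤ.+ + 1)) (base-nxt y ne))
          (≡.trans (solve 3 (λ n o b → n :* o :+ (b :- (b :+ con (+ 1)) :+ con (+ 1)) := n :* (o :+ con (+ 0))) ≡.refl (+ n) (Ω r x) (base y))
          (≡.cong (λ u → + n ℤ.* (Ω r x ℤ.+ u)) (≡.sym (unit-≢ (+ suc r) x λ e → ne
            (≡.trans (≡.cong (rotate (ℤ.- (+ suc r))) e) (≡.trans (rotate-res (ℤ.- (+ suc r)) (+ suc r))
              (≡.cong res (ℤ.+-inverseʳ (+ suc r))))))))))

      apply-τ^-δ₀ : ∀ r w → apply (τ^ r) δ₀ w 𝔽.≈ indicator (does (τ^ r ≟ᶜ w))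
      apply-τ^-δ₀ r w = begin
        actF (finite (τ^ r)) (δ₀ (inv (τ^ r) · w))
          ≈⟨ actF-cong (finite (τ^ r)) {δ₀ (inv (τ^ r) · w)} (δ₀-indicator (inv (τ^ r) · w)) ⟩
        actF (finite (τ^ r)) (indicator (does (idʷ ≟ᶜ (inv (τ^ r) · w))))
          ≈⟨ act-indicator (finite (τ^ r)) (does (idʷ ≟ᶜ (inv (τ^ r) · w))) ⟩
        indicator (does (idʷ ≟ᶜ (inv (τ^ r) · w)))
          ≡⟨ ≡.cong indicator (does-⇔ (mk⇔
               (λ e → ≈ᶜ-trans {τ^ r} {τ^ r · idʷ} {w} (≈ᶜ-sym {τ^ r · idʷ} {τ^ r} τ^r·id) (Equivalence.from (shiftᶜ (τ^ r) idʷ w) e))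
               (λ e → Equivalence.to (shiftᶜ (τ^ r) idʷ w) (≈ᶜ-trans {τ^ r · idʷ} {τ^ r} {w} τ^r·id e)))
               (idʷ ≟ᶜ (inv (τ^ r) · w)) (τ^ r ≟ᶜ w)) ⟩
        indicator (does (τ^ r ≟ᶜ w)) ∎
        where
        τ^r·id : τ^ r · idʷ ≈ᶜ τ^ r
        τ^r·id = ≗⇒~ {translation (τ^ r · idʷ)} {translation (τ^ r)} (λ x → ℤ.+-identityʳ _)

      -- With `translationsOnly-detect` in mind: j at τ^r is the translation by `Ω r`.
      ε-τ^ : ∀ r w → ε (j (τ^ r)) w 𝔽.≈ indicator (does (τ^ r ≟ᶜ w))
      ε-τ^ r w = begin
        ε (j (τ^ r)) w
          ≈⟨ ε-≋ᵗ {j (τ^ r · idʷ)} {j (τ^ r)} (≈ᵗ⇒≋ᵗ {j (τ^ r · idʷ)} {j (τ^ r)}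
               (IsSchubertBasis.cong isSchubertBasis {τ^ r · idʷ} {τ^ r} (up⇒W⁰ r [] [])
                 (≗⇒≈ʷ {τ^ r · idʷ} {τ^ r} (λ x → ℤ.+-identityʳ _) λ _ → ≡.refl))) w ⟨
        ε (j (value (r , []))) w
          ≈⟨ ε-j j isSchubertBasis r [] [] w ⟩
        apply (τ^ r) δ₀ w
          ≈⟨ apply-τ^-δ₀ r w ⟩
        indicator (does (τ^ r ≟ᶜ w)) ∎

      _⊞_ _⊟_ : Coweight → Coweight → Coweight
      (l ⊞ m) x = l x ℤ.+ m x
      (l ⊟ m) x = l x ℤ.- m x

      private

        module _ where
          open IntegerOrder

          move : ∀ l m k → m ~ (k ⊟ l) → l ~ (k ⊟ m)
          move l m k e = ~-shift (l ⊟ m) {m} {k ⊟ l} {l} {k ⊟ m} e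
            (λ x → solve 2 (λ l m → l := m :+ (l :- m)) ≡.refl (l x) (m x))
            (λ x → solve 3 (λ l m k → k :- m := (k :- l) :+ (l :- m)) ≡.refl (l x) (m x) (k x))

          zero-move : ∀ l k m → ((λ _ → + 0) ~ ((k ⊟ l) ⊞ m)) ⇔ (l ~ (k ⊞ m))
          zero-move l k m = mk⇔
            (λ e → ~-shift l {λ _ → + 0} {(k ⊟ l) ⊞ m} {l} {k ⊞ m} e (λ x → ≡.sym (ℤ.+-identityˡ (l x)))
              (λ x → solve 3 (λ l m k → k :+ m := ((k :- l) :+ m) :+ l) ≡.refl (l x) (m x) (k x)))
            (λ e → ~-shift (λ x → ℤ.- l x) {l} {k ⊞ m} {λ _ → + 0} {(k ⊟ l) ⊞ m} e (λ x → ≡.sym (ℤ.+-inverseʳ (l x)))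
              (λ x → solve 3 (λ l m k → (k :- l) :+ m := (k :+ m) :- l) ≡.refl (l x) (m x) (k x)))

        inv-translation : ∀ u w → finite u Perm.≈ Perm.id → (translation w ⊟ translation u) ≗ translation (inv u · w)
        inv-translation u w f x = ≡.trans (ℤ.+-comm (translation w x) _)
          (≡.cong (λ y → ℤ.- translation u y ℤ.+ translation w y) (≡.sym (f x)))

      -- The image is the quotient of the translations by `Ω p` and by `Ω (p - 1)`, which differ by
      -- the p-th unit vector according to `Ω-suc`. The computation takes place on coset functions,
      -- including that of the inverse `v`.
      φ-diagonal : ∀ p → 1 ℕ.≤ p → p ℕ.≤ n → φ (z p p) ≋ᵗ [ t (unit (+ p)) ]
      φ-diagonal p@(suc p-1) 1≤p p≤n = translationsOnly-detect {φ (z p p)} {[ t (unit (+ p)) ]}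
        (φ-translationsOnly (z p p)) only ε-agree
        where
        quotient : φ (z p (p ℕ.+ 0)) ≈ j (τ^ p · cᵂ 0) / j (τ^ p-1)
        quotient = φ-z p 0 1≤p (ℕ.≤-trans (ℕ.≤-reflexive (ℕ.+-identityʳ p)) p≤n)
        v = proj₁ quotient
        v∈ℙ = proj₁ (proj₂ quotient)
        v-inverse = proj₁ (proj₂ (proj₂ quotient))
        φ≈ = proj₂ (proj₂ (proj₂ quotient))
        jₚ = j (τ^ p · cᵂ 0)
        jₚ₋₁ = j (τ^ p-1)
        m = Ω p-1

        only : TranslationsOnly [ t (unit (+ p)) ]
        only w ne = 𝔽.trans (FormalSums.Coefficients.coeff-total 𝔽 Wₑ _≟ʷ_ [ t (unit (+ p)) ] w) (𝔽.trans (𝔽.+-identityʳ _) (𝔽.trans (𝔽.*-identityˡ _)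
          (𝔽.reflexive (≡.cong indicator (dec-false (t (unit (+ p)) ≟ʷ w) λ (_ , f) → ne λ x → ≡.sym (f x))))))

        -- As `v` is supported on translations, multiplying it by the class of τ^(p-1) shifts its
        -- coset function by `m`; the result has to be the function of 1.
        ε-v : ∀ w → ε v (t (translation w ⊟ m)) 𝔽.≈ δ₀ w
        ε-v w = begin
          ε v (t (translation w ⊟ m))
            ≈⟨ ε-total v (t (translation w ⊟ m)) ⟩
          total v (λ u → indicator (does (u ≟ᶜ t (translation w ⊟ m))))
            ≈⟨ translationsOnly-ext {v} (∈ℙ⇒translationsOnly {v} v∈ℙ)
                 {λ u → apply u (ε jₚ₋₁) w} {λ u → indicator (does (u ≟ᶜ t (translation w ⊟ m)))}
                 (λ u u′ e → apply-cong {ε jₚ₋₁} (λ a b e → ε-invariant jₚ₋₁ a b (proj₁ e)) w {u} {u′} e)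
                 (does-≟ᶜ-invariant (t (translation w ⊟ m))) term ⟨
          total v (λ u → apply u (ε jₚ₋₁) w)
            ≈⟨ ε-* v jₚ₋₁ w ⟨
          ε (v T.* jₚ₋₁) w
            ≈⟨ ε-≋ᵗ {v T.* jₚ₋₁} {T.1#} (≈ᵗ⇒≋ᵗ {v T.* jₚ₋₁} {T.1#} v-inverse) w ⟩
          δ₀ w ∎
          where
          term : ∀ u → finite u Perm.≈ Perm.id → apply u (ε jₚ₋₁) w 𝔽.≈ indicator (does (u ≟ᶜ t (translation w ⊟ m)))
          term u f = 𝔽.trans (actF-cong (finite u) {ε jₚ₋₁ (inv u · w)} (ε-τ^ p-1 (inv u · w)))
            (𝔽.trans (act-indicator (finite u) (does (τ^ p-1 ≟ᶜ (inv u · w)))) (𝔽.reflexive (≡.cong indicator (does-⇔ (mk⇔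
              (λ e → move (translation u) m (translation w) (≈ᶜ-trans {τ^ p-1} {inv u · w} {t (translation w ⊟ translation u)} e
                (≈ᶜ-sym {t (translation w ⊟ translation u)} {inv u · w} (≗⇒~ {translation w ⊟ translation u} {translation (inv u · w)} (inv-translation u w f)))))
              (λ e → ≈ᶜ-trans {τ^ p-1} {t (translation w ⊟ translation u)} {inv u · w} (move m (translation u) (translation w) e)
                (≗⇒~ {translation w ⊟ translation u} {translation (inv u · w)} (inv-translation u w f))))
              (τ^ p-1 ≟ᶜ (inv u · w)) (u ≟ᶜ t (translation w ⊟ m))))))

        ε-agree : ∀ w → ε (φ (z p p)) w 𝔽.≈ ε [ t (unit (+ p)) ] w
        ε-agree w = begin
          ε (φ (z p p)) w
            ≡⟨ ≡.cong (λ q → ε (φ (z p q)) w) (≡.sym (ℕ.+-identityʳ p)) ⟩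
          ε (φ (z p (p ℕ.+ 0))) w
            ≈⟨ ε-≋ᵗ {φ (z p (p ℕ.+ 0))} {jₚ T.* v} (≈ᵗ⇒≋ᵗ {φ (z p (p ℕ.+ 0))} {jₚ T.* v} φ≈) w ⟩
          ε (jₚ T.* v) w
            ≈⟨ ε-* jₚ v w ⟩
          total jₚ (λ u → apply u (ε v) w)
            ≈⟨ translationsOnly-ext {jₚ} (∈ℙ⇒translationsOnly {jₚ} (IsSchubertBasis.member isSchubertBasis {τ^ p · idʷ} (up⇒W⁰ p [] [])))
                 {λ u → apply u (ε v) w} {λ u → indicator (does (u ≟ᶜ w⁺))}
                 (λ u u′ e → apply-cong {ε v} (λ a b e → ε-invariant v a b (proj₁ e)) w {u} {u′} e)
                 (does-≟ᶜ-invariant w⁺) term ⟩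
          total jₚ (λ u → indicator (does (u ≟ᶜ w⁺)))
            ≈⟨ ε-total jₚ w⁺ ⟨
          ε jₚ w⁺
            ≈⟨ ε-≋ᵗ {jₚ} {j (τ^ p)} (≈ᵗ⇒≋ᵗ {jₚ} {j (τ^ p)} (IsSchubertBasis.cong isSchubertBasis {τ^ p · idʷ} {τ^ p} (up⇒W⁰ p [] [])
                 (≗⇒≈ʷ {τ^ p · idʷ} {τ^ p} (λ x → ℤ.+-identityʳ _) λ _ → ≡.refl))) w⁺ ⟩
          ε (j (τ^ p)) w⁺
            ≈⟨ ε-τ^ p w⁺ ⟩
          indicator (does (τ^ p ≟ᶜ w⁺))
            ≡⟨ ≡.cong indicator (does-⇔ (mk⇔
                 (λ e → ~-shift (λ x → ℤ.- m x) {Ω p} {translation w ⊞ m} {unit (+ p)} {translation w} e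
                   (λ x → ≡.sym (≡.trans (≡.cong (ℤ._- m x) (Ω-suc p-1 x)) (cancel₁ (m x) (unit (+ p) x))))
                   (λ x → ≡.sym (cancel₂ (m x) (translation w x))))
                 (λ e → ~-shift m {unit (+ p)} {translation w} {Ω p} {translation w ⊞ m} e
                   (λ x → ≡.trans (Ω-suc p-1 x) (ℤ.+-comm (m x) _)) (λ x → ≡.refl)))
                 (τ^ p ≟ᶜ w⁺) (t (unit (+ p)) ≟ᶜ w)) ⟩
          indicator (does (t (unit (+ p)) ≟ᶜ w))
            ≈⟨ 𝔽.trans (ε-total [ t (unit (+ p)) ] w) (𝔽.trans (𝔽.+-identityʳ _) (𝔽.*-identityˡ _)) ⟨
          ε [ t (unit (+ p)) ] w ∎
          where
          w⁺ = t (translation w ⊞ m)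
          cancel₁ : ∀ m e → m ℤ.+ e ℤ.- m ≡ e
          cancel₁ = solve 2 (λ m e → m :+ e :- m := e) ≡.refl
            where open IntegerOrder
          cancel₂ : ∀ m k → k ℤ.+ m ℤ.- m ≡ k
          cancel₂ = solve 2 (λ m k → k :+ m :- m := k) ≡.refl
            where open IntegerOrder
          term : ∀ u → finite u Perm.≈ Perm.id → apply u (ε v) w 𝔽.≈ indicator (does (u ≟ᶜ w⁺))
          term u f = begin
            actF (finite u) (ε v (inv u · w))
              ≈⟨ actF-cong (finite u) {ε v (inv u · w)} (ε-invariant v (inv u · w) (t ((w′ ⊞ m) ⊟ m)) (≗⇒~ {translation (inv u · w)} {(w′ ⊞ m) ⊟ m}
                   (λ x → ≡.trans (≡.sym (inv-translation u w f x)) (≡.sym (cancel₂ (m x) (w′ x)))))) ⟩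
            actF (finite u) (ε v (t ((w′ ⊞ m) ⊟ m)))
              ≈⟨ actF-cong (finite u) {ε v (t ((w′ ⊞ m) ⊟ m))} (𝔽.trans (ε-v (t (w′ ⊞ m))) (δ₀-indicator (t (w′ ⊞ m)))) ⟩
            actF (finite u) (indicator (does (idʷ ≟ᶜ t (w′ ⊞ m))))
              ≈⟨ act-indicator (finite u) (does (idʷ ≟ᶜ t (w′ ⊞ m))) ⟩
            indicator (does (idʷ ≟ᶜ t (w′ ⊞ m)))
              ≡⟨ ≡.cong indicator (does-⇔ (zero-move (translation u) (translation w) m) (idʷ ≟ᶜ t (w′ ⊞ m)) (u ≟ᶜ w⁺)) ⟩
            indicator (does (u ≟ᶜ w⁺)) ∎
            where w′ = translation w ⊟ translation u

    -- Conjugation transported to the coordinate ring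

    module Relations where
      open Setting ℝ n 2≤n
      open Residues
      open TwistedAlgebra
      open SchubertBasis
      open Centralizer
      open Conjugation
      open Isomorphism
      open Fractions S using (cancelˡ)
      open FractionField S using (Regular; fromRing)
      open SetoidReasoning 𝔽.setoid
      open IsSAlgebraIsomorphism isIsomorphism
      open IsRingMonomorphism isRingMonomorphism using (⟦⟧-cong; +-homo; *-homo; -‿homo)

      private
        module FC = FormalSums.Coefficients 𝔽 Wₑ _≟ʷ_
        module ZP = Presented S ZRelation

      φ-cong : ∀ {x y} → x Z.≈ y → φ x ≋ᵗ φ y
      φ-cong {x} {y} e = ≈ᵗ⇒≋ᵗ {φ x} {φ y} (⟦⟧-cong e)

      φ-⊕ : ∀ x y w → coefficient (φ (x ⊕ y)) w 𝔽.≈ coefficient (φ x) w 𝔽.+ coefficient (φ y) w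
      φ-⊕ x y w = 𝔽.trans (≈ᵗ⇒≋ᵗ {φ (x ⊕ y)} {φ x T.+ φ y} (+-homo x y) w) (FC.coeff-++ (φ x) (φ y) w)

      φ-⊖ : ∀ x w → coefficient (φ (⊖ x)) w 𝔽.≈ 𝔽.- coefficient (φ x) w
      φ-⊖ x w = 𝔽.trans (≈ᵗ⇒≋ᵗ {φ (⊖ x)} {T.- φ x} (-‿homo x) w) (FC.coeff-negate (φ x) w)

      φ-⊗ : ∀ x y → φ (x ⊗ y) ≋ᵗ φ x T.* φ y
      φ-⊗ x y = ≈ᵗ⇒≋ᵗ {φ (x ⊗ y)} {φ x T.* φ y} (*-homo x y)

      φ-con : ∀ p → φ (con p) ≋ᵗ fromS p
      φ-con p = ≈ᵗ⇒≋ᵗ {φ (con p)} {fromS p} (coefficients p)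

      φ-con-⊗ : ∀ p x → φ (con p ⊗ x) ≋ᵗ fromS p T.* φ x
      φ-con-⊗ p x w = 𝔽.trans (φ-⊗ (con p) x w) (*-congᵗ {φ (con p)} {fromS p} {φ x} {φ x} (φ-con p) (λ _ → 𝔽.refl) w)

      con-- : ∀ p q → con (p S.- q) Z.≈ con p Z.- con q
      con-- p q = Z.trans (ZP.con-+ p (S.- q)) (Z.+-congˡ (RingProperties.+-inverseˡ-unique Z.ring (con (S.- q)) (con q)
        (Z.trans (Z.sym (ZP.con-+ (S.- q) q)) (ZP.con-cong (S.-‿inverseˡ q)))))

      z-central : ∀ {i k} → 1 ℕ.≤ i → i ℕ.≤ k → suc k ℕ.≤ n →
                  z (suc i) (suc k) Z.≈ z i k Z.+ (con (a (+ i)) Z.- con (a (+ suc k))) Z.* z i (suc k)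
      z-central {i} {k} p q r = Z.trans (ZP.rel (centrality p q r))
        (Z.+-congˡ (Z.*-congʳ (con-- (a (+ i)) (a (+ suc k)))))

      z-zero : ∀ i k → k ℕ.< i → z i k ≡ con S.0#
      z-zero i k k<i with 1 ℕ.≤? i | i ℕ.≤? k | k ℕ.≤? n
      ... | yes _ | yes i≤k | yes _ = contradiction k<i (ℕ.≤⇒≯ i≤k)
      ... | yes _ | yes _   | no _  = ≡.refl
      ... | yes _ | no _    | _     = ≡.refl
      ... | no _  | _       | _     = ≡.refl

      module Twist (π : Permutation′ n) where
        infix 4 _⟿_

        -- Conjugation acts on the twisted algebra and permutes the coefficients S. On the
        -- coordinate ring it is recorded as a relation between preimages under φ, compatible with
        -- the ring operations.
        _⟿_ : Z.Carrier → Z.Carrier → Set _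
        x ⟿ y = conjugate π (φ x) ≋ᵗ φ y

        private
          at : Z.Carrier → Wₑ → 𝔽.Carrier
          at x w = actF π (coefficient (φ x) (conjugateʷ (Perm.flip π) w))

          from-at : ∀ {x y} → (∀ w → at x w 𝔽.≈ coefficient (φ y) w) → x ⟿ y
          from-at {x} e w = 𝔽.trans (coefficient-conjugate π (φ x) w) (e w)

          to-at : ∀ {x y} → x ⟿ y → ∀ w → at x w 𝔽.≈ coefficient (φ y) w
          to-at {x} e w = 𝔽.trans (𝔽.sym (coefficient-conjugate π (φ x) w)) (e w)

        ⟿-resp : ∀ {x x′ y y′} → x Z.≈ x′ → y Z.≈ y′ → x ⟿ y → x′ ⟿ y′
        ⟿-resp {x} {x′} {y} {y′} e f r w = 𝔽.trans (conjugate-cong π {φ x′} {φ x} (φ-cong (Z.sym e)) w)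
          (𝔽.trans (r w) (φ-cong f w))

        ⟿-⊕ : ∀ {x x′ y y′} → x ⟿ y → x′ ⟿ y′ → x ⊕ x′ ⟿ y ⊕ y′
        ⟿-⊕ {x} {x′} {y} {y′} e f = from-at {x ⊕ x′} {y ⊕ y′} λ w → begin
          at (x ⊕ x′) w
            ≈⟨ actF-cong π (φ-⊕ x x′ (conjugateʷ (Perm.flip π) w)) ⟩
          actF π (coefficient (φ x) (conjugateʷ (Perm.flip π) w) 𝔽.+ coefficient (φ x′) (conjugateʷ (Perm.flip π) w))
            ≈⟨ actF-+ π (coefficient (φ x) (conjugateʷ (Perm.flip π) w)) (coefficient (φ x′) (conjugateʷ (Perm.flip π) w)) ⟩
          at x w 𝔽.+ at x′ w
            ≈⟨ 𝔽.+-cong (to-at {x} {y} e w) (to-at {x′} {y′} f w) ⟩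
          coefficient (φ y) w 𝔽.+ coefficient (φ y′) w
            ≈⟨ φ-⊕ y y′ w ⟨
          coefficient (φ (y ⊕ y′)) w ∎

        ⟿-⊖ : ∀ {x y} → x ⟿ y → ⊖ x ⟿ ⊖ y
        ⟿-⊖ {x} {y} e = from-at {⊖ x} {⊖ y} λ w → begin
          at (⊖ x) w
            ≈⟨ actF-cong π (φ-⊖ x (conjugateʷ (Perm.flip π) w)) ⟩
          actF π (𝔽.- coefficient (φ x) (conjugateʷ (Perm.flip π) w))
            ≈⟨ frac-≡ {actF π (𝔽.- coefficient (φ x) (conjugateʷ (Perm.flip π) w))} {𝔽.- at x w} ≡.refl ≡.refl ⟩
          𝔽.- at x w
            ≈⟨ 𝔽.-‿cong (to-at {x} {y} e w) ⟩
          𝔽.- coefficient (φ y) w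
            ≈⟨ φ-⊖ y w ⟨
          coefficient (φ (⊖ y)) w ∎

        ⟿-⊗ : ∀ {x x′ y y′} → x ⟿ y → x′ ⟿ y′ → x ⊗ x′ ⟿ y ⊗ y′
        ⟿-⊗ {x} {x′} {y} {y′} e f w = begin
          coefficient (conjugate π (φ (x ⊗ x′))) w
            ≈⟨ conjugate-cong π {φ (x ⊗ x′)} {φ x T.* φ x′} (φ-⊗ x x′) w ⟩
          coefficient (conjugate π (φ x T.* φ x′)) w
            ≈⟨ conjugate-* π (φ x) (φ x′) w ⟩
          coefficient (conjugate π (φ x) T.* conjugate π (φ x′)) w
            ≈⟨ *-congᵗ {conjugate π (φ x)} {φ y} {conjugate π (φ x′)} {φ y′} e f w ⟩
          coefficient (φ y T.* φ y′) w
            ≈⟨ φ-⊗ y y′ w ⟨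
          coefficient (φ (y ⊗ y′)) w ∎

        ⟿-con : ∀ p → con p ⟿ con (permute π p)
        ⟿-con p = from-at {con p} {con (permute π p)} λ w → let ŵ = conjugateʷ (Perm.flip π) w in begin
          at (con p) w
            ≈⟨ actF-cong π (𝔽.trans (φ-con p ŵ) (coefficient-fromS p ŵ)) ⟩
          actF π (fromRing p 𝔽.* indicator (does (idʷ ≟ʷ ŵ)))
            ≈⟨ actF-* π (fromRing p) (indicator (does (idʷ ≟ʷ ŵ))) ⟩
          actF π (fromRing p) 𝔽.* actF π (indicator (does (idʷ ≟ʷ ŵ)))
            ≈⟨ 𝔽.*-cong (frac-≡ {actF π (fromRing p)} {fromRing (permute π p)} ≡.refl ≡.refl)
                 (𝔽.trans (act-indicator π (does (idʷ ≟ʷ ŵ))) (𝔽.reflexive (≡.cong indicator (conjugate-id w)))) ⟩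
          fromRing (permute π p) 𝔽.* indicator (does (idʷ ≟ʷ w))
            ≈⟨ 𝔽.trans (φ-con (permute π p) w) (coefficient-fromS (permute π p) w) ⟨
          coefficient (φ (con (permute π p))) w ∎
          where
          conjugate-id : ∀ w → does (idʷ ≟ʷ conjugateʷ (Perm.flip π) w) ≡ does (idʷ ≟ʷ w)
          conjugate-id w = does-⇔ (mk⇔
            (λ e → ≈ʷ-trans {idʷ} {conjugateʷ π idʷ} {w} (≈ʷ-sym {conjugateʷ π idʷ} {idʷ} fixed-id) (Equivalence.from (conjugateʷ-⇔ π idʷ w) e))
            (λ e → Equivalence.to (conjugateʷ-⇔ π idʷ w) (≈ʷ-trans {conjugateʷ π idʷ} {idʷ} {w} fixed-id e)))
            (idʷ ≟ʷ conjugateʷ (Perm.flip π) w) (idʷ ≟ʷ w)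
            where
            fixed-id : conjugateʷ π idʷ ≈ʷ idʷ
            fixed-id = ≗⇒≈ʷ {conjugateʷ π idʷ} {idʷ} (λ _ → ≡.refl) (λ x → Perm.inverseʳ π)

        -- Coefficients lie in F, where a regular scalar can be divided out. This is how an entry
        -- above the diagonal is solved from the centrality relation.
        ⟿-cancel : ∀ p {x y} → Regular (permute π p) → con p ⊗ x ⟿ con (permute π p) ⊗ y → x ⟿ y
        ⟿-cancel p {x} {y} regular e = from-at {x} {y} λ w → cancelˡ regular (begin
          fromRing (permute π p) 𝔽.* at x w
            ≈⟨ 𝔽.*-congʳ {at x w} (frac-≡ {fromRing (permute π p)} {actF π (fromRing p)} ≡.refl ≡.refl) ⟩
          actF π (fromRing p) 𝔽.* at x w
            ≈⟨ actF-* π (fromRing p) (coefficient (φ x) (conjugateʷ (Perm.flip π) w)) ⟨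
          actF π (fromRing p 𝔽.* coefficient (φ x) (conjugateʷ (Perm.flip π) w))
            ≈⟨ actF-cong π (𝔽.trans (φ-con-⊗ p x (conjugateʷ (Perm.flip π) w)) (coefficient-fromS-* p (φ x) (conjugateʷ (Perm.flip π) w))) ⟨
          at (con p ⊗ x) w
            ≈⟨ to-at {con p ⊗ x} {con (permute π p) ⊗ y} e w ⟩
          coefficient (φ (con (permute π p) ⊗ y)) w
            ≈⟨ 𝔽.trans (φ-con-⊗ (permute π p) y w) (coefficient-fromS-* (permute π p) (φ y) w) ⟩
          fromRing (permute π p) 𝔽.* coefficient (φ y) w ∎)

        ⟿-sum : ∀ {k} {f g : Fin k → Z.Carrier} → (∀ q → f q ⟿ g q) → SemiringSum.sum Z.semiring f ⟿ SemiringSum.sum Z.semiring g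
        ⟿-sum {zero}  e = ⟿-con S.0#
        ⟿-sum {suc k} {f} {g} e = ⟿-⊕ {f zero} {SemiringSum.sum Z.semiring (f ∘ suc)} {g zero} {SemiringSum.sum Z.semiring (g ∘ suc)}
          (e zero) (⟿-sum {k} {f ∘ suc} {g ∘ suc} (e ∘ suc))

        open DeterminantProperties ℂ[Z̃] using (sign; minor₀; Matrix)
        open Determinant ℂ[Z̃] using (det)
        open RawSemiringDefs (RawRing.rawSemiring Z.rawRing) using (_^_)

        ⟿-sign : ∀ k → (Z.- Z.1#) ^ k ⟿ (Z.- Z.1#) ^ k
        ⟿-sign zero    = ⟿-con S.1#
        ⟿-sign (suc k) = ⟿-⊗ {Z.- Z.1#} {(Z.- Z.1#) ^ k} {Z.- Z.1#} {(Z.- Z.1#) ^ k} (⟿-⊖ {Z.1#} {Z.1#} (⟿-con S.1#)) (⟿-sign k)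

        ⟿-det : ∀ {k} (M N : Matrix k) → (∀ r q → M r q ⟿ N r q) → det M ⟿ det N
        ⟿-det {zero} M N e = ⟿-con S.1#
        ⟿-det {suc k} M N e = ⟿-sum {suc k} {λ q → sign q Z.* M zero q Z.* det (minor₀ M q)} {λ q → sign q Z.* N zero q Z.* det (minor₀ N q)} λ q →
          ⟿-⊗ {sign q Z.* M zero q} {det (minor₀ M q)} {sign q Z.* N zero q} {det (minor₀ N q)}
            (⟿-⊗ {sign q} {M zero q} {sign q} {N zero q} (⟿-sign (toℕ q)) (e zero q))
            (⟿-det (minor₀ M q) (minor₀ N q) λ r s → e (suc r) (Fin.punchIn q s))

        -- The rule π t_l π⁻¹ = t_{πl} for the unit vectors l that belong to the diagonal entries.
        ⟿-diagonal : ∀ {p p′} → 1 ℕ.≤ p → p ℕ.≤ n → 1 ℕ.≤ p′ → p′ ℕ.≤ n → π ⟨$⟩ʳ res (+ p) ≡ res (+ p′) → z p p ⟿ z p′ p′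
        ⟿-diagonal {p} {p′} 1≤p p≤n 1≤p′ p′≤n e w = 𝔽.trans (conjugate-cong π {φ (z p p)} {[ t (unit (+ p)) ]} (φ-diagonal p 1≤p p≤n) w)
          (𝔽.trans (FC.coeff-total (conjugate π [ t (unit (+ p)) ]) w) (𝔽.trans singleton
          (𝔽.trans (𝔽.sym (FC.coeff-total [ t (unit (+ p′)) ] w)) (𝔽.sym (φ-diagonal p′ 1≤p′ p′≤n w)))))
          where
          equal : conjugateʷ π (t (unit (+ p))) ≈ʷ t (unit (+ p′))
          equal = ≗⇒≈ʷ {conjugateʷ π (t (unit (+ p)))} {t (unit (+ p′))}
            (λ x → ≡.trans (ℤ.+-identityʳ _) (≡.trans (ℤ.+-identityˡ _) (≡.trans
              (≡.cong (λ b → if b then + 1 else + 0) (does-⇔ (mk⇔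
                (λ q → ≡.trans (≡.sym (Perm.inverseʳ π)) (≡.trans (≡.cong (π ⟨$⟩ʳ_) q) e))
                (λ q → ≡.trans (≡.cong (π ⟨$⟩ˡ_) (≡.trans q (≡.sym e))) (Perm.inverseˡ π)))
                ((π ⟨$⟩ˡ x) Fin.≟ res (+ p)) (x Fin.≟ res (+ p′)))) ≡.refl)))
            (λ x → Perm.inverseʳ π)
          singleton : total (conjugate π [ t (unit (+ p)) ]) (λ v → indicator (does (v ≟ʷ w))) 𝔽.≈
                      total [ t (unit (+ p′)) ] (λ v → indicator (does (v ≟ʷ w)))
          singleton = 𝔽.+-congʳ {𝔽.0#} {actF π 𝔽.1# 𝔽.* indicator (does (conjugateʷ π (t (unit (+ p))) ≟ʷ w))}
            {𝔽.1# 𝔽.* indicator (does (t (unit (+ p′)) ≟ʷ w))} (𝔽.*-cong {actF π 𝔽.1#} {𝔽.1#} (actF-1 π) (𝔽.reflexive (≡.cong indicator (does-⇔ (mk⇔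
            (λ q → ≈ʷ-trans {t (unit (+ p′))} {conjugateʷ π (t (unit (+ p)))} {w} (≈ʷ-sym {conjugateʷ π (t (unit (+ p)))} {t (unit (+ p′))} equal) q)
            (λ q → ≈ʷ-trans {conjugateʷ π (t (unit (+ p)))} {t (unit (+ p′))} {w} equal q))
            (conjugateʷ π (t (unit (+ p))) ≟ʷ w) (t (unit (+ p′)) ≟ʷ w)))))

    -- Simple reflections acting on the matrix and on its minors

    module Minors where
      open Setting ℝ n 2≤n
      open Residues
      open WeylGroup
      open TwistedAlgebra
      open PetersonOperators using (swap)
      open Centralizer
      open Isomorphism
      open SetoidReasoning 𝔽.setoid
      open Relations

      open CentralityIdentities ℂ[Z̃]
      open DeterminantProperties ℂ[Z̃]
      open Determinant ℂ[Z̃] using (det)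

      parameter : ℕ → Z.Carrier
      parameter i = con (a (+ i))

      column : ∀ {k} → Vector ℕ k → Fin k → ℕ
      column l q = l (opposite q) ℕ.+ suc (toℕ q)

      private
        module _ where
          open CommutativeRing ℂ[Z̃] using (_+_; _*_; _-_; -_; 0#; refl) renaming (_≈_ to _≈ₚ_)
          open IntegerSolver ℂ[Z̃]

          vanish₁ : ∀ b → 0# + b * 0# ≈ₚ 0#
          vanish₁ = solve 1 (λ b → :0 :+ b :* :0 := :0) refl

          vanish₂ : ∀ b → 0# - b * 0# ≈ₚ 0#
          vanish₂ = solve 1 (λ b → :0 :- b :* :0 := :0) refl

          rewrite-minus : ∀ b x y → x - b * y ≈ₚ x + (- b) * y
          rewrite-minus = solve 3 (λ b x y → x :- b :* y := x :+ (:- b) :* y) refl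

        claim-cong : ∀ {w₁ w₁′ w₂ w₂′ w₃ w₃′ x x′ y y′ : Z.Carrier} → w₁ ≡ w₁′ → w₂ ≡ w₂′ → x ≡ x′ → y ≡ y′ → w₃ ≡ w₃′ →
                     w₁′ Z.- w₂′ Z.≈ (x′ Z.- y′) Z.* w₃′ → w₁ Z.- w₂ Z.≈ (x Z.- y) Z.* w₃
        claim-cong ≡.refl ≡.refl ≡.refl ≡.refl ≡.refl e = e

      module Adjacent (c : ℕ) (1≤c : 1 ℕ.≤ c) (c<n : c ℕ.< n) where
        π : Permutation′ n
        π = swap (res (+ c))

        open Twist π

        β : Z.Carrier
        β = parameter c Z.- parameter (suc c)

        -- Conjugation by π acts on (z_ij) by a column and a row operation.
        by-column by-column-and-row : ℕ → ℕ → Z.Carrier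
        by-column i d with d ℕ.≟ c
        ... | yes _ = z i c Z.+ β Z.* z i (suc c)
        ... | no _  = z i d

        by-column-and-row i d with i ℕ.≟ suc c
        ... | yes _ = by-column (suc c) d Z.- β Z.* by-column c d
        ... | no _  = by-column i d

        by-column-≡ : ∀ i → by-column i c ≡ z i c Z.+ β Z.* z i (suc c)
        by-column-≡ i with c ℕ.≟ c
        ... | yes _ = ≡.refl
        ... | no ne = contradiction ≡.refl ne

        by-column-≢ : ∀ i {d} → d ≢ c → by-column i d ≡ z i d
        by-column-≢ i {d} ne with d ℕ.≟ c
        ... | yes e = contradiction e ne
        ... | no _  = ≡.refl

        by-row-≡ : ∀ d → by-column-and-row (suc c) d ≡ by-column (suc c) d Z.- β Z.* by-column c d
        by-row-≡ d with suc c ℕ.≟ suc c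
        ... | yes _ = ≡.refl
        ... | no ne = contradiction ≡.refl ne

        by-row-≢ : ∀ {i} d → i ≢ suc c → by-column-and-row i d ≡ by-column i d
        by-row-≢ {i} d ne with i ℕ.≟ suc c
        ... | yes e = contradiction e ne
        ... | no _  = ≡.refl

        private
          π-here : π ⟨$⟩ʳ res (+ c) ≡ res (+ suc c)
          π-here = ≡.trans (transpose-left (res (+ c)) (nxt (res (+ c)))) (nxt-res-+ c)

          π-next : π ⟨$⟩ʳ res (+ suc c) ≡ res (+ c)
          π-next = ≡.trans (≡.cong (π ⟨$⟩ʳ_) (≡.sym (nxt-res-+ c))) (transpose-right (res (+ c)) (nxt (res (+ c))))

          π-other : ∀ {i} → 1 ℕ.≤ i → i ℕ.≤ n → i ≢ c → i ≢ suc c → π ⟨$⟩ʳ res (+ i) ≡ res (+ i)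
          π-other 1≤i i≤n p q = transpose-other (res (+ c)) (nxt (res (+ c)))
            (res-+-≢ 1≤i i≤n 1≤c (ℕ.<⇒≤ c<n) p)
            (λ e → res-+-≢ 1≤i i≤n (s≤s z≤n) c<n q (≡.trans e (nxt-res-+ c)))

          moved : ℕ → Z.Carrier
          moved i = con (var (π ⟨$⟩ʳ res (+ i)))

          moved-here : moved c ≡ parameter (suc c)
          moved-here = ≡.cong (λ v → con (var v)) π-here

          moved-next : moved (suc c) ≡ parameter c
          moved-next = ≡.cong (λ v → con (var v)) π-next

          moved-other : ∀ {i} → 1 ℕ.≤ i → i ℕ.≤ n → i ≢ c → i ≢ suc c → moved i ≡ parameter i
          moved-other p q r s = ≡.cong (λ v → con (var v)) (π-other p q r s)

          Twisted-centrality : ℕ → ℕ → Set _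
          Twisted-centrality i d = by-column-and-row (suc i) (suc d) Z.- by-column-and-row i d Z.≈
                                   (moved i Z.- moved (suc d)) Z.* by-column-and-row i (suc d)

        -- The conjugated entries satisfy the centrality relation with a_c and a_{c+1} exchanged.
        -- Once the new matrix satisfies the same relation, agreement on the diagonal propagates to
        -- all entries above it.
        twisted-centrality : ∀ i d → 1 ℕ.≤ i → i ℕ.≤ d → suc d ℕ.≤ n → Twisted-centrality i d
        twisted-centrality i d 1≤i i≤d d<n = by (i ℕ.≟ c) (i ℕ.≟ suc c) (d ℕ.≟ c) (suc d ℕ.≟ c)
          where
          central : z (suc i) (suc d) Z.≈ z i d Z.+ (parameter i Z.- parameter (suc d)) Z.* z i (suc d)
          central = z-central 1≤i i≤d d<n
          i≤n : i ℕ.≤ n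
          i≤n = ℕ.≤-trans i≤d (ℕ.<⇒≤ d<n)
          by : Dec (i ≡ c) → Dec (i ≡ suc c) → Dec (d ≡ c) → Dec (suc d ≡ c) → Twisted-centrality i d
          by (yes ≡.refl) _ (yes ≡.refl) _ = claim-cong
            (≡.trans (by-row-≡ (suc c)) (≡.cong₂ (λ x y → x Z.- β Z.* y) (by-column-≢ (suc c) ℕ.1+n≢n) (by-column-≢ c ℕ.1+n≢n)))
            (≡.trans (by-row-≢ c (ℕ.1+n≢n ∘ ≡.sym)) (by-column-≡ c)) moved-here moved-next
            (≡.trans (by-row-≢ (suc c) (ℕ.1+n≢n ∘ ≡.sym)) (by-column-≢ c ℕ.1+n≢n))
            (corner _ _ _ _ _ central)
          by (yes ≡.refl) _ (no d≢c) _ = claim-cong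
            (≡.trans (by-row-≡ (suc d)) (≡.cong₂ (λ x y → x Z.- β Z.* y) (by-column-≢ (suc c) 1+d≢c) (by-column-≢ c 1+d≢c)))
            (≡.trans (by-row-≢ d (ℕ.1+n≢n ∘ ≡.sym)) (by-column-≢ c d≢c)) moved-here
            (moved-other (s≤s z≤n) d<n 1+d≢c (d≢c ∘ ℕ.suc-injective))
            (≡.trans (by-row-≢ (suc d) (ℕ.1+n≢n ∘ ≡.sym)) (by-column-≢ c 1+d≢c))
            (out-of-row _ _ _ _ _ _ central)
            where
            1+d≢c : suc d ≢ c
            1+d≢c e = ℕ.1+n≰n (ℕ.≤-trans (ℕ.≤-reflexive e) i≤d)
          by (no i≢c) (yes ≡.refl) (yes ≡.refl) _ = contradiction i≤d ℕ.1+n≰n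
          by (no i≢c) (yes ≡.refl) (no d≢c) _ = claim-cong
            (≡.trans (by-row-≢ (suc d) ℕ.1+n≢n) (by-column-≢ (suc (suc c)) 1+d≢c))
            (≡.trans (by-row-≡ d) (≡.cong₂ (λ x y → x Z.- β Z.* y) (by-column-≢ (suc c) d≢c) (by-column-≢ c d≢c)))
            moved-next (moved-other (s≤s z≤n) d<n 1+d≢c (d≢c ∘ ℕ.suc-injective))
            (≡.trans (by-row-≡ (suc d)) (≡.cong₂ (λ x y → x Z.- β Z.* y) (by-column-≢ (suc c) 1+d≢c) (by-column-≢ c 1+d≢c)))
            (into-row _ _ _ _ _ _ _ _ central (z-central 1≤c (ℕ.<⇒≤ i≤d) d<n))
            where
            1+d≢c : suc d ≢ c
            1+d≢c e = ℕ.1+n≰n (ℕ.≤-trans (ℕ.≤-reflexive e) (ℕ.<⇒≤ i≤d))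
          by (no i≢c) (no i≢1+c) (yes ≡.refl) _ = claim-cong
            (≡.trans (by-row-≢ (suc c) (i≢c ∘ ℕ.suc-injective)) (by-column-≢ (suc i) ℕ.1+n≢n))
            (≡.trans (by-row-≢ c i≢1+c) (by-column-≡ i))
            (moved-other 1≤i i≤n i≢c i≢1+c) moved-next
            (≡.trans (by-row-≢ (suc c) i≢1+c) (by-column-≢ i ℕ.1+n≢n))
            (out-of-column _ _ _ _ _ _ central)
          by (no i≢c) (no i≢1+c) (no d≢c) (yes ≡.refl) = claim-cong
            (≡.trans (by-row-≢ (suc d) (i≢c ∘ ℕ.suc-injective)) (by-column-≡ (suc i)))
            (≡.trans (by-row-≢ d i≢1+c) (by-column-≢ i d≢c))
            (moved-other 1≤i i≤n i≢c i≢1+c) moved-here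
            (≡.trans (by-row-≢ (suc d) i≢1+c) (by-column-≡ i))
            (into-column _ _ _ _ _ _ _ _ central (z-central 1≤i (ℕ.≤-trans i≤d (ℕ.n≤1+n d)) c<n))
          by (no i≢c) (no i≢1+c) (no d≢c) (no 1+d≢c) = claim-cong
            (≡.trans (by-row-≢ (suc d) (i≢c ∘ ℕ.suc-injective)) (by-column-≢ (suc i) 1+d≢c))
            (≡.trans (by-row-≢ d i≢1+c) (by-column-≢ i d≢c))
            (moved-other 1≤i i≤n i≢c i≢1+c) (moved-other (s≤s z≤n) d<n 1+d≢c (d≢c ∘ ℕ.suc-injective))
            (≡.trans (by-row-≢ (suc d) i≢1+c) (by-column-≢ i 1+d≢c))
            (plain _ _ _ _ _ central)

        private
          central-c : z (suc c) (suc c) Z.≈ z c c Z.+ β Z.* z c (suc c)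
          central-c = z-central 1≤c ℕ.≤-refl c<n

          -- Conjugation exchanges z_cc and z_{c+1,c+1}. By centrality they differ by β z_{c,c+1},
          -- the amount that the column operation adds at (c, c) and the row operation subtracts at
          -- (c + 1, c + 1).
          entry-diagonal : ∀ i → 1 ℕ.≤ i → i ℕ.≤ n → z i i ⟿ by-column-and-row i i
          entry-diagonal i 1≤i i≤n = by (i ℕ.≟ c) (i ℕ.≟ suc c)
            where
            by : Dec (i ≡ c) → Dec (i ≡ suc c) → z i i ⟿ by-column-and-row i i
            by (yes ≡.refl) _ = ⟿-resp {z c c} {z c c} {z (suc c) (suc c)} {by-column-and-row c c} Z.refl
              (Z.trans central-c (Z.reflexive (≡.sym (≡.trans (by-row-≢ c (ℕ.1+n≢n ∘ ≡.sym)) (by-column-≡ c)))))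
              (⟿-diagonal 1≤i i≤n (s≤s z≤n) c<n π-here)
            by (no i≢c) (yes ≡.refl) = ⟿-resp {z i i} {z i i} {z c c} {by-column-and-row i i} Z.refl
              (Z.trans (Z.sym (diagonal-down _ _ _ _ _ central-c)) (Z.reflexive (≡.sym (≡.trans (by-row-≡ i)
                (≡.cong₂ (λ x y → x Z.- β Z.* y) (by-column-≢ i i≢c) (by-column-≢ c i≢c))))))
              (⟿-diagonal 1≤i i≤n 1≤c (ℕ.<⇒≤ c<n) π-next)
            by (no i≢c) (no i≢1+c) = ⟿-resp {z i i} {z i i} {z i i} {by-column-and-row i i} Z.refl
              (Z.reflexive (≡.sym (≡.trans (by-row-≢ i i≢1+c) (by-column-≢ i i≢c))))
              (⟿-diagonal 1≤i i≤n 1≤i i≤n (π-other 1≤i i≤n i≢c i≢1+c))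

          -- Induction on the distance m from the diagonal: (a_i - a_{d+1}) z_{i,d+1} = z_{i+1,d+1}
          -- - z_{i,d} expresses an entry through two entries one step nearer to the diagonal, up to
          -- a factor that is regular because i < d + 1.
          entry-above : ∀ m i d → i ℕ.+ m ≡ d → 1 ℕ.≤ i → d ℕ.≤ n → z i d ⟿ by-column-and-row i d
          entry-above zero i d e 1≤i d≤n = ≡.subst (λ d → d ℕ.≤ n → z i d ⟿ by-column-and-row i d)
            (≡.trans (≡.sym (ℕ.+-identityʳ i)) e) (entry-diagonal i 1≤i) d≤n
          entry-above (suc m) i zero e 1≤i d≤n = contradiction (≡.trans (≡.sym (ℕ.+-suc i m)) e) λ ()
          entry-above (suc m) i (suc d) e 1≤i d≤n = ⟿-cancel p {z i (suc d)} {by-column-and-row i (suc d)}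
            (regular-difference (λ q → res-+-≢ 1≤i (ℕ.≤-trans i≤d (ℕ.<⇒≤ d≤n)) (s≤s z≤n) d≤n (ℕ.<⇒≢ (s≤s i≤d))
              (≡.trans (≡.sym (Perm.inverseˡ π)) (≡.trans (≡.cong (π ⟨$⟩ˡ_) q) (Perm.inverseˡ π)))))
            (⟿-resp {z (suc i) (suc d) Z.- z i d} {con p Z.* z i (suc d)}
              {by-column-and-row (suc i) (suc d) Z.- by-column-and-row i d} {con (permute π p) Z.* by-column-and-row i (suc d)}
              (Z.trans (plain _ _ _ _ _ (z-central 1≤i i≤d d≤n)) (Z.*-congʳ (Z.sym (con-- (a (+ i)) (a (+ suc d))))))
              (Z.trans (twisted-centrality i d 1≤i i≤d d≤n) (Z.*-congʳ (Z.sym (con-- (var (π ⟨$⟩ʳ res (+ i))) (var (π ⟨$⟩ʳ res (+ suc d)))))))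
              (⟿-⊕ {z (suc i) (suc d)} {⊖ z i d} {by-column-and-row (suc i) (suc d)} {⊖ by-column-and-row i d}
                (entry-above m (suc i) (suc d) (≡.trans (≡.sym (ℕ.+-suc i m)) e) (s≤s z≤n) d≤n)
                (⟿-⊖ {z i d} {by-column-and-row i d} (entry-above m i d i+m≡d 1≤i (ℕ.<⇒≤ d≤n)))))
            where
            p = a (+ i) S.- a (+ suc d)
            i+m≡d : i ℕ.+ m ≡ d
            i+m≡d = ℕ.suc-injective (≡.trans (≡.sym (ℕ.+-suc i m)) e)
            i≤d : i ℕ.≤ d
            i≤d = ℕ.≤-trans (ℕ.m≤m+n i m) (ℕ.≤-reflexive i+m≡d)

          -- The critical entry is (c + 1, c): the column operation puts β z_{c+1,c+1} there and the
          -- row operation takes away β (z_cc + β z_{c,c+1}), which is the same by centrality.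
          -- Elsewhere the operations combine zeros.
          by-row-below : ∀ i d → d ℕ.< i → by-column-and-row i d Z.≈ Z.0#
          by-row-below i d d<i = by (i ℕ.≟ suc c) (d ℕ.≟ c)
            where
            by : Dec (i ≡ suc c) → Dec (d ≡ c) → by-column-and-row i d Z.≈ Z.0#
            by (yes ≡.refl) (yes ≡.refl) = Z.trans (Z.reflexive (≡.trans (by-row-≡ c)
                (≡.cong₂ (λ x y → x Z.- β Z.* y) (≡.trans (by-column-≡ (suc c)) (≡.cong (Z._+ β Z.* z (suc c) (suc c)) (z-zero (suc c) c d<i))) (by-column-≡ c))))
              (below-diagonal _ _ _ _ _ central-c)
            by (yes ≡.refl) (no d≢c) = Z.trans (Z.reflexive (≡.trans (by-row-≡ d)
                (≡.cong₂ (λ x y → x Z.- β Z.* y) (≡.trans (by-column-≢ (suc c) d≢c) (z-zero (suc c) d d<i))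
                  (≡.trans (by-column-≢ c d≢c) (z-zero c d (ℕ.≤∧≢⇒< (ℕ.≤-pred d<i) d≢c))))))
              (vanish₂ β)
            by (no i≢) (yes ≡.refl) = Z.trans (Z.reflexive (≡.trans (by-row-≢ c i≢) (≡.trans (by-column-≡ i)
                (≡.cong₂ (λ x y → x Z.+ β Z.* y) (z-zero i c d<i) (z-zero i (suc c) (ℕ.≤∧≢⇒< d<i (i≢ ∘ ≡.sym)))))))
              (vanish₁ β)
            by (no i≢) (no d≢c) = Z.reflexive (≡.trans (by-row-≢ d i≢) (≡.trans (by-column-≢ i d≢c) (z-zero i d d<i)))

        entry : ∀ i d → 1 ℕ.≤ i → d ℕ.≤ n → z i d ⟿ by-column-and-row i d
        entry i d 1≤i d≤n = by (i ℕ.≤? d)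
          where
          by : Dec (i ℕ.≤ d) → z i d ⟿ by-column-and-row i d
          by (yes i≤d) = entry-above (d ℕ.∸ i) i d (ℕ.m+[n∸m]≡n i≤d) 1≤i d≤n
          by (no i≰d)  = ⟿-resp {Z.0#} {z i d} {Z.0#} {by-column-and-row i d} (Z.reflexive (≡.sym (z-zero i d (ℕ.≰⇒> i≰d))))
            (Z.sym (by-row-below i d (ℕ.≰⇒> i≰d))) (⟿-con S.0#)

        module _ {k} (l l′ : Vector ℕ k) (q₀ : Fin k) (bounded : ∀ q → column l q ℕ.≤ n)
          (at-q₀ : column l q₀ ≡ c) (at-q₀′ : column l′ q₀ ≡ suc c)
          (elsewhere : ∀ q → q ≢ q₀ → column l q ≢ c × column l′ q ≡ column l q) where

          private
            X Y : Matrix k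
            X r q = by-column-and-row (suc (toℕ r)) (column l q)
            Y r q = by-column (suc (toℕ r)) (column l q)

          -- The row operation adds a multiple of row c to row c + 1. Among the first k rows, row c
          -- + 1 either does not occur or occurs together with row c, so the minor is unchanged.
          det-row-step : det X Z.≈ det Y
          -- Indices of rows start from 0, so index c belongs to row c + 1.
          det-row-step = by (Fin.any? λ r → toℕ r ℕ.≟ c)
            where
            operate : ∀ {k} {M N : Matrix k} (r : Fin k) → toℕ r ≡ c →
                      (∀ r′ → suc (toℕ r′) ≡ c → ∀ q → M r q Z.≈ N r q Z.+ (Z.- β) Z.* N r′ q) →
                      (∀ i q → i ≢ r → M i q Z.≈ N i q) → det M Z.≈ det N
            operate zero e _ _ = contradiction e (ℕ.<⇒≢ 1≤c)
            operate {suc k} {M} {N} (suc r) e p p′ = det-row-operation (Z.- β) r {M} {N}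
              (p (Fin.inject₁ r) (≡.trans (≡.cong suc (Fin.toℕ-inject₁ r)) e)) p′
            by : Dec (∃[ r ] toℕ r ≡ c) → det X Z.≈ det Y
            by (yes (r , e)) = operate {k} {X} {Y} r e
              (λ r′ e′ q → Z.trans (Z.reflexive (≡.trans (≡.cong (λ i → by-column-and-row (suc i) (column l q)) e) (by-row-≡ (column l q))))
                (Z.trans (rewrite-minus β (by-column (suc c) (column l q)) (by-column c (column l q)))
                (Z.reflexive (≡.cong₂ (λ x y → by-column (suc x) (column l q) Z.+ (Z.- β) Z.* by-column y (column l q)) (≡.sym e) (≡.sym e′)))))
              (λ i q i≢r → Z.reflexive (by-row-≢ (column l q) λ p → i≢r (Fin.toℕ-injective (≡.trans (ℕ.suc-injective p) (≡.sym e)))))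
            by (no ∄) = det-cong λ r q → Z.reflexive (by-row-≢ (column l q) λ p → ∄ (r , ℕ.suc-injective p))

          det-column-step : det Y Z.≈ minor l Z.+ β Z.* minor l′
          det-column-step = det-column-linear β q₀ {Y} {λ r q → z (suc (toℕ r)) (column l q)} {λ r q → z (suc (toℕ r)) (column l′ q)}
            (λ r → Z.reflexive (≡.trans (≡.cong (by-column (suc (toℕ r))) at-q₀) (≡.trans (by-column-≡ (suc (toℕ r)))
              (≡.cong₂ (λ x y → z (suc (toℕ r)) x Z.+ β Z.* z (suc (toℕ r)) y) (≡.sym at-q₀) (≡.sym at-q₀′)))))
            (λ r q q≢ → Z.reflexive (by-column-≢ (suc (toℕ r)) (proj₁ (elsewhere q q≢))) ,
              Z.reflexive (≡.trans (by-column-≢ (suc (toℕ r)) (proj₁ (elsewhere q q≢))) (≡.cong (z (suc (toℕ r))) (≡.sym (proj₂ (elsewhere q q≢))))))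

          minor-step : minor l ⟿ minor l Z.+ con (a (+ c) S.- a (+ suc c)) Z.* minor l′
          minor-step = ⟿-resp {minor l} {minor l} {det X} {minor l Z.+ con (a (+ c) S.- a (+ suc c)) Z.* minor l′} Z.refl
            (Z.trans det-row-step (Z.trans det-column-step (Z.+-congˡ (Z.*-congʳ (Z.sym (con-- (a (+ c)) (a (+ suc c))))))))
            (⟿-det (λ r q → z (suc (toℕ r)) (column l q)) X λ r q → entry (suc (toℕ r)) (column l q) (s≤s z≤n) (bounded q))

    -- Coset functions of minors

    module Comparison where
      open Setting ℝ n 2≤n
      open Residues
      open WeylGroup
      open Lengths
      open TwistedAlgebra
      open PetersonOperators using (act₂-cong; invariant-window; 1/α; swap; reflect; window-reflect; cancel-window) renaming (A to Aᵒ)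
      open SchubertBasis
      open Centralizer
      open Conjugation
      open Isomorphism
      open Fractions S using (wrap)
      open FractionField S using (fromRing)
      open SetoidReasoning 𝔽.setoid
      open Relations
      open Minors
      open IsRingMonomorphism (IsSAlgebraIsomorphism.isRingMonomorphism isIsomorphism) using (+-homo)

      open DividedDifferences 𝔽 Wₑ using (difference-def)
      open DeterminantProperties ℂ[Z̃] using (Matrix; det-cong; det-first-column)
      open Determinant ℂ[Z̃] using (det)

      ε-φ-⊕ : ∀ x y w → ε (φ (x ⊕ y)) w 𝔽.≈ ε (φ x) w 𝔽.+ ε (φ y) w
      ε-φ-⊕ x y w = 𝔽.trans (ε-≋ᵗ {φ (x ⊕ y)} {φ x T.+ φ y} (≈ᵗ⇒≋ᵗ {φ (x ⊕ y)} {φ x T.+ φ y} (+-homo x y)) w) (ε-++ (φ x) (φ y) w)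

      ε-φ-con-⊗ : ∀ p x w → ε (φ (con p ⊗ x)) w 𝔽.≈ fromRing p 𝔽.* ε (φ x) w
      ε-φ-con-⊗ p x w = 𝔽.trans (ε-≋ᵗ {φ (con p ⊗ x)} {fromS p T.* φ x} (φ-con-⊗ p x) w) (ε-fromS-* p (φ x) w)

      private
        module _ where
          open CommutativeRing 𝔽 using (_+_; _*_; _-_) renaming (_≈_ to _≈₁_; refl to refl₁)
          open IntegerSolver 𝔽

          isolate : ∀ i p m m′ → i * ((m + p * m′) - m) ≈₁ (i * p) * m′
          isolate = solve 4 (λ i p m m′ → i :* ((m :+ p :* m′) :- m) := (i :* p) :* m′) refl₁

      1/α-inverse : ∀ c → 1/α (res (+ c)) 𝔽.* fromRing (a (+ c) S.- a (+ suc c)) 𝔽.≈ 𝔽.1#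
      1/α-inverse c = wrap (S.trans (S.*-identityʳ _) (S.trans (S.*-identityˡ _)
        (S.trans (S.reflexive (≡.cong (λ v → var (res (+ c)) S.- var v) (≡.sym (nxt-res-+ c)))) (S.sym (S.trans (S.*-identityˡ _) (S.*-identityʳ _))))))

      -- By `minor-step`, s_c takes the coset function κ of the first minor to κ + α_c κ′, where κ′
      -- belongs to the second; dividing the difference by α_c leaves κ′.
      ε-minor-step : ∀ {k} c (1≤c : 1 ℕ.≤ c) (c<n : c ℕ.< n) (l l′ : Vector ℕ k) q₀ → (∀ q → column l q ℕ.≤ n) →
        column l q₀ ≡ c → column l′ q₀ ≡ suc c → (∀ q → q ≢ q₀ → column l q ≢ c × column l′ q ≡ column l q) →
        ∀ w → Aᵒ (res (+ c)) (ε (φ (minor l))) w 𝔽.≈ ε (φ (minor l′)) w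
      ε-minor-step c 1≤c c<n l l′ q₀ bounded at-q₀ at-q₀′ elsewhere w = begin
        Aᵒ ν κ w
          ≡⟨ difference-def (1/α ν) (actF (swap ν)) (reflect ν) κ w ⟩
        1/α ν 𝔽.* (actF (swap ν) (κ (reflect ν w)) 𝔽.- κ w)
          ≈⟨ 𝔽.*-congˡ {1/α ν} {actF (swap ν) (κ (reflect ν w)) 𝔽.- κ w} {(κ w 𝔽.+ fromRing p 𝔽.* κ′ w) 𝔽.- κ w}
               (𝔽.+-congʳ {𝔽.- κ w} {actF (swap ν) (κ (reflect ν w))} {κ w 𝔽.+ fromRing p 𝔽.* κ′ w} twisted) ⟩
        1/α ν 𝔽.* ((κ w 𝔽.+ fromRing p 𝔽.* κ′ w) 𝔽.- κ w)
          ≈⟨ isolate (1/α ν) (fromRing p) (κ w) (κ′ w) ⟩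
        (1/α ν 𝔽.* fromRing p) 𝔽.* κ′ w
          ≈⟨ 𝔽.*-congʳ {κ′ w} {1/α ν 𝔽.* fromRing p} {𝔽.1#} (1/α-inverse c) ⟩
        𝔽.1# 𝔽.* κ′ w
          ≈⟨ 𝔽.*-identityˡ (κ′ w) ⟩
        κ′ w ∎
        where
        ν = res (+ c)
        M = minor l
        M′ = minor l′
        κ = ε (φ M)
        κ′ = ε (φ M′)
        p = a (+ c) S.- a (+ suc c)

        -- For 1 ≤ c < n the reflection s_c has no translation part, so `reflect` agrees with left
        -- multiplication by the permutation that conjugates.
        ν≢0 : res (+ toℕ ν) ≢ res (+ 0)
        ν≢0 e = res-+-≢ 1≤c (ℕ.<⇒≤ c<n) (ℕ.≤-trans (s≤s z≤n) 2≤n) ℕ.≤-refl (ℕ.<⇒≢ c<n)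
          (≡.trans (≡.sym (res-toℕ ν)) (≡.trans e (≡.sym res-n)))

        reflect-≗ : translation (reflect ν w) ≗ translation (fromW (Perm.flip (swap ν)) · w)
        reflect-≗ x = ≡.cong₂ (λ y u → ℤ.- y ℤ.+ translation w (PC.transpose u (nxt ν) x))
          (s-shift-0 (+ toℕ ν) ν≢0 (finite (s (+ toℕ ν)) ⟨$⟩ʳ x)) (res-toℕ ν)

        twisted : actF (swap ν) (κ (reflect ν w)) 𝔽.≈ κ w 𝔽.+ fromRing p 𝔽.* κ′ w
        twisted = begin
          actF (swap ν) (κ (reflect ν w))
            ≈⟨ actF-cong (swap ν) {κ (reflect ν w)} (ε-invariant (φ M) (reflect ν w) (fromW (Perm.flip (swap ν)) · w)
                 (≗⇒~ {translation (reflect ν w)} {translation (fromW (Perm.flip (swap ν)) · w)} reflect-≗)) ⟩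
          actF (swap ν) (κ (fromW (Perm.flip (swap ν)) · w))
            ≈⟨ ε-conjugate (swap ν) (φ M) w ⟨
          ε (conjugate (swap ν) (φ M)) w
            ≈⟨ ε-≋ᵗ {conjugate (swap ν) (φ M)} {φ (M ⊕ con p ⊗ M′)}
                 (Adjacent.minor-step c 1≤c c<n l l′ q₀ bounded at-q₀ at-q₀′ elsewhere) w ⟩
          ε (φ (M ⊕ con p ⊗ M′)) w
            ≈⟨ ε-φ-⊕ M (con p ⊗ M′) w ⟩
          κ w 𝔽.+ ε (φ (con p ⊗ M′)) w
            ≈⟨ 𝔽.+-congˡ {κ w} {ε (φ (con p ⊗ M′)) w} {fromRing p 𝔽.* κ′ w} (ε-φ-con-⊗ p M′ w) ⟩
          κ w 𝔽.+ fromRing p 𝔽.* κ′ w ∎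

      -- The block starts at an arbitrary row because expansion along its first column leaves the
      -- block that starts one row later. The product of the diagonal translations telescopes to the
      -- translation by `Ω (i + k)` minus `Ω i`.
      ε-diagonal-minor : ∀ i k → i ℕ.+ k ℕ.≤ n → ∀ w →
        ε (φ (det {k} λ r q → z (suc (i ℕ.+ toℕ r)) (suc (i ℕ.+ toℕ q)))) w 𝔽.≈ indicator (does (t (Ω (i ℕ.+ k) ⊟ Ω i) ≟ᶜ w))
      ε-diagonal-minor i zero _ w = begin
        ε (φ (con S.1#)) w
          ≈⟨ ε-≋ᵗ {φ (con S.1#)} {fromS S.1#} (φ-con S.1#) w ⟩
        ε (fromS S.1#) w
          ≈⟨ 𝔽.trans (ε-total (fromS S.1#) w) (𝔽.trans (𝔽.+-identityʳ _) (𝔽.trans (𝔽.*-congʳ {indicator (does (idʷ ≟ᶜ w))} {𝔽.1# 𝔽.* 𝔽.1#} {𝔽.1#} (𝔽.*-identityˡ 𝔽.1#)) (𝔽.*-identityˡ _))) ⟩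
        indicator (does (idʷ ≟ᶜ w))
          ≡⟨ ≡.cong indicator (does-⇔ (mk⇔
               (≈ᶜ-trans {t (Ω (i ℕ.+ 0) ⊟ Ω i)} {idʷ} {w} trivial)
               (≈ᶜ-trans {idʷ} {t (Ω (i ℕ.+ 0) ⊟ Ω i)} {w} (≈ᶜ-sym {t (Ω (i ℕ.+ 0) ⊟ Ω i)} {idʷ} trivial))) (idʷ ≟ᶜ w) (t (Ω (i ℕ.+ 0) ⊟ Ω i) ≟ᶜ w)) ⟩
        indicator (does (t (Ω (i ℕ.+ 0) ⊟ Ω i) ≟ᶜ w)) ∎
        where
        trivial : t (Ω (i ℕ.+ 0) ⊟ Ω i) ≈ᶜ idʷ
        trivial = ≗⇒~ {Ω (i ℕ.+ 0) ⊟ Ω i} {λ _ → + 0} λ x →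
          ≡.trans (≡.cong (λ r → Ω r x ℤ.- Ω i x) (ℕ.+-identityʳ i)) (ℤ.+-inverseʳ (Ω i x))
      ε-diagonal-minor i (suc k) i+k≤n w = begin
        ε (φ (det M)) w
          ≈⟨ ε-≋ᵗ {φ (det M)} {φ (z₁ ⊗ det N)} (φ-cong det≈) w ⟩
        ε (φ (z₁ ⊗ det N)) w
          ≈⟨ ε-≋ᵗ {φ (z₁ ⊗ det N)} {φ z₁ T.* φ (det N)} (φ-⊗ z₁ (det N)) w ⟩
        ε (φ z₁ T.* φ (det N)) w
          ≈⟨ ε-≋ᵗ {φ z₁ T.* φ (det N)} {[ t e ] T.* φ (det N)}
               (*-congᵗ {φ z₁} {[ t e ]} {φ (det N)} {φ (det N)} (φ-diagonal (suc i) (s≤s z≤n) i<n) (λ _ → 𝔽.refl)) w ⟩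
        ε ([ t e ] T.* φ (det N)) w
          ≈⟨ ε-* [ t e ] (φ (det N)) w ⟩
        ([ t e ] ▷ ε (φ (det N))) w
          ≈⟨ singleton-▷ (t e) (ε (φ (det N))) w ⟩
        actF Perm.id (ε (φ (det N)) (inv (t e) · w))
          ≈⟨ actF-id (ε (φ (det N)) (inv (t e) · w)) ⟩
        ε (φ (det N)) (inv (t e) · w)
          ≈⟨ ε-diagonal-minor (suc i) k 1+i+k≤n (inv (t e) · w) ⟩
        indicator (does (t (Ω (suc i ℕ.+ k) ⊟ Ω (suc i)) ≟ᶜ (inv (t e) · w)))
          ≡⟨ ≡.cong indicator (does-⇔ (mk⇔
               (λ f → ≈ᶜ-trans {t (Ω (i ℕ.+ suc k) ⊟ Ω i)} {t e · t (Ω (suc i ℕ.+ k) ⊟ Ω (suc i))} {w}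
                 (≈ᶜ-sym {t e · t (Ω (suc i ℕ.+ k) ⊟ Ω (suc i))} {t (Ω (i ℕ.+ suc k) ⊟ Ω i)} telescope)
                 (Equivalence.from (shiftᶜ (t e) (t (Ω (suc i ℕ.+ k) ⊟ Ω (suc i))) w) f))
               (λ f → Equivalence.to (shiftᶜ (t e) (t (Ω (suc i ℕ.+ k) ⊟ Ω (suc i))) w)
                 (≈ᶜ-trans {t e · t (Ω (suc i ℕ.+ k) ⊟ Ω (suc i))} {t (Ω (i ℕ.+ suc k) ⊟ Ω i)} {w} telescope f)))
               (t (Ω (suc i ℕ.+ k) ⊟ Ω (suc i)) ≟ᶜ (inv (t e) · w)) (t (Ω (i ℕ.+ suc k) ⊟ Ω i) ≟ᶜ w)) ⟩
        indicator (does (t (Ω (i ℕ.+ suc k) ⊟ Ω i) ≟ᶜ w)) ∎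
        where
        e = unit (+ suc i)
        M : Matrix (suc k)
        M r q = z (suc (i ℕ.+ toℕ r)) (suc (i ℕ.+ toℕ q))
        N : Matrix k
        N r q = z (suc (suc i ℕ.+ toℕ r)) (suc (suc i ℕ.+ toℕ q))
        z₁ = z (suc i) (suc i)
        1+i+k≤n : suc i ℕ.+ k ℕ.≤ n
        1+i+k≤n = ℕ.≤-trans (ℕ.≤-reflexive (≡.sym (ℕ.+-suc i k))) i+k≤n
        i<n : suc i ℕ.≤ n
        i<n = ℕ.≤-trans (ℕ.m≤m+n (suc i) k) 1+i+k≤n

        det≈ : det M Z.≈ z₁ Z.* det N
        det≈ = Z.trans (det-first-column {k} {M} (λ r → Z.reflexive (z-zero _ _ (s≤s (ℕ.+-monoʳ-< i (s≤s z≤n))))))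
          (Z.*-cong {z (suc (i ℕ.+ 0)) (suc (i ℕ.+ 0))} {z₁} {det (λ r q → M (suc r) (suc q))} {det N} (Z.reflexive (≡.cong₂ (λ x y → z (suc x) (suc y)) (ℕ.+-identityʳ i) (ℕ.+-identityʳ i)))
            (det-cong {k} {λ r q → M (suc r) (suc q)} {N} λ r q → Z.reflexive (≡.cong₂ (λ x y → z (suc x) (suc y)) (ℕ.+-suc i (toℕ r)) (ℕ.+-suc i (toℕ q)))))

        telescope : t e · t (Ω (suc i ℕ.+ k) ⊟ Ω (suc i)) ≈ᶜ t (Ω (i ℕ.+ suc k) ⊟ Ω i)
        telescope = ≗⇒~ {translation (t e · t (Ω (suc i ℕ.+ k) ⊟ Ω (suc i)))} {Ω (i ℕ.+ suc k) ⊟ Ω i} λ x →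
          ≡.trans (≡.cong₂ (λ y r → e x ℤ.+ (Ω r x ℤ.- y)) (Ω-suc i x) (≡.sym (ℕ.+-suc i k)))
            (regroup (e x) (Ω (i ℕ.+ suc k) x) (Ω i x))
          where
          regroup : ∀ e y x → e ℤ.+ (y ℤ.- (x ℤ.+ e)) ≡ y ℤ.- x
          regroup = solve 3 (λ e y x → e :+ (y :- (x :+ e)) := y :- x) ≡.refl
            where open IntegerOrder

      private
        window-inv-τ^ : ∀ k w x → windowʷ (inv (τ^ k) · w) x ≡ windowʷ w (rotate (+ k) x) ℤ.+ ℤ.- (+ k)
        window-inv-τ^ k w x = ≡.trans (add-subtract (windowʷ (inv (τ^ k) · w) x) (+ k))
          (≡.cong (ℤ._+ ℤ.- (+ k)) (≡.trans (≡.sym (window-τ^ k (inv (τ^ k) · w) x)) (cancel-window (τ^ k) w (rotate (+ k) x))))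
          where
          add-subtract : ∀ x k → x ≡ x ℤ.+ k ℤ.+ ℤ.- k
          add-subtract = solve 2 (λ x k → x := x :+ k :+ :- k) ≡.refl
            where open IntegerOrder

        swap-rotate : ∀ k v x → PC.transpose (rotate (+ k) v) (nxt (rotate (+ k) v)) (rotate (+ k) x) ≡
                                rotate (+ k) (PC.transpose v (nxt v) x)
        swap-rotate k v x = by (position v x)
          where
          by : Position v x → PC.transpose (rotate (+ k) v) (nxt (rotate (+ k) v)) (rotate (+ k) x) ≡ rotate (+ k) (PC.transpose v (nxt v) x)
          by (here ≡.refl) = ≡.trans (transpose-left (rotate (+ k) v) (nxt (rotate (+ k) v)))
            (≡.sym (≡.trans (≡.cong (rotate (+ k)) (transpose-left v (nxt v))) (rotate-nxt (+ k) v)))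
          by (next ≡.refl) = ≡.trans (≡.cong (PC.transpose (rotate (+ k) v) (nxt (rotate (+ k) v))) (rotate-nxt (+ k) v))
            (≡.trans (transpose-right (rotate (+ k) v) (nxt (rotate (+ k) v))) (≡.cong (rotate (+ k)) (≡.sym (transpose-right v (nxt v)))))
          by (other p q) = ≡.trans (transpose-other (rotate (+ k) v) (nxt (rotate (+ k) v)) (p ∘ rotate-injective (+ k))
              (λ e → q (rotate-injective (+ k) (≡.trans e (≡.sym (rotate-nxt (+ k) v))))))
            (≡.cong (rotate (+ k)) (≡.sym (transpose-other v (nxt v) p q)))

      -- The relation A_{v+k} τ^k = τ^k A_v on functions: τ^k rotates the variables and the
      -- residues, so it takes α_v to α_{v+k} and s_v to s_{v+k}.
      A-τ^ : ∀ k v {κ} → Invariantᶜ κ → ∀ w → Aᵒ (rotate (+ k) v) (apply (τ^ k) κ) w 𝔽.≈ apply (τ^ k) (Aᵒ v κ) w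
      A-τ^ k v {κ} κ-inv w = begin
        Aᵒ ν (apply (τ^ k) κ) w
          ≡⟨ difference-def (1/α ν) (actF (swap ν)) (reflect ν) (apply (τ^ k) κ) w ⟩
        1/α ν 𝔽.* (actF (swap ν) (actF π (κ (inv (τ^ k) · reflect ν w))) 𝔽.- actF π (κ w′))
          ≈⟨ 𝔽.*-cong {1/α ν} {actF π (1/α v)} coefficient≈ (𝔽.+-congʳ {𝔽.- actF π (κ w′)}
               {actF (swap ν) (actF π (κ (inv (τ^ k) · reflect ν w)))} {actF π (actF (swap v) (κ (reflect v w′)))} reflected) ⟩
        actF π (1/α v) 𝔽.* (actF π (actF (swap v) (κ (reflect v w′))) 𝔽.- actF π (κ w′))
          ≈⟨ 𝔽.*-congˡ {actF π (1/α v)} (actF-- π (actF (swap v) (κ (reflect v w′))) (κ w′)) ⟨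
        actF π (1/α v) 𝔽.* actF π (actF (swap v) (κ (reflect v w′)) 𝔽.- κ w′)
          ≈⟨ actF-* π (1/α v) (actF (swap v) (κ (reflect v w′)) 𝔽.- κ w′) ⟨
        actF π (1/α v 𝔽.* (actF (swap v) (κ (reflect v w′)) 𝔽.- κ w′))
          ≡⟨ ≡.cong (actF π) (difference-def (1/α v) (actF (swap v)) (reflect v) κ w′) ⟨
        actF π (Aᵒ v κ w′) ∎
        where
        ν = rotate (+ k) v
        π = finite (τ^ k)
        w′ = inv (τ^ k) · w

        coefficient≈ : 1/α ν 𝔽.≈ actF π (1/α v)
        coefficient≈ = frac-≡ {1/α ν} {actF π (1/α v)} ≡.refl (≡.cong₂ (λ x y → var x S.- var y)
          (≡.sym (finite-τ^ k v)) (≡.sym (≡.trans (finite-τ^ k (nxt v)) (rotate-nxt (+ k) v))))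

        reflected : actF (swap ν) (actF π (κ (inv (τ^ k) · reflect ν w))) 𝔽.≈ actF π (actF (swap v) (κ (reflect v w′)))
        reflected = act₂-cong (swap ν) π π (swap v)
          (λ x → ≡.trans (≡.cong (swap ν ⟨$⟩ʳ_) (finite-τ^ k x)) (≡.trans (swap-rotate k v x) (≡.sym (finite-τ^ k _))))
          (κ (inv (τ^ k) · reflect ν w)) (κ (reflect v w′))
          (invariant-window {κ} κ-inv (inv (τ^ k) · reflect ν w) (reflect v w′) λ x →
            ≡.trans (window-inv-τ^ k (reflect ν w) x) (≡.trans (≡.cong (ℤ._+ ℤ.- (+ k)) (window-reflect ν w (rotate (+ k) x)))
            (≡.trans (≡.sym (op-equivariant (rotate (+ k)) (ℤ.- (+ k)) (rotate-injective (+ k)) (rotate-nxt (+ k)) v (window-inv-τ^ k w) x))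
            (≡.sym (window-reflect v w′ x)))))

    -- Minors as Schubert classes, by induction on boxes

    module Schubert where
      open Setting ℝ n 2≤n
      open Residues
      open WeylGroup
      open Lengths
      open TwistedAlgebra
      open PetersonOperators using (A-congF) renaming (A to Aᵒ)
      open SchubertBasis
      open Centralizer
      open Isomorphism
      open Relations
      open Minors
      open Comparison
      open Shapes

      open DeterminantProperties ℂ[Z̃] using (det-cong)
      open Determinant ℂ[Z̃] using (det)

      -- The residue that τ^k carries to i. Letters of the word live on this side of τ^k, column
      -- numbers on the other.
      position-of : ℕ → ℕ → Fin n
      position-of k i = res (+ i ℤ.- + k)

      rotate-position : ∀ k i → rotate (+ k) (position-of k i) ≡ res (+ i)
      rotate-position k i = ≡.trans (rotate-res (+ k) (+ i ℤ.- + k)) (≡.cong res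
        (solve 2 (λ i k → i :- k :+ k := i) ≡.refl (+ i) (+ k)))
        where open IntegerOrder

      nxt-position : ∀ k i → nxt (position-of k i) ≡ position-of k (suc i)
      nxt-position k i = ≡.trans (nxt-res (+ i ℤ.- + k)) (≡.cong res
        (solve 2 (λ i k → i :- k :+ con (+ 1) := con (+ 1) :+ i :- k) ≡.refl (+ i) (+ k)))
        where open IntegerOrder

      position-≢ : ∀ k {i i′} → 1 ℕ.≤ i → i ℕ.≤ n → 1 ℕ.≤ i′ → i′ ℕ.≤ n → i ≢ i′ → position-of k i ≢ position-of k i′
      position-≢ k {i} {i′} p q p′ q′ ne e = res-+-≢ p q p′ q′ ne
        (≡.trans (≡.sym (rotate-position k i)) (≡.trans (≡.cong (rotate (+ k)) e) (rotate-position k i′)))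

      module _ {k} (k≤n : k ℕ.≤ n) where

        suc-opposite : ∀ (p : Fin k) → suc (toℕ p) ℕ.+ toℕ (opposite p) ≡ k
        suc-opposite p = ≡.trans (≡.cong (suc (toℕ p) ℕ.+_) (Fin.opposite-prop p)) (ℕ.m+[n∸m]≡n (Fin.toℕ<n p))

        column≤n : ∀ (l : Vector ℕ k) → (∀ q → l q ℕ.≤ n ∸ k) → ∀ q → column l q ℕ.≤ n
        column≤n l bounded q = ℕ.≤-trans (ℕ.+-mono-≤ (bounded (opposite q)) (Fin.toℕ<n q)) (ℕ.≤-reflexive (ℕ.m∸n+n≡m k≤n))

        1≤column : ∀ (l : Vector ℕ k) q → 1 ℕ.≤ column l q
        1≤column l q = ℕ.≤-trans (s≤s z≤n) (ℕ.m≤n+m (suc (toℕ q)) (l (opposite q)))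

        column-< : ∀ (l : Vector ℕ k) → IsPartition l → ∀ {q q′} → toℕ q ℕ.< toℕ q′ → column l q ℕ.< column l q′
        column-< l partition {q} {q′} q<q′ = ℕ.+-mono-≤-< (partition (≡.subst₂ ℕ._≤_ (≡.sym (Fin.opposite-prop q′)) (≡.sym (Fin.opposite-prop q))
          (ℕ.∸-monoʳ-≤ k (s≤s (ℕ.<⇒≤ q<q′))))) (s≤s q<q′)

        column-injective : ∀ (l : Vector ℕ k) → IsPartition l → ∀ {q q′} → column l q ≡ column l q′ → q ≡ q′
        column-injective l partition {q} {q′} e = by (ℕ.<-cmp (toℕ q) (toℕ q′))
          where
          by : _ → q ≡ q′
          by (tri< p _ _) = contradiction e (ℕ.<⇒≢ (column-< l partition p))
          by (tri≈ _ p _) = Fin.toℕ-injective p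
          by (tri> _ _ p) = contradiction (≡.sym e) (ℕ.<⇒≢ (column-< l partition p))

        -- After adding the boxes of l, the affine window, raised by k, consists of
        -- i + n for the columns i of the minor and of the other i in {1, …, n}.
        InColumns : Vector ℕ k → State → Set
        InColumns l P = (∀ q → P (position-of k (column l q)) ≡ + column l q ℤ.+ + n ℤ.- + k)
                      × (∀ i → 1 ℕ.≤ i → i ℕ.≤ n → (∀ q → column l q ≢ i) → P (position-of k i) ≡ + i ℤ.- + k)

        -- For the empty shape the columns are 1, ..., k. The class of i - k is represented in {1,
        -- ..., n} by i - k + n when i ≤ k, and by i - k itself when k < i.
        base-inColumns : ∀ l → (∀ p → l p ≡ 0) → InColumns l base
        base-inColumns l l≡0 = (λ q → begin
            base (position-of k (column l q))
              ≡⟨ ≡.cong base (≡.trans (≡.cong (position-of k) (column≡ q)) (res-≡ (+ suc (toℕ q) ℤ.- + k) (+ (suc (toℕ q) ℕ.+ (n ∸ k))) (ℤ.-[1+ 0 ])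
                   (≡.trans (solve 3 (λ x n k → x :- k := x :+ (n :- k) :+ con ℤ.-[1+ 0 ] :* n) ≡.refl (+ suc (toℕ q)) (+ n) (+ k))
                     (≡.cong (λ y → + suc (toℕ q) ℤ.+ y ℤ.+ ℤ.-[1+ 0 ] ℤ.* + n) (≡.sym (+-∸ k≤n)))))) ⟩
            base (res (+ (suc (toℕ q) ℕ.+ (n ∸ k))))
              ≡⟨ base-res (s≤s z≤n) (ℕ.≤-trans (ℕ.+-monoˡ-≤ (n ∸ k) (Fin.toℕ<n q)) (ℕ.≤-reflexive (ℕ.m+[n∸m]≡n k≤n))) ⟩
            + suc (toℕ q) ℤ.+ + (n ∸ k)
              ≡⟨ ≡.cong₂ (λ x y → + x ℤ.+ y) (≡.sym (column≡ q)) (+-∸ k≤n) ⟩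
            + column l q ℤ.+ (+ n ℤ.- + k)
              ≡⟨ ℤ.+-assoc (+ column l q) (+ n) (ℤ.- (+ k)) ⟨
            + column l q ℤ.+ + n ℤ.- + k ∎) ,
          λ i 1≤i i≤n ∉ → by i 1≤i i≤n ∉ (i ℕ.≤? k)
          where
          open IntegerOrder
          open ≡.≡-Reasoning
          +-∸ : ∀ {x y} → y ℕ.≤ x → + (x ∸ y) ≡ + x ℤ.- + y
          +-∸ {x} {y} y≤x = ≡.trans (solve 2 (λ d y → d := d :+ y :- y) ≡.refl (+ (x ∸ y)) (+ y))
            (≡.cong (λ d → + d ℤ.- + y) (ℕ.m∸n+n≡m y≤x))
          column≡ : ∀ q → column l q ≡ suc (toℕ q)
          column≡ q = ≡.cong (ℕ._+ suc (toℕ q)) (l≡0 (opposite q))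
          by : ∀ i → 1 ℕ.≤ i → i ℕ.≤ n → (∀ q → column l q ≢ i) → Dec (i ℕ.≤ k) → base (position-of k i) ≡ + i ℤ.- + k
          by (suc i) _ _ ∉ (yes i<k) = contradiction (≡.trans (column≡ (Fin.fromℕ< i<k)) (≡.cong suc (Fin.toℕ-fromℕ< i<k))) (∉ (Fin.fromℕ< i<k))
          by i _ i≤n _ (no i≰k) = ≡.trans (≡.cong (λ x → base (res x)) (≡.sym (+-∸ k≤i)))
            (≡.trans (base-res (ℕ.m<n⇒0<n∸m (ℕ.≰⇒> i≰k)) (ℕ.≤-trans (ℕ.m∸n≤m i k) i≤n)) (+-∸ k≤i))
            where k≤i = ℕ.<⇒≤ (ℕ.≰⇒> i≰k)

        -- The induction hypothesis for a shape and its word. The window is carried along because it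
        -- shows that the letter of the next box climbs.
        Realized : List ℤ → Vector ℕ k → Set (c ⊔ ℓ)
        Realized ms l = Up (map res ms) × InColumns l (end (map res ms)) × (∀ w → ε (φ (minor l)) w 𝔽.≈ apply (τ^ k) (ξ ms) w)

        private
          diagonal : Fin k → Fin k → Z.Carrier
          diagonal r q = z (suc (0 ℕ.+ toℕ r)) (suc (0 ℕ.+ toℕ q))

        minor-empty : ∀ l → (∀ p → l p ≡ 0) → minor l Z.≈ det diagonal
        minor-empty l l≡0 = det-cong {k} {λ r q → z (suc (toℕ r)) (column l q)} {diagonal} λ r q →
          Z.reflexive (≡.cong₂ z {suc (toℕ r)} {suc (0 ℕ.+ toℕ r)} {column l q} {suc (0 ℕ.+ toℕ q)} ≡.refl
            (≡.cong (ℕ._+ suc (toℕ q)) (l≡0 (opposite q))))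

        ε-minor-empty : ∀ l → (∀ p → l p ≡ 0) → ∀ w → ε (φ (minor l)) w 𝔽.≈ apply (τ^ k) δ₀ w
        ε-minor-empty l l≡0 w = begin
          ε (φ (minor l)) w
            ≈⟨ ε-≋ᵗ {φ (minor l)} {φ (det diagonal)} (φ-cong (minor-empty l l≡0)) w ⟩
          ε (φ (det diagonal)) w
            ≈⟨ ε-diagonal-minor 0 k k≤n w ⟩
          indicator (does (t (Ω k ⊟ Ω 0) ≟ᶜ w))
            ≡⟨ ≡.cong indicator (does-⇔ (mk⇔ (≈ᶜ-trans {τ^ k} {t (Ω k ⊟ Ω 0)} {w} (≈ᶜ-sym {t (Ω k ⊟ Ω 0)} {τ^ k} same-coset))
                 (≈ᶜ-trans {t (Ω k ⊟ Ω 0)} {τ^ k} {w} same-coset)) (t (Ω k ⊟ Ω 0) ≟ᶜ w) (τ^ k ≟ᶜ w)) ⟩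
          indicator (does (τ^ k ≟ᶜ w))
            ≈⟨ apply-τ^-δ₀ k w ⟨
          apply (τ^ k) δ₀ w ∎
          where
          open SetoidReasoning 𝔽.setoid
          same-coset : t (Ω k ⊟ Ω 0) ≈ᶜ τ^ k
          same-coset = ≗⇒~ {Ω k ⊟ Ω 0} {Ω k} λ x → ℤ.+-identityʳ (Ω k x)

        realized-empty : ∀ l → (∀ p → l p ≡ 0) → Realized [] l
        realized-empty l l≡0 = [] , base-inColumns l l≡0 , ε-minor-empty l l≡0

        -- A box added to row p moves the column c of that row to c + 1, and its content is c - k,
        -- so behind τ^k its letter acts as s_c. As the columns of `l′` are distinct, c + 1 was not
        -- a column of `l`; its class therefore holds the small window element.
        realized-box : ∀ {ms l l′ m} p → Realized ms l → IsPartition l → IsPartition l′ → (∀ q → l′ q ℕ.≤ n ∸ k) →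
                       m ≡ + suc (l p) ℤ.- + suc (toℕ p) → l′ p ≡ suc (l p) → (∀ q → q ≢ p → l′ q ≡ l q) → Realized (m ∷ ms) l′
        realized-box {ms} {l} {l′} {m} p (up , inColumns , ε-minor) pl pl′ bounded′ m≡ at-p away =
          -- The ascent c + 1 - k < (c + n - k) + 1 amounts to 0 < n.
          ≡.subst₂ (λ x y → x ℤ.< y ℤ.+ + 1) (≡.sym P-next) (≡.sym P-here)
              (from₁ (ℤ.+<+ {0} {n} (ℕ.≤-trans (s≤s z≤n) 2≤n)) (solve 3 (λ c n k → c :+ n :- k :+ con (+ 1) :- (con (+ 1) :+ c :- k)
                := n :- con (+ 0)) ≡.refl (+ c₀) (+ n) (+ k))) ∷ up ,
          (in-columns , off-columns) ,
          λ w → begin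
              ε (φ (minor l′)) w
                ≈⟨ ε-minor-step c₀ 1≤c c<n l l′ q₀ (column≤n l bounded) ≡.refl at-q₀′ elsewhere w ⟨
              Aᵒ (res (+ c₀)) (ε (φ (minor l))) w
                ≈⟨ A-congF (res (+ c₀)) {ε (φ (minor l))} {apply (τ^ k) (ξ ms)} ε-minor w ⟩
              Aᵒ (res (+ c₀)) (apply (τ^ k) (ξ ms)) w
                ≡⟨ ≡.cong (λ u → Aᵒ u (apply (τ^ k) (ξ ms)) w) (≡.sym (≡.trans (≡.cong (rotate (+ k)) res-m) (rotate-position k c₀))) ⟩
              Aᵒ (rotate (+ k) (res m)) (apply (τ^ k) (ξ ms)) w
                ≈⟨ A-τ^ k (res m) {ξ ms} (ξ-invariant ms) w ⟩
              apply (τ^ k) (ξ (m ∷ ms)) w ∎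
          where
          open IntegerOrder
          open SetoidReasoning 𝔽.setoid
          q₀ = opposite p
          c₀ = column l q₀
          P = end (map res ms)

          opposite-q₀ : opposite q₀ ≡ p
          opposite-q₀ = Fin.opposite-involutive p

          opposite-≢ : ∀ {q} → q ≢ q₀ → opposite q ≢ p
          opposite-≢ {q} ne e = ne (≡.trans (≡.sym (Fin.opposite-involutive q)) (≡.cong opposite e))

          bounded : ∀ q → l q ℕ.≤ n ∸ k
          bounded q = by (q Fin.≟ p)
            where
            by : Dec (q ≡ p) → l q ℕ.≤ n ∸ k
            by (yes ≡.refl) = ℕ.≤-trans (ℕ.n≤1+n (l p)) (ℕ.≤-trans (ℕ.≤-reflexive (≡.sym at-p)) (bounded′ p))
            by (no ne) = ≡.subst (ℕ._≤ n ∸ k) (away q ne) (bounded′ q)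

          at-q₀′ : column l′ q₀ ≡ suc c₀
          at-q₀′ = ≡.cong (ℕ._+ suc (toℕ q₀)) (≡.trans (≡.cong l′ opposite-q₀) (≡.trans at-p (≡.cong (λ x → suc (l x)) (≡.sym opposite-q₀))))

          column-away : ∀ q → q ≢ q₀ → column l′ q ≡ column l q
          column-away q ne = ≡.cong (ℕ._+ suc (toℕ q)) (away (opposite q) (opposite-≢ ne))

          elsewhere : ∀ q → q ≢ q₀ → column l q ≢ c₀ × column l′ q ≡ column l q
          elsewhere q ne = (λ e → ne (column-injective l pl e)) , column-away q ne

          1≤c : 1 ℕ.≤ c₀
          1≤c = 1≤column l q₀

          c<n : c₀ ℕ.< n
          c<n = ≡.subst (ℕ._≤ n) at-q₀′ (column≤n l′ bounded′ q₀)

          suc-c∉ : ∀ q → column l q ≢ suc c₀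
          suc-c∉ q e = by (q Fin.≟ q₀)
            where
            by : ¬ Dec (q ≡ q₀)
            by (yes ≡.refl) = ℕ.1+n≢n (≡.sym e)
            by (no ne) = ne (column-injective l′ pl′ (≡.trans (column-away q ne) (≡.trans e (≡.sym at-q₀′))))

          res-m : res m ≡ position-of k c₀
          res-m = ≡.cong res (≡.trans m≡ (≡.sym (≡.trans
            (≡.cong₂ (λ x y → + (l x ℕ.+ suc (toℕ q₀)) ℤ.- + y) opposite-q₀ (≡.sym (suc-opposite p)))
            (solve 3 (λ x o t → x :+ (con (+ 1) :+ o) :- (con (+ 1) :+ t :+ o) := con (+ 1) :+ x :- (con (+ 1) :+ t)) ≡.refl
              (+ l p) (+ toℕ q₀) (+ toℕ p)))))

          P-here : P (res m) ≡ + c₀ ℤ.+ + n ℤ.- + k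
          P-here = ≡.trans (≡.cong P res-m) (proj₁ inColumns q₀)

          nxt-res-m : nxt (res m) ≡ position-of k (suc c₀)
          nxt-res-m = ≡.trans (≡.cong nxt res-m) (nxt-position k c₀)

          P-next : P (nxt (res m)) ≡ + suc c₀ ℤ.- + k
          P-next = ≡.trans (≡.cong P nxt-res-m) (proj₂ inColumns (suc c₀) (s≤s z≤n) c<n suc-c∉)

          unchanged : ∀ i → 1 ℕ.≤ i → i ℕ.≤ n → i ≢ c₀ → i ≢ suc c₀ → op (res m) P (position-of k i) ≡ P (position-of k i)
          unchanged i 1≤i i≤n ne ne′ = op-other (res m)
            (λ e → position-≢ k 1≤i i≤n 1≤c (ℕ.<⇒≤ c<n) ne (≡.trans e res-m))
            (λ e → position-≢ k 1≤i i≤n (s≤s z≤n) c<n ne′ (≡.trans e nxt-res-m))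

          in-columns : ∀ q → op (res m) P (position-of k (column l′ q)) ≡ + column l′ q ℤ.+ + n ℤ.- + k
          in-columns q = by (q Fin.≟ q₀)
            where
            by : Dec (q ≡ q₀) → op (res m) P (position-of k (column l′ q)) ≡ + column l′ q ℤ.+ + n ℤ.- + k
            by (yes ≡.refl) = ≡.subst (λ x → op (res m) P (position-of k x) ≡ + x ℤ.+ + n ℤ.- + k) (≡.sym at-q₀′)
              (≡.trans (≡.cong (op (res m) P) (≡.sym nxt-res-m)) (≡.trans (op-next (res m)) (≡.trans (≡.cong (ℤ._+ + 1) P-here)
              (solve 3 (λ c n k → c :+ n :- k :+ con (+ 1) := con (+ 1) :+ c :+ n :- k) ≡.refl (+ c₀) (+ n) (+ k)))))
            by (no ne) = ≡.subst (λ x → op (res m) P (position-of k x) ≡ + x ℤ.+ + n ℤ.- + k) (≡.sym (column-away q ne))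
              (≡.trans (unchanged (column l q) (1≤column l q) (column≤n l bounded q) (proj₁ (elsewhere q ne)) (suc-c∉ q)) (proj₁ inColumns q))

          off-columns : ∀ i → 1 ℕ.≤ i → i ℕ.≤ n → (∀ q → column l′ q ≢ i) → op (res m) P (position-of k i) ≡ + i ℤ.- + k
          off-columns i 1≤i i≤n ∉ = by (i ℕ.≟ c₀)
            where
            by : Dec (i ≡ c₀) → op (res m) P (position-of k i) ≡ + i ℤ.- + k
            by (yes ≡.refl) = ≡.trans (≡.cong (op (res m) P) (≡.sym res-m)) (≡.trans (op-here (res m)) (≡.trans (≡.cong (ℤ._- + 1) P-next)
              (solve 2 (λ c k → con (+ 1) :+ c :- k :- con (+ 1) := c :- k) ≡.refl (+ i) (+ k))))
            by (no ne) = ≡.trans (unchanged i 1≤i i≤n ne (λ e → ∉ q₀ (≡.trans at-q₀′ (≡.sym e))))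
              (proj₂ inColumns i 1≤i i≤n λ q → column-∉ q (q Fin.≟ q₀))
              where
              column-∉ : ∀ q → Dec (q ≡ q₀) → column l q ≢ i
              column-∉ q (yes ≡.refl) e = ne (≡.sym e)
              column-∉ q (no q≢)      e = ∉ q (≡.trans (column-away q q≢) e)

        realized : ∀ {ms l} → Built ms l → Realized ms l
        realized (empty l≡0) = realized-empty _ l≡0
        realized (box p b pl pl′ bounded m≡ at-p away) = realized-box p (realized b) pl pl′ bounded m≡ at-p away

        letters : Vector ℕ k → List ℤ
        letters l = concat (reverse (tabulate λ p → u (suc (toℕ p)) (l p)))

        realized-letters : ∀ l → IsPartition l → (∀ p → l p ℕ.≤ n ∸ k) → Realized (letters l) l
        realized-letters l pl bounded = realized (built l pl bounded)

        -- Both sides are supported on translations and have the coset function that the word of `l`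
        -- produces from δ, so `translationsOnly-detect` applies.
        φ-minor : ∀ l → IsPartition l → (∀ p → l p ℕ.≤ n ∸ k) → φ (minor l) ≈ᵗ j (value (k , letters l))
        φ-minor l pl bounded = ≋ᵗ⇒≈ᵗ {φ (minor l)} {j (value (k , letters l))}
          (translationsOnly-detect {φ (minor l)} {j (value (k , letters l))} (φ-translationsOnly (minor l))
            (∈ℙ⇒translationsOnly {j (value (k , letters l))} (IsSchubertBasis.member isSchubertBasis (up⇒W⁰ k (letters l) up)))
            λ w → 𝔽.trans (ε-minor w) (𝔽.sym (ε-j j isSchubertBasis k (letters l) up w)))
          where
          up = proj₁ (realized-letters l pl bounded)
          ε-minor = proj₂ (proj₂ (realized-letters l pl bounded))

        -- The window of τ^k w_λ has i + n at the columns i and i at the other positions. Lowering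
        -- all of it by n keeps the coset and gives the values required of w; within the coset,
        -- being sorted determines the element.
        value-recognition : ∀ l (pl : IsPartition l) (bounded : ∀ p → l p ℕ.≤ n ∸ k) w → Sorted w →
          (∀ q → windowʷ w (res (+ column l q)) ≡ + column l q) →
          (∀ i → 1 ℕ.≤ i → i ℕ.≤ n → (∀ q → column l q ≢ i) → windowʷ w (res (+ i)) ≡ + i ℤ.- + n) →
          value (k , letters l) ≈ʷ w
        value-recognition l pl bounded w sorted-w in-w off-w = coset ,
          sorted-unique {value (k , letters l)} {w} (sorted-value k (letters l) up) sorted-w coset
          where
          up = proj₁ (realized-letters l pl bounded)
          inColumns = proj₁ (proj₂ (realized-letters l pl bounded))
          open IntegerOrder
          at : ∀ i → windowʷ (value (k , letters l)) (res (+ i)) ≡ end (map res (letters l)) (position-of k i) ℤ.+ + k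
          at i = ≡.trans (≡.cong (windowʷ (value (k , letters l))) (≡.sym (rotate-position k i)))
            (≡.trans (window-τ^ k (word (letters l)) (position-of k i)) (≡.cong (ℤ._+ + k) (window-word (letters l) (position-of k i))))
          coset : value (k , letters l) ≈ᶜ w
          coset = window⇒≈ᶜ {value (k , letters l)} {w} (+ n) λ v → let i , 1≤i , i≤n , _ , e = base-∈ v in
            ≡.subst (λ v → windowʷ (value (k , letters l)) v ≡ windowʷ w v ℤ.+ + n) (≡.sym e)
              (by i 1≤i i≤n (Fin.any? λ q → column l q ℕ.≟ i))
            where
            by : ∀ i → 1 ℕ.≤ i → i ℕ.≤ n → Dec (∃[ q ] column l q ≡ i) →
                 windowʷ (value (k , letters l)) (res (+ i)) ≡ windowʷ w (res (+ i)) ℤ.+ + n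
            by i _ _ (yes (q , ≡.refl)) = ≡.trans (at i) (≡.trans (≡.cong (ℤ._+ + k) (proj₁ inColumns q))
              (≡.trans (solve 3 (λ c n k → c :+ n :- k :+ k := c :+ n) ≡.refl (+ i) (+ n) (+ k)) (≡.cong (ℤ._+ + n) (≡.sym (in-w q)))))
            by i 1≤i i≤n (no ∄) = ≡.trans (at i) (≡.trans (≡.cong (ℤ._+ + k) (proj₂ inColumns i 1≤i i≤n λ q e → ∄ (q , e)))
              (≡.trans (solve 3 (λ i n k → i :- k :+ k := i :- n :+ n) ≡.refl (+ i) (+ n) (+ k))
                (≡.cong (ℤ._+ + n) (≡.sym (off-w i 1≤i i≤n λ q e → ∄ (q , e))))))

    -- Rectangles and translations by fundamental coweights

    module Rectangles where
      open Setting ℝ n 2≤n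
      open Residues
      open WeylGroup
      open Lengths
      open TwistedAlgebra
      open Minors
      open Schubert

      open IntegerOrder

      ω-one-upto : ∀ i v → 1 ℕ.≤ toℕ v → toℕ v ℕ.≤ i → ω i v ≡ + 1
      ω-one-upto i v p q rewrite dec-true (1 ℕ.≤? toℕ v ×-dec toℕ v ℕ.≤? i) (p , q) = ≡.refl

      ω-zero-beyond : ∀ i v → ¬ (1 ℕ.≤ toℕ v × toℕ v ℕ.≤ i) → ω i v ≡ + 0
      ω-zero-beyond i v p rewrite dec-false (1 ℕ.≤? toℕ v ×-dec toℕ v ℕ.≤? i) p = ≡.refl

      sorted-by : ∀ w → (∀ x y → 1 ℕ.≤ x → x ℕ.< y → y ℕ.≤ n →
                    windowʷ w (finite w ⟨$⟩ʳ res (+ x)) ℤ.< windowʷ w (finite w ⟨$⟩ʳ res (+ y))) → Sorted w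
      sorted-by w increasing p q p<q =
        let x , 1≤x , _ , base-p , p≡ = base-∈ p
            y , _ , y≤n , base-q , q≡ = base-∈ q
        in ≡.subst₂ (λ p q → windowʷ w (finite w ⟨$⟩ʳ p) ℤ.< windowʷ w (finite w ⟨$⟩ʳ q)) (≡.sym p≡) (≡.sym q≡)
             (increasing x y 1≤x (ℤ.drop‿+<+ (≡.subst₂ ℤ._<_ base-p base-q p<q)) y≤n)

      module _ (i : ℕ) (i<n : i ℕ.< n) where

        window-low : ∀ x → 1 ℕ.≤ x → x ℕ.≤ i → window (-ω i) (res (+ x)) ≡ + x ℤ.- + n
        window-low x 1≤x x≤i = ≡.trans (≡.cong₂ (λ b y → b ℤ.+ + n ℤ.* ℤ.- y) (base-res 1≤x (ℕ.≤-trans x≤i (ℕ.<⇒≤ i<n)))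
            (ω-one-upto i (res (+ x)) (≡.subst (1 ℕ.≤_) (≡.sym toℕ≡) 1≤x) (≡.subst (ℕ._≤ i) (≡.sym toℕ≡) x≤i)))
          (solve 2 (λ x n → x :+ n :* :- con (+ 1) := x :- n) ≡.refl (+ x) (+ n))
          where
          toℕ≡ : toℕ (res (+ x)) ≡ x
          toℕ≡ = toℕ-res-< (ℕ.≤-<-trans x≤i i<n)

        window-high : ∀ x → i ℕ.< x → x ℕ.≤ n → window (-ω i) (res (+ x)) ≡ + x
        window-high x i<x x≤n = ≡.trans (≡.cong₂ (λ b y → b ℤ.+ + n ℤ.* ℤ.- y) (base-res (ℕ.≤-trans (s≤s z≤n) i<x) x≤n)
            (ω-zero-beyond i (res (+ x)) (by (x ℕ.≟ n))))
          (solve 2 (λ x n → x :+ n :* :- con (+ 0) := x) ≡.refl (+ x) (+ n))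
          where
          by : Dec (x ≡ n) → ¬ (1 ℕ.≤ toℕ (res (+ x)) × toℕ (res (+ x)) ℕ.≤ i)
          -- Position n is represented by the residue 0, where `ω` vanishes.
          by (yes ≡.refl) (1≤ , _) = ℕ.1+n≰n (ℕ.≤-trans 1≤ (ℕ.≤-reflexive toℕ-res-n))
          by (no x≢n) (_ , ≤i) = ℕ.1+n≰n (ℕ.≤-trans i<x (≡.subst (ℕ._≤ i) (toℕ-res-< (ℕ.≤∧≢⇒< x≤n x≢n)) ≤i))

        private
          k = n ∸ i

          k≤n : k ℕ.≤ n
          k≤n = ℕ.m∸n≤m n i

          i+k≡n : i ℕ.+ k ≡ n
          i+k≡n = ℕ.m+[n∸m]≡n (ℕ.<⇒≤ i<n)

          n∸k≡i : n ∸ k ≡ i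
          n∸k≡i = ℕ.m∸[m∸n]≡n (ℕ.<⇒≤ i<n)

          below : ∀ {x y} → x ℕ.< y → + x ℤ.- + n ℤ.< + y ℤ.- + n
          below x<y = ℤ.+-monoˡ-< (ℤ.- (+ n)) (ℤ.+<+ x<y)

          far : ∀ {x y} → x ℕ.< y ℕ.+ n → + x ℤ.- + n ℤ.< + y
          far {x} {y} p = from₁ (ℤ.+<+ p) (solve 3 (λ x y n → y :- (x :- n) := y :+ n :- x) ≡.refl (+ x) (+ y) (+ n))

          remaining : ∀ x → i ℕ.< x → x ℕ.≤ n → ∃[ q ] (x ≡ i ℕ.+ suc (toℕ {k} q))
          remaining x i<x x≤n = Fin.fromℕ< bound , ≡.sym (≡.trans (≡.cong (λ y → i ℕ.+ suc y) (Fin.toℕ-fromℕ< bound))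
            (≡.trans (ℕ.+-suc i (x ∸ suc i)) (ℕ.m+[n∸m]≡n i<x)))
            where
            bound : x ∸ suc i ℕ.< k
            bound = ℕ.+-cancelˡ-< i (x ∸ suc i) k (≡.subst₂ ℕ._≤_ (≡.sym (≡.trans (≡.sym (ℕ.+-suc i (x ∸ suc i)))
              (≡.trans (ℕ.+-suc i (x ∸ suc i)) (ℕ.m+[n∸m]≡n i<x)))) (≡.sym i+k≡n) x≤n)

        -- The translation lowers the positions 1, ..., i by n and keeps the others, so it is
        -- increasing on {1, ..., n}.
        -ω-sorted : Sorted (t (-ω i))
        -ω-sorted = sorted-by (t (-ω i)) λ x y 1≤x x<y y≤n → by x y 1≤x x<y y≤n (x ℕ.≤? i) (y ℕ.≤? i)
          where
          by : ∀ x y → 1 ℕ.≤ x → x ℕ.< y → y ℕ.≤ n → Dec (x ℕ.≤ i) → Dec (y ℕ.≤ i) →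
               window (-ω i) (res (+ x)) ℤ.< window (-ω i) (res (+ y))
          by x y 1≤x x<y y≤n (yes x≤i) (yes y≤i) = ≡.subst₂ ℤ._<_ (≡.sym (window-low x 1≤x x≤i))
            (≡.sym (window-low y (ℕ.≤-trans 1≤x (ℕ.<⇒≤ x<y)) y≤i)) (below x<y)
          by x y 1≤x x<y y≤n (yes x≤i) (no y≰i) = ≡.subst₂ ℤ._<_ (≡.sym (window-low x 1≤x x≤i))
            (≡.sym (window-high y (ℕ.≰⇒> y≰i) y≤n)) (far (ℕ.≤-trans x<y (ℕ.m≤m+n y n)))
          by x y 1≤x x<y y≤n (no x≰i) (yes y≤i) = contradiction (ℕ.≤-trans (ℕ.<⇒≤ x<y) y≤i) x≰i
          by x y 1≤x x<y y≤n (no x≰i) (no y≰i) = ≡.subst₂ ℤ._<_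
            (≡.sym (window-high x (ℕ.≰⇒> x≰i) (ℕ.≤-trans (ℕ.<⇒≤ x<y) y≤n))) (≡.sym (window-high y (ℕ.≰⇒> y≰i) y≤n)) (ℤ.+<+ x<y)

        R-bounded : ∀ p → R i p ℕ.≤ n ∸ k
        R-bounded p = ℕ.≤-reflexive (≡.sym n∸k≡i)

        R-partition : IsPartition (R i)
        R-partition _ = ℕ.≤-refl

        -- The columns of the rectangle are i + 1, ..., n, exactly the positions that the
        -- translation by -ω_i leaves in place.
        value-R : value (k , letters k≤n (R i)) ≈ʷ t (-ω i)
        value-R = value-recognition k≤n (R i) R-partition R-bounded (t (-ω i)) -ω-sorted
          (λ q → window-high (column (R i) q) (ℕ.m<m+n i (s≤s z≤n)) (column≤n k≤n (R i) R-bounded q))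
          λ x 1≤x x≤n ∉ → by x 1≤x x≤n ∉ (x ℕ.≤? i)
          where
          by : ∀ x → 1 ℕ.≤ x → x ℕ.≤ n → (∀ q → column (R i) q ≢ x) → Dec (x ℕ.≤ i) → window (-ω i) (res (+ x)) ≡ + x ℤ.- + n
          by x 1≤x x≤n ∉ (yes x≤i) = window-low x 1≤x x≤i
          by x 1≤x x≤n ∉ (no x≰i) = let q , e = remaining x (ℕ.≰⇒> x≰i) x≤n in contradiction (≡.sym e) (∉ q)

        φ-D : φ (D i) ≈ᵗ j (t (-ω i))
        φ-D = ≋ᵗ⇒≈ᵗ {φ (D i)} {j (t (-ω i))} λ w → 𝔽.trans
          (≈ᵗ⇒≋ᵗ {φ (D i)} {j (value (k , letters k≤n (R i)))} (φ-minor k≤n (R i) R-partition R-bounded) w)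
          (≈ᵗ⇒≋ᵗ {j (value (k , letters k≤n (R i)))} {j (t (-ω i))} (IsSchubertBasis.cong isSchubertBasis
            (up⇒W⁰ k (letters k≤n (R i)) (proj₁ (realized-letters k≤n (R i) R-partition R-bounded))) value-R) w)

        module _ (1≤i : 1 ℕ.≤ i) where
          private
            w = s (+ i) · t (-ω i)

            window-here : windowʷ w (res (+ i)) ≡ + i
            window-here = ≡.trans (window-s (+ i) (t (-ω i)) (res (+ i))) (≡.trans (op-here (res (+ i)))
              (≡.trans (≡.cong (ℤ._- + 1) (≡.trans (≡.cong (window (-ω i)) (nxt-res-+ i)) (window-high (suc i) ℕ.≤-refl i<n)))
              (solve 1 (λ i → con (+ 1) :+ i :- con (+ 1) := i) ≡.refl (+ i))))

            window-next : windowʷ w (res (+ suc i)) ≡ + suc i ℤ.- + n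
            window-next = ≡.trans (≡.cong (windowʷ w) (≡.sym (nxt-res-+ i))) (≡.trans (window-s (+ i) (t (-ω i)) (nxt (res (+ i))))
              (≡.trans (op-next (res (+ i))) (≡.trans (≡.cong (ℤ._+ + 1) (window-low i 1≤i ℕ.≤-refl))
              (solve 2 (λ i n → i :- n :+ con (+ 1) := con (+ 1) :+ i :- n) ≡.refl (+ i) (+ n)))))

            apart-from : ∀ {x} → 1 ℕ.≤ x → x ℕ.≤ n → x ≢ suc i → res (+ x) ≢ nxt (res (+ i))
            apart-from 1≤x x≤n ne e = res-+-≢ 1≤x x≤n (s≤s z≤n) i<n ne (≡.trans e (nxt-res-+ i))

            window-other : ∀ x → 1 ℕ.≤ x → x ℕ.≤ n → x ≢ i → x ≢ suc i → windowʷ w (res (+ x)) ≡ window (-ω i) (res (+ x))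
            window-other x 1≤x x≤n ne ne′ = ≡.trans (window-s (+ i) (t (-ω i)) (res (+ x)))
              (op-other (res (+ i)) (res-+-≢ 1≤x x≤n 1≤i (ℕ.<⇒≤ i<n) ne) (apart-from 1≤x x≤n ne′))

            V : ℕ → ℤ
            V x = windowʷ w (finite w ⟨$⟩ʳ res (+ x))

            V-before : ∀ x → 1 ℕ.≤ x → x ℕ.< i → V x ≡ + x ℤ.- + n
            V-before x 1≤x x<i = ≡.trans (≡.cong (windowʷ w) (transpose-other (res (+ i)) (res (+ i ℤ.+ + 1))
                (res-+-≢ 1≤x x≤n 1≤i (ℕ.<⇒≤ i<n) (ℕ.<⇒≢ x<i)) (λ e → apart-from 1≤x x≤n x≢1+i (≡.trans e (≡.sym (nxt-res (+ i)))))))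
              (≡.trans (window-other x 1≤x x≤n (ℕ.<⇒≢ x<i) x≢1+i) (window-low x 1≤x (ℕ.<⇒≤ x<i)))
              where
              x≤n = ℕ.≤-trans (ℕ.<⇒≤ x<i) (ℕ.<⇒≤ i<n)
              x≢1+i : x ≢ suc i
              x≢1+i = ℕ.<⇒≢ (ℕ.<-trans x<i ℕ.≤-refl)

            V-here : V i ≡ + suc i ℤ.- + n
            V-here = ≡.trans (≡.cong (windowʷ w) (≡.trans (transpose-left (res (+ i)) (res (+ i ℤ.+ + 1)))
              (≡.trans (≡.sym (nxt-res (+ i))) (nxt-res-+ i)))) window-next

            V-next : V (suc i) ≡ + i
            V-next = ≡.trans (≡.cong (windowʷ w) (≡.trans (≡.cong (finite w ⟨$⟩ʳ_) (≡.trans (≡.sym (nxt-res-+ i)) (nxt-res (+ i))))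
              (transpose-right (res (+ i)) (res (+ i ℤ.+ + 1))))) window-here

            V-after : ∀ x → suc i ℕ.< x → x ℕ.≤ n → V x ≡ + x
            V-after x i+1<x x≤n = ≡.trans (≡.cong (windowʷ w) (transpose-other (res (+ i)) (res (+ i ℤ.+ + 1))
                (res-+-≢ 1≤x x≤n 1≤i (ℕ.<⇒≤ i<n) x≢i) (λ e → apart-from 1≤x x≤n x≢1+i (≡.trans e (≡.sym (nxt-res (+ i)))))))
              (≡.trans (window-other x 1≤x x≤n x≢i x≢1+i) (window-high x (ℕ.<⇒≤ i+1<x) x≤n))
              where
              1≤x = ℕ.≤-trans (s≤s z≤n) (ℕ.<⇒≤ i+1<x)
              x≢1+i : x ≢ suc i
              x≢1+i = ℕ.<⇒≢ i+1<x ∘ ≡.sym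
              x≢i : x ≢ i
              x≢i = ℕ.<⇒≢ (ℕ.<-trans ℕ.≤-refl i+1<x) ∘ ≡.sym

            data Place (x : ℕ) : Set where
              earlier : x ℕ.< i → Place x
              first   : x ≡ i → Place x
              second  : x ≡ suc i → Place x
              later   : suc i ℕ.< x → Place x

            place : ∀ x → Place x
            place x with ℕ.<-cmp x i
            ... | tri< p _ _ = earlier p
            ... | tri≈ _ p _ = first p
            ... | tri> _ _ p with x ℕ.≟ suc i
            ...   | yes e = second e
            ...   | no ne = later (ℕ.≤∧≢⇒< p (ne ∘ ≡.sym))

            V-increasing : ∀ x y → 1 ℕ.≤ x → x ℕ.< y → y ℕ.≤ n → V x ℤ.< V y
            V-increasing x y 1≤x x<y y≤n = by (place x) (place y)
              where
              by : Place x → Place y → V x ℤ.< V y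
              by (earlier p) (earlier q) = ≡.subst₂ ℤ._<_ (≡.sym (V-before x 1≤x p)) (≡.sym (V-before y (ℕ.≤-trans 1≤x (ℕ.<⇒≤ x<y)) q)) (below x<y)
              by (earlier p) (first ≡.refl) = ≡.subst₂ ℤ._<_ (≡.sym (V-before x 1≤x p)) (≡.sym V-here) (below (ℕ.<-trans p ℕ.≤-refl))
              by (earlier p) (second ≡.refl) = ≡.subst₂ ℤ._<_ (≡.sym (V-before x 1≤x p)) (≡.sym V-next) (far (ℕ.≤-trans p (ℕ.m≤m+n i n)))
              by (earlier p) (later q) = ≡.subst₂ ℤ._<_ (≡.sym (V-before x 1≤x p)) (≡.sym (V-after y q y≤n)) (far (ℕ.≤-trans x<y (ℕ.m≤m+n y n)))
              by (first ≡.refl) (earlier q) = contradiction x<y (ℕ.<-asym q)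
              by (first ≡.refl) (first e) = contradiction (≡.sym e) (ℕ.<⇒≢ x<y)
              -- The inequality i + 1 - n < i rests on n ≥ 2.
              by (first ≡.refl) (second ≡.refl) = ≡.subst₂ ℤ._<_ (≡.sym V-here) (≡.sym V-next)
                (far (ℕ.≤-trans (ℕ.≤-reflexive (ℕ.+-comm 2 i)) (ℕ.+-monoʳ-≤ i 2≤n)))
              by (first ≡.refl) (later q) = ≡.subst₂ ℤ._<_ (≡.sym V-here) (≡.sym (V-after y q y≤n)) (far (ℕ.≤-trans q (ℕ.m≤m+n y n)))
              by (second ≡.refl) (earlier q) = contradiction (ℕ.<-trans x<y q) (ℕ.<-asym ℕ.≤-refl)
              by (second ≡.refl) (first ≡.refl) = contradiction x<y (ℕ.<-asym ℕ.≤-refl)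
              by (second ≡.refl) (second e) = contradiction (≡.sym e) (ℕ.<⇒≢ x<y)
              by (second ≡.refl) (later q) = ≡.subst₂ ℤ._<_ (≡.sym V-next) (≡.sym (V-after y q y≤n)) (ℤ.+<+ (ℕ.<-trans ℕ.≤-refl q))
              by (later p) (earlier q) = contradiction (ℕ.<-trans (ℕ.<-trans p x<y) q) (ℕ.<-asym ℕ.≤-refl)
              by (later p) (first ≡.refl) = contradiction (ℕ.<-trans p x<y) (ℕ.<-asym ℕ.≤-refl)
              by (later p) (second ≡.refl) = contradiction x<y (ℕ.<-asym p)
              by (later p) (later q) = ≡.subst₂ ℤ._<_ (≡.sym (V-after x p (ℕ.≤-trans (ℕ.<⇒≤ x<y) y≤n))) (≡.sym (V-after y q y≤n)) (ℤ.+<+ x<y)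

            1≤k : 1 ℕ.≤ k
            1≤k = ℕ.m<n⇒0<n∸m i<n

          R⁻-last : ∀ p → suc (toℕ p) ≡ k → R⁻ i p ≡ i ∸ 1
          R⁻-last p e rewrite dec-true (suc (toℕ p) ℕ.≟ n ∸ i) e = ≡.refl

          R⁻-before : ∀ p → suc (toℕ p) ≢ k → R⁻ i p ≡ i
          R⁻-before p ne rewrite dec-false (suc (toℕ p) ℕ.≟ n ∸ i) ne = ≡.refl

          R⁻≤ : ∀ p → R⁻ i p ℕ.≤ i
          R⁻≤ p = by (suc (toℕ p) ℕ.≟ k)
            where
            by : Dec (suc (toℕ p) ≡ k) → R⁻ i p ℕ.≤ i
            by (yes e) = ℕ.≤-trans (ℕ.≤-reflexive (R⁻-last p e)) (ℕ.m∸n≤m i 1)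
            by (no ne) = ℕ.≤-reflexive (R⁻-before p ne)

          R⁻-bounded : ∀ p → R⁻ i p ℕ.≤ n ∸ k
          R⁻-bounded p = ℕ.≤-trans (R⁻≤ p) (ℕ.≤-reflexive (≡.sym n∸k≡i))

          R⁻-partition : IsPartition (R⁻ i)
          R⁻-partition {p} {q} p≤q = by (suc (toℕ p) ℕ.≟ k) (suc (toℕ q) ℕ.≟ k)
            where
            by : Dec (suc (toℕ p) ≡ k) → Dec (suc (toℕ q) ≡ k) → R⁻ i q ℕ.≤ R⁻ i p
            by (no ne) _ = ℕ.≤-trans (R⁻≤ q) (ℕ.≤-reflexive (≡.sym (R⁻-before p ne)))
            by (yes e) (yes e′) = ℕ.≤-reflexive (≡.trans (R⁻-last q e′) (≡.sym (R⁻-last p e)))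
            by (yes e) (no ne) = contradiction (ℕ.≤-antisym (Fin.toℕ<n q) (ℕ.≤-trans (ℕ.≤-reflexive (≡.sym e)) (s≤s p≤q))) ne

          -- A minor reads the parts from the last to the first, so the shortened last row governs
          -- the first column.
          column-first : ∀ q → toℕ q ≡ 0 → column (R⁻ i) q ≡ i
          column-first q e = ≡.trans (≡.cong₂ (λ x y → x ℕ.+ suc y) (R⁻-last (opposite q) last) e)
            (≡.trans (ℕ.+-comm (i ∸ 1) 1) (ℕ.m+[n∸m]≡n 1≤i))
            where
            last : suc (toℕ (opposite q)) ≡ k
            last = ≡.trans (≡.cong suc (≡.sym (ℕ.+-identityʳ (toℕ (opposite q)))))
              (≡.trans (≡.cong (λ y → suc (toℕ (opposite q)) ℕ.+ y) (≡.sym e))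
              (≡.trans (≡.sym (ℕ.+-suc (toℕ (opposite q)) (toℕ q))) (≡.trans (ℕ.+-comm (toℕ (opposite q)) (suc (toℕ q))) (suc-opposite k≤n q))))

          column-rest : ∀ q → toℕ q ≢ 0 → column (R⁻ i) q ≡ i ℕ.+ suc (toℕ q)
          column-rest q ne = ≡.cong (ℕ._+ suc (toℕ q)) (R⁻-before (opposite q) λ e → ne (ℕ.+-cancelˡ-≡ (suc (toℕ (opposite q))) (toℕ q) 0
            (≡.trans (≡.sym (ℕ.+-suc (toℕ (opposite q)) (toℕ q))) (≡.trans (ℕ.+-comm (toℕ (opposite q)) (suc (toℕ q)))
              (≡.trans (suc-opposite k≤n q) (≡.trans (≡.sym e) (≡.sym (ℕ.+-identityʳ _))))))))

          -- The columns of the shortened rectangle are i, i + 2, ..., n. On the window of the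
          -- translation, s_i moves the element i + 1 down to i and the element i - n up to i + 1 -
          -- n, so these are the elements that are not lowered.
          value-R⁻ : value (k , letters k≤n (R⁻ i)) ≈ʷ s (+ i) · t (-ω i)
          value-R⁻ = value-recognition k≤n (R⁻ i) R⁻-partition R⁻-bounded w (sorted-by w V-increasing)
            (λ q → in-columns q (toℕ q ℕ.≟ 0)) λ x 1≤x x≤n ∉ → off-columns x 1≤x x≤n ∉ (place x)
            where
            in-columns : ∀ q → Dec (toℕ q ≡ 0) → windowʷ w (res (+ column (R⁻ i) q)) ≡ + column (R⁻ i) q
            in-columns q (yes e) = ≡.subst (λ x → windowʷ w (res (+ x)) ≡ + x) (≡.sym (column-first q e)) window-here
            in-columns q (no ne) = ≡.trans (window-other x (1≤column k≤n (R⁻ i) q) x≤n (ℕ.<⇒≢ (ℕ.<-trans ℕ.≤-refl i+1<x) ∘ ≡.sym) (ℕ.<⇒≢ i+1<x ∘ ≡.sym))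
              (window-high x (ℕ.<⇒≤ i+1<x) x≤n)
              where
              x = column (R⁻ i) q
              x≤n = column≤n k≤n (R⁻ i) R⁻-bounded q
              i+1<x : suc i ℕ.< x
              i+1<x = ℕ.≤-trans (ℕ.≤-reflexive (ℕ.+-comm 2 i)) (ℕ.≤-trans (ℕ.+-monoʳ-≤ i (s≤s (ℕ.n≢0⇒n>0 ne))) (ℕ.≤-reflexive (≡.sym (column-rest q ne))))
            off-columns : ∀ x → 1 ℕ.≤ x → x ℕ.≤ n → (∀ q → column (R⁻ i) q ≢ x) → Place x → windowʷ w (res (+ x)) ≡ + x ℤ.- + n
            off-columns x 1≤x x≤n ∉ (earlier p) = ≡.trans (window-other x 1≤x x≤n (ℕ.<⇒≢ p) (ℕ.<⇒≢ (ℕ.<-trans p ℕ.≤-refl)))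
              (window-low x 1≤x (ℕ.<⇒≤ p))
            off-columns x 1≤x x≤n ∉ (first ≡.refl) = contradiction (column-first (Fin.fromℕ< 1≤k) (Fin.toℕ-fromℕ< 1≤k)) (∉ (Fin.fromℕ< 1≤k))
            off-columns x 1≤x x≤n ∉ (second ≡.refl) = window-next
            off-columns x 1≤x x≤n ∉ (later p) = let q , e = remaining x (ℕ.<⇒≤ p) x≤n in
              contradiction (≡.trans (column-rest q (λ q≡0 → ℕ.<⇒≢ p (≡.sym (≡.trans e (≡.trans (≡.cong (λ y → i ℕ.+ suc y) q≡0) (ℕ.+-comm i 1))))))
                (≡.sym e)) (∉ q)

          φ-D′ : φ (D′ i) ≈ᵗ j (s (+ i) · t (-ω i))
          φ-D′ = ≋ᵗ⇒≈ᵗ {φ (D′ i)} {j w} λ v → 𝔽.trans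
            (≈ᵗ⇒≋ᵗ {φ (D′ i)} {j (value (k , letters k≤n (R⁻ i)))} (φ-minor k≤n (R⁻ i) R⁻-partition R⁻-bounded) v)
            (≈ᵗ⇒≋ᵗ {j (value (k , letters k≤n (R⁻ i)))} {j w} (IsSchubertBasis.cong isSchubertBasis
              (up⇒W⁰ k (letters k≤n (R⁻ i)) (proj₁ (realized-letters k≤n (R⁻ i) R⁻-partition R⁻-bounded))) value-R⁻) v)

open import Data.Nat.Base using (_≤_; _+_)

proposition27 : ∀ {c ℓ} (ℝ : RealNumbers c ℓ) (n : ℕ) (2≤n : 2 ≤ n) →
  let open Setting ℝ n 2≤n in
  (j : Wₑ → Twisted) → IsSchubertBasis j →
  (φ : CommutativeRing.Carrier ℂ[Z̃] → Twisted) → IsSAlgebraIsomorphism φ →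
  (∀ k p → 1 ≤ k → k + p ≤ n → φ (z k (k + p)) ≈ j (τ^ k · cᵂ p) / j (τ^ (k ∸ 1))) →
  (∀ k (l : Vector ℕ k) → k ≤ n → IsPartition l → (∀ p → l p ≤ n ∸ k) →
     φ (minor l) ≈ᵗ j (τ^ k · wᵃᶠ l))
  × (∀ i → i ≤ n ∸ 1 → φ (D i) ≈ᵗ j (t (-ω i)))
  × (∀ i → 1 ≤ i → i ≤ n ∸ 1 → φ (D′ i) ≈ᵗ j (s (+ i) · t (-ω i)))
proposition27 ℝ n 2≤n j isSchubertBasis φ isIsomorphism φ-z =
  (λ k l k≤n → φ-minor k≤n l) ,
  (λ i i≤n-1 → φ-D i (i<n i≤n-1)) ,
  (λ i 1≤i i≤n-1 → φ-D′ i (i<n i≤n-1) 1≤i)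
  where
  isomorphism : PetersonIsomorphism ℝ n 2≤n
  isomorphism = record { j = j ; isSchubertBasis = isSchubertBasis ; φ = φ ; isIsomorphism = isIsomorphism ; φ-z = φ-z }
  open Schubert ℝ n 2≤n isomorphism
  open Rectangles ℝ n 2≤n isomorphism
  i<n : ∀ {i} → i ℕ.≤ n ∸ 1 → i ℕ.< n
  i<n p = ℕ.≤-trans (s≤s p) (ℕ.≤-reflexive (ℕ.m+[n∸m]≡n {1} {n} (ℕ.≤-trans (s≤s z≤n) 2≤n)))
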